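{- Suppose $k-1\ge \delta\ge 3$ and $n$ is sufficiently large in terms of $\delta$ and $k$. Let $G^\star$ be obtained from the disjoint union of $K_k$ and $K_{\delta,n-k-\delta}$ by deleting an edge $e$ of $K_{\delta,n-k-\delta}$ and adding an edge from a vertex of $K_k$ to the endpoint of $e$ lying in the part of size $n-k-\delta$. Then, up to isomorphism, $G^\star$ is the unique graph with the maximum number of proper $k$-colorings among all connected graphs on $n$ vertices with chromatic number $k$ and minimum degree $\delta$.
   Context: All graphs are finite and simple. The number of proper $k$-colorings of $G$ is denoted $P_G(k)$. -}

module Defs where

open import Data.Nat using (ℕ; zero; suc; _≤_; _<_; _≡ᵇ_; _<ᵇ_; _+_)
open import Data.Bool using (Bool; true; false; _∧_; _∨_; not; T)
open import Data.Bool.Properties using (T?)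
open import Data.Fin using (Fin; toℕ)
open import Data.Fin.Properties as FinP using (all?)
open import Data.List using (List; []; _∷_; length; filter; map; concatMap)
open import Data.Fin.Properties using () renaming (_≟_ to _≟F_)
open import Data.Vec.Functional using (Vector) renaming (_∷_ to _∷ᶠ_)
open import Data.List using (allFin)
open import Data.Product using (Σ; _×_; ∃)
open import Relation.Nullary using (¬_; Dec; yes; no)
open import Relation.Nullary.Decidable using (¬?)
open import Relation.Binary.PropositionalEquality using (_≡_; _≢_; refl; cong; cong₂)
open import Data.Bool.Properties using (∨-comm; ∧-zeroʳ)
open import Function.Bundles using (_↔_; Inverse)

record Graph (n : ℕ) : Set where
  field
    adj   : Fin n → Fin n → Bool
    sym   : ∀ u v → adj u v ≡ adj v u
    irrefl : ∀ v → adj v v ≡ false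
open Graph public

Adj : ∀ {n} → Graph n → Fin n → Fin n → Set
Adj G u v = T (adj G u v)

Proper : ∀ {n} (G : Graph n) (k : ℕ) → (Fin n → Fin k) → Set
Proper G k c = ∀ u v → Adj G u v → c u ≢ c v

proper? : ∀ {n} (G : Graph n) (k : ℕ) (c : Fin n → Fin k) → Dec (Proper G k c)
proper? {n} G k c =
  all? (λ u → all? (λ v → dec u v))
  where
  dec : ∀ u v → Dec (Adj G u v → c u ≢ c v)
  dec u v with T? (adj G u v) | c u ≟F c v
  ... | yes a | yes e = no (λ f → f a e)
  ... | yes a | no ne = yes (λ _ → ne)
  ... | no na | _ = yes (λ a → Data.Empty.⊥-elim (na a))
    where import Data.Empty

allFuns : (n k : ℕ) → List (Fin n → Fin k)
allFuns zero k = (λ ()) ∷ []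
allFuns (suc n) k = concatMap (λ a → map (λ f → a ∷ᶠ f) (allFuns n k)) (allFin k)

P : ∀ {n} → Graph n → ℕ → ℕ
P {n} G k = length (filter (proper? G k) (allFuns n k))

Colorable : ∀ {n} → Graph n → ℕ → Set
Colorable {n} G k = Σ (Fin n → Fin k) (Proper G k)

ChromaticNumber : ∀ {n} → Graph n → ℕ → Set
ChromaticNumber G k = Colorable G k × (∀ j → j < k → ¬ Colorable G j)

degree : ∀ {n} → Graph n → Fin n → ℕ
degree {n} G v = length (filter (λ u → T? (adj G v u)) (allFin n))

MinDegree : ∀ {n} → Graph n → ℕ → Set
MinDegree {n} G δ = (∀ v → δ ≤ degree G v) × ∃ (λ v → degree G v ≡ δ)

data Reach {n} (G : Graph n) : Fin n → Fin n → Set where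
  here : ∀ {v} → Reach G v v
  step : ∀ {u w v} → Adj G u w → Reach G w v → Reach G u v

Connected : ∀ {n} → Graph n → Set
Connected {n} G = ∀ (u v : Fin n) → Reach G u v

_≅_ : ∀ {n} → Graph n → Graph n → Set
_≅_ {n} G H = Σ (Fin n ↔ Fin n) λ σ →
  ∀ u v → adj G u v ≡ adj H (Inverse.to σ u) (Inverse.to σ v)

-- G⋆ on vertex set {0,…,n-1}:
--   K_k on {0,…,k-1};
--   part A = {k,…,k+δ-1} (size δ), part B = {k+δ,…,n-1} (size n-k-δ);
--   all A–B edges except e = {k, k+δ}; plus the edge {0, k+δ}
--   (0 is a vertex of K_k, k+δ is the endpoint of e in the part of size n-k-δ).
eqℕ : ℕ → ℕ → Bool
eqℕ = _≡ᵇ_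

eqℕ-sym : ∀ x y → eqℕ x y ≡ eqℕ y x
eqℕ-sym zero zero = refl
eqℕ-sym zero (suc y) = refl
eqℕ-sym (suc x) zero = refl
eqℕ-sym (suc x) (suc y) = eqℕ-sym x y

eqℕ-refl : ∀ x → eqℕ x x ≡ true
eqℕ-refl zero = refl
eqℕ-refl (suc x) = eqℕ-refl x

module GStar (k δ : ℕ) where
  isK isA isB : ℕ → Bool
  isK x = x <ᵇ k
  isA x = not (x <ᵇ k) ∧ (x <ᵇ k + δ)
  isB x = not (x <ᵇ k + δ)

  core : ℕ → ℕ → Bool
  core x y = (isK x ∧ isK y)
           ∨ (isA x ∧ isB y ∧ not (eqℕ x k ∧ eqℕ y (k + δ)))
           ∨ (eqℕ x 0 ∧ eqℕ y (k + δ))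

  a : ℕ → ℕ → Bool
  a x y = (core x y ∨ core y x) ∧ not (eqℕ x y)

  a-sym : ∀ x y → a x y ≡ a y x
  a-sym x y = cong₂ _∧_ (∨-comm (core x y) (core y x)) (cong not (eqℕ-sym x y))

  a-irrefl : ∀ x → a x x ≡ false
  a-irrefl x rewrite eqℕ-refl x = ∧-zeroʳ (core x x ∨ core x x)

Gstar : (n k δ : ℕ) → Graph n
Gstar n k δ = record
  { adj = λ u v → GStar.a k δ (toℕ u) (toℕ v)
  ; sym = λ u v → GStar.a-sym k δ (toℕ u) (toℕ v)
  ; irrefl = λ v → GStar.a-irrefl k δ (toℕ v)
  }

{-# OPTIONS --safe #-}
-- Write k = q + 1, and let n be large. A connected k-chromatic graph H on h vertices has at most k! q^(h-k) proper
-- k-colourings, with equality exactly for k-cliques with trees attached, and every other graph loses a constant factor.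
-- For colour-critical H this comes from the entropy of a uniform colouring, revealed in a uniformly random order of the
-- vertices: a vertex whose neighbourhood is not monochromatic costs at most (k(k-1)(k-2))^(1/3) < q, each colour class
-- contains a vertex that sees all other colours and hence costs (k!)^(1/k), and monochromatic neighbourhoods are
-- rare because contracting the neighbourhood of v to one vertex and applying induction bounds the colourings constant on it.
-- Now let G have minimum degree δ and at least as many colourings as a near-extremal graph. A connected dominating set of
-- G whose complement J is a constant fraction of the vertices, followed by J in some order and in the reverse order, gives
-- a second entropy bound that saves a factor for every vertex of J whose neighbourhood is not monochromatic. Hence some v has a
-- neighbourhood N which is constant in a large proportion of the colourings. By the gap, contracting N turns G - v into
-- a k-clique with trees attached; minimum degree δ then leaves three families of graphs, and all of them except the extremal graph
-- are beaten through an injection of colourings that omits one colouring of the extremal graph.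
module Submission where

open import Defs renaming (sym to adj-sym; irrefl to adj-irrefl)
open import Data.Nat using (ℕ; zero; suc; _+_; _*_; _∸_; _^_; _≤_; _<_; _<ᵇ_; z≤n; s≤s; NonZero; nonZero; >-nonZero; _!)
open import Data.Nat.Properties renaming (_≟_ to _≟ℕ_)
open import Data.Nat.ListAction using (sum; product)
open import Data.Nat.ListAction.Properties using (product-++; product-↭; sum-++)
open import Data.Nat.Tactic.RingSolver using (solve-∀)
open import Data.Bool using (Bool; true; false; T; _∧_; _∨_; not)
open import Data.Bool.Properties using (T?) renaming (_≟_ to _≟B_)
open import Data.Fin using (Fin; toℕ; fromℕ<; punchOut; punchIn) renaming (zero to fz; suc to fs)
open import Data.List using (List; []; _∷_; _++_; [_]; length; map; take; _ʳ++_; filter; concatMap; allFin; replicate; reverse)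
open import Data.List.Properties using (reverse-++; unfold-reverse; length-++; length-map; filter-accept; filter-reject; filter-++; map-++; map-∘; ++-assoc; length-tabulate; length-take; take++drop≡id)
open import Data.List.Relation.Unary.All using (All; []; _∷_) renaming (all? to allL?; lookup to All-lookup; tabulate to All-tabulate)
open import Data.List.Relation.Unary.Any using (Any; here; there) renaming (any? to anyL?)
open import Data.List.Relation.Unary.AllPairs using ([]; _∷_)
open import Data.List.Relation.Unary.Unique.Propositional using (Unique)
open import Data.List.Relation.Unary.Unique.Propositional.Properties using () renaming (filter⁺ to unique-filter⁺; allFin⁺ to unique-allFin)
open import Data.List.Membership.Propositional using (_∈_; _∉_)
open import Data.List.Membership.Propositional.Properties using (∈-map⁺; ∈-map⁻; ∈-++⁺ˡ; ∈-++⁺ʳ; ∈-++⁻; ∈-filter⁺; ∈-filter⁻; ∈-allFin; ∈-∃++)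
open import Data.List.Relation.Binary.Permutation.Propositional using (_↭_; ↭-sym; prep; swap; ↭-reflexive) renaming (refl to ↭refl; trans to ↭trans)
open import Data.List.Relation.Binary.Permutation.Propositional.Properties using (∈-resp-↭; ++↭ʳ++; ↭-reverse; ↭-length; shift; drop-∷; ++⁺ˡ; ++⁺ʳ) renaming (map⁺ to ↭-map⁺; ++⁺ to ↭-++⁺; ++-comm to ↭-++-comm)
open import Data.Vec using (Vec; []; _∷_; lookup; tabulate)
open import Data.Vec.Properties using (lookup∘tabulate; tabulate-cong; tabulate∘lookup) renaming (≡-dec to ≡-dec-vec)
open import Data.Product using (Σ; ∃; _×_; _,_; proj₁; proj₂; ∃₂)
open import Data.Sum using (_⊎_; inj₁; inj₂)
open import Data.Empty using (⊥; ⊥-elim)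
open import Data.Unit using (tt)
open import Relation.Nullary using (¬_; Dec; yes; no; contradiction)
open import Relation.Nullary.Decidable using (¬?; _×-dec_; _→-dec_)
open import Relation.Unary using (Decidable)
open import Relation.Binary.PropositionalEquality using (_≡_; _≢_; refl; sym; trans; cong; cong₂; subst; subst₂; module ≡-Reasoning)
open import Relation.Binary.Definitions using (DecidableEquality; tri<; tri≈; tri>)
open import Data.Vec.Functional using () renaming (_∷_ to _∷ᶠ_)
open import Function using (_∘_; id; case_of_)
open import Function.Bundles using (_↔_; Inverse; mk↔ₛ′)
open import Data.Fin.Properties using (punchOut-injective; punchIn-injective; punchInᵢ≢i; pigeonhole; toℕ<n; toℕ-injective; toℕ-fromℕ<) renaming (_≟_ to _≟F_; all? to allF?; any? to anyF?)

-- Arithmetic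

-- All inequalities live in ℕ. The entropy log n of a uniform element of a list of length n appears
-- as `n ^ n`, an average over N orders as an N-th power whose root is taken at the end, and a gap
-- as a factor Z/(Z+1). Exponents such as 3k only clear cube roots and k-th roots. A random order
-- cannot serve for both entropy bounds. It suits colour-critical graphs, where degrees are at least
-- q and monochromatic neighbourhoods turn out to be rare. In the extremal graph the part of size δ
-- is monochromatic in most colourings, and a vertex revealed before all its neighbours then costs k
-- instead of q. The second bound therefore uses orders in which every vertex but the first has an
-- earlier neighbour. Such an order loses nothing against k q^(n-1), and it gains exactly at
-- vertices that see a second colour in time. The k vertices that see all other colours matter for
-- the exact constant: at (k!)^(1/k) each they contribute k! together, so that any saving elsewhere
-- is a saving against Tomescu's bound itself.

rearrangement : ∀ {a b A B} → a ≤ b → A ≤ B → a * B + A * b ≤ a * A + b * B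
rearrangement {a} {b} {A} {B} a≤b A≤B
  rewrite sym (m+[n∸m]≡n a≤b) | sym (m+[n∸m]≡n A≤B) =
  ≤-trans (m≤m+n _ (d * e)) (≤-reflexive (lem a A d e))
  where
  d = b ∸ a
  e = B ∸ A
  lem : ∀ a A d e → a * (A + e) + A * (a + d) + d * e ≡ a * A + (a + d) * (A + e)
  lem = solve-∀

young-step : ∀ M u v → u * v ^ M + u ^ M * v ≤ u ^ suc M + v ^ suc M
young-step M u v with ≤-total u v
... | inj₁ u≤v = rearrangement u≤v (^-monoˡ-≤ M u≤v)
... | inj₂ v≤u = subst₂ _≤_ (lem v u (u ^ M) (v ^ M)) (+-comm (v * v ^ M) (u * u ^ M)) (rearrangement v≤u (^-monoˡ-≤ M v≤u))
  where
  lem : ∀ v u U V → v * U + V * u ≡ u * V + U * v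
  lem = solve-∀

-- Young's inequality with weights 1 and N, cleared of denominators. The induction multiplies the
-- previous case by v; the mixed terms this creates are absorbed by `young-step`, a rearrangement
-- inequality.
young : ∀ N u v → suc N * (u * v ^ N) ≤ u ^ suc N + N * v ^ suc N
young zero u v = ≤-reflexive (lem u)
  where
  lem : ∀ u → 1 * (u * 1) ≡ u * 1 + 0
  lem = solve-∀
young (suc N) u v = begin
  suc (suc N) * (u * (v * W)) ≡⟨ lem₁ N u v W ⟩
  suc N * (u * W) * v + u * (v * W) ≤⟨ +-monoˡ-≤ _ (*-monoˡ-≤ v (young N u v)) ⟩
  (u ^ suc N + N * (v * W)) * v + u * (v * W) ≡⟨ lem₂ (u ^ suc N) N v W u ⟩
  (u * (v * W) + u ^ suc N * v) + N * (v * (v * W)) ≤⟨ +-monoˡ-≤ _ (young-step (suc N) u v) ⟩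
  (u ^ suc (suc N) + v ^ suc (suc N)) + N * (v * (v * W)) ≡⟨ +-assoc (u ^ suc (suc N)) (v ^ suc (suc N)) (N * (v * (v * W))) ⟩
  u ^ suc (suc N) + suc N * (v * (v * W)) ∎
  where
  open ≤-Reasoning
  W = v ^ N
  lem₁ : ∀ N u v W → suc (suc N) * (u * (v * W)) ≡ suc N * (u * W) * v + u * (v * W)
  lem₁ = solve-∀
  lem₂ : ∀ U N v W u → (U + N * (v * W)) * v + u * (v * W) ≡ (u * (v * W) + U * v) + N * (v * (v * W))
  lem₂ = solve-∀

^-distribʳ-* : ∀ m a b → (a * b) ^ m ≡ a ^ m * b ^ m
^-distribʳ-* zero a b = refl
^-distribʳ-* (suc m) a b rewrite ^-distribʳ-* m a b = lem a b (a ^ m) (b ^ m)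
  where
  lem : ∀ a b A B → a * b * (A * B) ≡ a * A * (b * B)
  lem = solve-∀

m^n>0′ : ∀ m n → 1 ≤ m → 1 ≤ m ^ n
m^n>0′ m zero _ = ≤-refl
m^n>0′ m (suc n) p = *-mono-≤ p (m^n>0′ m n p)

*-cancelˡ-≤′ : ∀ c {a b} → 1 ≤ c → c * a ≤ c * b → a ≤ b
*-cancelˡ-≤′ (suc c) _ = *-cancelˡ-≤ (suc c)

amgm-step : ∀ N S x → suc N ^ suc N * (S ^ N * x) ≤ N ^ N * (S + x) ^ suc N
amgm-step zero S x = subst₂ _≤_ (lem₁ x) (lem₂ S x) (m≤n+m x S)
  where
  lem₁ : ∀ x → x ≡ 1 * (1 * x)
  lem₁ = solve-∀
  lem₂ : ∀ S x → S + x ≡ 1 * ((S + x) * 1)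
  lem₂ = solve-∀
amgm-step N@(suc N′) S x = *-cancelˡ-≤′ N (s≤s z≤n) (+-cancelʳ-≤ (N * (M * M ^ N * (S * S ^ N))) _ _ (begin
  N * (M ^ M * (S ^ N * x)) + N * (M * M ^ N * (S * S ^ N)) ≡⟨ lem₁ N M (M ^ N) (S ^ N) S x ⟩
  M * (N * (S + x) * (M ^ N * S ^ N)) ≡⟨ cong (λ z → M * (N * (S + x) * z)) (sym (^-distribʳ-* N M S)) ⟩
  M * (N * (S + x) * (M * S) ^ N) ≤⟨ young N (N * (S + x)) (M * S) ⟩
  (N * (S + x)) ^ M + N * (M * S) ^ M ≡⟨ cong₂ (λ y z → y + N * z) (^-distribʳ-* M N (S + x)) (^-distribʳ-* M M S) ⟩
  N ^ M * (S + x) ^ M + N * (M ^ M * S ^ M) ≡⟨ cong (_+ N * (M ^ M * S ^ M)) (*-assoc N (N ^ N) _) ⟩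
  N * (N ^ N * (S + x) ^ M) + N * (M * M ^ N * (S * S ^ N)) ∎))
  where
  open ≤-Reasoning
  M = suc N
  lem₁ : ∀ N M a b S x → N * (M * a * (b * x)) + N * (M * a * (S * b)) ≡ M * (N * (S + x) * (a * b))
  lem₁ = solve-∀

amgm : ∀ xs → length xs ^ length xs * product xs ≤ sum xs ^ length xs
amgm [] = ≤-refl
amgm (x ∷ xs) = *-cancelˡ-≤′ (N ^ N) (nn N) (begin
  N ^ N * (suc N ^ suc N * (x * Π)) ≡⟨ lem (N ^ N) (suc N ^ suc N) x Π ⟩
  suc N ^ suc N * (N ^ N * Π * x) ≤⟨ *-monoʳ-≤ (suc N ^ suc N) (*-monoˡ-≤ x (amgm xs)) ⟩
  suc N ^ suc N * (sum xs ^ N * x) ≤⟨ amgm-step N (sum xs) x ⟩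
  N ^ N * (sum xs + x) ^ suc N ≡⟨ cong (λ z → N ^ N * z ^ suc N) (+-comm (sum xs) x) ⟩
  N ^ N * (x + sum xs) ^ suc N ∎)
  where
  open ≤-Reasoning
  N = length xs
  Π = product xs
  nn : ∀ N → 1 ≤ N ^ N
  nn zero = ≤-refl
  nn (suc N) = m^n>0′ (suc N) (suc N) (s≤s z≤n)
  lem : ∀ a b x p → a * (b * (x * p)) ≡ b * (a * p * x)
  lem = solve-∀

sum-replicate : ∀ n x → sum (replicate n x) ≡ n * x
sum-replicate zero x = refl
sum-replicate (suc n) x = cong (x +_) (sum-replicate n x)

product-replicate : ∀ n x → product (replicate n x) ≡ x ^ n
product-replicate zero x = refl
product-replicate (suc n) x = cong (x *_) (product-replicate n x)

length-replicate′ : ∀ {A : Set} n (x : A) → length (replicate n x) ≡ n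
length-replicate′ zero x = refl
length-replicate′ (suc n) x = cong suc (length-replicate′ n x)

weighted-amgm : ∀ M b x y → (M + b) ^ (M + b) * (x ^ M * y ^ b) ≤ (M * x + b * y) ^ (M + b)
weighted-amgm M b x y = subst₂ _≤_ (cong₂ (λ l p → l ^ l * p) len pr) (cong₂ _^_ sm len) (amgm xs)
  where
  xs = replicate M x ++ replicate b y
  len : length xs ≡ M + b
  len = trans (length-++ (replicate M x)) (cong₂ _+_ (length-replicate′ M x) (length-replicate′ b y))
  pr : product xs ≡ x ^ M * y ^ b
  pr = trans (product-++ (replicate M x) _) (cong₂ _*_ (product-replicate M x) (product-replicate b y))
  sm : sum xs ≡ M * x + b * y
  sm = trans (sum-++ (replicate M x) _) (cong₂ _+_ (sum-replicate M x) (sum-replicate b y))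

-- Splitting M + b equal-weight items into a block of r nonempty parts and one more part.
log-sum-step : ∀ M b r → (M + b) ^ (M + b) * r ^ M ≤ suc r ^ (M + b) * (M ^ M * b ^ b)
log-sum-step zero b r = ≤-trans (≤-reflexive (*-identityʳ (b ^ b)))
  (≤-trans (≤-reflexive (sym (*-identityˡ (b ^ b)))) (*-mono-≤ (m^n>0′ (suc r) b (s≤s z≤n)) (≤-reflexive (sym (*-identityˡ (b ^ b))))))
log-sum-step M@(suc _) zero r = subst (λ s → s ^ s * r ^ M ≤ suc r ^ s * (M ^ M * 1)) (sym (+-identityʳ M))
  (subst₂ _≤_ (*-comm (r ^ M) (M ^ M)) (cong (suc r ^ M *_) (sym (*-identityʳ (M ^ M)))) (*-monoˡ-≤ (M ^ M) (^-monoˡ-≤ M (n≤1+n r))))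
-- M copies of `r * b` and b copies of M have the sum (r+1)Mb. The factor `b ^ M * M ^ b`, which
-- weighted AM-GM leaves on both sides, is the one cancelled here.
log-sum-step M@(suc m) b@(suc c) r = *-cancelˡ-≤′ (b ^ M * M ^ b) (*-mono-≤ (m^n>0′ b M (s≤s z≤n)) (m^n>0′ M b (s≤s z≤n))) (begin
  b ^ M * M ^ b * (s ^ s * r ^ M) ≡⟨ lem₁ (b ^ M) (M ^ b) (s ^ s) (r ^ M) ⟩
  s ^ s * (r ^ M * b ^ M * M ^ b) ≡⟨ cong (λ z → s ^ s * (z * M ^ b)) (sym (^-distribʳ-* M r b)) ⟩
  s ^ s * ((r * b) ^ M * M ^ b) ≤⟨ weighted-amgm M b (r * b) M ⟩
  (M * (r * b) + b * M) ^ s ≡⟨ cong (_^ s) (lem₂ M r b) ⟩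
  (suc r * (M * b)) ^ s ≡⟨ ^-distribʳ-* s (suc r) (M * b) ⟩
  suc r ^ s * (M * b) ^ s ≡⟨ cong (suc r ^ s *_) (trans (^-distribʳ-* s M b) (cong₂ _*_ (^-distribˡ-+-* M M b) (^-distribˡ-+-* b M b))) ⟩
  suc r ^ s * (M ^ M * M ^ b * (b ^ M * b ^ b)) ≡⟨ lem₃ (suc r ^ s) (M ^ M) (M ^ b) (b ^ M) (b ^ b) ⟩
  b ^ M * M ^ b * (suc r ^ s * (M ^ M * b ^ b)) ∎)
  where
  open ≤-Reasoning
  s = M + b
  lem₁ : ∀ a b c d → a * b * (c * d) ≡ c * (d * a * b)
  lem₁ = solve-∀
  lem₂ : ∀ M r b → M * (r * b) + b * M ≡ suc r * (M * b)
  lem₂ = solve-∀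
  lem₃ : ∀ a b c d e → a * (b * c * (d * e)) ≡ d * c * (a * (b * e))
  lem₃ = solve-∀

-- Finite sets as duplicate-free lists

∉⇒All≢ : ∀ {A : Set} {x : A} {xs} → x ∉ xs → All (x ≢_) xs
∉⇒All≢ {xs = []} _ = []
∉⇒All≢ {xs = y ∷ xs} p = (λ e → p (here e)) ∷ ∉⇒All≢ (λ m → p (there m))

All≢⇒∉ : ∀ {A : Set} {x : A} {xs} → All (x ≢_) xs → x ∉ xs
All≢⇒∉ (p ∷ _) (here e) = p e
All≢⇒∉ (_ ∷ ps) (there m) = All≢⇒∉ ps m

unique-∷ : ∀ {A : Set} {x : A} {xs} → x ∉ xs → Unique xs → Unique (x ∷ xs)
unique-∷ p u = ∉⇒All≢ p ∷ u

unique-head : ∀ {A : Set} {x : A} {xs} → Unique (x ∷ xs) → x ∉ xs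
unique-head (a ∷ _) = All≢⇒∉ a

unique-tail : ∀ {A : Set} {x : A} {xs} → Unique (x ∷ xs) → Unique xs
unique-tail (_ ∷ u) = u

split-∈ : ∀ {A : Set} {x : A} {xs} → x ∈ xs → ∃ λ ys → xs ↭ x ∷ ys
split-∈ m with ∈-∃++ m
... | as , bs , refl = as ++ bs , shift _ as bs

unique-⊆-length : ∀ {A : Set} {xs ys : List A} → Unique xs → (∀ {x} → x ∈ xs → x ∈ ys) → length xs ≤ length ys
unique-⊆-length [] _ = z≤n
unique-⊆-length {xs = x ∷ xs} {ys} u@(_ ∷ u′) s with split-∈ (s (here refl))
... | zs , ys↭ = subst (suc (length xs) ≤_) (sym (↭-length ys↭)) (s≤s (unique-⊆-length u′ sub))
  where
  sub : ∀ {y} → y ∈ xs → y ∈ zs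
  sub m with ∈-resp-↭ ys↭ (s (there m))
  ... | here refl = contradiction m (unique-head u)
  ... | there m′ = m′

unique-map : ∀ {A B : Set} (f : A → B) {xs} → Unique xs → (∀ {x y} → x ∈ xs → y ∈ xs → f x ≡ f y → x ≡ y) → Unique (map f xs)
unique-map f [] _ = []
unique-map f {x ∷ xs} u@(_ ∷ u′) inj = unique-∷ h (unique-map f u′ (λ a b → inj (there a) (there b)))
  where
  h : f x ∉ map f xs
  h m with ∈-map⁻ f m
  ... | y , y∈ , e = unique-head u (subst (_∈ xs) (sym (inj (here refl) (there y∈) e)) y∈)

inj-length : ∀ {A B : Set} (f : A → B) {xs ys} → Unique xs → (∀ {x} → x ∈ xs → f x ∈ ys) →
  (∀ {x y} → x ∈ xs → y ∈ xs → f x ≡ f y → x ≡ y) → length xs ≤ length ys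
inj-length f {xs} {ys} u into inj = subst (_≤ length ys) (length-map f xs) (unique-⊆-length (unique-map f u inj) sub)
  where
  sub : ∀ {y} → y ∈ map f xs → y ∈ ys
  sub m with ∈-map⁻ f m
  ... | x , x∈ , refl = into x∈

unique-filter : ∀ {A : Set} {P : A → Set} (P? : Decidable P) {xs} → Unique xs → Unique (filter P? xs)
unique-filter P? {xs} u = unique-filter⁺ P? u

unique-++ : ∀ {A : Set} {xs ys : List A} → Unique xs → Unique ys → (∀ {x} → x ∈ xs → x ∉ ys) → Unique (xs ++ ys)
unique-++ {xs = []} _ v _ = v
unique-++ {xs = x ∷ xs} {ys} u@(_ ∷ u′) v d = unique-∷ h (unique-++ u′ v (λ m → d (there m)))
  where
  h : x ∉ xs ++ ys
  h m with ∈-++⁻ xs m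
  ... | inj₁ a = unique-head u a
  ... | inj₂ b = d (here refl) b

unique-++-disjoint : ∀ {A : Set} (xs : List A) {ys : List A} → Unique (xs ++ ys) → ∀ {x} → x ∈ xs → x ∉ ys
unique-++-disjoint (x ∷ xs) u (here refl) m = unique-head u (∈-++⁺ʳ xs m)
unique-++-disjoint (x ∷ xs) (_ ∷ u) (there a) m = unique-++-disjoint xs u a m

unique-++ˡ : ∀ {A : Set} (xs : List A) {ys : List A} → Unique (xs ++ ys) → Unique xs
unique-++ˡ [] _ = []
unique-++ˡ (x ∷ xs) u@(_ ∷ u′) = unique-∷ (λ m → unique-head u (∈-++⁺ˡ m)) (unique-++ˡ xs u′)

unique-++ʳ : ∀ {A : Set} (xs : List A) {ys : List A} → Unique (xs ++ ys) → Unique ys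
unique-++ʳ [] u = u
unique-++ʳ (x ∷ xs) (_ ∷ u) = unique-++ʳ xs u

unique-↭ : ∀ {A : Set} {xs ys : List A} → xs ↭ ys → Unique xs → Unique ys
unique-↭ ↭refl u = u
unique-↭ (prep x p) u@(_ ∷ u′) = unique-∷ (λ m → unique-head u (∈-resp-↭ (↭-sym p) m)) (unique-↭ p u′)
unique-↭ (swap x y p) ((x≢y ∷ a) ∷ (b ∷ u)) =
  ((λ e → x≢y (sym e)) ∷ ∉⇒All≢ (λ m → All≢⇒∉ b (∈-resp-↭ (↭-sym p) m))) ∷ (∉⇒All≢ (λ m → All≢⇒∉ a (∈-resp-↭ (↭-sym p) m)) ∷ unique-↭ p u)
unique-↭ (↭trans p q) u = unique-↭ q (unique-↭ p u)

same-elements-↭ : ∀ {A : Set} {xs ys : List A} → Unique xs → Unique ys → (∀ {x} → x ∈ xs → x ∈ ys) → (∀ {x} → x ∈ ys → x ∈ xs) → xs ↭ ys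
same-elements-↭ {xs = []} {[]} _ _ _ _ = ↭refl
same-elements-↭ {xs = []} {y ∷ ys} _ _ _ t with t (here refl)
... | ()
same-elements-↭ {xs = x ∷ xs} {ys} u@(_ ∷ u′) v s t with split-∈ (s (here refl))
... | zs , p = ↭trans (prep x (same-elements-↭ u′ (unique-tail uz) to from)) (↭-sym p)
  where
  uz : Unique (x ∷ zs)
  uz = unique-↭ p v
  to : ∀ {y} → y ∈ xs → y ∈ zs
  to m with ∈-resp-↭ p (s (there m))
  ... | here refl = contradiction m (unique-head u)
  ... | there m′ = m′
  from : ∀ {y} → y ∈ zs → y ∈ xs
  from m with t (∈-resp-↭ (↭-sym p) (there m))
  ... | here refl = contradiction m (unique-head uz)
  ... | there m′ = m′

length-allFin : ∀ n → length (allFin n) ≡ n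
length-allFin n = length-tabulate id

unique-full : ∀ {n} {xs : List (Fin n)} → Unique xs → length xs ≡ n → ∀ x → x ∈ xs
unique-full {n} {xs} u e x with anyL? (x ≟F_) xs
... | yes p = p
... | no ¬p = contradiction (≤-trans (unique-⊆-length (unique-∷ ¬p u) (λ {y} _ → ∈-allFin y)) (≤-reflexive (length-allFin n)))
                (λ q → <-irrefl e q)
-- Sums and products over lists

Π : ∀ {A : Set} → (A → ℕ) → List A → ℕ
Π f xs = product (map f xs)

Π-mono : ∀ {A : Set} {f g : A → ℕ} xs → (∀ {x} → x ∈ xs → f x ≤ g x) → Π f xs ≤ Π g xs
Π-mono [] _ = ≤-refl
Π-mono (x ∷ xs) h = *-mono-≤ (h (here refl)) (Π-mono xs (λ m → h (there m)))

Π-cong : ∀ {A : Set} {f g : A → ℕ} xs → (∀ {x} → x ∈ xs → f x ≡ g x) → Π f xs ≡ Π g xs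
Π-cong [] _ = refl
Π-cong (x ∷ xs) h = cong₂ _*_ (h (here refl)) (Π-cong xs (λ m → h (there m)))

Π-* : ∀ {A : Set} (f g : A → ℕ) xs → Π (λ x → f x * g x) xs ≡ Π f xs * Π g xs
Π-* f g [] = refl
Π-* f g (x ∷ xs) rewrite Π-* f g xs = lem (f x) (g x) (Π f xs) (Π g xs)
  where
  lem : ∀ a b A B → a * b * (A * B) ≡ a * A * (b * B)
  lem = solve-∀

Π-const : ∀ {A : Set} c (xs : List A) → Π (λ _ → c) xs ≡ c ^ length xs
Π-const c [] = refl
Π-const c (x ∷ xs) = cong (c *_) (Π-const c xs)

Π-^ : ∀ {A : Set} (f : A → ℕ) m xs → Π f xs ^ m ≡ Π (λ x → f x ^ m) xs
Π-^ f m [] = ^-zeroˡ m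
Π-^ f m (x ∷ xs) = trans (^-distribʳ-* m (f x) (Π f xs)) (cong (f x ^ m *_) (Π-^ f m xs))

Π-base-^ : ∀ {A : Set} c (f : A → ℕ) xs → Π (λ x → c ^ f x) xs ≡ c ^ sum (map f xs)
Π-base-^ c f [] = refl
Π-base-^ c f (x ∷ xs) = trans (cong (c ^ f x *_) (Π-base-^ c f xs)) (sym (^-distribˡ-+-* c (f x) _))

Π-swap : ∀ {A B : Set} (f : A → B → ℕ) xs ys → Π (λ x → Π (f x) ys) xs ≡ Π (λ y → Π (λ x → f x y) xs) ys
Π-swap f [] ys = sym (trans (Π-const 1 ys) (^-zeroˡ (length ys)))
Π-swap f (x ∷ xs) ys = trans (cong (Π (f x) ys *_) (Π-swap f xs ys)) (sym (Π-* (f x) (λ y → Π (λ x → f x y) xs) ys))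

Π-++ : ∀ {A : Set} (f : A → ℕ) xs ys → Π f (xs ++ ys) ≡ Π f xs * Π f ys
Π-++ f xs ys = trans (cong product (map-++ f xs ys)) (product-++ (map f xs) (map f ys))

Π-↭ : ∀ {A : Set} (f : A → ℕ) {xs ys} → xs ↭ ys → Π f xs ≡ Π f ys
Π-↭ f p = product-↭ (↭-map⁺ f p)

Π-concatMap : ∀ {A B : Set} (f : B → ℕ) (g : A → List B) xs → Π f (concatMap g xs) ≡ Π (λ x → Π f (g x)) xs
Π-concatMap f g [] = refl
Π-concatMap f g (x ∷ xs) = trans (Π-++ f (g x) (concatMap g xs)) (cong (Π f (g x) *_) (Π-concatMap f g xs))

length-concatMap : ∀ {A B : Set} (g : A → List B) xs → length (concatMap g xs) ≡ sum (map (length ∘ g) xs)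
length-concatMap g [] = refl
length-concatMap g (x ∷ xs) = trans (length-++ (g x)) (cong (length (g x) +_) (length-concatMap g xs))

sum-mono : ∀ {A : Set} {f g : A → ℕ} xs → (∀ {x} → x ∈ xs → f x ≤ g x) → sum (map f xs) ≤ sum (map g xs)
sum-mono [] _ = ≤-refl
sum-mono (x ∷ xs) h = +-mono-≤ (h (here refl)) (sum-mono xs (λ m → h (there m)))

sum-cong : ∀ {A : Set} {f g : A → ℕ} xs → (∀ {x} → x ∈ xs → f x ≡ g x) → sum (map f xs) ≡ sum (map g xs)
sum-cong [] _ = refl
sum-cong (x ∷ xs) h = cong₂ _+_ (h (here refl)) (sum-cong xs (λ m → h (there m)))

sum-const : ∀ {A : Set} c (xs : List A) → sum (map (λ _ → c) xs) ≡ length xs * c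
sum-const c [] = refl
sum-const c (x ∷ xs) = cong (c +_) (sum-const c xs)

sum-+ : ∀ {A : Set} (f g : A → ℕ) xs → sum (map (λ x → f x + g x) xs) ≡ sum (map f xs) + sum (map g xs)
sum-+ f g [] = refl
sum-+ f g (x ∷ xs) rewrite sum-+ f g xs = lem (f x) (g x) _ _
  where
  lem : ∀ a b A B → a + b + (A + B) ≡ a + A + (b + B)
  lem = solve-∀

sum-*ˡ : ∀ {A : Set} c (f : A → ℕ) xs → sum (map (λ x → c * f x) xs) ≡ c * sum (map f xs)
sum-*ˡ c f [] = sym (*-zeroʳ c)
sum-*ˡ c f (x ∷ xs) = trans (cong (c * f x +_) (sum-*ˡ c f xs)) (sym (*-distribˡ-+ c (f x) _))

sum-swap : ∀ {A B : Set} (f : A → B → ℕ) xs ys → sum (map (λ x → sum (map (f x) ys)) xs) ≡ sum (map (λ y → sum (map (λ x → f x y) xs)) ys)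
sum-swap f [] ys = sym (trans (sum-const 0 ys) (*-zeroʳ (length ys)))
sum-swap f (x ∷ xs) ys = trans (cong (sum (map (f x) ys) +_) (sum-swap f xs ys)) (sym (sum-+ (f x) (λ y → sum (map (λ x → f x y) xs)) ys))

bit : ∀ {A : Set} → Dec A → ℕ
bit (yes _) = 1
bit (no _) = 0

module _ {A : Set} {P : A → Set} (P? : Decidable P) where

  length-filter-sum : ∀ xs → length (filter P? xs) ≡ sum (map (bit ∘ P?) xs)
  length-filter-sum [] = refl
  length-filter-sum (x ∷ xs) with P? x
  ... | yes _ = cong suc (length-filter-sum xs)
  ... | no _ = length-filter-sum xs

  Π-filter : ∀ (f : A → ℕ) xs → Π f xs ≡ Π f (filter P? xs) * Π f (filter (¬? ∘ P?) xs)
  Π-filter f [] = refl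
  Π-filter f (x ∷ xs) with P? x
  ... | yes _ = trans (cong (f x *_) (Π-filter f xs)) (sym (*-assoc (f x) (Π f (filter P? xs)) (Π f (filter (¬? ∘ P?) xs))))
  ... | no _ = trans (cong (f x *_) (Π-filter f xs)) (lem (f x) (Π f (filter P? xs)) (Π f (filter (¬? ∘ P?) xs)))
    where
    lem : ∀ a b c → a * (b * c) ≡ b * (a * c)
    lem = solve-∀

  length-filter-¬ : ∀ xs → length xs ≡ length (filter P? xs) + length (filter (¬? ∘ P?) xs)
  length-filter-¬ [] = refl
  length-filter-¬ (x ∷ xs) with P? x
  ... | yes _ = cong suc (length-filter-¬ xs)
  ... | no _ = trans (cong suc (length-filter-¬ xs)) (sym (+-suc _ _))

length-filter-cong : ∀ {A : Set} {P Q : A → Set} (P? : Decidable P) (Q? : Decidable Q) xs →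
  (∀ {x} → x ∈ xs → P x → Q x) → (∀ {x} → x ∈ xs → Q x → P x) → length (filter P? xs) ≡ length (filter Q? xs)
length-filter-cong P? Q? [] _ _ = refl
length-filter-cong P? Q? (x ∷ xs) f g with P? x | Q? x
... | yes _ | yes _ = cong suc (length-filter-cong P? Q? xs (λ m → f (there m)) (λ m → g (there m)))
... | yes p | no ¬q = contradiction (f (here refl) p) ¬q
... | no ¬p | yes q = contradiction (g (here refl) q) ¬p
... | no _ | no _ = length-filter-cong P? Q? xs (λ m → f (there m)) (λ m → g (there m))

fibre-count : ∀ {A B : Set} (_≟_ : DecidableEquality B) (f : A → B) (w : B → ℕ) xs ys →
  (∀ {x} → x ∈ xs → f x ∈ ys) → (∀ {y} → y ∈ ys → length (filter (λ x → f x ≟ y) xs) ≤ w y) → length xs ≤ sum (map w ys)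
fibre-count {A} {B} _≟_ f w xs ys into h = begin
  length xs ≡⟨ sym (trans (sum-const 1 xs) (*-identityʳ _)) ⟩
  sum (map (λ _ → 1) xs) ≤⟨ sum-mono xs (λ m → one (into m)) ⟩
  sum (map (λ x → sum (map (𝟙′ x) ys)) xs) ≡⟨ sum-swap 𝟙′ xs ys ⟩
  sum (map (λ y → sum (map (λ x → 𝟙′ x y) xs)) ys) ≡⟨ sum-cong ys (λ {y} _ → sym (length-filter-sum (λ x → f x ≟ y) xs)) ⟩
  sum (map (λ y → length (filter (λ x → f x ≟ y) xs)) ys) ≤⟨ sum-mono ys h ⟩
  sum (map w ys) ∎
  where
  open ≤-Reasoning
  𝟙′ : A → B → ℕ
  𝟙′ x y = bit (f x ≟ y)
  one : ∀ {x ys} → f x ∈ ys → 1 ≤ sum (map (𝟙′ x) ys)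
  one {x} {y ∷ ys} (here e) with f x ≟ y
  ... | yes _ = s≤s z≤n
  ... | no ne = contradiction e ne
  one {x} {y ∷ ys} (there m) = ≤-trans (one m) (m≤n+m _ _)

-- Free colours and the chain rule for the entropy of a colouring

infix 4 _∈?_
_∈?_ : ∀ {n} (x : Fin n) xs → Dec (x ∈ xs)
x ∈? xs = anyL? (x ≟F_) xs

Adj-sym : ∀ {n} (G : Graph n) {u v} → Adj G u v → Adj G v u
Adj-sym G {u} {v} = subst T (adj-sym G u v)

Adj-irrefl : ∀ {n} (G : Graph n) {v} → ¬ Adj G v v
Adj-irrefl G {v} a = subst T (adj-irrefl G v) a

Colouring : ℕ → ℕ → Set
Colouring n k = Vec (Fin k) n

Seen : ∀ {n k} → Graph n → List (Fin n) → Fin n → Colouring n k → Fin k → Set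
Seen G E v X α = Any (λ u → Adj G v u × lookup X u ≡ α) E

seen? : ∀ {n k} (G : Graph n) E v (X : Colouring n k) α → Dec (Seen G E v X α)
seen? G E v X α = anyL? (λ u → T? (adj G v u) ×-dec (lookup X u ≟F α)) E

free : ∀ {n k} → Graph n → List (Fin n) → Fin n → Colouring n k → List (Fin k)
free {k = k} G E v X = filter (λ α → ¬? (seen? G E v X α)) (allFin k)

ProperOn : ∀ {n k} → Graph n → List (Fin n) → Colouring n k → Set
ProperOn G S X = ∀ {s t} → s ∈ S → t ∈ S → Adj G s t → lookup X s ≢ lookup X t

seen-intro : ∀ {n k} (G : Graph n) {E} v (X : Colouring n k) {u} → u ∈ E → Adj G v u → Seen G E v X (lookup X u)
seen-intro G v X (here refl) a = here (a , refl)
seen-intro G v X (there m) a = there (seen-intro G v X m a)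

seen-elim : ∀ {n k} (G : Graph n) {E} v (X : Colouring n k) {α} → Seen G E v X α → ∃ λ u → u ∈ E × Adj G v u × lookup X u ≡ α
seen-elim G v X (here (a , e)) = _ , here refl , a , e
seen-elim G v X (there s) with seen-elim G v X s
... | u , m , a , e = u , there m , a , e

-- The last hypothesis makes D rainbow, so its colours are `length D` distinct colours, none of them
-- free at v.
free-bound : ∀ {n k} (G : Graph n) E v (X : Colouring n k) D → Unique D → (∀ {u} → u ∈ D → u ∈ E × Adj G v u) →
  (∀ {u w} → u ∈ D → w ∈ D → lookup X u ≡ lookup X w → u ≡ w) → length (free G E v X) + length D ≤ k
free-bound {k = k} G E v X D uD sub inj = begin
  length F + length D ≡⟨ cong (length F +_) (sym (length-map (lookup X) D)) ⟩
  length F + length C ≡⟨ sym (length-++ F) ⟩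
  length (F ++ C) ≤⟨ unique-⊆-length (unique-++ (unique-filter free? (unique-allFin k)) (unique-map (lookup X) uD inj) dis) (λ _ → ∈-allFin _) ⟩
  length (allFin k) ≡⟨ length-allFin k ⟩
  k ∎
  where
  open ≤-Reasoning
  free? = λ α → ¬? (seen? G E v X α)
  F = free G E v X
  C = map (lookup X) D
  dis : ∀ {α} → α ∈ F → α ∉ C
  dis m c with ∈-map⁻ (lookup X) c
  ... | u , u∈ , refl = proj₂ (∈-filter⁻ free? {xs = allFin k} m) (seen-intro G v X (proj₁ (sub u∈)) (proj₂ (sub u∈)))

free-cong : ∀ {n k} (G : Graph n) E v (X Y : Colouring n k) → (∀ {u} → u ∈ E → lookup X u ≡ lookup Y u) →
  length (free G E v X) ≡ length (free G E v Y)
free-cong {k = k} G E v X Y e = length-filter-cong _ _ (allFin k)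
  (λ _ ns s → ns (tr Y X (λ m → sym (e m)) s)) (λ _ ns s → ns (tr X Y e s))
  where
  tr : ∀ X Y {α} → (∀ {u} → u ∈ E → lookup X u ≡ lookup Y u) → Seen G E v X α → Seen G E v Y α
  tr X Y {α} e s with seen-elim G v X s
  ... | u , m , a , c = subst (Seen G E v Y) (trans (sym (e m)) c) (seen-intro G v Y m a)

-- Entropy of a pair without logarithms: the hypothesis bounds the conditional entropy on each fibre
-- of c, and the entropy of the colour itself is at most log |F|. The induction splits off one
-- colour of F at a time and pays for it with `log-sum-step`. Empty fibres are harmless because 0 ^
-- 0 = 1.
log-sum : ∀ {A : Set} {k} (c : A → Fin k) (g : A → ℕ) F ys → Unique ys → (∀ {x} → x ∈ ys → c x ∈ F) →
  (∀ zs α → Unique zs → (∀ {x} → x ∈ zs → x ∈ ys) → (∀ {x} → x ∈ zs → c x ≡ α) → length zs ^ length zs ≤ Π g zs) →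
  length ys ^ length ys ≤ length F ^ length ys * Π g ys
log-sum c g [] [] _ _ _ = ≤-refl
log-sum c g [] (y ∷ ys) _ m _ with m (here refl)
... | ()
log-sum c g (α ∷ F) ys u mF H = *-cancelˡ-≤′ (r ^ M) pos (begin
  r ^ M * (length ys ^ length ys) ≡⟨ cong (λ z → r ^ M * z ^ z) len ⟩
  r ^ M * (M + b) ^ (M + b) ≡⟨ *-comm (r ^ M) _ ⟩
  (M + b) ^ (M + b) * r ^ M ≤⟨ log-sum-step M b r ⟩
  suc r ^ (M + b) * (M ^ M * b ^ b) ≤⟨ *-monoʳ-≤ (suc r ^ (M + b)) (*-mono-≤ ih (H yα α uα (λ m → proj₁ (∈-filter⁻ P? {xs = ys} m)) (λ m → proj₂ (∈-filter⁻ P? {xs = ys} m)))) ⟩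
  suc r ^ (M + b) * (r ^ M * Π g y′ * Π g yα) ≡⟨ lem (suc r ^ (M + b)) (r ^ M) (Π g y′) (Π g yα) ⟩
  r ^ M * (suc r ^ (M + b) * (Π g yα * Π g y′)) ≡⟨ cong₂ (λ l p → r ^ M * (suc r ^ l * p)) (sym len) (sym (Π-filter P? g ys)) ⟩
  r ^ M * (suc r ^ length ys * Π g ys) ∎)
  where
  open ≤-Reasoning
  P? = λ x → c x ≟F α
  yα = filter P? ys
  y′ = filter (¬? ∘ P?) ys
  b = length yα
  M = length y′
  r = length F
  uα : Unique yα
  uα = unique-filter P? u
  u′ : Unique y′
  u′ = unique-filter (¬? ∘ P?) u
  in′ : ∀ {x} → x ∈ y′ → c x ∈ F
  in′ m with ∈-filter⁻ (¬? ∘ P?) {xs = ys} m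
  ... | m′ , ne with mF m′
  ... | here e = contradiction e ne
  ... | there f = f
  len : length ys ≡ M + b
  len = trans (length-filter-¬ P? ys) (+-comm b M)
  ih : M ^ M ≤ r ^ M * Π g y′
  ih = log-sum c g F y′ u′ in′ (λ zs β uz sz → H zs β uz (λ m → proj₁ (∈-filter⁻ (¬? ∘ P?) {xs = ys} (sz m))))
  lem : ∀ a b c d → a * (b * c * d) ≡ b * (a * (d * c))
  lem = solve-∀
  -- The base r may be 0, but then no element is left and the exponent is 0 too.
  pos′ : ∀ zs F → (∀ {x} → x ∈ zs → c x ∈ F) → 1 ≤ length F ^ length zs
  pos′ [] F _ = ≤-refl
  pos′ (z ∷ zs) [] h with h (here refl)
  ... | ()
  pos′ (z ∷ zs) (f ∷ F) h = m^n>0′ (suc (length F)) (suc (length zs)) (s≤s z≤n)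
  pos : 1 ≤ r ^ M
  pos = pos′ y′ F in′

-- The product of the numbers of choices that a greedy colouring along τ meets when it follows X,
-- with E coloured before it starts. Its logarithm bounds the entropy revealed along τ.
weight : ∀ {n k} → Graph n → List (Fin n) → List (Fin n) → Colouring n k → ℕ
weight G E [] X = 1
weight G E (v ∷ τ) X = length (free G E v X) * weight G (v ∷ E) τ X

-- The chain rule for the entropy of a uniform element of ys, revealed along τ, exponentiated.
entropy-chain : ∀ {n k} (G : Graph n) S τ E (ys : List (Colouring n k)) → Unique ys → (∀ {X} → X ∈ ys → ProperOn G S X) →
  (∀ {u} → u ∈ E → u ∈ S) → (∀ {u} → u ∈ τ → u ∈ S) →
  (∀ {X Y u} → X ∈ ys → Y ∈ ys → u ∈ E → lookup X u ≡ lookup Y u) →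
  (∀ {X Y} → X ∈ ys → Y ∈ ys → (∀ {u} → u ∈ τ → lookup X u ≡ lookup Y u) → X ≡ Y) →
  length ys ^ length ys ≤ Π (weight G E τ) ys
entropy-chain G S [] E [] _ _ _ _ _ _ = ≤-refl
entropy-chain G S [] E (X ∷ []) _ _ _ _ _ _ = ≤-refl
entropy-chain G S [] E (X ∷ Y ∷ ys) ((ne ∷ _) ∷ _) _ _ _ _ det = contradiction (det (here refl) (there (here refl)) (λ ())) ne
entropy-chain G S (v ∷ τ) E [] _ _ _ _ _ _ = ≤-refl
entropy-chain G S (v ∷ τ) E ys@(X₀ ∷ _) u pr sE sτ ag det = begin
  length ys ^ length ys ≤⟨ log-sum (λ X → lookup X v) (weight G (v ∷ E) τ) F ys u inF inner ⟩
  length F ^ length ys * Π (weight G (v ∷ E) τ) ys ≡⟨ cong (_* Π (weight G (v ∷ E) τ) ys) (sym (Π-const (length F) ys)) ⟩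
  -- All colourings in ys agree on E, so the free colours at X₀ may be replaced by those at each X,
  -- which is what `weight` refers to.
  Π (λ _ → length F) ys * Π (weight G (v ∷ E) τ) ys ≡⟨ cong (_* Π (weight G (v ∷ E) τ) ys) (Π-cong {f = λ _ → length F} {g = λ X → length (free G E v X)} ys (λ {X} m → free-cong G E v X₀ X (λ e → ag (here refl) m e))) ⟩
  Π (λ X → length (free G E v X)) ys * Π (weight G (v ∷ E) τ) ys ≡⟨ sym (Π-* (λ X → length (free G E v X)) (weight G (v ∷ E) τ) ys) ⟩
  Π (weight G E (v ∷ τ)) ys ∎
  where
  open ≤-Reasoning
  F = free G E v X₀
  inF : ∀ {X} → X ∈ ys → lookup X v ∈ F
  inF {X} m = ∈-filter⁺ (λ α → ¬? (seen? G E v X₀ α)) (∈-allFin _) λ sn →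
    let (w , w∈ , a , e) = seen-elim G v X₀ sn in pr m (sτ (here refl)) (sE w∈) a (trans (sym e) (ag (here refl) m w∈))
  inner : ∀ zs α → Unique zs → (∀ {X} → X ∈ zs → X ∈ ys) → (∀ {X} → X ∈ zs → lookup X v ≡ α) → length zs ^ length zs ≤ Π (weight G (v ∷ E) τ) zs
  inner zs α uz sz cz = entropy-chain G S τ (v ∷ E) zs uz (λ m → pr (sz m))
    (λ { (here refl) → sτ (here refl) ; (there m) → sE m }) (λ m → sτ (there m))
    (λ { a b (here refl) → trans (cz a) (sym (cz b)) ; a b (there m) → ag (sz a) (sz b) m })
    (λ a b h → det (sz a) (sz b) (λ { (here refl) → trans (cz a) (sym (cz b)) ; (there m) → h m }))

-- Products over all orderings of a list

inserts : ∀ {A : Set} → A → List A → List (List A)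
inserts x [] = (x ∷ []) ∷ []
inserts x (y ∷ ys) = (x ∷ y ∷ ys) ∷ map (y ∷_) (inserts x ys)

perms : ∀ {A : Set} → List A → List (List A)
perms [] = [] ∷ []
perms (x ∷ xs) = concatMap (inserts x) (perms xs)

Π-map : ∀ {A B : Set} (f : B → ℕ) (g : A → B) xs → Π f (map g xs) ≡ Π (f ∘ g) xs
Π-map f g xs = cong product (sym (map-∘ xs))

-- Both sides run over all ways to insert x and y into z. Sorting them by the first letters leaves
-- the same statement for the tail.
Π-insert-comm : ∀ {A : Set} (f : List A → ℕ) x y z →
  Π (λ τ → Π f (inserts x τ)) (inserts y z) ≡ Π (λ τ → Π f (inserts y τ)) (inserts x z)
Π-insert-comm f x y [] = lem (f (x ∷ y ∷ [])) (f (y ∷ x ∷ []))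
  where
  lem : ∀ a b → a * (b * 1) * 1 ≡ b * (a * 1) * 1
  lem = solve-∀
Π-insert-comm f x y (c ∷ z) = begin
  f xy * (f yx * Π f (map (y ∷_) (map (c ∷_) (inserts x z)))) * Π (λ τ → Π f (inserts x τ)) (map (c ∷_) (inserts y z))
    ≡⟨ cong₂ (λ p q → f xy * (f yx * p) * q) (two y x) (rest x y) ⟩
  f xy * (f yx * Π (fc y) (inserts x z)) * (Π (fc x) (inserts y z) * Π (λ w → Π f′ (inserts x w)) (inserts y z))
    ≡⟨ cong (λ q → f xy * (f yx * Π (fc y) (inserts x z)) * (Π (fc x) (inserts y z) * q)) (Π-insert-comm f′ x y z) ⟩
  f xy * (f yx * Π (fc y) (inserts x z)) * (Π (fc x) (inserts y z) * Π (λ w → Π f′ (inserts y w)) (inserts x z))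
    ≡⟨ lem (f xy) (f yx) (Π (fc y) (inserts x z)) (Π (fc x) (inserts y z)) _ ⟩
  f yx * (f xy * Π (fc x) (inserts y z)) * (Π (fc y) (inserts x z) * Π (λ w → Π f′ (inserts y w)) (inserts x z))
    ≡⟨ sym (cong₂ (λ p q → f yx * (f xy * p) * q) (two x y) (rest y x)) ⟩
  f yx * (f xy * Π f (map (x ∷_) (map (c ∷_) (inserts y z)))) * Π (λ τ → Π f (inserts y τ)) (map (c ∷_) (inserts x z)) ∎
  where
  open ≡-Reasoning
  xy = x ∷ y ∷ c ∷ z
  yx = y ∷ x ∷ c ∷ z
  fc = λ a w → f (a ∷ c ∷ w)
  f′ = λ w → f (c ∷ w)
  two : ∀ a b → Π f (map (a ∷_) (map (c ∷_) (inserts b z))) ≡ Π (fc a) (inserts b z)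
  two a b = trans (Π-map f (a ∷_) (map (c ∷_) (inserts b z))) (Π-map (λ w → f (a ∷ w)) (c ∷_) (inserts b z))
  rest : ∀ a b → Π (λ τ → Π f (inserts a τ)) (map (c ∷_) (inserts b z)) ≡ Π (fc a) (inserts b z) * Π (λ w → Π f′ (inserts a w)) (inserts b z)
  rest a b = trans (Π-map (λ τ → Π f (inserts a τ)) (c ∷_) (inserts b z))
    (trans (Π-cong (inserts b z) (λ {w} _ → cong (f (a ∷ c ∷ w) *_) (Π-map f (c ∷_) (inserts a w))))
      (Π-* (fc a) (λ w → Π f′ (inserts a w)) (inserts b z)))
  lem : ∀ a b p q r → a * (b * p) * (q * r) ≡ b * (a * q) * (p * r)
  lem = solve-∀

Π-perms-∷ : ∀ {A : Set} (f : List A → ℕ) x xs → Π f (perms (x ∷ xs)) ≡ Π (λ τ → Π f (inserts x τ)) (perms xs)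
Π-perms-∷ f x xs = Π-concatMap f (inserts x) (perms xs)

-- Allows a vertex and a chosen set of its neighbours to be moved to the end of the list, which
-- `perms` orders before it inserts anything else.
Π-perms-↭ : ∀ {A : Set} {xs ys : List A} → xs ↭ ys → (f : List A → ℕ) → Π f (perms xs) ≡ Π f (perms ys)
Π-perms-↭ ↭refl f = refl
Π-perms-↭ (prep {xs} {ys} x p) f = trans (Π-perms-∷ f x xs) (trans (Π-perms-↭ p (λ τ → Π f (inserts x τ))) (sym (Π-perms-∷ f x ys)))
Π-perms-↭ (swap {xs} {ys} x y p) f = begin
  Π f (perms (x ∷ y ∷ xs)) ≡⟨ trans (Π-perms-∷ f x (y ∷ xs)) (Π-perms-∷ (λ τ → Π f (inserts x τ)) y xs) ⟩
  Π (λ τ → Π (λ τ → Π f (inserts x τ)) (inserts y τ)) (perms xs) ≡⟨ Π-cong (perms xs) (λ {z} _ → Π-insert-comm f x y z) ⟩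
  Π (λ τ → Π (λ τ → Π f (inserts y τ)) (inserts x τ)) (perms xs) ≡⟨ Π-perms-↭ p _ ⟩
  Π (λ τ → Π (λ τ → Π f (inserts y τ)) (inserts x τ)) (perms ys) ≡⟨ sym (trans (Π-perms-∷ f y (x ∷ ys)) (Π-perms-∷ (λ τ → Π f (inserts y τ)) x ys)) ⟩
  Π f (perms (y ∷ x ∷ ys)) ∎
  where open ≡-Reasoning
Π-perms-↭ (↭trans p q) f = trans (Π-perms-↭ p f) (Π-perms-↭ q f)

∈-inserts : ∀ {A : Set} {x : A} {σ τ} → τ ∈ inserts x σ → τ ↭ x ∷ σ
∈-inserts {σ = []} (here refl) = ↭refl
∈-inserts {σ = y ∷ σ} (here refl) = ↭refl
∈-inserts {x = x} {σ = y ∷ σ} (there m) with ∈-map⁻ (y ∷_) m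
... | τ , τ∈ , refl = ↭trans (prep y (∈-inserts τ∈)) (swap y x ↭refl)

concatMap-∈ : ∀ {A B : Set} (f : A → List B) xs {y} → y ∈ concatMap f xs → ∃ λ x → x ∈ xs × y ∈ f x
concatMap-∈ f (x ∷ xs) m with ∈-++⁻ (f x) m
... | inj₁ a = x , here refl , a
... | inj₂ b with concatMap-∈ f xs b
... | z , z∈ , y∈ = z , there z∈ , y∈

∈-perms : ∀ {A : Set} {xs σ : List A} → σ ∈ perms xs → σ ↭ xs
∈-perms {xs = []} (here refl) = ↭refl
∈-perms {xs = x ∷ xs} m with concatMap-∈ (inserts x) (perms xs) m
... | τ , τ∈ , σ∈ = ↭trans (∈-inserts σ∈) (prep x (∈-perms τ∈))

perms-length : ∀ {A : Set} (xs : List A) {σ} → σ ∈ perms xs → length σ ≡ length xs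
perms-length xs m = ↭-length (∈-perms {xs = xs} m)

^-^-comm : ∀ a b c → (a ^ b) ^ c ≡ (a ^ c) ^ b
^-^-comm a b c = trans (^-*-assoc a b c) (trans (cong (a ^_) (*-comm b c)) (sym (^-*-assoc a c b)))

length-inserts : ∀ {A : Set} (x : A) σ → length (inserts x σ) ≡ suc (length σ)
length-inserts x [] = refl
length-inserts x (y ∷ σ) = cong suc (trans (length-map (y ∷_) (inserts x σ)) (length-inserts x σ))

length-perms-∷ : ∀ {A : Set} (x : A) xs → length (perms (x ∷ xs)) ≡ length (perms xs) * suc (length xs)
length-perms-∷ x xs = begin
  length (concatMap (inserts x) (perms xs)) ≡⟨ length-concatMap (inserts x) (perms xs) ⟩
  sum (map (length ∘ inserts x) (perms xs)) ≡⟨ sum-cong (perms xs) (λ {σ} m → trans (length-inserts x σ) (cong suc (perms-length xs m))) ⟩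
  sum (map (λ _ → suc (length xs)) (perms xs)) ≡⟨ sum-const (suc (length xs)) (perms xs) ⟩
  length (perms xs) * suc (length xs) ∎
  where open ≡-Reasoning

length-perms : ∀ {A : Set} (xs : List A) → length (perms xs) ≡ length xs !
length-perms [] = refl
length-perms (x ∷ xs) = trans (length-perms-∷ x xs) (trans (*-comm _ (suc (length xs))) (cong (suc (length xs) *_) (length-perms xs)))

perms-nonempty : ∀ {A : Set} (xs : List A) → 1 ≤ length (perms xs)
perms-nonempty [] = ≤-refl
perms-nonempty (x ∷ xs) = subst (1 ≤_) (sym (length-perms-∷ x xs)) (*-mono-≤ (perms-nonempty xs) (s≤s z≤n))

rank : ∀ {n} → List (Fin n) → Fin n → List (Fin n) → ℕ
rank R v [] = 0
rank R v (x ∷ σ) with x ≟F v | x ∈? R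
... | yes _ | _ = 0
... | no _ | yes _ = suc (rank R v σ)
... | no _ | no _ = rank R v σ

upto : (ℕ → ℕ) → ℕ → ℕ
upto h zero = h 0
upto h (suc m) = h 0 * upto (h ∘ suc) m

module _ {n} (R : List (Fin n)) (v : Fin n) where

  rank-here : ∀ σ → rank R v (v ∷ σ) ≡ 0
  rank-here σ with v ≟F v | v ∈? R
  ... | yes _ | _ = refl
  ... | no ne | _ = contradiction refl ne

  rank-in : ∀ {x} σ → x ≢ v → x ∈ R → rank R v (x ∷ σ) ≡ suc (rank R v σ)
  rank-in {x} σ ne m with x ≟F v | x ∈? R
  ... | yes e | _ = contradiction e ne
  ... | no _ | yes _ = refl
  ... | no _ | no nm = contradiction m nm

  rank-out : ∀ {x} σ → x ≢ v → x ∉ R → rank R v (x ∷ σ) ≡ rank R v σ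
  rank-out {x} σ ne nm with x ≟F v | x ∈? R
  ... | yes e | _ = contradiction e ne
  ... | no _ | yes m = contradiction m nm
  ... | no _ | no _ = refl

  rank-tail : ∀ {x} σ τ → rank R v σ ≡ rank R v τ → rank R v (x ∷ σ) ≡ rank R v (x ∷ τ)
  rank-tail {x} σ τ e with x ≟F v | x ∈? R
  ... | yes _ | _ = refl
  ... | no _ | yes _ = cong suc e
  ... | no _ | no _ = e

  rank-insert-other : ∀ {x} σ {τ} → x ≢ v → x ∉ R → τ ∈ inserts x σ → rank R v τ ≡ rank R v σ
  rank-insert-other [] ne nm (here refl) = rank-out [] ne nm
  rank-insert-other (y ∷ σ) ne nm (here refl) = rank-out (y ∷ σ) ne nm
  rank-insert-other (y ∷ σ) ne nm (there m) with ∈-map⁻ (y ∷_) m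
  ... | τ , τ∈ , refl = rank-tail {y} τ σ (rank-insert-other σ ne nm τ∈)

  rank-insert-self : ∀ (h : ℕ → ℕ) σ → v ∉ σ → (∀ {x} → x ∈ σ → x ∈ R) → Π (λ τ → h (rank R v τ)) (inserts v σ) ≡ upto h (length σ)
  rank-insert-self h [] _ _ = trans (*-identityʳ _) (cong h (rank-here []))
  rank-insert-self h (y ∷ σ) v∉ sub = cong₂ _*_ (cong h (rank-here (y ∷ σ)))
    (trans (Π-map (λ τ → h (rank R v τ)) (y ∷_) (inserts v σ))
      (trans (Π-cong (inserts v σ) (λ {τ} _ → cong h (rank-in τ (λ e → v∉ (here (sym e))) (sub (here refl)))))
        (rank-insert-self (h ∘ suc) σ (λ m → v∉ (there m)) (λ m → sub (there m)))))

  -- Inserting an element of zs never changes the rank of v, so it only repeats each factor equally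
  -- often. In the base case v is inserted into an ordering of R, where each rank from 0 to |R|
  -- occurs once. The exponent |R| + 1 on the left stands for a geometric mean.
  rank-product-++ : ∀ (h : ℕ → ℕ) zs → Unique (zs ++ v ∷ R) →
    Π (λ σ → h (rank R v σ)) (perms (zs ++ v ∷ R)) ^ suc (length R) ≡ upto h (length R) ^ length (perms (zs ++ v ∷ R))
  rank-product-++ h [] u = begin
    Π f (perms (v ∷ R)) ^ suc (length R) ≡⟨ cong (_^ suc (length R)) (trans (Π-perms-∷ f v R) (Π-cong (perms R) self)) ⟩
    Π (λ _ → upto h (length R)) (perms R) ^ suc (length R) ≡⟨ cong (_^ suc (length R)) (Π-const (upto h (length R)) (perms R)) ⟩
    (upto h (length R) ^ length (perms R)) ^ suc (length R) ≡⟨ ^-*-assoc (upto h (length R)) (length (perms R)) (suc (length R)) ⟩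
    upto h (length R) ^ (length (perms R) * suc (length R)) ≡⟨ cong (upto h (length R) ^_) (sym (length-perms-∷ v R)) ⟩
    upto h (length R) ^ length (perms (v ∷ R)) ∎
    where
    open ≡-Reasoning
    f = λ σ → h (rank R v σ)
    self : ∀ {σ} → σ ∈ perms R → Π f (inserts v σ) ≡ upto h (length R)
    self m = trans (rank-insert-self h _ (λ v∈ → unique-head u (∈-resp-↭ (∈-perms {xs = R} m) v∈)) (∈-resp-↭ (∈-perms {xs = R} m))) (cong (upto h) (perms-length R m))
  rank-product-++ h (x ∷ zs) u@(_ ∷ u′) = begin
    Π f (perms (x ∷ ws)) ^ r ≡⟨ cong (_^ r) (trans (Π-perms-∷ f x ws) (Π-cong (perms ws) other)) ⟩
    Π (λ σ → f σ ^ suc (length ws)) (perms ws) ^ r ≡⟨ cong (_^ r) (sym (Π-^ f (suc (length ws)) (perms ws))) ⟩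
    (Π f (perms ws) ^ suc (length ws)) ^ r ≡⟨ ^-^-comm (Π f (perms ws)) (suc (length ws)) r ⟩
    (Π f (perms ws) ^ r) ^ suc (length ws) ≡⟨ cong (_^ suc (length ws)) (rank-product-++ h zs u′) ⟩
    (upto h (length R) ^ length (perms ws)) ^ suc (length ws) ≡⟨ ^-*-assoc (upto h (length R)) (length (perms ws)) (suc (length ws)) ⟩
    upto h (length R) ^ (length (perms ws) * suc (length ws)) ≡⟨ cong (upto h (length R) ^_) (sym (length-perms-∷ x ws)) ⟩
    upto h (length R) ^ length (perms (x ∷ ws)) ∎
    where
    open ≡-Reasoning
    f = λ σ → h (rank R v σ)
    ws = zs ++ v ∷ R
    r = suc (length R)
    other : ∀ {σ} → σ ∈ perms ws → Π f (inserts x σ) ≡ f σ ^ suc (length ws)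
    other {σ} m = trans (Π-cong (inserts x σ) (λ τ∈ → cong h (rank-insert-other σ x≢v x∉R τ∈)))
      (trans (Π-const (f σ) (inserts x σ)) (cong (f σ ^_) (trans (length-inserts x σ) (cong suc (perms-length ws m)))))
      where
      x≢v : x ≢ v
      x≢v e = unique-head u (∈-++⁺ʳ zs (here e))
      x∉R : x ∉ R
      x∉R q = unique-head u (∈-++⁺ʳ zs (there q))

  -- In a uniformly random ordering the rank of v among v ∷ R is uniform.
  rank-product : ∀ (h : ℕ → ℕ) {xs} → Unique xs → v ∈ xs → Unique (v ∷ R) → (∀ {x} → x ∈ R → x ∈ xs) →
    Π (λ σ → h (rank R v σ)) (perms xs) ^ suc (length R) ≡ upto h (length R) ^ length (perms xs)
  rank-product h {xs} u v∈ uR sub = trans (cong (_^ suc (length R)) (Π-perms-↭ p f))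
    (trans (rank-product-++ h zs (unique-↭ p u)) (cong (upto h (length R) ^_) (trans (length-perms (zs ++ v ∷ R)) (trans (cong _! (sym (↭-length p))) (sym (length-perms xs))))))
    where
    f = λ σ → h (rank R v σ)
    out? = λ x → ¬? (x ∈? (v ∷ R))
    zs = filter out? xs
    vR⊆ : ∀ {x} → x ∈ v ∷ R → x ∈ xs
    vR⊆ (here refl) = v∈
    vR⊆ (there m) = sub m
    to : ∀ {x} → x ∈ xs → x ∈ zs ++ v ∷ R
    to {x} m with x ∈? (v ∷ R)
    ... | yes q = ∈-++⁺ʳ zs q
    ... | no q = ∈-++⁺ˡ (∈-filter⁺ out? m q)
    from : ∀ {x} → x ∈ zs ++ v ∷ R → x ∈ xs
    from m with ∈-++⁻ zs m
    ... | inj₁ a = proj₁ (∈-filter⁻ out? {xs = xs} a)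
    ... | inj₂ b = vR⊆ b
    p : xs ↭ zs ++ v ∷ R
    p = same-elements-↭ u (unique-++ (unique-filter out? u) uR (λ a → proj₂ (∈-filter⁻ out? {xs = xs} a))) to from

count-in : ∀ {n} → List (Fin n) → List (Fin n) → ℕ
count-in R E = length (filter (_∈? R) E)

-- Turns a local bound by the number of earlier elements of `R v` into a product over vertices. E₀
-- holds the vertices that are always revealed beforehand: none for random orders, the connected
-- dominating set for the two fixed orders.
weight-rank : ∀ {n k} (G : Graph n) (X : Colouring n k) (S E₀ : List (Fin n)) (R : Fin n → List (Fin n)) (h : Fin n → ℕ → ℕ) →
  (∀ {v E} → v ∈ S → Unique E → (∀ {u} → u ∈ E₀ → u ∈ E) → length (free G E v X) ≤ h v (count-in (R v) E)) →
  ∀ σ E → (∀ {v} → v ∈ σ → v ∈ S) → (∀ {v} → v ∈ E₀ → v ∈ E) → Unique σ → Unique E → (∀ {v} → v ∈ σ → v ∉ E) →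
  weight G E σ X ≤ Π (λ v → h v (count-in (R v) E + rank (R v) v σ)) σ
weight-rank G X S E₀ R h b [] E _ _ _ _ _ = ≤-refl
weight-rank G X S E₀ R h b (v ∷ σ) E σS ES uσ@(_ ∷ uσ′) uE d = *-mono-≤
  (≤-trans (b (σS (here refl)) uE ES) (≤-reflexive (cong (h v) (trans (sym (+-identityʳ _)) (cong (count-in (R v) E +_) (sym (rank-here (R v) v σ)))))))
  (≤-trans (weight-rank G X S E₀ R h b σ (v ∷ E) (λ m → σS (there m)) (λ m → there (ES m)) uσ′ (unique-∷ (d (here refl)) uE) d′)
    (≤-reflexive (Π-cong σ (λ {w} m → cong (h w) (move w (λ e → unique-head uσ (subst (_∈ σ) e m)))))))
  where
  d′ : ∀ {w} → w ∈ σ → w ∉ v ∷ E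
  d′ m (here refl) = unique-head uσ m
  d′ m (there m′) = d (there m) m′
  -- When v passes from the remaining order into E, an element of `R w` leaves the rank and enters
  -- the count, so their sum is the number of elements of `R w` before w throughout.
  move : ∀ w → w ≢ v → count-in (R w) (v ∷ E) + rank (R w) w σ ≡ count-in (R w) E + rank (R w) w (v ∷ σ)
  move w ne = case v ∈? R w of λ
    { (yes p) → trans (cong (_+ rank (R w) w σ) (cong length (filter-accept (_∈? R w) p))) (trans (sym (+-suc (count-in (R w) E) (rank (R w) w σ))) (cong (count-in (R w) E +_) (sym (rank-in (R w) w σ (λ e → ne (sym e)) p))))
    ; (no p) → trans (cong (_+ rank (R w) w σ) (cong length (filter-reject (_∈? R w) p))) (cong (count-in (R w) E +_) (sym (rank-out (R w) w σ (λ e → ne (sym e)) p))) }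

-- Colourings of a vertex list, extended by zero

allColourings : ∀ n k → List (Colouring n k)
allColourings zero k = [] ∷ []
allColourings (suc n) k = concatMap (λ a → map (a ∷_) (allColourings n k)) (allFin k)

unique-concatMap : ∀ {A B : Set} (f : A → List B) {xs} → Unique xs → (∀ {x} → x ∈ xs → Unique (f x)) →
  (∀ {x y z} → x ∈ xs → y ∈ xs → z ∈ f x → z ∈ f y → x ≡ y) → Unique (concatMap f xs)
unique-concatMap f [] _ _ = []
unique-concatMap f {x ∷ xs} u@(_ ∷ u′) uf d = unique-++ (uf (here refl)) (unique-concatMap f u′ (λ m → uf (there m)) (λ a b → d (there a) (there b))) dis
  where
  dis : ∀ {z} → z ∈ f x → z ∉ concatMap f xs
  dis m m′ with concatMap-∈ f xs m′
  ... | y , y∈ , z∈ = unique-head u (subst (_∈ xs) (sym (d (here refl) (there y∈) m z∈)) y∈)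

∈-concatMap : ∀ {A B : Set} (f : A → List B) {xs x y} → x ∈ xs → y ∈ f x → y ∈ concatMap f xs
∈-concatMap f (here refl) m = ∈-++⁺ˡ m
∈-concatMap f {x ∷ xs} (there a) m = ∈-++⁺ʳ (f x) (∈-concatMap f a m)

unique-allColourings : ∀ n k → Unique (allColourings n k)
unique-allColourings zero k = [] ∷ []
unique-allColourings (suc n) k = unique-concatMap _ (unique-allFin k)
  (λ {a} _ → unique-map (a ∷_) (unique-allColourings n k) (λ _ _ → tail-≡))
  (λ {a} {b} _ _ m m′ → heads a b m m′)
  where
  tail-≡ : ∀ {a : Fin k} {X Y : Colouring n k} → a ∷ X ≡ a ∷ Y → X ≡ Y
  tail-≡ refl = refl
  heads : ∀ a b {Z} → Z ∈ map (a ∷_) (allColourings n k) → Z ∈ map (b ∷_) (allColourings n k) → a ≡ b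
  heads a b m m′ with ∈-map⁻ (a ∷_) m | ∈-map⁻ (b ∷_) m′
  ... | _ , _ , refl | _ , _ , refl = refl

∈-allColourings : ∀ {n k} (X : Colouring n k) → X ∈ allColourings n k
∈-allColourings [] = here refl
∈-allColourings {suc n} {k} (a ∷ X) = ∈-concatMap (λ a → map (a ∷_) (allColourings n k)) (∈-allFin a) (∈-map⁺ (a ∷_) (∈-allColourings X))

vec-ext : ∀ {A : Set} {n} {X Y : Vec A n} → (∀ i → lookup X i ≡ lookup Y i) → X ≡ Y
vec-ext {X = X} {Y} h = trans (sym (tabulate∘lookup X)) (trans (tabulate-cong h) (tabulate∘lookup Y))

ifDec : ∀ {A B : Set} → Dec A → B → B → B
ifDec (yes _) x y = x
ifDec (no _) x y = y

ifDec-yes : ∀ {A B : Set} (d : Dec A) {x y : B} → A → ifDec d x y ≡ x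
ifDec-yes (yes _) _ = refl
ifDec-yes (no ¬a) a = contradiction a ¬a

ifDec-no : ∀ {A B : Set} (d : Dec A) {x y : B} → ¬ A → ifDec d x y ≡ y
ifDec-no (yes a) ¬a = contradiction a ¬a
ifDec-no (no _) _ = refl

module _ {n k′ : ℕ} where

  private k = suc k′

  -- Selects one vector for each colouring of S, so that colourings of different vertex lists share
  -- one type and counting vectors counts colourings.
  ZeroOff : List (Fin n) → Colouring n k → Set
  ZeroOff S X = ∀ v → v ∉ S → lookup X v ≡ fz

  IsCol : Graph n → List (Fin n) → Colouring n k → Set
  IsCol G S X = (∀ s t → s ∈ S → t ∈ S → Adj G s t → lookup X s ≢ lookup X t) × ZeroOff S X

  isCol? : ∀ G S X → Dec (IsCol G S X)
  isCol? G S X = allF? (λ s → allF? (λ t → (s ∈? S) →-dec ((t ∈? S) →-dec (T? (adj G s t) →-dec ¬? (lookup X s ≟F lookup X t)))))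
    ×-dec allF? (λ v → ¬? (v ∈? S) →-dec (lookup X v ≟F fz))

  abstract
    Cols : Graph n → List (Fin n) → List (Colouring n k)
    Cols G S = filter (isCol? G S) (allColourings n k)

    unique-Cols : ∀ G S → Unique (Cols G S)
    unique-Cols G S = unique-filter (isCol? G S) (unique-allColourings n k)

    Cols-intro : ∀ {G S X} → ProperOn G S X → ZeroOff S X → X ∈ Cols G S
    Cols-intro {G} {S} {X} p z = ∈-filter⁺ (isCol? G S) (∈-allColourings X) ((λ s t → p) , z)

    Cols-proper : ∀ {G S X} → X ∈ Cols G S → ProperOn G S X
    Cols-proper {G} {S} m a b = proj₁ (proj₂ (∈-filter⁻ (isCol? G S) {xs = allColourings n k} m)) _ _ a b

    Cols-zero : ∀ {G S X} → X ∈ Cols G S → ZeroOff S X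
    Cols-zero {G} {S} m = proj₂ (proj₂ (∈-filter⁻ (isCol? G S) {xs = allColourings n k} m))

    Cols-≡ : ∀ G S → Cols G S ≡ filter (isCol? G S) (allColourings n k)
    Cols-≡ G S = refl

  # : Graph n → List (Fin n) → ℕ
  # G S = length (Cols G S)

  restr : List (Fin n) → Colouring n k → Colouring n k
  restr T X = tabulate λ v → ifDec (v ∈? T) (lookup X v) fz

  restr-in : ∀ {T} X {v} → v ∈ T → lookup (restr T X) v ≡ lookup X v
  restr-in {T} X {v} m = trans (lookup∘tabulate _ v) (ifDec-yes (v ∈? T) m)

  restr-out : ∀ {T} X {v} → v ∉ T → lookup (restr T X) v ≡ fz
  restr-out {T} X {v} m = trans (lookup∘tabulate _ v) (ifDec-no (v ∈? T) m)

  restr-≡ : ∀ {T} X Y → restr T X ≡ restr T Y → ∀ {v} → v ∈ T → lookup X v ≡ lookup Y v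
  restr-≡ {T} X Y e {v} m = trans (sym (restr-in X m)) (trans (cong (λ Z → lookup Z v) e) (restr-in Y m))

  Cols-ext : ∀ {G S X Y} → X ∈ Cols G S → Y ∈ Cols G S → (∀ {u} → u ∈ S → lookup X u ≡ lookup Y u) → X ≡ Y
  Cols-ext {G} {S} {X} {Y} mX mY h = vec-ext e
    where
    e : ∀ i → lookup X i ≡ lookup Y i
    e i with i ∈? S
    ... | yes m = h m
    ... | no ¬m = trans (Cols-zero {G} mX i ¬m) (sym (Cols-zero {G} mY i ¬m))

  restr-Cols : ∀ {G S T X} → (∀ {u} → u ∈ T → u ∈ S) → X ∈ Cols G S → restr T X ∈ Cols G T
  restr-Cols {G} {S} {T} {X} sub m = Cols-intro {G}
    (λ a b ad e → Cols-proper {G} m (sub a) (sub b) ad (trans (sym (restr-in X a)) (trans e (restr-in X b)))) (λ v → restr-out X)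

  -- Counts by fibres of the restriction to T: a colouring is determined there by its colour at u,
  -- for which L lists the possibilities.
  restrict-count : ∀ (xs ys : List (Colouring n k)) T u (L : Colouring n k → List (Fin k)) → Unique xs → (∀ {X} → X ∈ xs → restr T X ∈ ys) →
    (∀ {X} → X ∈ xs → lookup X u ∈ L (restr T X)) →
    (∀ {X Y} → X ∈ xs → Y ∈ xs → restr T X ≡ restr T Y → lookup X u ≡ lookup Y u → X ≡ Y) →
    length xs ≤ sum (map (length ∘ L) ys)
  restrict-count xs ys T u L ux into inL inj = fibre-count vec≟ (restr T) (length ∘ L) xs ys into fib
    where
    vec≟ : DecidableEquality (Colouring n k)
    vec≟ = ≡-dec-vec _≟F_
    fib : ∀ {c} → c ∈ ys → length (filter (λ X → vec≟ (restr T X) c) xs) ≤ length (L c)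
    fib {c} _ = inj-length (λ X → lookup X u) (unique-filter (λ X → vec≟ (restr T X) c) ux) to
      (λ a b e → inj (fst a) (fst b) (trans (snd a) (sym (snd b))) e)
      where
      fst : ∀ {X} → X ∈ filter (λ X → vec≟ (restr T X) c) xs → X ∈ xs
      fst m = proj₁ (∈-filter⁻ (λ X → vec≟ (restr T X) c) {xs = xs} m)
      snd : ∀ {X} → X ∈ filter (λ X → vec≟ (restr T X) c) xs → restr T X ≡ c
      snd m = proj₂ (∈-filter⁻ (λ X → vec≟ (restr T X) c) {xs = xs} m)
      to : ∀ {X} → X ∈ filter (λ X → vec≟ (restr T X) c) xs → lookup X u ∈ L c
      to {X} m = subst (λ z → lookup X u ∈ L z) (snd m) (inL (fst m))

  extend-sum : ∀ G S u {Q Q′ : Colouring n k → Set} (Q? : Decidable Q) (Q′? : Decidable Q′) (L : Colouring n k → List (Fin k)) →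
    (∀ {X} → X ∈ Cols G (u ∷ S) → Q X → Q′ (restr S X)) → (∀ {X} → X ∈ Cols G (u ∷ S) → Q X → lookup X u ∈ L (restr S X)) →
    length (filter Q? (Cols G (u ∷ S))) ≤ sum (map (length ∘ L) (filter Q′? (Cols G S)))
  extend-sum G S u Q? Q′? L q l = restrict-count _ _ S u L (unique-filter Q? (unique-Cols G (u ∷ S)))
    (λ m → ∈-filter⁺ Q′? (restr-Cols {G} there (fst m)) (q (fst m) (snd m))) (λ m → l (fst m) (snd m))
    (λ {X} {Y} a b e e′ → Cols-ext {G} (fst a) (fst b) (λ { (here refl) → e′ ; (there m) → restr-≡ X Y e m }))
    where
    fst : ∀ {X} → X ∈ filter Q? (Cols G (u ∷ S)) → X ∈ Cols G (u ∷ S)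
    fst m = proj₁ (∈-filter⁻ Q? {xs = Cols G (u ∷ S)} m)
    snd : ∀ {X} → X ∈ filter Q? (Cols G (u ∷ S)) → _
    snd m = proj₂ (∈-filter⁻ Q? {xs = Cols G (u ∷ S)} m)

  #-∷ : ∀ G S u → # G (u ∷ S) ≤ sum (map (λ c → length (free G S u c)) (Cols G S))
  #-∷ G S u = restrict-count (Cols G (u ∷ S)) (Cols G S) S u (free G S u) (unique-Cols G (u ∷ S)) (restr-Cols {G} there) fr
    (λ {X} {Y} a b e e′ → Cols-ext {G} a b (λ { (here refl) → e′ ; (there m) → restr-≡ X Y e m }))
    where
    fr : ∀ {X} → X ∈ Cols G (u ∷ S) → lookup X u ∈ free G S u (restr S X)
    fr {X} m = ∈-filter⁺ (λ α → ¬? (seen? G S u (restr S X) α)) (∈-allFin _) λ sn →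
      let (w , w∈ , a , e) = seen-elim G u (restr S X) sn in
      Cols-proper {G} m (here refl) (there w∈) a (trans (sym e) (restr-in X w∈))

  free≤ : ∀ G S u (X : Colouring n k) {s} → s ∈ S → Adj G u s → length (free G S u X) ≤ k′
  free≤ G S u X {s} m a = +-cancelʳ-≤ 1 _ _ (≤-trans (free-bound G S u X [ s ] ([] ∷ []) (λ { (here refl) → m , a }) (λ { (here refl) (here refl) _ → refl })) (≤-reflexive (+-comm 1 k′)))

  #-∷-adj : ∀ G S u {s} → s ∈ S → Adj G u s → # G (u ∷ S) ≤ # G S * k′
  #-∷-adj G S u m a = ≤-trans (#-∷ G S u) (≤-trans (sum-mono (Cols G S) (λ {X} _ → free≤ G S u X m a)) (≤-reflexive (sum-const k′ (Cols G S))))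

  #-[] : ∀ G → # G [] ≤ 1
  #-[] G = inj-length (λ _ → tt) {ys = tt ∷ []} (unique-Cols G []) (λ _ → here refl) (λ a b _ → Cols-ext {G} a b (λ ()))

  Clique : Graph n → List (Fin n) → Set
  Clique G Q = ∀ {x y} → x ∈ Q → y ∈ Q → x ≢ y → Adj G x y

  #-clique : ∀ G Q → Unique Q → Clique G Q → ∀ r → length Q + r ≡ k → # G Q * r ! ≤ k !
  #-clique G [] _ _ r refl = ≤-trans (*-monoˡ-≤ (r !) (#-[] G)) (≤-reflexive (*-identityˡ (r !)))
  #-clique G (u ∷ Q) uQ@(_ ∷ uQ′) cl r e = begin
    # G (u ∷ Q) * r ! ≤⟨ *-monoˡ-≤ (r !) (≤-trans (#-∷ G Q u) (sum-mono (Cols G Q) fr)) ⟩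
    sum (map (λ _ → suc r) (Cols G Q)) * r ! ≡⟨ cong (_* r !) (sum-const (suc r) (Cols G Q)) ⟩
    # G Q * suc r * r ! ≡⟨ *-assoc (# G Q) (suc r) (r !) ⟩
    # G Q * suc r ! ≤⟨ #-clique G Q uQ′ (λ a b → cl (there a) (there b)) (suc r) e′ ⟩
    k ! ∎
    where
    open ≤-Reasoning
    e′ : length Q + suc r ≡ k
    e′ = trans (+-suc (length Q) r) e
    fr : ∀ {X} → X ∈ Cols G Q → length (free G Q u X) ≤ suc r
    fr {X} m = +-cancelʳ-≤ (length Q) _ _ (≤-trans (free-bound G Q u X Q uQ′ (λ w → w , cl (here refl) (there w) (λ { refl → unique-head uQ w })) inj)
      (≤-reflexive (trans (sym e′) (+-comm (length Q) (suc r)))))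
      where
      inj : ∀ {a b} → a ∈ Q → b ∈ Q → lookup X a ≡ lookup X b → a ≡ b
      inj {a} {b} ma mb ee with a ≟F b
      ... | yes eq = eq
      ... | no ne = contradiction ee (Cols-proper {G} m ma mb (cl (there ma) (there mb) ne))

-- Contracting the neighbourhood of a vertex

nbrs : ∀ {n} → Graph n → List (Fin n) → Fin n → List (Fin n)
nbrs G S v = filter (λ u → T? (adj G v u)) S

nbrs-in : ∀ {n} (G : Graph n) S {v u} → u ∈ S → Adj G v u → u ∈ nbrs G S v
nbrs-in G S {v} m a = ∈-filter⁺ (λ u → T? (adj G v u)) m a

nbrs-∈ : ∀ {n} (G : Graph n) S {v u} → u ∈ nbrs G S v → u ∈ S
nbrs-∈ G S {v} m = proj₁ (∈-filter⁻ (λ u → T? (adj G v u)) {xs = S} m)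

nbrs-adj : ∀ {n} (G : Graph n) S {v u} → u ∈ nbrs G S v → Adj G v u
nbrs-adj G S {v} m = proj₂ (∈-filter⁻ (λ u → T? (adj G v u)) {xs = S} m)

unique-nbrs : ∀ {n} (G : Graph n) {S} v → Unique S → Unique (nbrs G S v)
unique-nbrs G v u = unique-filter (λ u → T? (adj G v u)) u

ColOn : ∀ {n} → Graph n → List (Fin n) → ℕ → Set
ColOn {n} G S j = Σ (Fin n → Fin j) λ c → ∀ s t → s ∈ S → t ∈ S → Adj G s t → c s ≢ c t

colOn? : ∀ {n} (G : Graph n) S j → Dec (ColOn G S j)
colOn? {n} G S j with anyL? (λ X → allF? (λ s → allF? (λ t → (s ∈? S) →-dec ((t ∈? S) →-dec (T? (adj G s t) →-dec ¬? (lookup X s ≟F lookup X t)))))) (allColourings n j)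
... | yes a = yes (get a)
  where
  get : ∀ {xs} → Any (λ (X : Colouring n j) → ∀ s t → s ∈ S → t ∈ S → Adj G s t → lookup X s ≢ lookup X t) xs → ColOn G S j
  get (here {x = X} p) = lookup X , p
  get (there p) = get p
... | no na = no λ { (c , p) → na (put (∈-allColourings (tabulate c)) λ s t ms mt a e →
                p s t ms mt a (trans (sym (lookup∘tabulate c s)) (trans e (lookup∘tabulate c t)))) }
  where
  put : ∀ {P : Colouring n j → Set} {xs X} → X ∈ xs → P X → Any P xs
  put (here refl) p = here p
  put (there m) p = there (put m p)

-- Connectedness as the existence of an edge across every cut. In this form it passes to
-- contractions by pulling a cut back, and it hands `grow` and `advance` the next vertex to be
-- added.
Conn : ∀ {n} → Graph n → List (Fin n) → Set
Conn {n} G S = ∀ (f : Fin n → Bool) {a b} → a ∈ S → b ∈ S → f a ≡ true → f b ≡ false →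
  ∃₂ λ x y → x ∈ S × y ∈ S × f x ≡ true × f y ≡ false × Adj G x y

true≢false : true ≢ false
true≢false ()

another : ∀ {m} → Fin (suc (suc m)) → Fin (suc (suc m))
another fz = fs fz
another (fs _) = fz

another-≢ : ∀ {m} (α : Fin (suc (suc m))) → another α ≢ α
another-≢ fz ()
another-≢ (fs _) ()

others-length : ∀ k (α : Fin (suc k)) → length (filter (λ β → ¬? (β ≟F α)) (allFin (suc k))) ≤ k
others-length k α = +-cancelʳ-≤ 1 _ _ (≤-trans (≤-reflexive (sym (length-++ F {α ∷ []}))) (≤-trans (unique-⊆-length (unique-++ (unique-filter ne? (unique-allFin (suc k))) ([] ∷ []) dis) (λ _ → ∈-allFin _))
  (≤-reflexive (trans (length-allFin (suc k)) (+-comm 1 k)))))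
  where
  ne? = λ β → ¬? (β ≟F α)
  F = filter ne? (allFin (suc k))
  dis : ∀ {β} → β ∈ F → β ∉ α ∷ []
  dis m (here refl) = proj₂ (∈-filter⁻ ne? {xs = allFin (suc k)} m) refl

-- The contraction keeps the vertex type `Fin n`: r represents the whole of N, and the other
-- vertices of N remain as vertices that the list `S/` leaves out.
module Contract {n} (G : Graph n) (N : List (Fin n)) (r : Fin n) where

  touches : Fin n → Bool
  touches y = ifDec (anyL? (λ a → T? (adj G a y)) N) true false

  kadj : ∀ x y → Dec (x ≡ r) → Dec (y ≡ r) → Bool
  kadj x y (yes _) (yes _) = false
  kadj x y (yes _) (no _) = touches y
  kadj x y (no _) (yes _) = touches x
  kadj x y (no _) (no _) = adj G x y

  contract : Graph n
  contract = record
    { adj = λ x y → kadj x y (x ≟F r) (y ≟F r)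
    ; sym = λ x y → s x y (x ≟F r) (y ≟F r)
    ; irrefl = λ x → i x (x ≟F r) }
    where
    s : ∀ x y d e → kadj x y d e ≡ kadj y x e d
    s x y (yes _) (yes _) = refl
    s x y (yes _) (no _) = refl
    s x y (no _) (yes _) = refl
    s x y (no _) (no _) = adj-sym G x y
    i : ∀ x d → kadj x x d d ≡ false
    i x (yes _) = refl
    i x (no _) = adj-irrefl G x

  touches-intro : ∀ {a y} → a ∈ N → Adj G a y → T (touches y)
  touches-intro {a} {y} m ad = subst T (sym (ifDec-yes (anyL? (λ a → T? (adj G a y)) N) (put m ad))) tt
    where
    put : ∀ {N} → a ∈ N → Adj G a y → Any (λ a → Adj G a y) N
    put (here refl) p = here p
    put (there m) p = there (put m p)

  touches-elim : ∀ {y} → T (touches y) → ∃ λ a → a ∈ N × Adj G a y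
  touches-elim {y} t with anyL? (λ a → T? (adj G a y)) N
  ... | yes p = get p
    where
    get : ∀ {N} → Any (λ a → Adj G a y) N → ∃ λ a → a ∈ N × Adj G a y
    get (here p) = _ , here refl , p
    get (there p) with get p
    ... | a , m , q = a , there m , q

  contract-r : ∀ {a y} → y ≢ r → a ∈ N → Adj G a y → Adj contract r y
  contract-r {a} {y} ne m ad with r ≟F r | y ≟F r
  ... | _ | yes e = contradiction e ne
  ... | no e | no _ = contradiction refl e
  ... | yes _ | no _ = touches-intro m ad

  contract-r⁻ : ∀ {y} → Adj contract r y → ∃ λ a → a ∈ N × Adj G a y
  contract-r⁻ {y} t with r ≟F r | y ≟F r
  ... | no e | _ = contradiction refl e
  ... | yes _ | no _ = touches-elim t

  contract-o : ∀ {x y} → x ≢ r → y ≢ r → adj contract x y ≡ adj G x y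
  contract-o {x} {y} nx ny with x ≟F r | y ≟F r
  ... | yes e | _ = contradiction e nx
  ... | no _ | yes e = contradiction e ny
  ... | no _ | no _ = refl

Mono : ∀ {n k} → List (Fin n) → Colouring n k → Set
Mono N X = All (λ a → All (λ b → lookup X a ≡ lookup X b) N) N

mono? : ∀ {n k} N (X : Colouring n k) → Dec (Mono N X)
mono? N X = allL? (λ a → allL? (λ b → lookup X a ≟F lookup X b) N) N

Mono-≡ : ∀ {n k N} {X : Colouring n k} {a b} → Mono N X → a ∈ N → b ∈ N → lookup X a ≡ lookup X b
Mono-≡ m a b = All-lookup (All-lookup m a) b

module Quotient {n} (G : Graph n) (S : List (Fin n)) (uS : Unique S) {v r} (v∈ : v ∈ S) (r∈ : r ∈ nbrs G S v) where

  N = nbrs G S v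
  open Contract G N r public
  out? = λ x → ¬? (x ∈? (v ∷ N))
  rest = filter out? S
  S/ : List (Fin n)
  S/ = r ∷ rest
  K = contract

  rest-∈ : ∀ {x} → x ∈ rest → x ∈ S
  rest-∈ m = proj₁ (∈-filter⁻ out? {xs = S} m)

  rest-∉ : ∀ {x} → x ∈ rest → x ∉ v ∷ N
  rest-∉ m = proj₂ (∈-filter⁻ out? {xs = S} m)

  rest-≢r : ∀ {x} → x ∈ rest → x ≢ r
  rest-≢r m refl = rest-∉ m (there r∈)

  unique-S/ : Unique S/
  unique-S/ = unique-∷ (λ m → rest-≢r m refl) (unique-filter out? uS)

  vN-∈ : ∀ {x} → x ∈ v ∷ N → x ∈ S
  vN-∈ (here refl) = v∈
  vN-∈ (there m) = nbrs-∈ G S m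

  unique-vN : Unique (v ∷ N)
  unique-vN = unique-∷ (λ m → Adj-irrefl G (nbrs-adj G S m)) (unique-nbrs G v uS)

  S↭ : S ↭ rest ++ v ∷ N
  S↭ = same-elements-↭ uS (unique-++ (unique-filter out? uS) unique-vN rest-∉) to from
    where
    to : ∀ {x} → x ∈ S → x ∈ rest ++ v ∷ N
    to {x} m with x ∈? (v ∷ N)
    ... | yes q = ∈-++⁺ʳ rest q
    ... | no q = ∈-++⁺ˡ (∈-filter⁺ out? m q)
    from : ∀ {x} → x ∈ rest ++ v ∷ N → x ∈ S
    from m with ∈-++⁻ rest m
    ... | inj₁ a = rest-∈ a
    ... | inj₂ b = vN-∈ b

  S-cases : ∀ {x} → x ∈ S → x ∈ rest ⊎ (x ≡ v ⊎ x ∈ N)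
  S-cases m with ∈-++⁻ rest (∈-resp-↭ S↭ m)
  ... | inj₁ a = inj₁ a
  ... | inj₂ (here e) = inj₂ (inj₁ e)
  ... | inj₂ (there b) = inj₂ (inj₂ b)

  length-S/ : length S/ + length N ≡ length S
  length-S/ = trans (sym (+-suc (length rest) (length N))) (trans (sym (length-++ rest {v ∷ N})) (sym (↭-length S↭)))

  -- A colouring that is constant on N descends to the contraction, and v, all of whose neighbours
  -- in S have the colour of r, has k′ choices left.
  mono-count : ∀ {k′} → length (filter (mono? {k = suc k′} N) (Cols G S)) ≤ # {k′ = k′} K S/ * k′
  mono-count {k′} = ≤-trans (restrict-count xs (Cols K S/) S/ v L (unique-filter (mono? N) (unique-Cols G S)) into inL inj)
      (≤-trans (sum-mono (Cols K S/) (λ {c} _ → others-length k′ (lookup c r))) (≤-reflexive (sum-const k′ (Cols K S/))))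
    where
    xs = filter (mono? {k = suc k′} N) (Cols G S)
    L : Colouring n (suc k′) → List (Fin (suc k′))
    L c = filter (λ β → ¬? (β ≟F lookup c r)) (allFin (suc k′))
    fst : ∀ {X} → X ∈ xs → X ∈ Cols G S
    fst m = proj₁ (∈-filter⁻ (mono? N) {xs = Cols G S} m)
    snd : ∀ {X} → X ∈ xs → Mono N X
    snd m = proj₂ (∈-filter⁻ (mono? N) {xs = Cols G S} m)
    into : ∀ {X} → X ∈ xs → restr S/ X ∈ Cols K S/
    into {X} m = Cols-intro {G = K} (λ a b ad e → pr a b ad (trans (sym (restr-in X a)) (trans e (restr-in X b)))) (λ v → restr-out X)
      where
      half : ∀ {t} → t ∈ rest → Adj K r t → lookup X r ≢ lookup X t
      half t∈ ad e with contract-r⁻ ad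
      ... | a , a∈ , at = Cols-proper {G = G} (fst m) (nbrs-∈ G S a∈) (rest-∈ t∈) at (trans (Mono-≡ {X = X} (snd m) a∈ r∈) e)
      pr : ∀ {s t} → s ∈ S/ → t ∈ S/ → Adj K s t → lookup X s ≢ lookup X t
      pr (here refl) (here refl) ad _ = Adj-irrefl K {r} ad
      pr (here refl) (there b) ad e = half b ad e
      pr {s} (there a) (here refl) ad e = half a (Adj-sym K {s} {r} ad) (sym e)
      pr (there a) (there b) ad e = Cols-proper {G = G} (fst m) (rest-∈ a) (rest-∈ b) (subst T (contract-o (rest-≢r a) (rest-≢r b)) ad) e
    inL : ∀ {X} → X ∈ xs → lookup X v ∈ L (restr S/ X)
    inL {X} m = ∈-filter⁺ (λ β → ¬? (β ≟F lookup (restr S/ X) r)) (∈-allFin _) λ e →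
      Cols-proper {G = G} (fst m) v∈ (nbrs-∈ G S r∈) (nbrs-adj G S r∈) (trans e (restr-in {T = S/} X (here refl)))
    inj : ∀ {X Y} → X ∈ xs → Y ∈ xs → restr S/ X ≡ restr S/ Y → lookup X v ≡ lookup Y v → X ≡ Y
    inj {X} {Y} a b e e′ = Cols-ext {G = G} (fst a) (fst b) λ m → go (S-cases m)
      where
      go : ∀ {u} → u ∈ rest ⊎ (u ≡ v ⊎ u ∈ N) → lookup X u ≡ lookup Y u
      go (inj₁ m) = restr-≡ {T = S/} X Y e (there m)
      go (inj₂ (inj₁ refl)) = e′
      go (inj₂ (inj₂ m)) = trans (Mono-≡ {X = X} (snd a) m r∈) (trans (restr-≡ {T = S/} X Y e (here refl)) (Mono-≡ {X = Y} (snd b) r∈ m))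

  -- A cut of the contraction is pulled back to one that is constant on v ∷ N. The edge crossing it
  -- cannot lie inside v ∷ N, so it survives.
  contract-conn : Conn G S → Conn K S/
  contract-conn cn f {a} {b} a∈ b∈ fa fb = fin (cn f′ (lift∈ a∈) (lift∈ b∈) (trans (f′-S/ a∈) fa) (trans (f′-S/ b∈) fb))
    where
    f′ : Fin n → Bool
    f′ x = ifDec (x ∈? (v ∷ N)) (f r) (f x)
    lift∈ : ∀ {x} → x ∈ S/ → x ∈ S
    lift∈ (here refl) = nbrs-∈ G S r∈
    lift∈ (there m) = rest-∈ m
    f′-in : ∀ {x} → x ∈ v ∷ N → f′ x ≡ f r
    f′-in {x} m = ifDec-yes (x ∈? (v ∷ N)) m
    f′-rest : ∀ {x} → x ∈ rest → f′ x ≡ f x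
    f′-rest {x} m = ifDec-no (x ∈? (v ∷ N)) (rest-∉ m)
    f′-S/ : ∀ {x} → x ∈ S/ → f′ x ≡ f x
    f′-S/ (here refl) = f′-in (there r∈)
    f′-S/ (there m) = f′-rest m
    clash : ∀ {x y} → x ∈ v ∷ N → y ∈ v ∷ N → f′ x ≡ true → f′ y ≡ false → ⊥
    clash mx my fx fy = true≢false (trans (sym fx) (trans (trans (f′-in mx) (sym (f′-in my))) fy))
    fin : (∃₂ λ x y → x ∈ S × y ∈ S × f′ x ≡ true × f′ y ≡ false × Adj G x y) → ∃₂ λ x y → x ∈ S/ × y ∈ S/ × f x ≡ true × f y ≡ false × Adj K x y
    fin (x , y , x∈ , y∈ , fx , fy , ad) with S-cases x∈ | S-cases y∈
    ... | inj₁ mx | inj₁ my = x , y , there mx , there my , trans (sym (f′-rest mx)) fx , trans (sym (f′-rest my)) fy , subst T (sym (contract-o (rest-≢r mx) (rest-≢r my))) ad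
    ... | inj₁ mx | inj₂ (inj₁ refl) = contradiction (there (nbrs-in G S x∈ (Adj-sym G ad))) (rest-∉ mx)
    ... | inj₁ mx | inj₂ (inj₂ my) = x , r , there mx , here refl , trans (sym (f′-rest mx)) fx , trans (sym (f′-in (there my))) fy , Adj-sym K {r} {x} (contract-r (rest-≢r mx) my (Adj-sym G ad))
    ... | inj₂ (inj₁ refl) | inj₁ my = contradiction (there (nbrs-in G S y∈ ad)) (rest-∉ my)
    ... | inj₂ (inj₂ mx) | inj₁ my = r , y , here refl , there my , trans (sym (f′-in (there mx))) fx , trans (sym (f′-rest my)) fy , contract-r (rest-≢r my) mx ad
    ... | inj₂ (inj₁ refl) | inj₂ (inj₁ refl) = ⊥-elim (clash (here refl) (here refl) fx fy)
    ... | inj₂ (inj₁ refl) | inj₂ (inj₂ my) = ⊥-elim (clash (here refl) (there my) fx fy)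
    ... | inj₂ (inj₂ mx) | inj₂ (inj₁ refl) = ⊥-elim (clash (there mx) (here refl) fx fy)
    ... | inj₂ (inj₂ mx) | inj₂ (inj₂ my) = ⊥-elim (clash (there mx) (there my) fx fy)

  -- Contraction does not lower the chromatic number: a colouring lifts by giving all of the
  -- independent set N the colour of r, and v any other colour, which exists as there are at least
  -- two.
  contract-col : (∀ {a b} → a ∈ N → b ∈ N → ¬ Adj G a b) → ∀ {m} → ColOn K S/ (suc (suc m)) → ColOn G S (suc (suc m))
  contract-col ind {m} (c , pr) = c′ , λ s t ms mt → go (S-cases ms) (S-cases mt)
    where
    c′ : Fin n → Fin (suc (suc m))
    c′ x = ifDec (x ≟F v) (another (c r)) (ifDec (x ∈? N) (c r) (c x))
    v∉N : v ∉ N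
    v∉N = unique-head unique-vN
    c-v : c′ v ≡ another (c r)
    c-v = ifDec-yes (v ≟F v) refl
    c-N : ∀ {x} → x ∈ N → c′ x ≡ c r
    c-N {x} m = trans (ifDec-no (x ≟F v) (λ { refl → v∉N m })) (ifDec-yes (x ∈? N) m)
    c-o : ∀ {x} → x ∈ rest → c′ x ≡ c x
    c-o {x} m = trans (ifDec-no (x ≟F v) (λ e → rest-∉ m (here e))) (ifDec-no (x ∈? N) (λ q → rest-∉ m (there q)))
    go : ∀ {s t} → s ∈ rest ⊎ (s ≡ v ⊎ s ∈ N) → t ∈ rest ⊎ (t ≡ v ⊎ t ∈ N) → Adj G s t → c′ s ≢ c′ t
    go {s} {t} (inj₁ a) (inj₁ b) ad e = pr s t (there a) (there b) (subst T (sym (contract-o (rest-≢r a) (rest-≢r b))) ad) (trans (sym (c-o a)) (trans e (c-o b)))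
    go (inj₁ a) (inj₂ (inj₁ refl)) ad e = rest-∉ a (there (nbrs-in G S (rest-∈ a) (Adj-sym G ad)))
    go {s} {t} (inj₁ a) (inj₂ (inj₂ b)) ad e = pr r s (here refl) (there a) (contract-r (rest-≢r a) b (Adj-sym G ad)) (trans (sym (c-N b)) (trans (sym e) (c-o a)))
    go (inj₂ (inj₁ refl)) (inj₁ b) ad e = rest-∉ b (there (nbrs-in G S (rest-∈ b) ad))
    go {s} {t} (inj₂ (inj₂ a)) (inj₁ b) ad e = pr r t (here refl) (there b) (contract-r (rest-≢r b) a ad) (trans (sym (c-N a)) (trans e (c-o b)))
    go (inj₂ (inj₁ refl)) (inj₂ (inj₁ refl)) ad e = Adj-irrefl G ad
    go (inj₂ (inj₁ refl)) (inj₂ (inj₂ b)) ad e = another-≢ (c r) (trans (sym c-v) (trans e (c-N b)))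
    go (inj₂ (inj₂ a)) (inj₂ (inj₁ refl)) ad e = another-≢ (c r) (trans (sym c-v) (trans (sym e) (c-N a)))
    go (inj₂ (inj₂ a)) (inj₂ (inj₂ b)) ad e = ind a b ad

-- Numerical estimates

upto-factorial : ∀ m → upto (suc m ∸_) m ≡ suc m !
upto-factorial zero = refl
upto-factorial (suc m) = cong (suc (suc m) *_) (upto-factorial m)

upto-const : ∀ c m → upto (λ _ → c) m ≡ c ^ suc m
upto-const c zero = sym (*-identityʳ c)
upto-const c (suc m) = cong (c *_) (upto-const c m)

^-cancelʳ-≤ : ∀ a b n → 1 ≤ n → a ^ n ≤ b ^ n → a ≤ b
^-cancelʳ-≤ a b (suc n) _ h with a ≤? b
... | yes p = p
... | no ¬p = contradiction h (<⇒≱ (^-monoˡ-< (suc n) (≰⇒> ¬p)))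

*-cancelʳ-≤′ : ∀ c {a b} → 1 ≤ c → a * c ≤ b * c → a ≤ b
*-cancelʳ-≤′ (suc c) {a} {b} _ = *-cancelʳ-≤ a b (suc c)

-- At most one in `tame p + 1` pairs of a vertex and a colouring may have a monochromatic
-- neighbourhood. One in four suits the estimate `cube-bound`, but for p = 2 the contraction bound
-- in `rare-core` gives only one in three.
tame : ℕ → ℕ
tame 2 = 2
tame _ = 3

abstract
  -- `costS` and `costM` are 3k-th powers of the mean costs (k(k-1)(k-2))^(1/3) of a vertex seeing
  -- two colours and (k q^q)^(1/k) of a vertex of which only the degree q is used. `tower` also
  -- clears the average over `tame p + 1` vertices, and `weightTop` is the cost q on that scale.
  -- `gapZ` comes from `gap-root`.
  tower costS costM weightTop gapZ : ℕ → ℕ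
  tower p = 3 * (2 + p) * suc (tame p)
  costS p = ((2 + p) * (suc p * p)) ^ (2 + p)
  costM p = ((2 + p) * suc p ^ suc p) ^ 3
  weightTop p = suc p ^ tower p
  gapZ p = tower p * weightTop p

  tower-≡ : ∀ p → tower p ≡ 3 * (2 + p) * suc (tame p)
  tower-≡ p = refl

  costS-≡ : ∀ p → costS p ≡ ((2 + p) * (suc p * p)) ^ (2 + p)
  costS-≡ p = refl

  costM-≡ : ∀ p → costM p ≡ ((2 + p) * suc p ^ suc p) ^ 3
  costM-≡ p = refl

  weightTop-≡ : ∀ p → weightTop p ≡ suc p ^ tower p
  weightTop-≡ p = refl

  gapZ-≡ : ∀ p → gapZ p ≡ tower p * weightTop p
  gapZ-≡ p = refl

  -- For p = 2 the margin is thin: 24^8 · 108^3 against 3^36, about 1.39 against 1.50 times 10^17.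
  -- It is settled by evaluation.
  small-check : (costS 2 ^ 2 * costM 2 <ᵇ weightTop 2) ≡ true
  small-check = refl

bernoulli-up : ∀ Y j → Y ^ j * (Y + j) ≤ (1 + Y) ^ j * Y
bernoulli-up Y zero = ≤-reflexive (lem Y)
  where
  lem : ∀ Y → 1 * (Y + 0) ≡ 1 * Y
  lem = solve-∀
bernoulli-up Y (suc j) = begin
  Y * Y ^ j * (Y + suc j) ≡⟨ *-comm (Y * Y ^ j) (Y + suc j) ⟩
  (Y + suc j) * (Y * Y ^ j) ≤⟨ m≤m+n _ (j * Y ^ j) ⟩
  (Y + suc j) * (Y * Y ^ j) + j * Y ^ j ≡⟨ lem Y j (Y ^ j) ⟩
  (1 + Y) * (Y ^ j * (Y + j)) ≤⟨ *-monoʳ-≤ (1 + Y) (bernoulli-up Y j) ⟩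
  (1 + Y) * ((1 + Y) ^ j * Y) ≡⟨ sym (*-assoc (1 + Y) ((1 + Y) ^ j) Y) ⟩
  (1 + Y) * (1 + Y) ^ j * Y ∎
  where
  open ≤-Reasoning
  lem : ∀ Y j A → (Y + suc j) * (Y * A) + j * A ≡ (1 + Y) * (A * (Y + j))
  lem = solve-∀

-- The product of the estimates (1 + 1/Z)(1 - (i+1)/Z) ≤ 1 - i/Z for i < j. Truncated subtraction
-- makes it trivial once j reaches Z.
bernoulli-down : ∀ Z j → suc Z ^ j * (Z ∸ j) ≤ Z ^ j * Z
bernoulli-down Z zero = ≤-refl
bernoulli-down Z (suc j) = begin
  suc Z * suc Z ^ j * (Z ∸ suc j) ≡⟨ lem (suc Z) (suc Z ^ j) (Z ∸ suc j) ⟩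
  suc Z ^ j * (suc Z * (Z ∸ suc j)) ≤⟨ *-monoʳ-≤ (suc Z ^ j) (h Z j) ⟩
  suc Z ^ j * (Z * (Z ∸ j)) ≡⟨ lem′ (suc Z ^ j) Z (Z ∸ j) ⟩
  Z * (suc Z ^ j * (Z ∸ j)) ≤⟨ *-monoʳ-≤ Z (bernoulli-down Z j) ⟩
  Z * (Z ^ j * Z) ≡⟨ sym (*-assoc Z (Z ^ j) Z) ⟩
  Z * Z ^ j * Z ∎
  where
  open ≤-Reasoning
  lem : ∀ a b c → a * b * c ≡ b * (a * c)
  lem = solve-∀
  lem′ : ∀ a b c → a * (b * c) ≡ b * (a * c)
  lem′ = solve-∀
  h : ∀ Z j → suc Z * (Z ∸ suc j) ≤ Z * (Z ∸ j)
  h zero j = ≤-reflexive (+-identityʳ (0 ∸ suc j))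
  h (suc Z) j with ≤-total (suc Z) j
  ... | inj₁ le rewrite m≤n⇒m∸n≡0 (≤-trans (n≤1+n Z) le) | *-zeroʳ Z = z≤n
  ... | inj₂ j≤ with m≤n⇒m<n∨m≡n j≤
  ... | inj₂ refl rewrite m≤n⇒m∸n≡0 (n≤1+n Z) | *-zeroʳ Z = z≤n
  ... | inj₁ (s≤s j<) rewrite +-∸-assoc 1 j< = begin
    suc (suc Z) * d ≡⟨ lm Z d ⟩
    suc Z * d + d ≤⟨ +-monoʳ-≤ (suc Z * d) (≤-trans (m∸n≤m Z j) (n≤1+n Z)) ⟩
    suc Z * d + suc Z ≡⟨ lm′ Z d ⟩
    suc Z * suc d ∎
    where
    d = Z ∸ j
    lm : ∀ Z d → suc (suc Z) * d ≡ suc Z * d + d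
    lm = solve-∀
    lm′ : ∀ Z d → suc Z * d + suc Z ≡ suc Z * suc d
    lm′ = solve-∀

-- The e-th root of 1 - 1/W is at most eW/(eW + 1), by `bernoulli-down` at Z = eW. With e =
-- `tower p` and W = `weightTop p` this Z is `gapZ p`.
gap-root : ∀ x y e W′ → 1 ≤ e → x ^ e * suc W′ ≤ y ^ e * W′ → x * suc (e * suc W′) ≤ y * (e * suc W′)
gap-root x y e W′ 1≤e h = ^-cancelʳ-≤ _ _ e 1≤e (*-cancelʳ-≤′ (e * suc W′) (*-mono-≤ 1≤e (s≤s (z≤n {W′}))) (begin
  (x * suc Z) ^ e * (e * suc W′) ≡⟨ cong (_* (e * suc W′)) (^-distribʳ-* e x (suc Z)) ⟩
  x ^ e * suc Z ^ e * (e * suc W′) ≡⟨ lem (x ^ e) (suc Z ^ e) e (suc W′) ⟩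
  x ^ e * suc W′ * (suc Z ^ e * e) ≤⟨ *-monoˡ-≤ (suc Z ^ e * e) h ⟩
  y ^ e * W′ * (suc Z ^ e * e) ≡⟨ lem₂ (y ^ e) W′ (suc Z ^ e) e ⟩
  y ^ e * (suc Z ^ e * (e * W′)) ≡⟨ cong (λ z → y ^ e * (suc Z ^ e * z)) (sym (trans (cong (_∸ e) (*-suc e W′)) (m+n∸m≡n e (e * W′)))) ⟩
  y ^ e * (suc Z ^ e * (Z ∸ e)) ≤⟨ *-monoʳ-≤ (y ^ e) (bernoulli-down Z e) ⟩
  y ^ e * (Z ^ e * Z) ≡⟨ sym (*-assoc (y ^ e) (Z ^ e) Z) ⟩
  y ^ e * Z ^ e * Z ≡⟨ cong (_* Z) (sym (^-distribʳ-* e y Z)) ⟩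
  (y * Z) ^ e * Z ∎))
  where
  open ≤-Reasoning
  Z = e * suc W′
  lem : ∀ a b c d → a * b * (c * d) ≡ a * d * (b * c)
  lem = solve-∀
  lem₂ : ∀ a b c d → a * b * (c * d) ≡ a * (c * (d * b))
  lem₂ = solve-∀

private
  -- With Y = kp = q² - 1 the claim becomes k Y^k < q (Y+1)^k. Bernoulli's inequality reduces this
  -- to kY < q(Y + k), where the right side is kq².
  cube-bound : ∀ p → 1 ≤ p → (2 + p) * suc p ^ suc p * ((2 + p) * (suc p * p)) ^ (2 + p) < suc p ^ (4 * (2 + p))
  cube-bound p 1≤p = *-cancelʳ-< Y _ _ (begin-strict
    k * q ^ q * (k * (q * p)) ^ k * Y ≡⟨ cong (λ z → k * q ^ q * z * Y) (trans (cong (_^ k) (lem₁ k q p)) (^-distribʳ-* k Y q)) ⟩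
    k * q ^ q * (Y ^ k * q ^ k) * Y ≡⟨ lem₂ k (q ^ q) (Y ^ k) (q ^ k) Y ⟩
    q ^ q * q ^ k * (Y ^ k * (k * Y)) <⟨ *-monoʳ-< (q ^ q * q ^ k) {{posqq}} (*-monoʳ-< (Y ^ k) {{>-nonZero (m^n>0′ Y k 1≤Y)}} kY<) ⟩
    q ^ q * q ^ k * (Y ^ k * (q * (Y + k))) ≡⟨ lem₃ (q ^ q * q ^ k) (Y ^ k) q (Y + k) ⟩
    q ^ q * q ^ k * q * (Y ^ k * (Y + k)) ≤⟨ *-monoʳ-≤ (q ^ q * q ^ k * q) (bernoulli-up Y k) ⟩
    q ^ q * q ^ k * q * ((1 + Y) ^ k * Y) ≡⟨ cong (λ z → q ^ q * q ^ k * q * (z ^ k * Y)) (lem₄ p) ⟩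
    q ^ q * q ^ k * q * ((q * q) ^ k * Y) ≡⟨ cong (λ z → q ^ q * q ^ k * q * (z * Y)) (^-distribʳ-* k q q) ⟩
    q ^ q * q ^ k * q * (q ^ k * q ^ k * Y) ≡⟨ lem₅ (q ^ q) (q ^ k) q Y ⟩
    q * q ^ q * q ^ k * q ^ k * q ^ k * Y ≡⟨ cong (_* Y) (sym four) ⟩
    q ^ (4 * k) * Y ∎)
    where
    open ≤-Reasoning
    k = 2 + p
    q = suc p
    Y = k * p
    1≤Y : 1 ≤ Y
    1≤Y = *-mono-≤ (s≤s (z≤n {suc p})) 1≤p
    posqq : NonZero (q ^ q * q ^ k)
    posqq = >-nonZero (*-mono-≤ (m^n>0′ q q (s≤s z≤n)) (m^n>0′ q k (s≤s z≤n)))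
    lem₁ : ∀ k q p → k * (q * p) ≡ k * p * q
    lem₁ = solve-∀
    lem₂ : ∀ k a y b Y → k * a * (y * b) * Y ≡ a * b * (y * (k * Y))
    lem₂ = solve-∀
    lem₃ : ∀ a b c d → a * (b * (c * d)) ≡ a * c * (b * d)
    lem₃ = solve-∀
    lem₄ : ∀ p → 1 + (2 + p) * p ≡ suc p * suc p
    lem₄ = solve-∀
    lem₅ : ∀ a b q Y → a * b * q * (b * b * Y) ≡ q * a * b * b * b * Y
    lem₅ = solve-∀
    four : q ^ (4 * k) ≡ q * q ^ q * q ^ k * q ^ k * q ^ k
    four = trans (cong (q ^_) (l4 k)) (trans (^-distribˡ-+-* q (k + k + k) k)
      (trans (cong (_* q ^ k) (trans (^-distribˡ-+-* q (k + k) k) (cong (_* q ^ k) (^-distribˡ-+-* q k k)))) refl))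
      where
      l4 : ∀ k → 4 * k ≡ k + k + k + k
      l4 = solve-∀
    kY< : k * Y < q * (Y + k)
    kY< = ≤-trans (m≤m+n _ (suc p)) (≤-reflexive (l p))
      where
      l : ∀ p → suc ((2 + p) * ((2 + p) * p)) + suc p ≡ suc p * ((2 + p) * p + (2 + p))
      l = solve-∀

  big-case : ∀ p → 1 ≤ p → tame p ≡ 3 → costS p ^ 3 * costM p < weightTop p
  big-case p 1≤p t = subst₂ _<_ eq₁ eq₂ (^-monoˡ-< 3 (cube-bound p 1≤p))
    where
    eq₁ : ((2 + p) * suc p ^ suc p * ((2 + p) * (suc p * p)) ^ (2 + p)) ^ 3 ≡ costS p ^ 3 * costM p
    eq₁ = trans (^-distribʳ-* 3 ((2 + p) * suc p ^ suc p) _) (trans (*-comm (((2 + p) * suc p ^ suc p) ^ 3) _)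
      (sym (cong₂ (λ x y → x ^ 3 * y) (costS-≡ p) (costM-≡ p))))
    eq₂ : (suc p ^ (4 * (2 + p))) ^ 3 ≡ weightTop p
    eq₂ = trans (^-*-assoc (suc p) (4 * (2 + p)) 3) (sym (trans (weightTop-≡ p) (cong (suc p ^_) (trans (tower-≡ p) (trans (cong (λ z → 3 * (2 + p) * suc z) t) (l p))))))
      where
      l : ∀ p → 3 * (2 + p) * 4 ≡ 4 * (2 + p) * 3
      l = solve-∀

cost-product : ∀ p → 2 ≤ p → costS p ^ tame p * costM p < weightTop p
cost-product 1 (s≤s ())
cost-product 2 _ = <ᵇ⇒< (costS 2 ^ 2 * costM 2) (weightTop 2) (subst T (sym small-check) tt)
cost-product (suc (suc (suc p))) _ = big-case (3 + p) (s≤s z≤n) refl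

-- Holds since k(k-2) < q². It allows the number of monochromatic pairs to be rounded up in
-- `entropy-root`.
costS≤costM : ∀ p → costS p ≤ costM p
costS≤costM p = begin
  costS p ≡⟨ costS-≡ p ⟩
  (k * (q * p)) ^ k ≤⟨ ^-monoˡ-≤ k (≤-trans (m≤m+n _ q) (≤-reflexive (l₁ p))) ⟩
  (q * (q * q)) ^ k ≡⟨ trans (^-distribʳ-* k q (q * q)) (cong (q ^ k *_) (^-distribʳ-* k q q)) ⟩
  q * q ^ q * (q * q ^ q * (q * q ^ q)) ≤⟨ *-mono-≤ le (*-mono-≤ le le) ⟩
  k * q ^ q * (k * q ^ q * (k * q ^ q)) ≡⟨ cong (λ z → k * q ^ q * (k * q ^ q * z)) (sym (*-identityʳ _)) ⟩
  (k * q ^ q) ^ 3 ≡⟨ sym (costM-≡ p) ⟩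
  costM p ∎
  where
  open ≤-Reasoning
  k = 2 + p
  q = suc p
  l₁ : ∀ p → (2 + p) * (suc p * p) + suc p ≡ suc p * (suc p * suc p)
  l₁ = solve-∀
  le : q * q ^ q ≤ k * q ^ q
  le = *-monoˡ-≤ (q ^ q) (n≤1+n q)

-- Colour-critical graphs

missing-colour : ∀ {q} (l : List (Fin q)) → length l < q → ∃ λ α → α ∉ l
missing-colour {q} l h with anyF? (λ α → ¬? (α ∈? l))
... | yes r = r
... | no ¬r = contradiction h (≤⇒≯ (≤-trans (≤-reflexive (sym (length-allFin q))) (unique-⊆-length (unique-allFin q) all-in)))
  where
  all-in : ∀ {α} → α ∈ allFin q → α ∈ l
  all-in {α} _ with α ∈? l
  ... | yes m = m
  ... | no m = contradiction (α , m) ¬r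

col-insert : ∀ {n} (G : Graph n) S T u {j} ((c , _) : ColOn G S j) (α : Fin j) → (∀ {x} → x ∈ T → x ≢ u → x ∈ S) →
  (∀ {x} → x ∈ T → Adj G u x → c x ≢ α) → ColOn G T j
col-insert {n} G S T u {j} (c , pr) α sub ok = c′ , pr′
  where
  c′ : Fin n → Fin j
  c′ x = ifDec (x ≟F u) α (c x)
  c-o : ∀ {x} → x ≢ u → c′ x ≡ c x
  c-o {x} ne = ifDec-no (x ≟F u) ne
  pr′ : ∀ s t → s ∈ T → t ∈ T → Adj G s t → c′ s ≢ c′ t
  pr′ s t ms mt ad e with s ≟F u | t ≟F u
  ... | yes refl | yes refl = Adj-irrefl G ad
  ... | yes refl | no nt = ok mt ad (sym e)
  ... | no ns | yes refl = ok ms (Adj-sym G ad) e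
  ... | no ns | no nt = pr s t (sub ms ns) (sub mt nt) ad e

greedy-col : ∀ {n} (G : Graph n) S {j} → length S ≤ suc j → ColOn G S (suc j)
greedy-col G [] _ = (λ _ → fz) , λ _ _ ()
greedy-col G (u ∷ S) {j} h with greedy-col G S {j} (≤-trans (n≤1+n _) h)
... | c , pr with missing-colour (map c S) (subst (_< suc j) (sym (length-map c S)) h)
... | α , α∉ = col-insert G S (u ∷ S) u (c , pr) α sub (λ m ad e → α∉ (subst (_∈ map c S) e (∈-map⁺ c (sub m (λ { refl → Adj-irrefl G ad })))))
  where
  sub : ∀ {x} → x ∈ u ∷ S → x ≢ u → x ∈ S
  sub (here refl) ne = contradiction refl ne
  sub (there m) _ = m

noncol-length : ∀ {n} (G : Graph n) S {j} → ¬ ColOn G S (suc j) → suc (suc j) ≤ length S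
noncol-length G S {j} nc with suc (suc j) ≤? length S
... | yes h = h
... | no h = contradiction (greedy-col G S (≤-pred (≰⇒> h))) nc

squash : ∀ {q} → Fin (suc (suc q)) → Fin (suc (suc q)) → Fin (suc q)
squash α γ with α ≟F γ
-- An arbitrary value: on the vertices in question `squash` is applied only after the class α has
-- been emptied.
... | yes _ = fz
... | no ne = punchOut ne

squash-inj : ∀ {q} (α : Fin (suc (suc q))) {γ δ} → γ ≢ α → δ ≢ α → squash α γ ≡ squash α δ → γ ≡ δ
squash-inj α {γ} {δ} nγ nδ e with α ≟F γ | α ≟F δ
... | yes q | _ = contradiction (sym q) nγ
... | no _ | yes q = contradiction (sym q) nδ
... | no a | no b = punchOut-injective a b e

Dominates : ∀ {n k} → Graph n → List (Fin n) → Colouring n k → Fin n → Set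
Dominates G H X v = ∀ β → β ≢ lookup X v → Seen G H v X β

dominates? : ∀ {n k} (G : Graph n) H (X : Colouring n k) v → Dec (Dominates G H X v)
dominates? G H X v = allF? (λ β → ¬? (β ≟F lookup X v) →-dec seen? G H v X β)

-- If no vertex of colour α sees every other colour, then the class α can be dissolved.
dominator : ∀ {n p} (G : Graph n) H → ¬ ColOn G H (suc p) → ∀ (X : Colouring n (2 + p)) → ProperOn G H X → ∀ α →
  ∃ λ v → v ∈ H × lookup X v ≡ α × Dominates G H X v
dominator {n} {p} G H nc X pr α with anyL? (λ v → (lookup X v ≟F α) ×-dec dominates? G H X v) H
... | yes a = get a
  where
  get : ∀ {xs} → Any (λ v → lookup X v ≡ α × Dominates G H X v) xs → ∃ λ v → v ∈ xs × lookup X v ≡ α × Dominates G H X v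
  get (here (e , d)) = _ , here refl , e , d
  get (there a) with get a
  ... | v , m , r = v , there m , r
... | no ¬a = contradiction (c , pr′) nc
  where
  put : ∀ {P : Fin n → Set} {xs x} → x ∈ xs → P x → Any P xs
  put (here refl) q = here q
  put (there m) q = there (put m q)
  free? : ∀ v → Dec (∃ λ β → β ≢ lookup X v × ¬ Seen G H v X β)
  free? v = anyF? (λ β → ¬? (β ≟F lookup X v) ×-dec ¬? (seen? G H v X β))
  alt : ∀ v → Dec (∃ λ β → β ≢ lookup X v × ¬ Seen G H v X β) → Fin (2 + p)
  alt v (yes (β , _)) = β
  alt v (no _) = fz
  alt-ok : ∀ {v} → v ∈ H → lookup X v ≡ α → alt v (free? v) ≢ α × ¬ Seen G H v X (alt v (free? v))
  alt-ok {v} m refl with free? v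
  ... | yes (β , ne , ns) = ne , ns
  ... | no no-β = contradiction (put m (refl , dom)) ¬a
    where
    dom : Dominates G H X v
    dom β ne with seen? G H v X β
    ... | yes s = s
    ... | no ns = contradiction (β , ne , ns) no-β
  c₀ : Fin n → Fin (2 + p)
  c₀ v = ifDec (lookup X v ≟F α) (alt v (free? v)) (lookup X v)
  c : Fin n → Fin (suc p)
  c v = squash α (c₀ v)
  c₀-≢ : ∀ {v} → v ∈ H → c₀ v ≢ α
  c₀-≢ {v} m with lookup X v ≟F α
  ... | yes e = proj₁ (alt-ok m e)
  ... | no ne = ne
  c₀-pr : ∀ s t → s ∈ H → t ∈ H → Adj G s t → c₀ s ≢ c₀ t
  c₀-pr s t ms mt ad e with lookup X s ≟F α | lookup X t ≟F α
  -- Two vertices of the dissolved class may receive the same new colour, but as they shared α they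
  -- are not adjacent.
  ... | yes es | yes et = pr ms mt ad (trans es (sym et))
  ... | yes es | no nt = proj₂ (alt-ok ms es) (subst (Seen G H s X) (sym e) (seen-intro G s X mt ad))
  ... | no ns | yes et = proj₂ (alt-ok mt et) (subst (Seen G H t X) e (seen-intro G t X ms (Adj-sym G ad)))
  ... | no ns | no nt = pr ms mt ad e
  pr′ : ∀ s t → s ∈ H → t ∈ H → Adj G s t → c s ≢ c t
  pr′ s t ms mt ad e = c₀-pr s t ms mt ad (squash-inj α (c₀-≢ ms) (c₀-≢ mt) e)

-- A vertex v with a set R of neighbours bounds the number of free colours of v by h (number of earlier elements of R),
-- which over all orderings contributes C after the (3k)-th power is taken.
record Plan {n k : ℕ} (G : Graph n) (H : List (Fin n)) (X : Colouring n k) (v : Fin n) (C : ℕ) : Set where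
  field
    R : List (Fin n)
    h : ℕ → ℕ
    unique : Unique (v ∷ R)
    inH : ∀ {u} → u ∈ R → u ∈ H
    bound : ∀ {E} → Unique E → length (free G E v X) ≤ h (count-in R E)
    power : ∀ A N → A ^ suc (length R) ≡ upto h (length R) ^ N → A ^ (3 * k) ≡ C ^ N

power-3k : ∀ A N U k → A ^ k ≡ U ^ N → A ^ (3 * k) ≡ (U ^ 3) ^ N
power-3k A N U k e = begin
  A ^ (3 * k) ≡⟨ cong (A ^_) (*-comm 3 k) ⟩
  A ^ (k * 3) ≡⟨ sym (^-*-assoc A k 3) ⟩
  (A ^ k) ^ 3 ≡⟨ cong (_^ 3) e ⟩
  (U ^ N) ^ 3 ≡⟨ ^-^-comm U N 3 ⟩
  (U ^ 3) ^ N ∎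
  where open ≡-Reasoning

module _ {n p : ℕ} (G : Graph n) (H : List (Fin n)) (X : Colouring n (2 + p)) {v : Fin n} where

  private
    k = 2 + p
    q = suc p

  free≤k : ∀ E → length (free G E v X) ≤ k
  free≤k E = ≤-trans (≤-reflexive (sym (+-identityʳ _))) (free-bound G E v X [] [] (λ ()) (λ ()))

  rainbow-bound : ∀ R → (∀ {u} → u ∈ R → Adj G v u) → (∀ {a b} → a ∈ R → b ∈ R → lookup X a ≡ lookup X b → a ≡ b) →
    ∀ {E} → Unique E → length (free G E v X) ≤ k ∸ count-in R E
  rainbow-bound R ad inj {E} uE = m+n≤o⇒m≤o∸n _ (free-bound G E v X (filter (_∈? R) E) (unique-filter (_∈? R) uE)
    (λ m → fst m , ad (snd m)) (λ a b → inj (snd a) (snd b)))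
    where
    fst : ∀ {u} → u ∈ filter (_∈? R) E → u ∈ E
    fst m = proj₁ (∈-filter⁻ (_∈? R) {xs = E} m)
    snd : ∀ {u} → u ∈ filter (_∈? R) E → u ∈ R
    snd m = proj₂ (∈-filter⁻ (_∈? R) {xs = E} m)

  -- R holds one neighbour of each other colour. The rank of v is uniform on 0, ..., q, and i
  -- earlier representatives leave at most k - i colours, so the geometric mean is (k!)^(1/k).
  plan-dominator : Dominates G H X v → Plan G H X v ((k !) ^ 3)
  plan-dominator dom = record
    { R = R ; h = k ∸_ ; unique = unique-∷ v∉ (unique-map rep (unique-allFin q) (λ {i} {j} _ _ e → punchIn-injective (lookup X v) i j (trans (sym (rep-col i)) (trans (cong (lookup X) e) (rep-col j)))))
    ; inH = inH ; bound = rainbow-bound R adR inj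
    ; power = λ A N e → power-3k A N (k !) k (trans (cong (λ l → A ^ suc l) (sym lenR)) (trans e (cong (_^ N) (trans (cong (upto (k ∸_)) lenR) (upto-factorial q))))) }
    where
    sees : ∀ i → ∃ λ u → u ∈ H × Adj G v u × lookup X u ≡ punchIn (lookup X v) i
    sees i = seen-elim G v X (dom (punchIn (lookup X v) i) (punchInᵢ≢i (lookup X v) i))
    rep : Fin q → Fin n
    rep i = proj₁ (sees i)
    rep-col : ∀ i → lookup X (rep i) ≡ punchIn (lookup X v) i
    rep-col i = proj₂ (proj₂ (proj₂ (sees i)))
    R = map rep (allFin q)
    lenR : length R ≡ q
    lenR = trans (length-map rep (allFin q)) (length-allFin q)
    adR : ∀ {u} → u ∈ R → Adj G v u
    adR m with ∈-map⁻ rep m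
    ... | i , _ , refl = proj₁ (proj₂ (proj₂ (sees i)))
    inH : ∀ {u} → u ∈ R → u ∈ H
    inH m with ∈-map⁻ rep m
    ... | i , _ , refl = proj₁ (proj₂ (sees i))
    v∉ : v ∉ R
    v∉ m = Adj-irrefl G (adR m)
    inj : ∀ {a b} → a ∈ R → b ∈ R → lookup X a ≡ lookup X b → a ≡ b
    inj ma mb e with ∈-map⁻ rep ma | ∈-map⁻ rep mb
    ... | i , _ , refl | j , _ , refl = cong rep (punchIn-injective (lookup X v) i j (trans (sym (rep-col i)) (trans e (rep-col j))))

  -- R consists of two neighbours of different colours; the three equally likely ranks leave at most
  -- k, k - 1 and k - 2 colours.
  plan-bicoloured : ∀ {a b} → a ∈ nbrs G H v → b ∈ nbrs G H v → lookup X a ≢ lookup X b → Plan G H X v (costS p)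
  plan-bicoloured {a} {b} ma mb ne = record
    { R = a ∷ b ∷ [] ; h = k ∸_
    ; unique = ((λ { refl → Adj-irrefl G ada }) ∷ (λ { refl → Adj-irrefl G adb }) ∷ []) ∷ (((λ { refl → ne refl }) ∷ []) ∷ ([] ∷ []))
    ; inH = λ { (here refl) → nbrs-∈ G H ma ; (there (here refl)) → nbrs-∈ G H mb }
    ; bound = rainbow-bound (a ∷ b ∷ []) (λ { (here refl) → ada ; (there (here refl)) → adb }) inj
    ; power = pw }
    where
    ada = nbrs-adj G H ma
    adb = nbrs-adj G H mb
    inj : ∀ {x y} → x ∈ a ∷ b ∷ [] → y ∈ a ∷ b ∷ [] → lookup X x ≡ lookup X y → x ≡ y
    inj (here refl) (here refl) _ = refl
    inj (here refl) (there (here refl)) e = contradiction e ne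
    inj (there (here refl)) (here refl) e = contradiction (sym e) ne
    inj (there (here refl)) (there (here refl)) _ = refl
    pw : ∀ A N → A ^ 3 ≡ (k * (q * p)) ^ N → A ^ (3 * k) ≡ costS p ^ N
    pw A N e = trans (sym (^-*-assoc A 3 k)) (trans (cong (_^ k) e) (trans (^-^-comm (k * (q * p)) N k) (cong (_^ N) (sym (costS-≡ p)))))

  -- Nothing is assumed about the colours of the q neighbours in R: rank 0 leaves at most k colours,
  -- and each of the other q ranks at most q, because some neighbour came earlier.
  plan-mono : Unique H → q ≤ length (nbrs G H v) → Plan G H X v (costM p)
  plan-mono uH deg = record
    { R = R ; h = h ; unique = unique-∷ (λ m → Adj-irrefl G (nbrs-adj G H (sub m))) (unique-++ˡ R (subst Unique (sym (take++drop≡id q N)) (unique-nbrs G v uH)))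
    ; inH = λ m → nbrs-∈ G H (sub m) ; bound = bd
    ; power = λ A N e → trans (power-3k A N (k * q ^ q) k (trans (cong (λ l → A ^ suc l) (sym lenR)) (trans e (cong (_^ N) (trans (cong (upto h) lenR) (cong (k *_) (upto-const q p))))))) (cong (_^ N) (sym (costM-≡ p))) }
    where
    N = nbrs G H v
    R = take q N
    h : ℕ → ℕ
    h zero = k
    h (suc _) = q
    lenR : length R ≡ q
    lenR = trans (length-take q N) (m≤n⇒m⊓n≡m deg)
    sub : ∀ {u} → u ∈ R → u ∈ N
    sub {u} m = subst (u ∈_) (take++drop≡id q N) (∈-++⁺ˡ m)
    bd : ∀ {E} → Unique E → length (free G E v X) ≤ h (count-in R E)
    bd {E} uE with filter (_∈? R) E in eq
    ... | [] = free≤k E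
    ... | u ∷ us = free≤ G E v X (proj₁ u∈) (nbrs-adj G H (sub (proj₂ u∈)))
      where
      u∈ : u ∈ E × u ∈ R
      u∈ = ∈-filter⁻ (_∈? R) {xs = E} (subst (u ∈_) (sym eq) (here refl))

not-mono : ∀ {n k} N (X : Colouring n k) → ¬ Mono N X → ∃₂ λ a b → a ∈ N × b ∈ N × lookup X a ≢ lookup X b
not-mono N X nm with anyF? (λ a → anyF? (λ b → (a ∈? N) ×-dec ((b ∈? N) ×-dec ¬? (lookup X a ≟F lookup X b))))
... | yes (a , b , r) = a , b , r
... | no nr = contradiction (All-tabulate (λ ma → All-tabulate (λ mb → eq ma mb))) nm
  where
  eq : ∀ {a b} → a ∈ N → b ∈ N → lookup X a ≡ lookup X b
  eq {a} {b} ma mb with lookup X a ≟F lookup X b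
  ... | yes e = e
  ... | no ne = contradiction (a , b , ma , mb , ne) nr

module Critical {n p : ℕ} (G : Graph n) (H : List (Fin n)) (uH : Unique H) (nc : ¬ ColOn G H (suc p))
  (crit : ∀ {u} → u ∈ H → ColOn G (filter (λ x → ¬? (x ≟F u)) H) (suc p)) (w : ℕ) (lenH : length H ≡ w + (2 + p)) where

  private
    k = 2 + p
    q = suc p
    Cs = costS p
    CM = costM p
    Cb = (k !) ^ 3

  Xs : List (Colouring n k)
  Xs = Cols G H
  N = length (perms H)

  degree-bound : ∀ {v} → v ∈ H → q ≤ length (nbrs G H v)
  degree-bound {v} v∈ = ≮⇒≥ λ small → nc (extend small)
    where
    H′ = filter (λ x → ¬? (x ≟F v)) H
    extend : length (nbrs G H v) < q → ColOn G H q
    extend small with crit v∈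
    ... | c , pr with missing-colour (map c (nbrs G H v)) (subst (_< q) (sym (length-map c (nbrs G H v))) small)
    ... | α , α∉ = col-insert G H′ H v (c , pr) α (λ m ne → ∈-filter⁺ (λ x → ¬? (x ≟F v)) m ne)
                     (λ m ad e → α∉ (subst (_∈ map c (nbrs G H v)) e (∈-map⁺ c (nbrs-in G H m ad))))

  monoCount : Colouring n k → ℕ
  monoCount X = length (filter (λ v → mono? (nbrs G H v) X) H)

  module AtColouring (X : Colouring n k) (X∈ : X ∈ Xs) where

    abstract
      dm : ∀ α → ∃ λ v → v ∈ H × lookup X v ≡ α × Dominates G H X v
      dm = dominator G H nc X (Cols-proper {G = G} X∈)

      Bs : List (Fin n)
      Bs = map (λ α → proj₁ (dm α)) (allFin k)

      unique-Bs : Unique Bs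
      unique-Bs = unique-map (λ α → proj₁ (dm α)) (unique-allFin k) λ {α} {β} _ _ e →
        trans (sym (proj₁ (proj₂ (proj₂ (dm α))))) (trans (cong (lookup X) e) (proj₁ (proj₂ (proj₂ (dm β)))))

      length-Bs : length Bs ≡ k
      length-Bs = trans (length-map _ (allFin k)) (length-allFin k)

      Bs-∈ : ∀ {v} → v ∈ Bs → v ∈ H × Dominates G H X v
      Bs-∈ m with ∈-map⁻ (λ α → proj₁ (dm α)) m
      ... | α , _ , refl = proj₁ (proj₂ (dm α)) , proj₂ (proj₂ (proj₂ (dm α)))

    t : Fin n → ℕ
    t v = bit (mono? (nbrs G H v) X)

    cost : Fin n → ℕ
    cost v = ifDec (v ∈? Bs) Cb (ifDec (mono? (nbrs G H v) X) CM Cs)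

    abstract
      plan : ∀ {v} → v ∈ H → Plan G H X v (cost v)
      plan {v} v∈ with v ∈? Bs | mono? (nbrs G H v) X
      ... | yes b | _ = plan-dominator G H X (proj₂ (Bs-∈ b))
      ... | no _ | yes _ = plan-mono G H X uH (degree-bound v∈)
      ... | no _ | no nm = let (a , b , ma , mb , ne) = not-mono (nbrs G H v) X nm in plan-bicoloured G H X ma mb ne

    open Plan

    Rf : Fin n → List (Fin n)
    Rf v with v ∈? H
    ... | yes m = R (plan m)
    ... | no _ = []

    hf : Fin n → ℕ → ℕ
    hf v with v ∈? H
    ... | yes m = h (plan m)
    ... | no _ = λ _ → 0

    f-bound : ∀ {v E} → v ∈ H → Unique E → (∀ {u} → u ∈ [] → u ∈ E) → length (free G E v X) ≤ hf v (count-in (Rf v) E)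
    f-bound {v} m uE _ with v ∈? H
    ... | yes m′ = bound (plan m′) uE
    ... | no nm = contradiction m nm

    local : Fin n → ℕ
    local v = Π (λ σ → hf v (rank (Rf v) v σ)) (perms H)

    local-power : ∀ {v} → v ∈ H → local v ^ (3 * k) ≡ cost v ^ N
    local-power {v} m with v ∈? H
    ... | yes m′ = power (plan m′) (Π (λ σ → h (plan m′) (rank (R (plan m′)) v σ)) (perms H)) N (rank-product (R (plan m′)) v (h (plan m′)) uH m (unique (plan m′)) (inH (plan m′)))
    ... | no nm = contradiction m nm

    weights : Π (λ σ → weight G [] σ X) (perms H) ≤ Π local H
    weights = ≤-trans (Π-mono (perms H) (λ {σ} m → each σ (∈-perms {xs = H} m))) (≤-reflexive (Π-swap (λ σ v → hf v (rank (Rf v) v σ)) (perms H) H))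
      where
      each : ∀ σ → σ ↭ H → weight G [] σ X ≤ Π (λ v → hf v (rank (Rf v) v σ)) H
      each σ p = ≤-trans (weight-rank G X H [] Rf hf f-bound σ [] (∈-resp-↭ p) (λ ()) (unique-↭ (↭-sym p) uH) [] (λ _ ()))
        (≤-reflexive (Π-↭ (λ v → hf v (rank (Rf v) v σ)) p))

    rest : List (Fin n)
    rest = filter (λ v → ¬? (v ∈? Bs)) H

    H↭ : H ↭ rest ++ Bs
    H↭ = same-elements-↭ uH (unique-++ (unique-filter out? uH) unique-Bs (λ m → proj₂ (∈-filter⁻ out? {xs = H} m))) to from
      where
      out? = λ v → ¬? (v ∈? Bs)
      to : ∀ {x} → x ∈ H → x ∈ rest ++ Bs
      to {x} m with x ∈? Bs
      ... | yes b = ∈-++⁺ʳ rest b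
      ... | no b = ∈-++⁺ˡ (∈-filter⁺ out? m b)
      from : ∀ {x} → x ∈ rest ++ Bs → x ∈ H
      from m with ∈-++⁻ rest m
      ... | inj₁ a = proj₁ (∈-filter⁻ out? {xs = H} a)
      ... | inj₂ b = proj₁ (Bs-∈ b)

    length-rest : length rest ≡ w
    length-rest = +-cancelʳ-≡ k (length rest) w (trans (cong (length rest +_) (sym length-Bs)) (trans (sym (length-++ rest {Bs})) (trans (sym (↭-length H↭)) lenH)))

    -- The powers of `Cs` and `CM` replace a quotient `CM / Cs` for each monochromatic vertex. A
    -- vertex of `Bs` is charged `Cb` in any case; should it be monochromatic, `costS≤costM` covers
    -- it.
    costs : Π cost H * Cs ^ monoCount X ≤ Cb ^ k * Cs ^ w * CM ^ monoCount X
    costs = begin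
      Π cost H * Cs ^ monoCount X ≡⟨ cong (λ z → Π cost H * Cs ^ z) (length-filter-sum (λ v → mono? (nbrs G H v) X) H) ⟩
      Π cost H * Cs ^ sum (map t H) ≡⟨ cong (Π cost H *_) (sym (Π-base-^ Cs t H)) ⟩
      Π cost H * Π (λ v → Cs ^ t v) H ≡⟨ sym (Π-* cost (λ v → Cs ^ t v) H) ⟩
      Π (λ v → cost v * Cs ^ t v) H ≡⟨ trans (Π-↭ (λ v → cost v * Cs ^ t v) H↭) (Π-++ (λ v → cost v * Cs ^ t v) rest Bs) ⟩
      Π (λ v → cost v * Cs ^ t v) rest * Π (λ v → cost v * Cs ^ t v) Bs ≤⟨ *-mono-≤ (Π-mono rest (λ m → c-rest (proj₂ (∈-filter⁻ (λ v → ¬? (v ∈? Bs)) {xs = H} m)))) (Π-mono Bs c-Bs) ⟩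
      Π (λ v → Cs * CM ^ t v) rest * Π (λ v → Cb * CM ^ t v) Bs ≡⟨ cong₂ _*_ (trans (Π-* (λ _ → Cs) (λ v → CM ^ t v) rest) (cong (_* A) (trans (Π-const Cs rest) (cong (Cs ^_) length-rest))))
                                                                        (trans (Π-* (λ _ → Cb) (λ v → CM ^ t v) Bs) (cong (_* B) (trans (Π-const Cb Bs) (cong (Cb ^_) length-Bs)))) ⟩
      Cs ^ w * A * (Cb ^ k * B) ≡⟨ lem (Cs ^ w) A (Cb ^ k) B ⟩
      Cb ^ k * Cs ^ w * (A * B) ≡⟨ cong (Cb ^ k * Cs ^ w *_) (trans (sym (Π-++ (λ v → CM ^ t v) rest Bs)) (trans (sym (Π-↭ (λ v → CM ^ t v) H↭)) (Π-base-^ CM t H))) ⟩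
      Cb ^ k * Cs ^ w * CM ^ sum (map t H) ≡⟨ cong (λ z → Cb ^ k * Cs ^ w * CM ^ z) (sym (length-filter-sum (λ v → mono? (nbrs G H v) X) H)) ⟩
      Cb ^ k * Cs ^ w * CM ^ monoCount X ∎
      where
      open ≤-Reasoning
      A = Π (λ v → CM ^ t v) rest
      B = Π (λ v → CM ^ t v) Bs
      lem : ∀ a b c d → a * b * (c * d) ≡ c * a * (b * d)
      lem = solve-∀
      c-rest : ∀ {v} → v ∉ Bs → cost v * Cs ^ t v ≤ Cs * CM ^ t v
      c-rest {v} nm with v ∈? Bs | mono? (nbrs G H v) X
      ... | yes m | _ = contradiction m nm
      ... | no _ | yes _ = ≤-reflexive (l CM Cs)
        where
        l : ∀ a b → a * (b * 1) ≡ b * (a * 1)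
        l = solve-∀
      ... | no _ | no _ = ≤-refl
      c-Bs : ∀ {v} → v ∈ Bs → cost v * Cs ^ t v ≤ Cb * CM ^ t v
      c-Bs {v} m with v ∈? Bs
      ... | no nm = contradiction m nm
      ... | yes _ = *-monoʳ-≤ Cb (^-monoˡ-≤ (t v) (costS≤costM p))

    total : Π (λ σ → weight G [] σ X) (perms H) ^ (3 * k) * (Cs ^ monoCount X) ^ N ≤ (Cb ^ k * Cs ^ w * CM ^ monoCount X) ^ N
    total = begin
      Π (λ σ → weight G [] σ X) (perms H) ^ (3 * k) * (Cs ^ monoCount X) ^ N ≤⟨ *-monoˡ-≤ ((Cs ^ monoCount X) ^ N) (^-monoˡ-≤ (3 * k) weights) ⟩
      Π local H ^ (3 * k) * (Cs ^ monoCount X) ^ N ≡⟨ cong (_* (Cs ^ monoCount X) ^ N) (trans (Π-^ local (3 * k) H) (trans (Π-cong H local-power) (sym (Π-^ cost N H)))) ⟩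
      Π cost H ^ N * (Cs ^ monoCount X) ^ N ≡⟨ sym (^-distribʳ-* N (Π cost H) (Cs ^ monoCount X)) ⟩
      (Π cost H * Cs ^ monoCount X) ^ N ≤⟨ ^-monoˡ-≤ N costs ⟩
      (Cb ^ k * Cs ^ w * CM ^ monoCount X) ^ N ∎
      where open ≤-Reasoning

  count : ℕ
  count = length Xs

  monoTotal : ℕ
  monoTotal = sum (map monoCount Xs)

  chain : ∀ {σ} → σ ∈ perms H → count ^ count ≤ Π (weight G [] σ) Xs
  chain {σ} m = entropy-chain G H σ [] Xs (unique-Cols G H) (λ m → Cols-proper {G = G} m) (λ ()) (∈-resp-↭ σ↭) (λ _ _ ())
    (λ a b e → Cols-ext {G = G} a b (λ u∈ → e (∈-resp-↭ (↭-sym σ↭) u∈)))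
    where
    σ↭ : σ ↭ H
    σ↭ = ∈-perms {xs = H} m

  -- The chain rule holds along every order. Multiplying over all N orders and taking the N-th root
  -- averages over a random one, and exchanging products turns the cost of an order into costs of
  -- vertices.
  entropy : (count ^ count) ^ (3 * k) * Cs ^ monoTotal ≤ (Cb ^ k * Cs ^ w) ^ count * CM ^ monoTotal
  entropy = ^-cancelʳ-≤ _ _ N (perms-nonempty H) (begin
    ((count ^ count) ^ (3 * k) * Cs ^ monoTotal) ^ N ≡⟨ ^-distribʳ-* N ((count ^ count) ^ (3 * k)) (Cs ^ monoTotal) ⟩
    ((count ^ count) ^ (3 * k)) ^ N * (Cs ^ monoTotal) ^ N ≡⟨ cong₂ _*_ (^-^-comm (count ^ count) (3 * k) N) (trans (cong (_^ N) (sym (Π-base-^ Cs monoCount Xs))) (Π-^ (λ X → Cs ^ monoCount X) N Xs)) ⟩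
    ((count ^ count) ^ N) ^ (3 * k) * Π (λ X → (Cs ^ monoCount X) ^ N) Xs ≤⟨ *-monoˡ-≤ (Π (λ X → (Cs ^ monoCount X) ^ N) Xs) (^-monoˡ-≤ (3 * k) orders) ⟩
    Π (λ X → Π (λ σ → weight G [] σ X) (perms H)) Xs ^ (3 * k) * Π (λ X → (Cs ^ monoCount X) ^ N) Xs ≡⟨ cong (_* Π (λ X → (Cs ^ monoCount X) ^ N) Xs) (Π-^ (λ X → Π (λ σ → weight G [] σ X) (perms H)) (3 * k) Xs) ⟩
    Π (λ X → Π (λ σ → weight G [] σ X) (perms H) ^ (3 * k)) Xs * Π (λ X → (Cs ^ monoCount X) ^ N) Xs ≡⟨ sym (Π-* (λ X → Π (λ σ → weight G [] σ X) (perms H) ^ (3 * k)) (λ X → (Cs ^ monoCount X) ^ N) Xs) ⟩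
    Π (λ X → Π (λ σ → weight G [] σ X) (perms H) ^ (3 * k) * (Cs ^ monoCount X) ^ N) Xs ≤⟨ Π-mono Xs (λ {X} m → AtColouring.total X m) ⟩
    Π (λ X → (Cb ^ k * Cs ^ w * CM ^ monoCount X) ^ N) Xs ≡⟨ sym (Π-^ (λ X → Cb ^ k * Cs ^ w * CM ^ monoCount X) N Xs) ⟩
    Π (λ X → Cb ^ k * Cs ^ w * CM ^ monoCount X) Xs ^ N ≡⟨ cong (_^ N) (trans (Π-* (λ _ → Cb ^ k * Cs ^ w) (λ X → CM ^ monoCount X) Xs) (cong₂ _*_ (Π-const (Cb ^ k * Cs ^ w) Xs) (Π-base-^ CM monoCount Xs))) ⟩
    ((Cb ^ k * Cs ^ w) ^ count * CM ^ monoTotal) ^ N ∎)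
    where
    open ≤-Reasoning
    orders : (count ^ count) ^ N ≤ Π (λ X → Π (λ σ → weight G [] σ X) (perms H)) Xs
    orders = ≤-trans (≤-reflexive (sym (Π-const (count ^ count) (perms H)))) (≤-trans (Π-mono (perms H) chain) (≤-reflexive (Π-swap (λ σ X → weight G [] σ X) (perms H) Xs)))

costS-positive : ∀ p → 1 ≤ p → 1 ≤ costS p
costS-positive p h = subst (1 ≤_) (sym (costS-≡ p)) (m^n>0′ _ (2 + p) (*-mono-≤ (s≤s (z≤n {suc p})) (*-mono-≤ (s≤s (z≤n {p})) h)))

weightTop-positive : ∀ p → 1 ≤ weightTop p
weightTop-positive p = subst (1 ≤_) (sym (weightTop-≡ p)) (m^n>0′ (suc p) (tower p) (s≤s z≤n))

tower-positive : ∀ p → 4 ≤ tower p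
tower-positive p = subst (4 ≤_) (sym (tower-≡ p)) (≤-trans (≤-trans (m≤m+n 4 (2 + 3 * p)) (≤-reflexive (l p))) (m≤m*n (3 * (2 + p)) (suc (tame p))))
  where
  l : ∀ p → 4 + (2 + 3 * p) ≡ 3 * (2 + p)
  l = solve-∀

gapZ-≥4 : ∀ p → 4 ≤ gapZ p
gapZ-≥4 p = subst (4 ≤_) (sym (gapZ-≡ p)) (*-mono-≤ (tower-positive p) (weightTop-positive p))

-- If the monochromatic pairs number at most P w/t, then the worst case is equality: the y missing
-- pairs on the scale of t are filled up at the higher price CM. What remains is a P-th power on
-- both sides.
entropy-root : ∀ P μ w t′ k Cs CM B → 1 ≤ P → 1 ≤ Cs → Cs ≤ CM → suc t′ * μ ≤ P * w →
  (P ^ P) ^ (3 * k) * Cs ^ μ ≤ (B * Cs ^ w) ^ P * CM ^ μ → (P ^ (3 * k)) ^ suc t′ ≤ B ^ suc t′ * (Cs ^ t′ * CM) ^ w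
entropy-root P μ w t′ k Cs CM B 1≤P 1≤Cs Cs≤CM tμ ent = *-cancelʳ-≤′ (Cs ^ w) (m^n>0′ Cs w 1≤Cs) (^-cancelʳ-≤ _ _ P 1≤P (begin
  ((P ^ (3 * k)) ^ t * Cs ^ w) ^ P ≡⟨ ^-distribʳ-* P ((P ^ (3 * k)) ^ t) (Cs ^ w) ⟩
  ((P ^ (3 * k)) ^ t) ^ P * (Cs ^ w) ^ P ≡⟨ cong₂ _*_ (trans (^-^-comm (P ^ (3 * k)) t P) (cong (_^ t) (^-^-comm P (3 * k) P))) csw ⟩
  ((P ^ P) ^ (3 * k)) ^ t * ((Cs ^ μ) ^ t * Cs ^ y) ≡⟨ trans (sym (*-assoc (((P ^ P) ^ (3 * k)) ^ t) ((Cs ^ μ) ^ t) (Cs ^ y))) (cong (_* Cs ^ y) (sym (^-distribʳ-* t ((P ^ P) ^ (3 * k)) (Cs ^ μ)))) ⟩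
  ((P ^ P) ^ (3 * k) * Cs ^ μ) ^ t * Cs ^ y ≤⟨ *-mono-≤ (^-monoˡ-≤ t ent) (^-monoˡ-≤ y Cs≤CM) ⟩
  ((B * Cs ^ w) ^ P * CM ^ μ) ^ t * CM ^ y ≡⟨ trans (cong (_* CM ^ y) (^-distribʳ-* t ((B * Cs ^ w) ^ P) (CM ^ μ))) (*-assoc (((B * Cs ^ w) ^ P) ^ t) ((CM ^ μ) ^ t) (CM ^ y)) ⟩
  ((B * Cs ^ w) ^ P) ^ t * ((CM ^ μ) ^ t * CM ^ y) ≡⟨ cong₂ _*_ (^-^-comm (B * Cs ^ w) P t) (sym (pw CM)) ⟩
  ((B * Cs ^ w) ^ t) ^ P * (CM ^ w) ^ P ≡⟨ sym (^-distribʳ-* P ((B * Cs ^ w) ^ t) (CM ^ w)) ⟩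
  ((B * Cs ^ w) ^ t * CM ^ w) ^ P ≡⟨ cong (_^ P) regroup ⟩
  (B ^ t * (Cs ^ t′ * CM) ^ w * Cs ^ w) ^ P ∎))
  where
  open ≤-Reasoning
  t = suc t′
  y = P * w ∸ t * μ
  pw : ∀ c → (c ^ w) ^ P ≡ (c ^ μ) ^ t * c ^ y
  pw c = trans (^-*-assoc c w P) (trans (cong (c ^_) (trans (*-comm w P) (sym (m+[n∸m]≡n tμ))))
    (trans (^-distribˡ-+-* c (t * μ) y) (cong (_* c ^ y) (trans (cong (c ^_) (*-comm t μ)) (sym (^-*-assoc c μ t))))))
  csw = pw Cs
  regroup : (B * Cs ^ w) ^ t * CM ^ w ≡ B ^ t * (Cs ^ t′ * CM) ^ w * Cs ^ w
  regroup = trans (cong (_* CM ^ w) (^-distribʳ-* t B (Cs ^ w))) (trans (l (B ^ t) (Cs ^ w) ((Cs ^ w) ^ t′) (CM ^ w))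
    (cong (λ z → B ^ t * z * Cs ^ w) (sym (trans (^-distribʳ-* w (Cs ^ t′) CM) (cong (_* CM ^ w) (^-^-comm Cs t′ w))))))
    where
    l : ∀ b c d m → b * (c * d) * m ≡ b * (d * m) * c
    l = solve-∀

-- Of the w factors C < W, one is bounded by W - 1 and the others by W. That single factor becomes
-- the gap when the e-th root is taken, so at least one vertex beyond the first k is required.
gap-from-root : ∀ P p w f e W → 1 ≤ w → 1 ≤ e → 1 ≤ W → W ≡ suc p ^ e → ∀ C k → C < W → P ^ e ≤ f ^ e * C ^ w →
  P * suc p ^ k * suc (e * W) ≤ f * suc p ^ (w + k) * (e * W)
gap-from-root P p (suc w′) f e (suc W′) _ 1≤e _ eqW C k (s≤s C≤W′) h = gap-root (P * q ^ k) (f * q ^ (w + k)) e W′ 1≤e (begin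
  (P * q ^ k) ^ e * W ≡⟨ cong (_* W) (^-distribʳ-* e P (q ^ k)) ⟩
  P ^ e * (q ^ k) ^ e * W ≤⟨ *-monoˡ-≤ W (*-monoˡ-≤ ((q ^ k) ^ e) h) ⟩
  f ^ e * (C * C ^ w′) * (q ^ k) ^ e * W ≤⟨ *-monoˡ-≤ W (*-monoˡ-≤ ((q ^ k) ^ e) (*-monoʳ-≤ (f ^ e) (*-mono-≤ C≤W′ (^-monoˡ-≤ w′ (≤-trans C≤W′ (n≤1+n W′)))))) ⟩
  f ^ e * (W′ * W ^ w′) * (q ^ k) ^ e * W ≡⟨ lem (f ^ e) W′ (W ^ w′) ((q ^ k) ^ e) W ⟩
  f ^ e * (W ^ w * (q ^ k) ^ e) * W′ ≡⟨ cong (λ z → f ^ e * (z * (q ^ k) ^ e) * W′) (trans (cong (_^ w) eqW) (^-^-comm q e w)) ⟩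
  f ^ e * ((q ^ w) ^ e * (q ^ k) ^ e) * W′ ≡⟨ cong (λ z → f ^ e * z * W′) (trans (sym (^-distribʳ-* e (q ^ w) (q ^ k))) (cong (_^ e) (sym (^-distribˡ-+-* q w k)))) ⟩
  f ^ e * (q ^ (w + k)) ^ e * W′ ≡⟨ cong (_* W′) (sym (^-distribʳ-* e f (q ^ (w + k)))) ⟩
  (f * q ^ (w + k)) ^ e * W′ ∎)
  where
  open ≤-Reasoning
  q = suc p
  w = suc w′
  W = suc W′
  lem : ∀ f a b c d → f * (a * b) * c * d ≡ f * (d * b * c) * a
  lem = solve-∀

numeric-gap : ∀ p P μ w → 2 ≤ p → 1 ≤ w → suc (tame p) * μ ≤ P * w →
  (P ^ P) ^ (3 * (2 + p)) * costS p ^ μ ≤ ((((2 + p) !) ^ 3) ^ (2 + p) * costS p ^ w) ^ P * costM p ^ μ →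
  P * suc p ^ (2 + p) * suc (gapZ p) ≤ (2 + p) ! * suc p ^ (w + (2 + p)) * gapZ p
numeric-gap p zero μ w _ _ _ _ = z≤n
numeric-gap p P@(suc _) μ w 2≤p 1≤w tμ ent = subst (λ z → P * suc p ^ k * suc z ≤ k ! * suc p ^ (w + k) * z) (sym (gapZ-≡ p))
  (gap-from-root P p w (k !) (tower p) (weightTop p) 1≤w (≤-trans (s≤s z≤n) (tower-positive p)) (weightTop-positive p) (weightTop-≡ p)
    (costS p ^ tame p * costM p) k (cost-product p 2≤p)
    (subst₂ (λ a b → a ≤ b * (costS p ^ tame p * costM p) ^ w) e₁ e₂
      (entropy-root P μ w (tame p) k (costS p) (costM p) (((k !) ^ 3) ^ k) (s≤s z≤n) (costS-positive p (≤-trans (s≤s z≤n) 2≤p)) (costS≤costM p) tμ ent)))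
  where
  k = 2 + p
  e₁ : (P ^ (3 * k)) ^ suc (tame p) ≡ P ^ tower p
  e₁ = trans (^-*-assoc P (3 * k) (suc (tame p))) (cong (P ^_) (sym (tower-≡ p)))
  e₂ : (((k !) ^ 3) ^ k) ^ suc (tame p) ≡ (k !) ^ tower p
  e₂ = trans (cong (_^ suc (tame p)) (^-*-assoc (k !) 3 k)) (trans (^-*-assoc (k !) (3 * k) (suc (tame p))) (cong ((k !) ^_) (sym (tower-≡ p))))

-- Since w ≥ q, the quotient (w + k)/w is at most 7/3 for p = 2 and at most 3 otherwise. Dividing by
-- q^p, which is 9 or at least 24, and bounding (Z + 1)/Z by 9/7 or 2 gives the shares 1/3 and 1/4.
rare-core : ∀ p P μ w Z → 2 ≤ p → suc p ≤ w → 4 ≤ Z → μ * suc p ^ p * Z ≤ (w + (2 + p)) * P * suc Z → suc (tame p) * μ ≤ P * w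
rare-core 1 _ _ _ _ (s≤s ()) _ _ _
rare-core 2 P μ w Z _ 3≤w 4≤Z h = *-cancelˡ-≤′ 9 (s≤s z≤n) (*-cancelʳ-≤′ Z (≤-trans (s≤s z≤n) 4≤Z) (begin
  9 * (3 * μ) * Z ≡⟨ l₁ μ Z ⟩
  3 * (μ * 9 * Z) ≤⟨ *-monoʳ-≤ 3 h ⟩
  3 * ((w + 4) * P * suc Z) ≡⟨ l₂ w P Z ⟩
  (3 * w + 12) * (P * suc Z) ≤⟨ *-monoˡ-≤ (P * suc Z) (≤-trans (+-monoʳ-≤ (3 * w) (*-monoʳ-≤ 4 3≤w)) (≤-reflexive (l₃ w))) ⟩
  7 * w * (P * suc Z) ≡⟨ l₄ w P Z ⟩
  w * P * (7 * Z + 7) ≤⟨ *-monoʳ-≤ (w * P) (+-monoʳ-≤ (7 * Z) (≤-trans (n≤1+n 7) (*-monoʳ-≤ 2 4≤Z))) ⟩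
  w * P * (7 * Z + 2 * Z) ≡⟨ l₅ w P Z ⟩
  9 * (P * w) * Z ∎))
  where
  open ≤-Reasoning
  l₁ : ∀ μ Z → 9 * (3 * μ) * Z ≡ 3 * (μ * 9 * Z)
  l₁ = solve-∀
  l₂ : ∀ w P Z → 3 * ((w + 4) * P * suc Z) ≡ (3 * w + 12) * (P * suc Z)
  l₂ = solve-∀
  l₃ : ∀ w → 3 * w + 4 * w ≡ 7 * w
  l₃ = solve-∀
  l₄ : ∀ w P Z → 7 * w * (P * suc Z) ≡ w * P * (7 * Z + 7)
  l₄ = solve-∀
  l₅ : ∀ w P Z → w * P * (7 * Z + 2 * Z) ≡ 9 * (P * w) * Z
  l₅ = solve-∀
rare-core p@(suc (suc (suc r))) P μ w Z _ q≤w 4≤Z h = *-cancelˡ-≤′ 6 (s≤s z≤n) (*-cancelʳ-≤′ Z (≤-trans (s≤s z≤n) 4≤Z) (begin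
  6 * (4 * μ) * Z ≡⟨ l₁ μ Z ⟩
  μ * 24 * Z ≤⟨ *-monoˡ-≤ Z (*-monoʳ-≤ μ 24≤) ⟩
  μ * suc p ^ p * Z ≤⟨ h ⟩
  (w + (2 + p)) * P * suc Z ≤⟨ *-mono-≤ (*-monoˡ-≤ P (+-monoʳ-≤ w (≤-trans 2+p≤ (+-mono-≤ q≤w q≤w)))) (≤-trans (+-monoˡ-≤ Z (≤-trans (s≤s z≤n) 4≤Z)) ≤-refl) ⟩
  (w + (w + w)) * P * (Z + Z) ≡⟨ l₂ w P Z ⟩
  6 * (P * w) * Z ∎))
  where
  open ≤-Reasoning
  l₁ : ∀ μ Z → 6 * (4 * μ) * Z ≡ μ * 24 * Z
  l₁ = solve-∀
  l₂ : ∀ w P Z → (w + (w + w)) * P * (Z + Z) ≡ 6 * (P * w) * Z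
  l₂ = solve-∀
  2+p≤ : 2 + p ≤ suc p + suc p
  2+p≤ = s≤s (≤-trans (m≤m+n (suc p) p) (≤-reflexive (+-comm (suc p) p)))
  24≤ : 24 ≤ suc p ^ p
  24≤ = ≤-trans (≤-trans (m≤m+n 24 40) (^-monoˡ-≤ 3 (s≤s (s≤s (s≤s (s≤s (z≤n {r}))))))) (^-monoʳ-≤ (suc p) (s≤s (s≤s (s≤s (z≤n {r})))))

-- The contraction bound measures μ against Tomescu's bound. If the gap fails, P itself is nearly
-- that bound, and μ becomes small in comparison with P.
rare-or-gap : ∀ p P μ w f → 2 ≤ p → (μ ≡ 0 ⊎ suc p ≤ w) → μ * (suc p ^ (2 + p) * suc p ^ p) ≤ (w + (2 + p)) * (f * suc p ^ (w + (2 + p))) →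
  P * suc p ^ (2 + p) * suc (gapZ p) ≤ f * suc p ^ (w + (2 + p)) * gapZ p ⊎ suc (tame p) * μ ≤ P * w
rare-or-gap p P .0 w f _ (inj₁ refl) _ = inj₂ (≤-trans (≤-reflexive (*-zeroʳ (suc (tame p)))) z≤n)
rare-or-gap p P μ w f 2≤p (inj₂ q≤w) h with P * suc p ^ (2 + p) * suc (gapZ p) ≤? f * suc p ^ (w + (2 + p)) * gapZ p
... | yes g = inj₁ g
... | no ¬g = inj₂ (rare-core p P μ w Z 2≤p q≤w (gapZ-≥4 p) (*-cancelʳ-≤′ Q (m^n>0′ (suc p) (2 + p) (s≤s z≤n)) (begin
  μ * suc p ^ p * Z * Q ≡⟨ l₁ μ (suc p ^ p) Z Q ⟩
  μ * (Q * suc p ^ p) * Z ≤⟨ *-monoˡ-≤ Z h ⟩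
  L * (f * suc p ^ L) * Z ≡⟨ *-assoc L (f * suc p ^ L) Z ⟩
  L * (f * suc p ^ L * Z) ≤⟨ *-monoʳ-≤ L (<⇒≤ (≰⇒> ¬g)) ⟩
  L * (P * Q * suc Z) ≡⟨ l₂ L P Q (suc Z) ⟩
  L * P * suc Z * Q ∎)))
  where
  open ≤-Reasoning
  Z = gapZ p
  Q = suc p ^ (2 + p)
  L = w + (2 + p)
  l₁ : ∀ a b c d → a * b * c * d ≡ a * (d * b) * c
  l₁ = solve-∀
  l₂ : ∀ a b c d → a * (b * c * d) ≡ a * b * d * c
  l₂ = solve-∀

-- Tomescu's bound with a gap

-- Tomescu's bound k! q^(|S| - k), lowered by the factor Z/(Z+1); multiplication by q^k avoids the
-- difference in the exponent.
Gap : ∀ {n} (p : ℕ) → Graph n → List (Fin n) → Set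
Gap p G S = # {k′ = suc p} G S * suc p ^ (2 + p) * suc (gapZ p) ≤ (2 + p) ! * suc p ^ length S * gapZ p

Bounded : ∀ {n} (p : ℕ) → Graph n → List (Fin n) → Set
Bounded p G S = # {k′ = suc p} G S * suc p ^ (2 + p) ≤ (2 + p) ! * suc p ^ length S

gap⇒bounded : ∀ {n} p (G : Graph n) S → Gap p G S → Bounded p G S
gap⇒bounded p G S g = *-cancelʳ-≤′ (suc (gapZ p)) (s≤s z≤n) (≤-trans g (*-monoʳ-≤ ((2 + p) ! * suc p ^ length S) (n≤1+n (gapZ p))))

head-∈ : ∀ {A : Set} (xs : List A) → 1 ≤ length xs → ∃ λ x → x ∈ xs
head-∈ (x ∷ xs) _ = x , here refl

sum-cases : ∀ {A : Set} {P : Set} (m : A → ℕ) c f xs → (∀ {v} → v ∈ xs → m v ≡ 0 ⊎ (P × m v * c ≤ f)) →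
  (sum (map m xs) ≡ 0 ⊎ P) × sum (map m xs) * c ≤ length xs * f
sum-cases m c f [] _ = inj₁ refl , z≤n
sum-cases m c f (x ∷ xs) h with h (here refl) | sum-cases m c f xs (λ m → h (there m))
... | inj₁ e | inj₁ z , b rewrite e = inj₁ z , ≤-trans b (m≤n+m _ f)
... | inj₁ e | inj₂ P , b rewrite e = inj₂ P , ≤-trans b (m≤n+m _ f)
... | inj₂ (P , le) | _ , b = inj₂ P , ≤-trans (≤-reflexive (*-distribʳ-+ c (m x) _)) (+-mono-≤ le b)

empty-length : ∀ {A : Set} (xs : List A) → (∀ {x} → x ∉ xs) → length xs ≡ 0
empty-length [] _ = refl
empty-length (x ∷ xs) h = contradiction (here refl) h

module _ {n : ℕ} (G : Graph n) (S : List (Fin n)) (v : Fin n) where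

  private
    N = nbrs G S v

  InnerEdge : Set
  InnerEdge = ∃₂ λ a b → a ∈ N × b ∈ N × Adj G a b

  innerEdge? : Dec InnerEdge
  innerEdge? = anyF? (λ a → anyF? (λ b → (a ∈? N) ×-dec ((b ∈? N) ×-dec T? (adj G a b))))

  innerEdge-mono : ∀ {k′} → InnerEdge → length (filter (mono? {k = suc k′} N) (Cols G S)) ≡ 0
  innerEdge-mono {k′} (a , b , ma , mb , ad) = empty-length _ λ {X} m →
    let (m₁ , mono) = ∈-filter⁻ (mono? {k = suc k′} N) {xs = Cols G S} m in
    Cols-proper {G = G} m₁ (nbrs-∈ G S ma) (nbrs-∈ G S mb) ad (Mono-≡ {X = X} mono ma mb)

-- An edge inside the neighbourhood of v rules out monochromatic colourings. Otherwise the
-- hypothesis on smaller graphs, applied to the contraction, bounds their number by k! q^(|H| - k -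
-- p). The contraction still has at least k vertices and v has at least q neighbours, which also
-- yields the `q ≤ w` needed for `rare-core`.
critical-gap : ∀ {n} p → 2 ≤ p → (G : Graph n) (H : List (Fin n)) → Unique H → Conn G H → ¬ ColOn G H (suc p) →
  (∀ {u} → u ∈ H → ColOn G (filter (λ x → ¬? (x ≟F u)) H) (suc p)) → 3 + p ≤ length H →
  (∀ (K : Graph n) S → Unique S → Conn K S → ¬ ColOn K S (suc p) → length S < length H → Bounded p K S) → Gap p G H
critical-gap {n} p@(suc p₁) 2≤p G H uH cn nc crit big IH =
  case rare-or-gap p count monoTotal w (k !) 2≤p (proj₁ μ-bound) (subst (λ l → monoTotal * (q ^ k * q ^ p) ≤ l * (k ! * q ^ l)) lenH (proj₂ μ-bound)) of λ
    { (inj₁ g) → subst (λ l → count * q ^ k * suc (gapZ p) ≤ k ! * q ^ l * gapZ p) (sym lenH) g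
    ; (inj₂ rare) → subst (λ l → count * q ^ k * suc (gapZ p) ≤ k ! * q ^ l * gapZ p) (sym lenH) (numeric-gap p count monoTotal w 2≤p 1≤w rare entropy) }
  where
  k = 2 + p
  q = suc p
  w = length H ∸ k
  lenH : length H ≡ w + k
  lenH = sym (m∸n+n≡m (≤-trans (n≤1+n k) big))
  1≤w : 1 ≤ w
  1≤w = m<n⇒0<n∸m big
  open Critical G H uH nc crit w lenH
  m : Fin n → ℕ
  m v = length (filter (mono? {k = k} (nbrs G H v)) (Cols G H))
  m-bound : ∀ {v} → v ∈ H → m v ≡ 0 ⊎ (q ≤ w × m v * (q ^ k * q ^ p) ≤ k ! * q ^ length H)
  m-bound {v} v∈ with innerEdge? G H v
  ... | yes ie = inj₁ (innerEdge-mono G H v ie)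
  ... | no ¬ie = inj₂ (q≤w , le)
    where
    deg = degree-bound v∈
    r = proj₁ (head-∈ (nbrs G H v) (≤-trans (s≤s z≤n) deg))
    r∈ = proj₂ (head-∈ (nbrs G H v) (≤-trans (s≤s z≤n) deg))
    module Q = Quotient G H uH v∈ r∈
    ncK : ¬ ColOn Q.K Q.S/ q
    ncK c = nc (Q.contract-col (λ ma mb ad → ¬ie (_ , _ , ma , mb , ad)) c)
    q≤w : q ≤ w
    q≤w = +-cancelʳ-≤ k q w (≤-trans (≤-reflexive (+-comm q k)) (≤-trans (+-mono-≤ (noncol-length Q.K Q.S/ ncK) deg) (≤-reflexive (trans Q.length-S/ lenH))))
    smaller : length Q.S/ < length H
    smaller = subst (suc (length Q.S/) ≤_) Q.length-S/ (≤-trans (≤-reflexive (+-comm 1 (length Q.S/))) (+-monoʳ-≤ (length Q.S/) (≤-trans (s≤s z≤n) deg)))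
    le : m v * (q ^ k * q ^ p) ≤ k ! * q ^ length H
    le = begin
      m v * (q ^ k * q ^ p) ≤⟨ *-monoˡ-≤ (q ^ k * q ^ p) (Q.mono-count {k′ = q}) ⟩
      # Q.K Q.S/ * q * (q ^ k * q ^ p) ≡⟨ l (# Q.K Q.S/) q (q ^ k) (q ^ p) ⟩
      # Q.K Q.S/ * q ^ k * q ^ q ≤⟨ *-mono-≤ (IH Q.K Q.S/ Q.unique-S/ (Q.contract-conn cn) ncK smaller) (^-monoʳ-≤ q deg) ⟩
      k ! * q ^ length Q.S/ * q ^ length Q.N ≡⟨ trans (*-assoc (k !) (q ^ length Q.S/) _) (cong (k ! *_) (trans (sym (^-distribˡ-+-* q (length Q.S/) (length Q.N))) (cong (q ^_) Q.length-S/))) ⟩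
      k ! * q ^ length H ∎
      where
      open ≤-Reasoning
      l : ∀ a b c d → a * b * (c * d) ≡ a * c * (b * d)
      l = solve-∀
  total : monoTotal ≡ sum (map m H)
  total = trans (sum-cong Xs (λ {X} _ → length-filter-sum (λ v → mono? (nbrs G H v) X) H))
    (trans (sum-swap (λ X v → bit (mono? (nbrs G H v) X)) Xs H) (sum-cong H (λ {v} _ → sym (length-filter-sum (mono? (nbrs G H v)) Xs))))
  μ-bound : (monoTotal ≡ 0 ⊎ q ≤ w) × monoTotal * (q ^ k * q ^ p) ≤ length H * (k ! * q ^ length H)
  μ-bound = subst (λ z → (z ≡ 0 ⊎ q ≤ w) × z * (q ^ k * q ^ p) ≤ length H * (k ! * q ^ length H)) (sym total) (sum-cases m (q ^ k * q ^ p) (k ! * q ^ length H) H m-bound)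

-- Cliques with trees attached, and the induction for Tomescu's bound

data Ext {n} (G : Graph n) (k : ℕ) : List (Fin n) → Set where
  clique : ∀ {Q} → length Q ≡ k → Clique {k′ = k} G Q → Ext G k Q
  leaf : ∀ {T u s} → Ext G k T → s ∈ T → Adj G u s → (∀ {t} → t ∈ T → Adj G u t → t ≡ s) → u ∉ T → Ext G k (u ∷ T)

#-↭ : ∀ {n k′} (G : Graph n) {S T} → (∀ {x} → x ∈ S → x ∈ T) → (∀ {x} → x ∈ T → x ∈ S) → # {k′ = k′} G S ≡ # {k′ = k′} G T
#-↭ {n} {k′} G {S} {T} to from = trans (cong length (Cols-≡ G S)) (trans (length-filter-cong (isCol? G S) (isCol? G T) (allColourings n (suc k′)) (λ {X} _ → mv {X = X} from to) (λ {X} _ → mv {X = X} to from)) (cong length (sym (Cols-≡ G T))))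
  where
  mv : ∀ {S T X} → (∀ {x} → x ∈ T → x ∈ S) → (∀ {x} → x ∈ S → x ∈ T) → IsCol {k′ = k′} G S X → IsCol G T X
  mv f g (pr , z) = (λ s t ms mt → pr s t (f ms) (f mt)) , (λ v nm → z v (λ m → nm (g m)))

ext-bounded : ∀ {n} p (G : Graph n) T → Unique T → Ext G (2 + p) T → Bounded p G T
ext-bounded p G Q uQ (clique len cl) = subst (λ l → # {k′ = suc p} G Q * suc p ^ (2 + p) ≤ (2 + p) ! * suc p ^ l) (sym len)
  (*-monoˡ-≤ (suc p ^ (2 + p)) (≤-trans (≤-reflexive (sym (*-identityʳ (# {k′ = suc p} G Q)))) (#-clique {k′ = suc p} G Q uQ cl 0 (trans (+-identityʳ _) len))))
ext-bounded p G (u ∷ T) (_ ∷ uT) (leaf e s∈ ad _ _) = begin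
  # G (u ∷ T) * q ^ k ≤⟨ *-monoˡ-≤ (q ^ k) (#-∷-adj G T u s∈ ad) ⟩
  # G T * q * q ^ k ≡⟨ l (# G T) q (q ^ k) ⟩
  q * (# G T * q ^ k) ≤⟨ *-monoʳ-≤ q (ext-bounded p G T uT e) ⟩
  q * (k ! * q ^ length T) ≡⟨ l′ q (k !) (q ^ length T) ⟩
  k ! * q ^ length (u ∷ T) ∎
  where
  open ≤-Reasoning
  k = 2 + p
  q = suc p
  l : ∀ a b c → a * b * c ≡ b * (a * c)
  l = solve-∀
  l′ : ∀ a b c → a * (b * c) ≡ b * (a * c)
  l′ = solve-∀

eqCols : ∀ {n k′} (G : Graph n) S (s t : Fin n) → List (Colouring n (suc k′))
eqCols G S s t = filter (λ X → lookup X s ≟F lookup X t) (Cols G S)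

eqCols-head : ∀ {n k′} (G : Graph n) T u {t} → t ∈ T → length (eqCols {k′ = k′} G (u ∷ T) u t) ≤ # {k′ = k′} G T
eqCols-head {k′ = k′} G T u {t} t∈ = ≤-trans (restrict-count (eqCols G (u ∷ T) u t) (Cols G T) T u (λ c → lookup c t ∷ [])
    (unique-filter E? (unique-Cols G (u ∷ T))) (λ m → restr-Cols {G = G} there (fst m))
    (λ {X} m → here (trans (snd m) (sym (restr-in X t∈))))
    (λ {X} {Y} a b e e′ → Cols-ext {G = G} (fst a) (fst b) (λ { (here refl) → e′ ; (there m) → restr-≡ X Y e m })))
  (≤-reflexive (trans (sum-const 1 (Cols G T)) (*-identityʳ _)))
  where
  E? = λ X → lookup X u ≟F lookup X t
  fst : ∀ {X} → X ∈ eqCols {k′ = k′} G (u ∷ T) u t → X ∈ Cols G (u ∷ T)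
  fst m = proj₁ (∈-filter⁻ E? {xs = Cols G (u ∷ T)} m)
  snd : ∀ {X} → X ∈ eqCols {k′ = k′} G (u ∷ T) u t → lookup X u ≡ lookup X t
  snd m = proj₂ (∈-filter⁻ E? {xs = Cols G (u ∷ T)} m)

-- If s or t is the newest leaf u, the other one dictates its colour and the factor q for u is lost.
-- An older pair keeps its share while both sides gain a factor q. Two vertices of the clique never
-- agree.
ext-eq : ∀ {n} p (G : Graph n) T → Unique T → Ext G (2 + p) T → ∀ {s t} → s ∈ T → t ∈ T → s ≢ t →
  length (eqCols {k′ = suc p} G T s t) * (suc p ^ (2 + p) * suc p) ≤ (2 + p) ! * suc p ^ length T
ext-eq p G Q uQ (clique len cl) {s} {t} ms mt ne = ≤-trans (≤-reflexive (cong (_* (suc p ^ (2 + p) * suc p)) (empty-length (eqCols G Q s t) none))) z≤n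
  where
  none : ∀ {X} → X ∉ eqCols {k′ = suc p} G Q s t
  none {X} m = let (m₁ , e) = ∈-filter⁻ (λ X → lookup X s ≟F lookup X t) {xs = Cols G Q} m in Cols-proper {G = G} m₁ ms mt (cl ms mt ne) e
ext-eq p G (u ∷ T) uT@(_ ∷ uT′) (leaf e s∈ ad _ _) ms mt ne = go ms mt ne
  where
  open ≤-Reasoning
  k = 2 + p
  q = suc p
  l : ∀ a b c → a * (b * c) ≡ c * (a * b)
  l = solve-∀
  l′ : ∀ a b c → a * (b * c) ≡ b * (a * c)
  l′ = solve-∀
  l″ : ∀ a b c → a * b * c ≡ b * (a * c)
  l″ = solve-∀
  head-case : ∀ {t} → t ∈ T → length (eqCols {k′ = q} G (u ∷ T) u t) * (q ^ k * q) ≤ k ! * q ^ length (u ∷ T)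
  head-case {t} m = begin
    length (eqCols {k′ = q} G (u ∷ T) u t) * (q ^ k * q) ≤⟨ *-monoˡ-≤ (q ^ k * q) (eqCols-head G T u m) ⟩
    # G T * (q ^ k * q) ≡⟨ l (# G T) (q ^ k) q ⟩
    q * (# G T * q ^ k) ≤⟨ *-monoʳ-≤ q (ext-bounded p G T uT′ e) ⟩
    q * (k ! * q ^ length T) ≡⟨ l′ q (k !) (q ^ length T) ⟩
    k ! * q ^ length (u ∷ T) ∎
  go : ∀ {s t} → s ∈ u ∷ T → t ∈ u ∷ T → s ≢ t → length (eqCols {k′ = q} G (u ∷ T) s t) * (q ^ k * q) ≤ k ! * q ^ length (u ∷ T)
  go (here refl) (here refl) ne = contradiction refl ne
  go (here refl) (there m) _ = head-case m
  go {s} (there m) (here refl) _ = ≤-trans (≤-reflexive (cong (_* (q ^ k * q)) (length-filter-cong (λ X → lookup X s ≟F lookup X u) (λ X → lookup X u ≟F lookup X s) (Cols G (u ∷ T)) (λ _ → sym) (λ _ → sym)))) (head-case m)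
  go {s} {t} (there a) (there b) ne = begin
    length (eqCols {k′ = q} G (u ∷ T) s t) * (q ^ k * q) ≤⟨ *-monoˡ-≤ (q ^ k * q) (≤-trans (extend-sum G T u E? E? (free G T u) (λ {X} _ ee → trans (restr-in X a) (trans ee (sym (restr-in X b)))) inF)
        (≤-trans (sum-mono (eqCols G T s t) (λ {X} _ → free≤ G T u X s∈ ad)) (≤-reflexive (sum-const q (eqCols G T s t))))) ⟩
    length (eqCols {k′ = q} G T s t) * q * (q ^ k * q) ≡⟨ l″ (length (eqCols {k′ = q} G T s t)) q (q ^ k * q) ⟩
    q * (length (eqCols {k′ = q} G T s t) * (q ^ k * q)) ≤⟨ *-monoʳ-≤ q (ext-eq p G T uT′ e a b ne) ⟩
    q * (k ! * q ^ length T) ≡⟨ l′ q (k !) (q ^ length T) ⟩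
    k ! * q ^ length (u ∷ T) ∎
    where
    E? = λ (X : Colouring _ k) → lookup X s ≟F lookup X t
    inF : ∀ {X} → X ∈ Cols G (u ∷ T) → lookup X s ≡ lookup X t → lookup X u ∈ free G T u (restr T X)
    inF {X} m _ = ∈-filter⁺ (λ α → ¬? (seen? G T u (restr T X) α)) (∈-allFin _) λ sn →
      let (w , w∈ , ad′ , eq) = seen-elim G u (restr T X) sn in
      Cols-proper {G = G} m (here refl) (there w∈) ad′ (trans (sym eq) (restr-in X w∈))

gapZ-large : ∀ p → 2 + p ≤ gapZ p
gapZ-large p = subst (2 + p ≤_) (sym (gapZ-≡ p)) (≤-trans (≤-trans (≤-trans (m≤n*m (2 + p) 3) (m≤m*n (3 * (2 + p)) (suc (tame p)))) (≤-reflexive (sym (tower-≡ p))))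
  (≤-trans (≤-reflexive (sym (*-identityʳ (tower p)))) (*-monoʳ-≤ (tower p) (weightTop-positive p))))

-- The vertex u has at most p free colours unless s and t agree, which by `ext-eq` happens in at
-- most a 1/q share of Tomescu's bound. So u contributes p + 1/q in place of q, and the difference
-- exceeds the gap since `gapZ p` is at least k.
two-neighbours-gap : ∀ {n} p → 1 ≤ p → ∀ (G : Graph n) T u → Unique T → Ext G (2 + p) T → ∀ {s t} → s ∈ T → t ∈ T → s ≢ t → Adj G u s → Adj G u t → Gap p G (u ∷ T)
two-neighbours-gap {n} p 1≤p G T u uT e {s} {t} ms mt ne as at = *-cancelʳ-≤′ q (s≤s z≤n) (begin
  # G (u ∷ T) * q ^ k * suc Z * q ≤⟨ *-monoˡ-≤ q (*-monoˡ-≤ (suc Z) (*-monoˡ-≤ (q ^ k) count)) ⟩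
  (x * p + E) * q ^ k * suc Z * q ≡⟨ l₁ x p E (q ^ k) (suc Z) q ⟩
  (x * q ^ k * (p * q) + E * (q ^ k * q)) * suc Z ≤⟨ *-monoˡ-≤ (suc Z) (+-mono-≤ (*-monoˡ-≤ (p * q) (ext-bounded p G T uT e)) (ext-eq p G T uT e ms mt ne)) ⟩
  (A * (p * q) + A) * suc Z ≡⟨ l₂ A p q Z ⟩
  A * (p * q * Z + Z + (p * q + 1)) ≤⟨ *-monoʳ-≤ A (+-monoʳ-≤ (p * q * Z + Z) (≤-trans (+-monoʳ-≤ (p * q) 1≤p) (≤-trans (≤-reflexive (l₃ p)) (*-monoʳ-≤ p (gapZ-large p))))) ⟩
  A * (p * q * Z + Z + p * Z) ≡⟨ l₄ (k !) (q ^ length T) p Z ⟩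
  k ! * q ^ length (u ∷ T) * Z * q ∎)
  where
  open ≤-Reasoning
  k = 2 + p
  q = suc p
  Z = gapZ p
  x = # {k′ = q} G T
  E = length (eqCols {k′ = q} G T s t)
  A = k ! * q ^ length T
  l₁ : ∀ x p E K Z q → (x * p + E) * K * Z * q ≡ (x * K * (p * q) + E * (K * q)) * Z
  l₁ = solve-∀
  l₂ : ∀ A p q Z → (A * (p * q) + A) * suc Z ≡ A * (p * q * Z + Z + (p * q + 1))
  l₂ = solve-∀
  l₃ : ∀ p → p * suc p + p ≡ p * (2 + p)
  l₃ = solve-∀
  l₄ : ∀ f y p Z → f * y * (p * suc p * Z + Z + p * Z) ≡ f * (suc p * y) * Z * suc p
  l₄ = solve-∀
  fr : ∀ {X} → X ∈ Cols G T → length (free G T u X) ≤ p + bit (lookup X s ≟F lookup X t)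
  fr {X} m with lookup X s ≟F lookup X t
  ... | yes _ = ≤-trans (free≤ G T u X ms as) (≤-reflexive (+-comm 1 p))
  ... | no neq = ≤-trans (+-cancelʳ-≤ 2 _ p (≤-trans (free-bound G T u X (s ∷ t ∷ []) ((ne ∷ []) ∷ ([] ∷ [])) (λ { (here refl) → ms , as ; (there (here refl)) → mt , at })
      (λ { (here refl) (here refl) _ → refl ; (here refl) (there (here refl)) e → contradiction e neq ; (there (here refl)) (here refl) e → contradiction (sym e) neq ; (there (here refl)) (there (here refl)) _ → refl }))
      (≤-reflexive (+-comm 2 p)))) (≤-reflexive (sym (+-identityʳ p)))
  count : # {k′ = q} G (u ∷ T) ≤ x * p + E
  count = ≤-trans (#-∷ G T u) (≤-trans (sum-mono (Cols G T) fr) (≤-reflexive (trans (sum-+ (λ _ → p) (λ X → bit (lookup X s ≟F lookup X t)) (Cols G T))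
    (cong₂ _+_ (sum-const p (Cols G T)) (sym (length-filter-sum (λ X → lookup X s ≟F lookup X t) (Cols G T)))))))

without : ∀ {n} → Fin n → List (Fin n) → List (Fin n)
without u S = filter (λ x → ¬? (x ≟F u)) S

without-∈ : ∀ {n} {u x : Fin n} {S} → x ∈ S → x ≢ u → x ∈ without u S
without-∈ {u = u} m ne = ∈-filter⁺ (λ x → ¬? (x ≟F u)) m ne

without-⊆ : ∀ {n} {u x : Fin n} {S} → x ∈ without u S → x ∈ S
without-⊆ {u = u} {S = S} m = proj₁ (∈-filter⁻ (λ x → ¬? (x ≟F u)) {xs = S} m)

without-shorter : ∀ {n} {u : Fin n} S → Unique S → u ∈ S → length (without u S) < length S
without-shorter {u = u} S uS m = unique-⊆-length {xs = u ∷ without u S} (unique-∷ (λ m′ → proj₂ (∈-filter⁻ (λ x → ¬? (x ≟F u)) {xs = S} m′) refl) (unique-filter (λ x → ¬? (x ≟F u)) uS))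
  λ { (here refl) → m ; (there m′) → without-⊆ {u = u} m′ }

IsCritical : ∀ {n} → Graph n → List (Fin n) → ℕ → Set
IsCritical G H j = ∀ {u} → u ∈ H → ColOn G (without u H) j

any-witness : ∀ {A : Set} {P : A → Set} {xs : List A} → Any P xs → ∃ λ x → x ∈ xs × P x
any-witness (here p) = _ , here refl , p
any-witness (there a) with any-witness a
... | x , m , p = x , there m , p

any-intro : ∀ {A : Set} {P : A → Set} {xs : List A} {x} → x ∈ xs → P x → Any P xs
any-intro (here refl) p = here p
any-intro (there m) p = there (any-intro m p)

critical-subset : ∀ {n} (G : Graph n) j m S → length S ≤ m → Unique S → ¬ ColOn G S j →
  ∃ λ H → (∀ {x} → x ∈ H → x ∈ S) × Unique H × ¬ ColOn G H j × IsCritical G H j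
critical-subset G j m S le uS nc with anyL? (λ u → ¬? (colOn? G (without u S) j)) S
... | no na = S , id , uS , nc , crit
  where
  crit : IsCritical G S j
  crit {u} u∈ with colOn? G (without u S) j
  ... | yes c = c
  ... | no nc′ = contradiction (any-intro u∈ nc′) na
critical-subset G j zero [] le uS nc | yes ()
critical-subset G j (suc m) S le uS nc | yes a with any-witness a
... | u , u∈ , nc′ with critical-subset G j m (without u S) (≤-pred (≤-trans (without-shorter S uS u∈) le)) (unique-filter (λ x → ¬? (x ≟F u)) uS) nc′
... | H , sub , r = H , (λ x → without-⊆ {u = u} (sub x)) , r

-- If no edge crossed the cut, a colouring of H without b on the side of a and one of H without a on
-- the side of b would together colour H.
critical-conn : ∀ {n} (G : Graph n) H {j} → ¬ ColOn G H j → IsCritical G H j → Conn G H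
critical-conn {n} G H {j} nc crit f {a} {b} a∈ b∈ fa fb
  with anyF? (λ x → anyF? (λ y → (x ∈? H) ×-dec ((y ∈? H) ×-dec ((f x ≟B true) ×-dec ((f y ≟B false) ×-dec T? (adj G x y))))))
... | yes r = r
... | no none = contradiction (c , pr) nc
  where
  c₁ = crit b∈
  c₂ = crit a∈
  pick : Bool → Fin n → Fin j
  pick true = proj₁ c₁
  pick false = proj₁ c₂
  c : Fin n → Fin j
  c x = pick (f x) x
  pr : ∀ s t → s ∈ H → t ∈ H → Adj G s t → c s ≢ c t
  pr s t ms mt ad e with f s in es | f t in et
  ... | true | true = proj₂ c₁ s t (without-∈ ms (λ { refl → true≢false (trans (sym es) fb) })) (without-∈ mt (λ { refl → true≢false (trans (sym et) fb) })) ad e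
  ... | true | false = none (s , t , ms , mt , es , et , ad)
  ... | false | true = none (t , s , mt , ms , et , es , Adj-sym G ad)
  ... | false | false = proj₂ c₂ s t (without-∈ ms (λ { refl → true≢false (trans (sym fa) es) })) (without-∈ mt (λ { refl → true≢false (trans (sym fa) et) })) ad e

critical-clique : ∀ {n} p (G : Graph n) H → Unique H → ¬ ColOn G H (suc p) → IsCritical G H (suc p) → length H ≡ 2 + p → Clique {k′ = 2 + p} G H
critical-clique p G H uH nc crit len {x} {y} mx my ne with y ∈? nbrs G H x
... | yes m = nbrs-adj G H m
... | no nm = contradiction (≤-trans (s≤s (s≤s (Critical.degree-bound {p = p} G H uH nc crit 0 len mx)))
    (unique-⊆-length {xs = x ∷ y ∷ nbrs G H x} (unique-∷ x∉ (unique-∷ nm (unique-nbrs G x uH))) sub)) (λ h → 1+n≰n (subst (3 + p ≤_) len h))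
  where
  x∉ : x ∉ y ∷ nbrs G H x
  x∉ (here e) = ne e
  x∉ (there m) = Adj-irrefl G (nbrs-adj G H m)
  sub : ∀ {z} → z ∈ x ∷ y ∷ nbrs G H x → z ∈ H
  sub (here refl) = mx
  sub (there (here refl)) = my
  sub (there (there m)) = nbrs-∈ G H m

Tomescu : ∀ {n} (p : ℕ) → Graph n → List (Fin n) → Set
Tomescu p G S = (∃ λ T → S ↭ T × Ext G (2 + p) T) ⊎ Gap p G S

tomescu⇒bounded : ∀ {n} p (G : Graph n) S → Unique S → Tomescu p G S → Bounded p G S
tomescu⇒bounded p G S uS (inj₂ g) = gap⇒bounded p G S g
tomescu⇒bounded p G S uS (inj₁ (T , perm , e)) = subst₂ (λ x l → x * suc p ^ (2 + p) ≤ (2 + p) ! * suc p ^ l)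
  (sym (#-↭ G (∈-resp-↭ perm) (∈-resp-↭ (↭-sym perm)))) (sym (↭-length perm)) (ext-bounded p G T (unique-↭ perm uS) e)

gap-∷ : ∀ {n} p (G : Graph n) T u {s} → s ∈ T → Adj G u s → Gap p G T → Gap p G (u ∷ T)
gap-∷ p G T u ms ad g = begin
  # G (u ∷ T) * q ^ k * suc Z ≤⟨ *-monoˡ-≤ (suc Z) (*-monoˡ-≤ (q ^ k) (#-∷-adj G T u ms ad)) ⟩
  # G T * q * q ^ k * suc Z ≡⟨ l (# G T) q (q ^ k) (suc Z) ⟩
  q * (# G T * q ^ k * suc Z) ≤⟨ *-monoʳ-≤ q g ⟩
  q * (k ! * q ^ length T * Z) ≡⟨ l′ q (k !) (q ^ length T) Z ⟩
  k ! * (q * q ^ length T) * Z ∎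
  where
  open ≤-Reasoning
  k = 2 + p
  q = suc p
  Z = gapZ p
  l : ∀ a b c d → a * b * c * d ≡ b * (a * c * d)
  l = solve-∀
  l′ : ∀ a b c d → a * (b * c * d) ≡ b * (a * c) * d
  l′ = solve-∀

-- An edge leaving T supplies the next vertex u. It multiplies the count by at most q, so a gap
-- persists; a clique with trees persists if u has one neighbour in T, and turns into a gap if u has
-- two. The number m bounds the vertices still missing.
grow : ∀ {n} p → 1 ≤ p → (G : Graph n) (S : List (Fin n)) → Unique S → Conn G S → ∀ m T → length S ≤ length T + m → Unique T → (∀ {x} → x ∈ T → x ∈ S) →
  (∃ λ a → a ∈ T) → Ext G (2 + p) T ⊎ Gap p G T → Tomescu p G S
grow {n} p 1≤p G S uS cn m T le uT sub (a , a∈) st with anyL? (λ x → ¬? (x ∈? T)) S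
... | no na = done st
  where
  all-in : ∀ {x} → x ∈ S → x ∈ T
  all-in {x} mx with x ∈? T
  ... | yes i = i
  ... | no ni = contradiction (any-intro mx ni) na
  perm : S ↭ T
  perm = same-elements-↭ uS uT all-in sub
  done : Ext G (2 + p) T ⊎ Gap p G T → Tomescu p G S
  done (inj₁ e) = inj₁ (T , perm , e)
  done (inj₂ g) = inj₂ (subst₂ (λ x l → x * suc p ^ (2 + p) * suc (gapZ p) ≤ (2 + p) ! * suc p ^ l * gapZ p) (#-↭ G sub all-in) (sym (↭-length perm)) g)
grow {n} p 1≤p G S uS cn zero T le uT sub (a , a∈) st | yes b with any-witness b
... | y , y∈ , y∉ = contradiction (≤-trans (unique-⊆-length {xs = y ∷ T} (unique-∷ y∉ uT) (λ { (here refl) → y∈ ; (there i) → sub i })) le) (λ h → <-irrefl (sym (+-identityʳ (length T))) h)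
grow {n} p 1≤p G S uS cn (suc m) T le uT sub (a , a∈) st | yes b with any-witness b
... | y , y∈ , y∉ with cn (λ x → ifDec (x ∈? T) true false) (sub a∈) y∈ (ifDec-yes (a ∈? T) a∈) (ifDec-no (y ∈? T) y∉)
... | s , u , s∈ , u∈ , fs≡ , fu≡ , ad = grow p 1≤p G S uS cn m (u ∷ T) (≤-trans le (≤-reflexive (+-suc (length T) m))) (unique-∷ u∉T uT)
    (λ { (here refl) → u∈ ; (there i) → sub i }) (u , here refl) (next st)
  where
  s∈T : s ∈ T
  s∈T with s ∈? T
  ... | yes i = i
  ... | no _ = contradiction (sym fs≡) true≢false
  u∉T : u ∉ T
  u∉T i with u ∈? T
  ... | yes _ = true≢false fu≡
  ... | no ni = ni i
  next : Ext G (2 + p) T ⊎ Gap p G T → Ext G (2 + p) (u ∷ T) ⊎ Gap p G (u ∷ T)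
  next (inj₂ g) = inj₂ (gap-∷ p G T u s∈T (Adj-sym G ad) g)
  next (inj₁ e) with anyL? (λ t → T? (adj G u t) ×-dec ¬? (t ≟F s)) T
  ... | yes w with any-witness w
  ... | t , t∈ , at , ne = inj₂ (two-neighbours-gap p 1≤p G T u uT e s∈T t∈ (λ e → ne (sym e)) (Adj-sym G ad) at)
  next (inj₁ e) | no nw = inj₁ (leaf e s∈T (Adj-sym G ad) only u∉T)
    where
    only : ∀ {t} → t ∈ T → Adj G u t → t ≡ s
    only {t} t∈ at with t ≟F s
    ... | yes eq = eq
    ... | no ne = contradiction (any-intro t∈ (at , ne)) nw

-- `grow` starts from a critical subgraph. With k vertices this is a clique; with more it has a gap,
-- by the bound for graphs with fewer vertices.
tomescu-≤ : ∀ {n} p → 2 ≤ p → ∀ m (G : Graph n) S → length S ≤ m → Unique S → Conn G S → ¬ ColOn G S (suc p) → Tomescu p G S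
tomescu-≤ p 2≤p zero G [] le uS cn nc = contradiction ((λ _ → fz) , (λ _ _ ())) nc
tomescu-≤ {n} p 2≤p (suc m) G S le uS cn nc with critical-subset G (suc p) (length S) S ≤-refl uS nc
... | H , sub , uH , ncH , crit = grow p (≤-trans (s≤s z≤n) 2≤p) G S uS cn (length S) H (m≤n+m (length S) (length H)) uH sub
    (head-∈ H (≤-trans (s≤s z≤n) big)) start
  where
  big : 2 + p ≤ length H
  big = noncol-length G H ncH
  H≤ : length H ≤ suc m
  H≤ = ≤-trans (unique-⊆-length uH sub) le
  start : Ext G (2 + p) H ⊎ Gap p G H
  start with m≤n⇒m<n∨m≡n big
  ... | inj₂ e = inj₁ (clique (sym e) (critical-clique p G H uH ncH crit (sym e)))
  ... | inj₁ lt = inj₂ (critical-gap p 2≤p G H uH (critical-conn G H ncH crit) ncH crit lt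
      (λ K S′ uS′ cS′ nS′ sm → tomescu⇒bounded p K S′ uS′ (tomescu-≤ p 2≤p m K S′ (≤-pred (≤-trans sm H≤)) uS′ cS′ nS′)))

tomescu : ∀ {n} p → 2 ≤ p → (G : Graph n) (S : List (Fin n)) → Unique S → Conn G S → ¬ ColOn G S (suc p) → Tomescu p G S
tomescu p 2≤p G S = tomescu-≤ p 2≤p (length S) G S ≤-refl

-- Connected dominating sets with a large complement

data ConnOrder {n} (G : Graph n) : List (Fin n) → Set where
  root : ∀ {v} → ConnOrder G (v ∷ [])
  next : ∀ {v s D} → ConnOrder G D → s ∈ D → Adj G v s → ConnOrder G (v ∷ D)

length-without : ∀ {n} (x : Fin n) A → Unique A → length A ≤ suc (length (without x A))
length-without x A uA = unique-⊆-length {ys = x ∷ without x A} uA λ {y} m → go y m (y ≟F x)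
  where
  go : ∀ y → y ∈ A → Dec (y ≡ x) → y ∈ x ∷ without x A
  go y m (yes refl) = here refl
  go y m (no ne) = there (without-∈ m ne)

unique-without : ∀ {n} (x : Fin n) {A} → Unique A → Unique (without x A)
unique-without x uA = unique-filter (λ y → ¬? (y ≟F x)) uA

∉-without : ∀ {n} (x : Fin n) A → x ∉ without x A
∉-without x A m = proj₂ (∈-filter⁻ (λ y → ¬? (y ≟F x)) {xs = A} m) refl

-- The growth of a tree with inner vertices D and leaves A ∪ Z, where Z collects leaves without outside neighbours.
module Leaves {n} (G : Graph n) (cn : Conn G (allFin n)) (deg : ∀ v → 3 ≤ length (nbrs G (allFin n) v)) where

  private
    V = allFin n

  record State : Set where
    field
      D A Z : List (Fin n)
      uD : Unique D
      uA : Unique A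
      uZ : Unique Z
      DA : ∀ {x} → x ∈ D → x ∉ A
      DZ : ∀ {x} → x ∈ D → x ∉ Z
      AZ : ∀ {x} → x ∈ A → x ∉ Z
      order : ConnOrder G D
      attA : ∀ {x} → x ∈ A → ∃ λ d → d ∈ D × Adj G x d
      attZ : ∀ {x} → x ∈ Z → ∃ λ d → d ∈ D × Adj G x d
    All′ : List (Fin n)
    All′ = D ++ A ++ Z
    field
      closedD : ∀ {x y} → x ∈ D → Adj G x y → y ∈ All′
      closedZ : ∀ {x y} → x ∈ Z → Adj G x y → y ∈ All′
      -- A leaf pays for two inner vertices and an exhausted one for three. When everything is
      -- covered this gives |D| ≤ 3|J|, hence `many`.
      pot : length D ≤ 2 * (length A + length Z) + length Z

    inD : ∀ {x} → x ∈ D → x ∈ All′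
    inD = ∈-++⁺ˡ
    inA : ∀ {x} → x ∈ A → x ∈ All′
    inA m = ∈-++⁺ʳ D (∈-++⁺ˡ m)
    inZ : ∀ {x} → x ∈ Z → x ∈ All′
    inZ m = ∈-++⁺ʳ D (∈-++⁺ʳ A m)
    All′-cases : ∀ {x} → x ∈ All′ → x ∈ D ⊎ (x ∈ A ⊎ x ∈ Z)
    All′-cases m with ∈-++⁻ D m
    ... | inj₁ a = inj₁ a
    ... | inj₂ b = inj₂ (∈-++⁻ A b)
    uAll : Unique All′
    uAll = unique-++ uD (unique-++ uA uZ AZ) λ {x} m m′ → case ∈-++⁻ A m′ of λ { (inj₁ a) → DA m a ; (inj₂ z) → DZ m z }

  open State

  Out : State → Fin n → List (Fin n)
  Out s x = filter (λ y → ¬? (y ∈? All′ s)) (nbrs G V x)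

  Out-adj : ∀ s {x y} → y ∈ Out s x → Adj G x y
  Out-adj s {x} m = nbrs-adj G V (proj₁ (∈-filter⁻ (λ y → ¬? (y ∈? All′ s)) {xs = nbrs G V x} m))

  Out-∉ : ∀ s {x y} → y ∈ Out s x → y ∉ All′ s
  Out-∉ s {x} m = proj₂ (∈-filter⁻ (λ y → ¬? (y ∈? All′ s)) {xs = nbrs G V x} m)

  Out-in : ∀ s {x y} → Adj G x y → y ∉ All′ s → y ∈ Out s x
  Out-in s {x} {y} ad no-y = ∈-filter⁺ (λ y → ¬? (y ∈? All′ s)) (nbrs-in G V (∈-allFin y) ad) no-y

  unique-Out : ∀ s x → Unique (Out s x)
  unique-Out s x = unique-filter (λ y → ¬? (y ∈? All′ s)) (unique-nbrs G x (unique-allFin n))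

  Bigger : State → State → Set
  Bigger s s′ = length (All′ s) < length (All′ s′)

  bigger : ∀ s s′ u → (∀ {x} → x ∈ All′ s → x ∈ All′ s′) → u ∉ All′ s → u ∈ All′ s′ → Bigger s s′
  bigger s s′ u sub nu iu = unique-⊆-length {xs = u ∷ All′ s} (unique-∷ nu (uAll s)) λ { (here refl) → iu ; (there m) → sub m }

  -- One more inner vertex against at least one more leaf on balance, which is worth two.
  expand : ∀ s {x} → x ∈ A s → 2 ≤ length (Out s x) → ∃ (Bigger s)
  expand s {x} x∈ two = s′ , bigger s s′ u sub (Out-∉ s u∈) (inA s′ (∈-++⁺ˡ u∈))
    where
    O = Out s x
    u = proj₁ (head-∈ O (≤-trans (s≤s z≤n) two))
    u∈ = proj₂ (head-∈ O (≤-trans (s≤s z≤n) two))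
    A″ = without x (A s)
    sub₀ : ∀ {y} → y ∈ All′ s → y ∈ (x ∷ D s) ++ (O ++ A″) ++ Z s
    sub₀ {y} m with All′-cases s m
    ... | inj₁ d = there (∈-++⁺ˡ d)
    ... | inj₂ (inj₂ z) = there (∈-++⁺ʳ (D s) (∈-++⁺ʳ (O ++ A″) z))
    ... | inj₂ (inj₁ a) with y ≟F x
    ... | yes refl = here refl
    ... | no ne = there (∈-++⁺ʳ (D s) (∈-++⁺ˡ (∈-++⁺ʳ O (without-∈ a ne))))
    s′ : State
    s′ = record
      { D = x ∷ D s ; A = O ++ A″ ; Z = Z s
      ; uD = unique-∷ (λ m → DA s m x∈) (uD s)
      ; uA = unique-++ (unique-Out s x) (unique-without x (uA s)) (λ m m′ → Out-∉ s m (inA s (without-⊆ {u = x} m′)))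
      ; uZ = uZ s
      ; DA = λ { (here refl) m → case ∈-++⁻ O m of λ { (inj₁ o) → Out-∉ s o (inA s x∈) ; (inj₂ a) → ∉-without x (A s) a }
               ; (there d) m → case ∈-++⁻ O m of λ { (inj₁ o) → Out-∉ s o (inD s d) ; (inj₂ a) → DA s d (without-⊆ {u = x} a) } }
      ; DZ = λ { (here refl) z → AZ s x∈ z ; (there d) z → DZ s d z }
      ; AZ = λ m z → case ∈-++⁻ O m of λ { (inj₁ o) → Out-∉ s o (inZ s z) ; (inj₂ a) → AZ s (without-⊆ {u = x} a) z }
      ; order = let (d , d∈ , ad) = attA s x∈ in next (order s) d∈ ad
      ; attA = λ m → case ∈-++⁻ O m of λ { (inj₁ o) → x , here refl , Adj-sym G (Out-adj s o) ; (inj₂ a) → let (d , d∈ , ad) = attA s (without-⊆ {u = x} a) in d , there d∈ , ad }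
      ; attZ = λ z → let (d , d∈ , ad) = attZ s z in d , there d∈ , ad
      ; closedD = λ { (here refl) ad → cl _ ad ; (there d) ad → sub₀ (closedD s d ad) }
      ; closedZ = λ z ad → sub₀ (closedZ s z ad)
      ; pot = pot′ }
      where
      cl : ∀ y → Adj G x y → y ∈ (x ∷ D s) ++ (O ++ A″) ++ Z s
      cl y ad with y ∈? All′ s
      ... | yes i = sub₀ i
      ... | no ni = there (∈-++⁺ʳ (D s) (∈-++⁺ˡ (∈-++⁺ˡ (Out-in s ad ni))))
      pot′ : suc (length (D s)) ≤ 2 * (length (O ++ A″) + length (Z s)) + length (Z s)
      pot′ = begin
        suc (length (D s)) ≤⟨ s≤s (pot s) ⟩
        suc (2 * (length (A s) + length (Z s)) + length (Z s)) ≤⟨ ≤-trans (n≤1+n _) (≤-reflexive (l (length (A s)) (length (Z s)))) ⟩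
        2 * (suc (length (A s)) + length (Z s)) + length (Z s) ≤⟨ +-monoˡ-≤ (length (Z s)) (*-monoʳ-≤ 2 (+-monoˡ-≤ (length (Z s)) more)) ⟩
        2 * (length (O ++ A″) + length (Z s)) + length (Z s) ∎
        where
        open ≤-Reasoning
        l : ∀ a z → suc (suc (2 * (a + z) + z)) ≡ 2 * (suc a + z) + z
        l = solve-∀
        more : suc (length (A s)) ≤ length (O ++ A″)
        more = ≤-trans (s≤s (length-without x (A s) (uA s))) (≤-trans (+-monoˡ-≤ (length A″) two) (≤-reflexive (sym (length-++ O))))
    sub : ∀ {y} → y ∈ All′ s → y ∈ All′ s′
    sub = sub₀

  -- Making x inner gains no leaf by itself, but u becomes inner at once and brings at least two new
  -- leaves: two inner vertices against one more leaf on balance, which just suffices.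
  expand₂ : ∀ s {x u} → x ∈ A s → u ∈ Out s x → (∀ {y} → y ∈ Out s x → y ≡ u) → 2 ≤ length (without u (Out s u)) → ∃ (Bigger s)
  expand₂ s {x} {u} x∈ u∈ only two = s′ , bigger s s′ u sub₀ (Out-∉ s u∈) (here refl)
    where
    O = without u (Out s u)
    O-∉ : ∀ {y} → y ∈ O → y ∉ All′ s
    O-∉ m = Out-∉ s {u} (without-⊆ {u = u} m)
    A″ = without x (A s)
    T′ = (u ∷ x ∷ D s) ++ (O ++ A″) ++ Z s
    sub₀ : ∀ {y} → y ∈ All′ s → y ∈ T′
    sub₀ {y} m with All′-cases s m
    ... | inj₁ d = there (there (∈-++⁺ˡ d))
    ... | inj₂ (inj₂ z) = there (there (∈-++⁺ʳ (D s) (∈-++⁺ʳ (O ++ A″) z)))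
    ... | inj₂ (inj₁ a) with y ≟F x
    ... | yes refl = there (here refl)
    ... | no ne = there (there (∈-++⁺ʳ (D s) (∈-++⁺ˡ (∈-++⁺ʳ O (without-∈ a ne)))))
    u∉ = Out-∉ s u∈
    s′ : State
    s′ = record
      { D = u ∷ x ∷ D s ; A = O ++ A″ ; Z = Z s
      ; uD = unique-∷ (λ { (here refl) → u∉ (inA s x∈) ; (there d) → u∉ (inD s d) }) (unique-∷ (λ m → DA s m x∈) (uD s))
      ; uA = unique-++ (unique-without u (unique-Out s u)) (unique-without x (uA s)) (λ m m′ → O-∉ m (inA s (without-⊆ {u = x} m′)))
      ; uZ = uZ s
      ; DA = λ { (here refl) m → case ∈-++⁻ O m of λ { (inj₁ o) → ∉-without u (Out s u) o ; (inj₂ a) → u∉ (inA s (without-⊆ {u = x} a)) }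
               ; (there (here refl)) m → case ∈-++⁻ O m of λ { (inj₁ o) → O-∉ o (inA s x∈) ; (inj₂ a) → ∉-without x (A s) a }
               ; (there (there d)) m → case ∈-++⁻ O m of λ { (inj₁ o) → O-∉ o (inD s d) ; (inj₂ a) → DA s d (without-⊆ {u = x} a) } }
      ; DZ = λ { (here refl) z → u∉ (inZ s z) ; (there (here refl)) z → AZ s x∈ z ; (there (there d)) z → DZ s d z }
      ; AZ = λ m z → case ∈-++⁻ O m of λ { (inj₁ o) → O-∉ o (inZ s z) ; (inj₂ a) → AZ s (without-⊆ {u = x} a) z }
      ; order = let (d , d∈ , ad) = attA s x∈ in next (next (order s) d∈ ad) (here refl) (Adj-sym G (Out-adj s u∈))
      ; attA = λ m → case ∈-++⁻ O m of λ { (inj₁ o) → u , here refl , Adj-sym G (Out-adj s {u} (without-⊆ {u = u} o)) ; (inj₂ a) → let (d , d∈ , ad) = attA s (without-⊆ {u = x} a) in d , there (there d∈) , ad }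
      ; attZ = λ z → let (d , d∈ , ad) = attZ s z in d , there (there d∈) , ad
      ; closedD = λ { (here refl) ad → clu _ ad ; (there (here refl)) ad → clx _ ad ; (there (there d)) ad → sub₀ (closedD s d ad) }
      ; closedZ = λ z ad → sub₀ (closedZ s z ad)
      ; pot = pot′ }
      where
      clx : ∀ y → Adj G x y → y ∈ T′
      clx y ad with y ∈? All′ s
      ... | yes i = sub₀ i
      ... | no ni with only (Out-in s ad ni)
      ... | refl = here refl
      clu : ∀ y → Adj G u y → y ∈ T′
      clu y ad with y ∈? All′ s
      ... | yes i = sub₀ i
      ... | no ni = there (there (∈-++⁺ʳ (D s) (∈-++⁺ˡ (∈-++⁺ˡ (without-∈ (Out-in s ad ni) (λ { refl → Adj-irrefl G ad }))))))
      pot′ : suc (suc (length (D s))) ≤ 2 * (length (O ++ A″) + length (Z s)) + length (Z s)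
      pot′ = begin
        suc (suc (length (D s))) ≤⟨ s≤s (s≤s (pot s)) ⟩
        suc (suc (2 * (length (A s) + length (Z s)) + length (Z s))) ≡⟨ l (length (A s)) (length (Z s)) ⟩
        2 * (suc (length (A s)) + length (Z s)) + length (Z s) ≤⟨ +-monoˡ-≤ (length (Z s)) (*-monoʳ-≤ 2 (+-monoˡ-≤ (length (Z s)) more)) ⟩
        2 * (length (O ++ A″) + length (Z s)) + length (Z s) ∎
        where
        open ≤-Reasoning
        l : ∀ a z → suc (suc (2 * (a + z) + z)) ≡ 2 * (suc a + z) + z
        l = solve-∀
        more : suc (length (A s)) ≤ length (O ++ A″)
        more = ≤-trans (s≤s (length-without x (A s) (uA s))) (≤-trans (+-monoˡ-≤ (length A″) two) (≤-reflexive (sym (length-++ O))))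

  -- Attaching u to x exhausts x′.
  exhaust : ∀ s {x x′ u} → x ∈ A s → x′ ∈ A s → x′ ≢ x → u ∈ Out s x → (∀ {y} → y ∈ Out s x → y ≡ u) → (∀ {y} → y ∈ Out s x′ → y ≡ u) → ∃ (Bigger s)
  exhaust s {x} {x′} {u} x∈ x′∈ ne u∈ only only′ = s′ , bigger s s′ u sub₀ (Out-∉ s u∈) (there (∈-++⁺ʳ (D s) (here refl)))
    where
    u∉ = Out-∉ s u∈
    A₁ = without x (A s)
    A₂ = without x′ A₁
    A₂-in : ∀ {y} → y ∈ A₂ → y ∈ A s
    A₂-in m = without-⊆ {u = x} (without-⊆ {u = x′} m)
    A₂-≢x : x ∉ A₂
    A₂-≢x m = ∉-without x (A s) (without-⊆ {u = x′} m)
    T′ = (x ∷ D s) ++ (u ∷ A₂) ++ (x′ ∷ Z s)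
    sub₀ : ∀ {y} → y ∈ All′ s → y ∈ T′
    sub₀ {y} m with All′-cases s m
    ... | inj₁ d = there (∈-++⁺ˡ d)
    ... | inj₂ (inj₂ z) = there (∈-++⁺ʳ (D s) (∈-++⁺ʳ (u ∷ A₂) (there z)))
    ... | inj₂ (inj₁ a) with y ≟F x | y ≟F x′
    ... | yes refl | _ = here refl
    ... | no _ | yes refl = there (∈-++⁺ʳ (D s) (∈-++⁺ʳ (u ∷ A₂) (here refl)))
    ... | no n₁ | no n₂ = there (∈-++⁺ʳ (D s) (there (∈-++⁺ˡ (without-∈ (without-∈ a n₁) n₂))))
    cl : ∀ {w} → (∀ {y} → y ∈ Out s w → y ≡ u) → ∀ y → Adj G w y → y ∈ T′
    cl o y ad with y ∈? All′ s
    ... | yes i = sub₀ i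
    ... | no ni with o (Out-in s ad ni)
    ... | refl = there (∈-++⁺ʳ (D s) (here refl))
    s′ : State
    s′ = record
      { D = x ∷ D s ; A = u ∷ A₂ ; Z = x′ ∷ Z s
      ; uD = unique-∷ (λ m → DA s m x∈) (uD s)
      ; uA = unique-∷ (λ m → u∉ (inA s (A₂-in m))) (unique-without x′ (unique-without x (uA s)))
      ; uZ = unique-∷ (λ m → AZ s x′∈ m) (uZ s)
      ; DA = λ { (here refl) (here refl) → u∉ (inA s x∈) ; (here refl) (there m) → A₂-≢x m
               ; (there d) (here refl) → u∉ (inD s d) ; (there d) (there m) → DA s d (A₂-in m) }
      ; DZ = λ { (here refl) (here e) → ne (sym e) ; (here refl) (there z) → AZ s x∈ z
               ; (there d) (here refl) → DA s d x′∈ ; (there d) (there z) → DZ s d z }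
      ; AZ = λ { (here refl) (here refl) → u∉ (inA s x′∈) ; (here refl) (there z) → u∉ (inZ s z)
               ; (there m) (here refl) → ∉-without x′ A₁ m ; (there m) (there z) → AZ s (A₂-in m) z }
      ; order = let (d , d∈ , ad) = attA s x∈ in next (order s) d∈ ad
      ; attA = λ { (here refl) → x , here refl , Adj-sym G (Out-adj s u∈) ; (there m) → let (d , d∈ , ad) = attA s (A₂-in m) in d , there d∈ , ad }
      ; attZ = λ { (here refl) → let (d , d∈ , ad) = attA s x′∈ in d , there d∈ , ad ; (there z) → let (d , d∈ , ad) = attZ s z in d , there d∈ , ad }
      ; closedD = λ { (here refl) ad → cl only _ ad ; (there d) ad → sub₀ (closedD s d ad) }
      ; closedZ = λ { (here refl) ad → cl only′ _ ad ; (there z) ad → sub₀ (closedZ s z ad) }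
      ; pot = pot′ }
      where
      -- The number of leaves stays the same. The new inner vertex x is paid for by x′, which gains
      -- the extra unit of an exhausted leaf.
      pot′ : suc (length (D s)) ≤ 2 * (suc (length A₂) + suc (length (Z s))) + suc (length (Z s))
      pot′ = begin
        suc (length (D s)) ≤⟨ s≤s (pot s) ⟩
        suc (2 * (length (A s) + length (Z s)) + length (Z s)) ≤⟨ s≤s (+-monoˡ-≤ (length (Z s)) (*-monoʳ-≤ 2 (+-monoˡ-≤ (length (Z s)) (≤-trans (length-without x (A s) (uA s)) (s≤s (length-without x′ A₁ (unique-without x (uA s)))))))) ⟩
        suc (2 * (suc (suc (length A₂)) + length (Z s)) + length (Z s)) ≡⟨ l (length A₂) (length (Z s)) ⟩
        2 * (suc (length A₂) + suc (length (Z s))) + suc (length (Z s)) ∎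
        where
        open ≤-Reasoning
        l : ∀ a z → suc (2 * (suc (suc a) + z) + z) ≡ 2 * (suc a + suc z) + suc z
        l = solve-∀

  short-only : ∀ {B : Set} {u : B} {O : List B} → ¬ 2 ≤ length O → u ∈ O → ∀ {y} → y ∈ O → y ≡ u
  short-only {O = a ∷ []} _ (here refl) (here refl) = refl
  short-only {O = a ∷ b ∷ O} h _ _ = contradiction (s≤s (s≤s z≤n)) h

  -- Let u be an outside neighbour of x. If neither `expand` nor `expand₂` applies at x, then u has
  -- at most one neighbour outside besides itself, so by degree 3 it has a second neighbour w in the
  -- tree. Either w can be expanded, or u is the only outside neighbour of both x and w.
  advance : ∀ s → (∃ λ y → y ∉ All′ s) → (∃ λ d → d ∈ D s) → ∃ (Bigger s)
  advance s (y , y∉) (d , d∈) = found (cn (λ x → ifDec (x ∈? All′ s) true false) (∈-allFin d) (∈-allFin y) (ifDec-yes (d ∈? All′ s) (inD s d∈)) (ifDec-no (y ∈? All′ s) y∉))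
    where
    found : (∃₂ λ x u → x ∈ V × u ∈ V × ifDec (x ∈? All′ s) true false ≡ true × ifDec (u ∈? All′ s) true false ≡ false × Adj G x u) → ∃ (Bigger s)
    found (x , u , _ , _ , fx , fu , ad) = go
      where
      u∉ : u ∉ All′ s
      u∉ i with u ∈? All′ s
      ... | yes _ = true≢false fu
      ... | no ni = ni i
      x-in : x ∈ All′ s
      x-in with x ∈? All′ s
      ... | yes i = i
      ... | no _ = contradiction (sym fx) true≢false
      leafA : ∀ {w} → w ∈ All′ s → Adj G w u → w ∈ A s
      leafA i adw with All′-cases s i
      ... | inj₁ d = contradiction (closedD s d adw) u∉
      ... | inj₂ (inj₁ a) = a
      ... | inj₂ (inj₂ z) = contradiction (closedZ s z adw) u∉
      u∈O : u ∈ Out s x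
      u∈O = Out-in s ad u∉
      go : ∃ (Bigger s)
      go with 2 ≤? length (Out s x)
      ... | yes two = expand s (leafA x-in ad) two
      ... | no ¬two with 2 ≤? length (without u (Out s u))
      ... | yes two = expand₂ s (leafA x-in ad) u∈O (short-only ¬two u∈O) two
      ... | no ¬two′ = last (anyF? (λ w → ¬? (w ≟F x) ×-dec ((w ∈? All′ s) ×-dec T? (adj G u w))))
        where
        last : Dec (∃ λ w → w ≢ x × w ∈ All′ s × Adj G u w) → ∃ (Bigger s)
        last (yes (w , ne , w∈ , uw)) with 2 ≤? length (Out s w)
        ... | yes two = expand s (leafA w∈ (Adj-sym G uw)) two
        ... | no ¬tw = exhaust s (leafA x-in ad) (leafA w∈ (Adj-sym G uw)) ne u∈O (short-only ¬two u∈O) (short-only ¬tw (Out-in s (Adj-sym G uw) u∉))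
        last (no none) = contradiction (≤-trans (deg u) (unique-⊆-length {ys = x ∷ without u (Out s u)} (unique-nbrs G u (unique-allFin n)) sub)) few
          where
          few : ¬ 3 ≤ suc (length (without u (Out s u)))
          few (s≤s h) = ¬two′ h
          sub : ∀ {w} → w ∈ nbrs G V u → w ∈ x ∷ without u (Out s u)
          sub {w} m with w ≟F x | w ∈? All′ s
          ... | yes refl | _ = here refl
          ... | no ne | yes i = contradiction (w , ne , i , nbrs-adj G V m) none
          ... | no ne | no ni = there (without-∈ (Out-in s (nbrs-adj G V m) ni) (λ { refl → Adj-irrefl G (nbrs-adj G V m) }))

  record Leafy : Set where
    field
      D J : List (Fin n)
      whole : allFin n ↭ D ++ J
      order : ConnOrder G D
      attached : ∀ {x} → x ∈ J → ∃ λ d → d ∈ D × Adj G x d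
      many : n ≤ 4 * length J

  run : ∀ m (s : State) → n ≤ length (All′ s) + m → (∃ λ d → d ∈ D s) → Leafy
  run m s le d with anyF? (λ y → ¬? (y ∈? All′ s))
  ... | no none = record
    { D = D s ; J = A s ++ Z s ; whole = perm ; order = order s
    ; attached = λ m → case ∈-++⁻ (A s) m of λ { (inj₁ a) → attA s a ; (inj₂ z) → attZ s z }
    ; many = subst₂ _≤_ (trans (sym (↭-length perm)) (length-allFin n)) refl (begin
        length (All′ s) ≡⟨ length-++ (D s) ⟩
        length (D s) + length (A s ++ Z s) ≤⟨ +-monoˡ-≤ (length (A s ++ Z s)) (pot s) ⟩
        2 * (length (A s) + length (Z s)) + length (Z s) + length (A s ++ Z s) ≤⟨ +-monoˡ-≤ (length (A s ++ Z s)) (+-monoʳ-≤ (2 * (length (A s) + length (Z s))) (m≤n+m (length (Z s)) (length (A s)))) ⟩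
        2 * (length (A s) + length (Z s)) + (length (A s) + length (Z s)) + length (A s ++ Z s) ≡⟨ cong (λ z → 2 * z + z + length (A s ++ Z s)) (sym (length-++ (A s))) ⟩
        2 * length (A s ++ Z s) + length (A s ++ Z s) + length (A s ++ Z s) ≡⟨ l (length (A s ++ Z s)) ⟩
        4 * length (A s ++ Z s) ∎) }
    where
    open ≤-Reasoning
    l : ∀ x → 2 * x + x + x ≡ 4 * x
    l = solve-∀
    all-in : ∀ {y} → y ∈ allFin n → y ∈ All′ s
    all-in {y} _ with y ∈? All′ s
    ... | yes i = i
    ... | no ni = contradiction (y , ni) none
    perm : allFin n ↭ All′ s
    perm = same-elements-↭ (unique-allFin n) (uAll s) all-in (λ {y} _ → ∈-allFin y)
  run zero s le d | yes (y , y∉) = contradiction (≤-trans (unique-⊆-length {xs = y ∷ All′ s} {ys = allFin n} (unique-∷ y∉ (uAll s)) (λ {z} _ → ∈-allFin z)) (≤-reflexive (length-allFin n)))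
    (λ h → 1+n≰n (≤-trans h (≤-trans le (≤-reflexive (+-identityʳ _)))))
  run (suc m) s le d | yes y with advance s y d
  ... | s′ , big = run m s′ (≤-trans le (≤-trans (≤-reflexive (+-suc (length (All′ s)) m)) (+-monoˡ-≤ m big))) (root-of (order s′))
    where
    root-of : ∀ {D} → ConnOrder G D → ∃ λ d → d ∈ D
    root-of root = _ , here refl
    root-of (next _ _ _) = _ , here refl

  leafy : Fin n → Leafy
  leafy v = run n s₀ (m≤n+m n (length (All′ s₀))) (v , here refl)
    where
    v∉ : v ∉ nbrs G V v
    v∉ m = Adj-irrefl G (nbrs-adj G V m)
    s₀ : State
    s₀ = record
      { D = v ∷ [] ; A = nbrs G V v ; Z = []
      ; uD = [] ∷ [] ; uA = unique-nbrs G v (unique-allFin n) ; uZ = []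
      ; DA = λ { (here refl) → v∉ } ; DZ = λ _ () ; AZ = λ _ () ; order = root
      ; attA = λ m → v , here refl , Adj-sym G (nbrs-adj G V m) ; attZ = λ ()
      ; closedD = λ { {y = y} (here refl) ad → there (∈-++⁺ˡ (nbrs-in G V (∈-allFin y) ad)) } ; closedZ = λ ()
      ; pot = ≤-trans (≤-trans (s≤s z≤n) (deg v)) (≤-trans (m≤m+n _ (length (nbrs G V v))) (≤-reflexive (l (length (nbrs G V v))))) }
      where
      l : ∀ x → x + x ≡ 2 * (x + 0) + 0
      l = solve-∀

-- Colourings in which many vertices see several colours

-- `ConnOrder` lists the newest vertex first, hence the reversal. Every vertex but the root has an
-- earlier neighbour, and the factor q on the left replaces the exponent |D| - 1.
weight-order : ∀ {n p} (G : Graph n) {D} → ConnOrder G D → ∀ τ (X : Colouring n (2 + p)) →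
  weight G [] (D ʳ++ τ) X * suc p ≤ (2 + p) * suc p ^ length D * weight G D τ X
weight-order {p = p} G {v ∷ []} root τ X = begin
  length (free G [] v X) * W * q ≤⟨ *-monoˡ-≤ q (*-monoˡ-≤ W (free≤k G [] X [])) ⟩
  (2 + p) * W * q ≡⟨ l (2 + p) W q ⟩
  (2 + p) * (q * 1) * W ∎
  where
  open ≤-Reasoning
  q = suc p
  W = weight G (v ∷ []) τ X
  l : ∀ a b c → a * b * c ≡ a * (c * 1) * b
  l = solve-∀
weight-order {p = p} G {v ∷ D} (next o s∈ ad) τ X = begin
  weight G [] (D ʳ++ (v ∷ τ)) X * q ≤⟨ weight-order G o (v ∷ τ) X ⟩
  (2 + p) * q ^ length D * (length (free G D v X) * W) ≤⟨ *-monoʳ-≤ ((2 + p) * q ^ length D) (*-monoˡ-≤ W (free≤ G D v X s∈ ad)) ⟩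
  (2 + p) * q ^ length D * (q * W) ≡⟨ l (2 + p) (q ^ length D) q W ⟩
  (2 + p) * (q * q ^ length D) * W ∎
  where
  open ≤-Reasoning
  q = suc p
  W = weight G (v ∷ D) τ X
  l : ∀ a b c d → a * b * (c * d) ≡ a * (c * b) * d
  l = solve-∀

rank-before : ∀ {n} {w v : Fin n} as bs → v ∉ as → w ∈ as → 1 ≤ rank (w ∷ []) v (as ++ v ∷ bs)
rank-before {w = w} {v} (a ∷ as) bs v∉ m with a ≟F v | a ∈? (w ∷ [])
... | yes refl | _ = contradiction (here refl) v∉
... | no _ | yes _ = s≤s z≤n
rank-before (a ∷ as) bs v∉ (here refl) | no _ | no na = contradiction (here refl) na
rank-before (a ∷ as) bs v∉ (there m) | no _ | no na = rank-before as bs (λ i → v∉ (there i)) m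

rank-reverse : ∀ {n} {w v : Fin n} J → Unique J → v ∈ J → w ∈ J → w ≢ v → 1 ≤ rank (w ∷ []) v J ⊎ 1 ≤ rank (w ∷ []) v (reverse J)
rank-reverse {w = w} {v} J uJ v∈ w∈ ne with ∈-∃++ v∈
... | as , bs , refl with ∈-++⁻ as w∈
... | inj₁ wa = inj₁ (rank-before as bs (λ i → unique-++-disjoint as uJ i (here refl)) wa)
... | inj₂ (here e) = contradiction e ne
... | inj₂ (there wb) = inj₂ (subst (λ L → 1 ≤ rank (w ∷ []) v L) (sym rev) (rank-before (reverse bs) (reverse as) v∉ (∈-resp-↭ (↭-sym (↭-reverse bs)) wb)))
  where
  rev : reverse (as ++ v ∷ bs) ≡ reverse bs ++ v ∷ reverse as
  rev = trans (reverse-++ as (v ∷ bs)) (trans (cong (_++ reverse as) (unfold-reverse v bs)) (++-assoc (reverse bs) (v ∷ []) (reverse as)))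
  v∉ : v ∉ reverse bs
  v∉ i = unique-head (unique-++ʳ as uJ) (∈-resp-↭ (↭-reverse bs) i)

module Savings {n p : ℕ} (G : Graph n) (D J : List (Fin n)) (whole : allFin n ↭ D ++ J) (order : ConnOrder G D)
  (attached : ∀ {x} → x ∈ J → ∃ λ d → d ∈ D × Adj G x d) where

  private
    V = allFin n
    k = 2 + p
    q = suc p

  Xs : List (Colouring n k)
  Xs = Cols G V

  unique-DJ : Unique (D ++ J)
  unique-DJ = unique-↭ whole (unique-allFin n)

  c : Colouring n k → Fin n → ℕ
  c X v = ifDec (mono? (nbrs G V v) X) q p

  module AtX (X : Colouring n k) where

    abstract
      conflict : ∀ {v} (m : v ∈ J) → ¬ Mono (nbrs G V v) X → ∃ λ w → Adj G v w × lookup X w ≢ lookup X (proj₁ (attached m))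
      conflict {v} m nm with not-mono (nbrs G V v) X nm
      ... | a , b , ma , mb , ne with lookup X a ≟F lookup X (proj₁ (attached m))
      ... | no na = a , nbrs-adj G V ma , na
      ... | yes e = b , nbrs-adj G V mb , λ e′ → ne (trans e (sym e′))

    Rf : Fin n → List (Fin n)
    Rf v with v ∈? J | mono? (nbrs G V v) X
    ... | yes m | no nm = proj₁ (conflict m nm) ∷ []
    ... | yes _ | yes _ = []
    ... | no _ | _ = []

    h₂ : ℕ → ℕ
    h₂ zero = q
    h₂ (suc _) = p

    h₂≤q : ∀ i → h₂ i ≤ q
    h₂≤q zero = ≤-refl
    h₂≤q (suc _) = n≤1+n p

    h₂≡p : ∀ {i} → 1 ≤ i → h₂ i ≤ p
    h₂≡p (s≤s _) = ≤-refl

    hf : Fin n → ℕ → ℕ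
    hf v with mono? (nbrs G V v) X
    ... | yes _ = λ _ → q
    ... | no _ = h₂

    f-bound : ∀ {v E} → v ∈ J → Unique E → (∀ {u} → u ∈ D → u ∈ E) → length (free G E v X) ≤ hf v (count-in (Rf v) E)
    f-bound {v} {E} m uE DE with v ∈? J | mono? (nbrs G V v) X
    ... | no nm | _ = contradiction m nm
    ... | yes m′ | yes _ = free≤ G E v X (DE (proj₁ (proj₂ (attached m′)))) (proj₂ (proj₂ (attached m′)))
    ... | yes m′ | no nm = go
      where
      u = proj₁ (attached m′)
      u∈ = DE (proj₁ (proj₂ (attached m′)))
      au = proj₂ (proj₂ (attached m′))
      w = proj₁ (conflict m′ nm)
      aw = proj₁ (proj₂ (conflict m′ nm))
      ne = proj₂ (proj₂ (conflict m′ nm))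
      go : length (free G E v X) ≤ h₂ (count-in (w ∷ []) E)
      go with filter (_∈? (w ∷ [])) E in eq
      ... | [] = free≤ G E v X u∈ au
      ... | x ∷ _ = +-cancelʳ-≤ 2 _ p (≤-trans (free-bound G E v X (w ∷ u ∷ []) (((λ e → ne (cong (lookup X) e)) ∷ []) ∷ ([] ∷ []))
            (λ { (here refl) → w∈ , aw ; (there (here refl)) → u∈ , au })
            (λ { (here refl) (here refl) _ → refl ; (here refl) (there (here refl)) e → contradiction e ne ; (there (here refl)) (here refl) e → contradiction (sym e) ne ; (there (here refl)) (there (here refl)) _ → refl }))
            (≤-reflexive (+-comm 2 p)))
        where
        w∈ : w ∈ E
        w∈ with ∈-filter⁻ (_∈? (w ∷ [])) {xs = E} (subst (x ∈_) (sym eq) (here refl))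
        ... | x∈ , here refl = x∈

    -- After D is revealed, v sees the colour of its attachment vertex in both orders. If its
    -- neighbourhood is not monochromatic, some neighbour w has another colour; w lies in D or
    -- precedes v in J or in its reverse. One of the two factors is then at most p.
    ends : ∀ {v} → v ∈ J → hf v (count-in (Rf v) D + rank (Rf v) v J) * hf v (count-in (Rf v) D + rank (Rf v) v (reverse J)) ≤ q * c X v
    ends {v} m with v ∈? J | mono? (nbrs G V v) X
    ... | no nm | _ = contradiction m nm
    ... | yes _ | yes _ = ≤-refl
    ... | yes m′ | no nm = go (∈-++⁻ D (∈-resp-↭ whole (∈-allFin w)))
      where
      w = proj₁ (conflict m′ nm)
      w≢v : w ≢ v
      w≢v e = Adj-irrefl G (subst (Adj G v) e (proj₁ (proj₂ (conflict m′ nm))))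
      a = count-in (w ∷ []) D + rank (w ∷ []) v J
      b = count-in (w ∷ []) D + rank (w ∷ []) v (reverse J)
      left : 1 ≤ a → h₂ a * h₂ b ≤ q * p
      left l = ≤-trans (*-mono-≤ (h₂≡p l) (h₂≤q b)) (≤-reflexive (*-comm p q))
      right : 1 ≤ b → h₂ a * h₂ b ≤ q * p
      right l = *-mono-≤ (h₂≤q a) (h₂≡p l)
      go : w ∈ D ⊎ w ∈ J → h₂ a * h₂ b ≤ q * p
      go (inj₁ wD) = left (≤-trans (nonempty (∈-filter⁺ (_∈? (w ∷ [])) wD (here refl))) (m≤m+n _ _))
        where
        nonempty : ∀ {x} {xs : List (Fin n)} → x ∈ xs → 1 ≤ length xs
        nonempty (here _) = s≤s z≤n
        nonempty (there _) = s≤s z≤n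
      go (inj₂ wJ) with rank-reverse J (unique-++ʳ D unique-DJ) m wJ w≢v
      ... | inj₁ r = left (≤-trans r (m≤n+m _ (count-in (w ∷ []) D)))
      ... | inj₂ r = right (≤-trans r (m≤n+m _ (count-in (w ∷ []) D)))

    both : weight G D J X * weight G D (reverse J) X ≤ Π (λ v → q * c X v) J
    both = begin
      weight G D J X * weight G D (reverse J) X ≤⟨ *-mono-≤ (wr J id (unique-++ʳ D unique-DJ)) (≤-trans (wr (reverse J) (∈-resp-↭ (↭-reverse J)) (unique-↭ (↭-sym (↭-reverse J)) (unique-++ʳ D unique-DJ))) (≤-reflexive (Π-↭ (λ v → hf v (count-in (Rf v) D + rank (Rf v) v (reverse J))) (↭-reverse J)))) ⟩
      Π (λ v → hf v (count-in (Rf v) D + rank (Rf v) v J)) J * Π (λ v → hf v (count-in (Rf v) D + rank (Rf v) v (reverse J))) J ≡⟨ sym (Π-* _ _ J) ⟩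
      Π (λ v → hf v (count-in (Rf v) D + rank (Rf v) v J) * hf v (count-in (Rf v) D + rank (Rf v) v (reverse J))) J ≤⟨ Π-mono J ends ⟩
      Π (λ v → q * c X v) J ∎
      where
      open ≤-Reasoning
      wr : ∀ σ → (∀ {v} → v ∈ σ → v ∈ J) → Unique σ → weight G D σ X ≤ Π (λ v → hf v (count-in (Rf v) D + rank (Rf v) v σ)) σ
      wr σ sub uσ = weight-rank G X J D Rf hf f-bound σ D sub id uσ (unique-++ˡ D unique-DJ) (λ m m′ → unique-++-disjoint D unique-DJ m′ (sub m))

    total : weight G [] (D ʳ++ J) X * weight G [] (D ʳ++ reverse J) X * (q * q) ≤ k * q ^ n * (k * q ^ length D) * Π (c X) J
    total = begin
      W₁ * W₂ * (q * q) ≡⟨ l₁ W₁ W₂ q ⟩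
      W₁ * q * (W₂ * q) ≤⟨ *-mono-≤ (weight-order G order J X) (weight-order G order (reverse J) X) ⟩
      B * weight G D J X * (B * weight G D (reverse J) X) ≡⟨ l₂ B (weight G D J X) (weight G D (reverse J) X) ⟩
      B * B * (weight G D J X * weight G D (reverse J) X) ≤⟨ *-monoʳ-≤ (B * B) both ⟩
      B * B * Π (λ v → q * c X v) J ≡⟨ cong (B * B *_) (trans (Π-* (λ _ → q) (c X) J) (cong (_* Π (c X) J) (Π-const q J))) ⟩
      B * B * (q ^ length J * Π (c X) J) ≡⟨ l₃ k (q ^ length D) (q ^ length J) (Π (c X) J) ⟩
      k * (q ^ length D * q ^ length J) * B * Π (c X) J ≡⟨ cong (λ z → k * z * B * Π (c X) J) (trans (sym (^-distribˡ-+-* q (length D) (length J))) (cong (q ^_) len)) ⟩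
      k * q ^ n * B * Π (c X) J ∎
      where
      open ≤-Reasoning
      W₁ = weight G [] (D ʳ++ J) X
      W₂ = weight G [] (D ʳ++ reverse J) X
      B = k * q ^ length D
      len : length D + length J ≡ n
      len = trans (sym (length-++ D)) (trans (sym (↭-length whole)) (length-allFin n))
      l₁ : ∀ a b q → a * b * (q * q) ≡ a * q * (b * q)
      l₁ = solve-∀
      l₂ : ∀ B a b → B * a * (B * b) ≡ B * B * (a * b)
      l₂ = solve-∀
      l₃ : ∀ k d j c → k * d * (k * d) * (j * c) ≡ k * (d * j) * (k * d) * c
      l₃ = solve-∀

  M : ℕ
  M = length Xs

  nonMono : Colouring n k → ℕ
  nonMono X = length (filter (λ v → ¬? (mono? (nbrs G V v) X)) J)

  c-product : ∀ X → Π (c X) J * q ^ nonMono X ≡ q ^ length J * p ^ nonMono X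
  c-product X = begin
    Π (c X) J * q ^ nonMono X ≡⟨ cong (λ z → Π (c X) J * q ^ z) (length-filter-sum N? J) ⟩
    Π (c X) J * q ^ sum (map (bit ∘ N?) J) ≡⟨ trans (cong (Π (c X) J *_) (sym (Π-base-^ q (bit ∘ N?) J))) (sym (Π-* (c X) (λ v → q ^ bit (N? v)) J)) ⟩
    Π (λ v → c X v * q ^ bit (N? v)) J ≡⟨ Π-cong J (λ {v} _ → pt v) ⟩
    Π (λ v → q * p ^ bit (N? v)) J ≡⟨ trans (Π-* (λ _ → q) (λ v → p ^ bit (N? v)) J) (cong₂ _*_ (Π-const q J) (Π-base-^ p (bit ∘ N?) J)) ⟩
    q ^ length J * p ^ sum (map (bit ∘ N?) J) ≡⟨ cong (λ z → q ^ length J * p ^ z) (sym (length-filter-sum N? J)) ⟩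
    q ^ length J * p ^ nonMono X ∎
    where
    open ≡-Reasoning
    N? = λ v → ¬? (mono? (nbrs G V v) X)
    pt : ∀ v → c X v * q ^ bit (N? v) ≡ q * p ^ bit (N? v)
    pt v with mono? (nbrs G V v) X
    ... | yes _ = refl
    ... | no _ = l p q
      where
      l : ∀ p q → p * (q * 1) ≡ q * (p * 1)
      l = solve-∀

  ν : ℕ
  ν = sum (map nonMono Xs)

  chain₂ : ∀ {J′} → J′ ↭ J → M ^ M ≤ Π (weight G [] (D ʳ++ J′)) Xs
  chain₂ {J′} e = entropy-chain G V (D ʳ++ J′) [] Xs (unique-Cols G V) (λ m → Cols-proper {G = G} m) (λ ()) (λ {u} _ → ∈-allFin u) (λ _ _ ())
    (λ a b h → Cols-ext {G = G} a b (λ {u} _ → h (∈-resp-↭ (++↭ʳ++ D J′) (∈-resp-↭ (++⁺ˡ D (↭-sym e)) (∈-resp-↭ whole (∈-allFin u))))))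

  -- The product of the chain rules for both orders. The factor q * q stems from the roots of the
  -- two orders, and the powers with exponent ν charge p instead of q once for each pair of a leaf
  -- and a colouring that is not constant on its neighbourhood.
  savings : (M * M * (q * q)) ^ M * q ^ ν ≤ (k * q ^ n * (k * q ^ n)) ^ M * p ^ ν
  savings = begin
    (M * M * (q * q)) ^ M * q ^ ν ≡⟨ cong (_* q ^ ν) (trans (^-distribʳ-* M (M * M) (q * q)) (cong (_* (q * q) ^ M) (^-distribʳ-* M M M))) ⟩
    M ^ M * M ^ M * (q * q) ^ M * q ^ ν ≤⟨ *-monoˡ-≤ (q ^ ν) (*-monoˡ-≤ ((q * q) ^ M) (*-mono-≤ (chain₂ ↭refl) (chain₂ (↭-reverse J)))) ⟩
    Π (weight G [] (D ʳ++ J)) Xs * Π (weight G [] (D ʳ++ reverse J)) Xs * (q * q) ^ M * q ^ ν ≡⟨ cong₂ (λ a b → Π (weight G [] (D ʳ++ J)) Xs * Π (weight G [] (D ʳ++ reverse J)) Xs * a * b) (sym (Π-const (q * q) Xs)) (sym (Π-base-^ q nonMono Xs)) ⟩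
    Π (weight G [] (D ʳ++ J)) Xs * Π (weight G [] (D ʳ++ reverse J)) Xs * Π (λ _ → q * q) Xs * Π (λ X → q ^ nonMono X) Xs ≡⟨ sym (trans (Π-* _ (λ X → q ^ nonMono X) Xs) (cong (_* Π (λ X → q ^ nonMono X) Xs) (trans (Π-* _ (λ _ → q * q) Xs) (cong (_* Π (λ _ → q * q) Xs) (Π-* (weight G [] (D ʳ++ J)) (weight G [] (D ʳ++ reverse J)) Xs))))) ⟩
    Π (λ X → weight G [] (D ʳ++ J) X * weight G [] (D ʳ++ reverse J) X * (q * q) * q ^ nonMono X) Xs ≤⟨ Π-mono Xs (λ {X} _ → each X) ⟩
    Π (λ X → k * q ^ n * (k * q ^ n) * p ^ nonMono X) Xs ≡⟨ trans (Π-* (λ _ → k * q ^ n * (k * q ^ n)) (λ X → p ^ nonMono X) Xs) (cong₂ _*_ (Π-const (k * q ^ n * (k * q ^ n)) Xs) (Π-base-^ p nonMono Xs)) ⟩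
    (k * q ^ n * (k * q ^ n)) ^ M * p ^ ν ∎
    where
    open ≤-Reasoning
    len : length D + length J ≡ n
    len = trans (sym (length-++ D)) (trans (sym (↭-length whole)) (length-allFin n))
    each : ∀ X → weight G [] (D ʳ++ J) X * weight G [] (D ʳ++ reverse J) X * (q * q) * q ^ nonMono X ≤ k * q ^ n * (k * q ^ n) * p ^ nonMono X
    each X = begin
      weight G [] (D ʳ++ J) X * weight G [] (D ʳ++ reverse J) X * (q * q) * q ^ nonMono X ≤⟨ *-monoˡ-≤ (q ^ nonMono X) (AtX.total X) ⟩
      k * q ^ n * (k * q ^ length D) * Π (c X) J * q ^ nonMono X ≡⟨ *-assoc (k * q ^ n * (k * q ^ length D)) (Π (c X) J) (q ^ nonMono X) ⟩
      k * q ^ n * (k * q ^ length D) * (Π (c X) J * q ^ nonMono X) ≡⟨ cong (k * q ^ n * (k * q ^ length D) *_) (c-product X) ⟩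
      k * q ^ n * (k * q ^ length D) * (q ^ length J * p ^ nonMono X) ≡⟨ l (k * q ^ n) k (q ^ length D) (q ^ length J) (p ^ nonMono X) ⟩
      k * q ^ n * (k * (q ^ length D * q ^ length J)) * p ^ nonMono X ≡⟨ cong (λ z → k * q ^ n * (k * z) * p ^ nonMono X) (trans (sym (^-distribˡ-+-* q (length D) (length J))) (cong (q ^_) len)) ⟩
      k * q ^ n * (k * q ^ n) * p ^ nonMono X ∎
      where
      l : ∀ a k d j c → a * (k * d) * (j * c) ≡ a * (k * (d * j)) * c
      l = solve-∀

exponent-drop : ∀ X Y p q a b → 1 ≤ p → p ≤ q → a ≤ b → X * q ^ b ≤ Y * p ^ b → X * q ^ a ≤ Y * p ^ a
exponent-drop X Y p q a b 1≤p p≤q a≤b h = *-cancelʳ-≤′ (p ^ d) (m^n>0′ p d 1≤p) (begin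
  X * q ^ a * p ^ d ≤⟨ *-monoʳ-≤ (X * q ^ a) (^-monoˡ-≤ d p≤q) ⟩
  X * q ^ a * q ^ d ≡⟨ trans (*-assoc X (q ^ a) (q ^ d)) (cong (X *_) (trans (sym (^-distribˡ-+-* q a d)) (cong (q ^_) e))) ⟩
  X * q ^ b ≤⟨ h ⟩
  Y * p ^ b ≡⟨ sym (trans (*-assoc Y (p ^ a) (p ^ d)) (cong (Y *_) (trans (sym (^-distribˡ-+-* p a d)) (cong (p ^_) e)))) ⟩
  Y * p ^ a * p ^ d ∎)
  where
  open ≤-Reasoning
  d = b ∸ a
  e : a + d ≡ b
  e = m+[n∸m]≡n a≤b

leafBound : ℕ → ℕ → ℕ → ℕ
leafBound p δ Z = ((2 + p) * (2 + p) * (suc p ^ (2 + p) * suc p ^ δ * (suc p ^ (2 + p) * suc p ^ δ))) ^ suc Z * p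

-- A count within the factor q^k q^δ of k! q^(n+1) tolerates only a bounded total saving, so (q/p)^j
-- is at most the constant K. Bernoulli's inequality (q/p)^j ≥ 1 + j/p then bounds j by Kp, which is
-- `leafBound`.
few-leaves : ∀ p δ n M ν j Z → 1 ≤ p → (2 + p) ! * suc p ^ suc n ≤ M * (suc p ^ (2 + p) * suc p ^ δ) → j * M ≤ ν * suc Z →
  (M * M * (suc p * suc p)) ^ M * suc p ^ ν ≤ ((2 + p) * suc p ^ n * ((2 + p) * suc p ^ n)) ^ M * p ^ ν → j ≤ leafBound p δ Z
few-leaves p δ n M ν j Z 1≤p low jM sav = +-cancelˡ-≤ p _ _ (≤-trans pj (m≤n+m _ p))
  where
  open ≤-Reasoning
  k = 2 + p
  q = suc p
  t = suc Z
  c = q ^ k * q ^ δ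
  N = q ^ n
  1≤q : 1 ≤ q
  1≤q = s≤s z≤n
  F≥ : N * q ≤ M * c
  F≥ = ≤-trans (≤-reflexive (*-comm N q)) (≤-trans (≤-trans (≤-reflexive (sym (*-identityˡ (q * N)))) (*-monoˡ-≤ (q * N) (1≤n! k))) low)
  1≤M : 1 ≤ M
  1≤M = pos M F≥
    where
    pos : ∀ M → N * q ≤ M * c → 1 ≤ M
    pos zero h = contradiction (≤-trans (*-mono-≤ (m^n>0′ q n 1≤q) 1≤q) h) λ ()
    pos (suc M) _ = s≤s z≤n
  s₁ : ((M * M * (q * q)) ^ t * q ^ j) ^ M ≤ ((k * N * (k * N)) ^ t * p ^ j) ^ M
  s₁ = begin
    ((M * M * (q * q)) ^ t * q ^ j) ^ M ≡⟨ trans (^-distribʳ-* M ((M * M * (q * q)) ^ t) (q ^ j)) (cong₂ _*_ (^-^-comm (M * M * (q * q)) t M) (^-*-assoc q j M)) ⟩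
    ((M * M * (q * q)) ^ M) ^ t * q ^ (j * M) ≤⟨ exponent-drop (((M * M * (q * q)) ^ M) ^ t) (((k * N * (k * N)) ^ M) ^ t) p q (j * M) (ν * t) 1≤p (n≤1+n p) jM s₀ ⟩
    ((k * N * (k * N)) ^ M) ^ t * p ^ (j * M) ≡⟨ sym (trans (^-distribʳ-* M ((k * N * (k * N)) ^ t) (p ^ j)) (cong₂ _*_ (^-^-comm (k * N * (k * N)) t M) (^-*-assoc p j M))) ⟩
    ((k * N * (k * N)) ^ t * p ^ j) ^ M ∎
    where
    s₀ : ((M * M * (q * q)) ^ M) ^ t * q ^ (ν * t) ≤ ((k * N * (k * N)) ^ M) ^ t * p ^ (ν * t)
    s₀ = subst₂ _≤_ (trans (^-distribʳ-* t ((M * M * (q * q)) ^ M) (q ^ ν)) (cong (((M * M * (q * q)) ^ M) ^ t *_) (^-*-assoc q ν t)))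
                    (trans (^-distribʳ-* t ((k * N * (k * N)) ^ M) (p ^ ν)) (cong (((k * N * (k * N)) ^ M) ^ t *_) (^-*-assoc p ν t))) (^-monoˡ-≤ t sav)
  s₂ : (M * M * (q * q)) ^ t * q ^ j ≤ (k * N * (k * N)) ^ t * p ^ j
  s₂ = ^-cancelʳ-≤ _ _ M 1≤M s₁
  K = (k * k * (c * c)) ^ t
  s₃ : q ^ j ≤ K * p ^ j
  s₃ = *-cancelˡ-≤′ ((N * N) ^ t) (m^n>0′ (N * N) t (*-mono-≤ (m^n>0′ q n 1≤q) (m^n>0′ q n 1≤q))) (begin
    (N * N) ^ t * q ^ j ≤⟨ *-monoˡ-≤ (q ^ j) (^-monoˡ-≤ t (begin
        N * N ≤⟨ m≤m*n (N * N) (q * q * (q * q)) ⟩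
        N * N * (q * q * (q * q)) ≡⟨ l₁ N q ⟩
        N * q * (N * q) * (q * q) ≤⟨ *-monoˡ-≤ (q * q) (*-mono-≤ F≥ F≥) ⟩
        M * c * (M * c) * (q * q) ≡⟨ l₂ M c q ⟩
        M * M * (q * q) * (c * c) ∎)) ⟩
    (M * M * (q * q) * (c * c)) ^ t * q ^ j ≡⟨ trans (cong (_* q ^ j) (^-distribʳ-* t (M * M * (q * q)) (c * c))) (l₃ ((M * M * (q * q)) ^ t) ((c * c) ^ t) (q ^ j)) ⟩
    (M * M * (q * q)) ^ t * q ^ j * (c * c) ^ t ≤⟨ *-monoˡ-≤ ((c * c) ^ t) s₂ ⟩
    (k * N * (k * N)) ^ t * p ^ j * (c * c) ^ t ≡⟨ trans (l₃ ((k * N * (k * N)) ^ t) (p ^ j) ((c * c) ^ t)) (cong (_* p ^ j) (sym (^-distribʳ-* t (k * N * (k * N)) (c * c)))) ⟩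
    (k * N * (k * N) * (c * c)) ^ t * p ^ j ≡⟨ cong (λ z → z ^ t * p ^ j) (l₄ k N c) ⟩
    (N * N * (k * k * (c * c))) ^ t * p ^ j ≡⟨ trans (cong (_* p ^ j) (^-distribʳ-* t (N * N) (k * k * (c * c)))) (*-assoc ((N * N) ^ t) K (p ^ j)) ⟩
    (N * N) ^ t * (K * p ^ j) ∎)
    where
    l₁ : ∀ N q → N * N * (q * q * (q * q)) ≡ N * q * (N * q) * (q * q)
    l₁ = solve-∀
    l₂ : ∀ M c q → M * c * (M * c) * (q * q) ≡ M * M * (q * q) * (c * c)
    l₂ = solve-∀
    l₃ : ∀ a b c → a * b * c ≡ a * c * b
    l₃ = solve-∀
    l₄ : ∀ k N c → k * N * (k * N) * (c * c) ≡ N * N * (k * k * (c * c))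
    l₄ = solve-∀
  pj : p + j ≤ K * p
  pj = *-cancelˡ-≤′ (p ^ j) (m^n>0′ p j 1≤p) (begin
    p ^ j * (p + j) ≤⟨ bernoulli-up p j ⟩
    q ^ j * p ≤⟨ *-monoˡ-≤ p s₃ ⟩
    K * p ^ j * p ≡⟨ l K (p ^ j) p ⟩
    p ^ j * (K * p) ∎)
    where
    l : ∀ a b c → a * b * c ≡ b * (a * c)
    l = solve-∀

-- If every vertex has a monochromatic neighbourhood in at most a fraction Z/(Z+1) of the colourings that a
-- near-extremal graph has, then the many leaves of a spanning tree make colourings exponentially rare.
not-all-gap : ∀ {n} p δ Z (G : Graph n) → 1 ≤ p → Conn G (allFin n) → (∀ v → 3 ≤ length (nbrs G (allFin n) v)) →
  (2 + p) ! * suc p ^ suc n ≤ # {k′ = suc p} G (allFin n) * (suc p ^ (2 + p) * suc p ^ δ) →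
  (∀ v → length (filter (mono? {k = 2 + p} (nbrs G (allFin n) v)) (Cols G (allFin n))) * (suc p ^ (2 + p) * suc p ^ δ) * suc Z ≤ (2 + p) ! * suc p ^ suc n * Z) →
  ¬ 4 * leafBound p δ Z < n
not-all-gap {suc n′} p δ Z G 1≤p cn deg low gap big = contradiction (≤-trans (Leaves.Leafy.many L) (*-monoʳ-≤ 4 (few-leaves p δ n M ν (length J) Z 1≤p low jM savings))) (<⇒≱ big)
  where
  n = suc n′
  V = allFin n
  q = suc p
  k = 2 + p
  c = q ^ k * q ^ δ
  L = Leaves.leafy G cn deg fz
  open Leaves.Leafy L using (D; J; whole; order; attached)
  open Savings {p = p} G D J whole order attached using (Xs; M; ν; savings)
  N? : ∀ v → Decidable (λ (X : Colouring n k) → ¬ Mono (nbrs G V v) X)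
  N? v X = ¬? (mono? (nbrs G V v) X)
  nm : Fin n → ℕ
  nm v = length (filter (N? v) Xs)
  ν≡ : ν ≡ sum (map nm J)
  ν≡ = trans (sum-cong Xs (λ {X} _ → length-filter-sum (λ v → N? v X) J)) (trans (sum-swap (λ X v → bit (N? v X)) Xs J) (sum-cong J (λ {v} _ → sym (length-filter-sum (N? v) Xs))))
  each : ∀ v → M ≤ suc Z * nm v
  each v = +-cancelˡ-≤ (m * suc Z) _ _ (begin
    m * suc Z + M ≤⟨ +-monoˡ-≤ M mZ ⟩
    M * Z + M ≡⟨ trans (+-comm (M * Z) M) (sym (*-suc M Z)) ⟩
    M * suc Z ≡⟨ cong (_* suc Z) (length-filter-¬ (mono? (nbrs G V v)) Xs) ⟩
    (m + nm v) * suc Z ≡⟨ trans (*-distribʳ-+ (suc Z) m (nm v)) (cong (m * suc Z +_) (*-comm (nm v) (suc Z))) ⟩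
    m * suc Z + suc Z * nm v ∎)
    where
    open ≤-Reasoning
    m = length (filter (mono? {k = k} (nbrs G V v)) Xs)
    mZ : m * suc Z ≤ M * Z
    mZ = *-cancelʳ-≤′ c (*-mono-≤ (m^n>0′ q k (s≤s z≤n)) (m^n>0′ q δ (s≤s z≤n))) (begin
      m * suc Z * c ≡⟨ l m (suc Z) c ⟩
      m * c * suc Z ≤⟨ gap v ⟩
      k ! * q ^ suc n * Z ≤⟨ *-monoˡ-≤ Z low ⟩
      M * c * Z ≡⟨ l M c Z ⟩
      M * Z * c ∎)
      where
      l : ∀ a b c → a * b * c ≡ a * c * b
      l = solve-∀
  jM : length J * M ≤ ν * suc Z
  jM = begin
    length J * M ≡⟨ sym (sum-const M J) ⟩
    sum (map (λ _ → M) J) ≤⟨ sum-mono J (λ {v} _ → each v) ⟩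
    sum (map (λ v → suc Z * nm v) J) ≡⟨ sum-*ˡ (suc Z) nm J ⟩
    suc Z * sum (map nm J) ≡⟨ trans (cong (suc Z *_) (sym ν≡)) (*-comm (suc Z) ν) ⟩
    ν * suc Z ∎
    where open ≤-Reasoning

-- The shape of near-extremal graphs

⊆-full : ∀ {A : Set} {xs ys : List A} → DecidableEquality A → Unique xs → (∀ {x} → x ∈ xs → x ∈ ys) → length ys ≤ length xs → ∀ {y} → y ∈ ys → y ∈ xs
⊆-full {xs = xs} {ys} _≟_ u sub le {y} m with anyL? (y ≟_) xs
... | yes i = i
... | no ni = contradiction (≤-trans (unique-⊆-length {xs = y ∷ xs} (unique-∷ ni u) λ { (here refl) → m ; (there i) → sub i }) le) 1+n≰n

module _ {n : ℕ} (G : Graph n) (p : ℕ) where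

  private
    V = allFin n

  -- The bipartite part: A is the contracted neighbourhood, and B consists of v and the vertices
  -- that hang from r in the contraction.
  record Common (A B : List (Fin n)) : Set where
    field
      independent : ∀ {a b} → a ∈ A → b ∈ A → ¬ Adj G a b
      complete : ∀ {a b} → a ∈ A → b ∈ B → Adj G a b
      only-A : ∀ {b x} → b ∈ B → Adj G b x → x ∈ A

  -- Here r belongs to the k-clique of the contraction. Only q clique vertices are left in G, and
  -- each of them has an edge into A.
  record Family₁ (A B : List (Fin n)) : Set where
    field
      Q : List (Fin n)
      whole : V ↭ Q ++ A ++ B
      length-Q : length Q ≡ suc p
      clique-Q : Clique {k′ = suc p} G Q
      touched : ∀ {q} → q ∈ Q → ∃ λ a → a ∈ A × Adj G a q

  -- Here r hangs from a clique vertex s.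
  record Family₂ (A B : List (Fin n)) : Set where
    field
      Q : List (Fin n)
      s a : Fin n
      whole : V ↭ Q ++ A ++ B
      length-Q : length Q ≡ 2 + p
      clique-Q : Clique {k′ = suc p} G Q
      s∈ : s ∈ Q
      a∈ : a ∈ A
      joined : Adj G a s

  -- Here r hangs from y, and y from the clique vertex s. The extremal graph is of this kind, with y
  -- the endpoint of the deleted edge outside A.
  record Family₃ (A B : List (Fin n)) : Set where
    field
      Q : List (Fin n)
      s y : Fin n
      whole : V ↭ Q ++ A ++ y ∷ B
      length-Q : length Q ≡ 2 + p
      clique-Q : Clique {k′ = suc p} G Q
      s∈ : s ∈ Q
      joined : Adj G y s
      only-y : ∀ {x} → Adj G y x → x ≡ s ⊎ x ∈ A
      only-Q : ∀ {q x} → q ∈ Q → Adj G q x → x ∈ Q ⊎ (q ≡ s × x ≡ y)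

  module Analysis (δ : ℕ) (3≤δ : 3 ≤ δ) (deg : ∀ v → δ ≤ length (nbrs G V v)) {v r : Fin n} (r∈ : r ∈ nbrs G V v)
    (len : length (nbrs G V v) ≡ δ) (ind : ∀ {a b} → a ∈ nbrs G V v → b ∈ nbrs G V v → ¬ Adj G a b) where

    open Quotient G V (unique-allFin n) {v} {r} (∈-allFin v) r∈

    few-nbrs : ∀ {u} L → (∀ {x} → Adj G u x → x ∈ L) → δ ≤ length L
    few-nbrs {u} L sub = ≤-trans (deg u) (unique-⊆-length (unique-nbrs G u (unique-allFin n)) (λ m → sub (nbrs-adj G V m)))

    -- The use of δ ≥ 3: tree vertices that are too far from r retain at most two neighbours in G
    -- and are excluded by their degree.
    lonely : ∀ {u} {P : Set} L → length L ≤ 2 → (∀ {x} → Adj G u x → x ∈ L) → P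
    lonely L le sub = contradiction (≤-trans 3≤δ (≤-trans (few-nbrs L sub) le)) λ { (s≤s (s≤s ())) }

    ∉N : ∀ {u} → u ∈ rest → v ≢ u × u ∉ N
    ∉N m = (λ { refl → rest-∉ m (here refl) }) , (λ i → rest-∉ m (there i))

    K→G : ∀ {x y} → x ∈ rest → y ∈ rest → Adj K x y → Adj G x y
    K→G mx my = subst T (contract-o (rest-≢r mx) (rest-≢r my))

    transfer : ∀ {u x} → u ∈ rest → Adj G u x → (x ∈ rest × Adj K u x) ⊎ (x ∈ N × Adj K u r)
    transfer {u} {x} u∈ ad with S-cases (∈-allFin x)
    ... | inj₁ m = inj₁ (m , subst T (sym (contract-o (rest-≢r u∈) (rest-≢r m))) ad)
    ... | inj₂ (inj₁ refl) = contradiction (nbrs-in G V (∈-allFin u) (Adj-sym G ad)) (proj₂ (∉N u∈))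
    ... | inj₂ (inj₂ m) = inj₂ (m , Adj-sym K {r} {u} (contract-r (rest-≢r u∈) m (Adj-sym G ad)))

    Pendant : Fin n → Set
    Pendant b = b ∈ rest × (∀ {x} → x ∈ S/ → Adj K b x → x ≡ r)

    pendant-N : ∀ {b} → Pendant b → ∀ {x} → Adj G b x → x ∈ N
    pendant-N (b∈ , only) ad with transfer b∈ ad
    ... | inj₁ (m , kad) = contradiction (only (there m) kad) (rest-≢r m)
    ... | inj₂ (m , _) = m

    -- All neighbours of b lie in N, and b has at least δ = |N| of them.
    pendant-full : ∀ {b} → Pendant b → ∀ {a} → a ∈ N → Adj G a b
    pendant-full {b} pb a∈ = Adj-sym G (nbrs-adj G V (⊆-full _≟F_ (unique-nbrs G b (unique-allFin n)) (λ m → pendant-N pb (nbrs-adj G V m)) (≤-trans (≤-reflexive len) (deg b)) a∈))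

    common : ∀ {Bs} → (∀ {b} → b ∈ Bs → Pendant b) → Common N (v ∷ Bs)
    common pend = record
      { independent = ind
      ; complete = λ { a∈ (here refl) → Adj-sym G (nbrs-adj G V a∈) ; a∈ (there m) → pendant-full (pend m) a∈ }
      ; only-A = λ { {x = x} (here refl) ad → nbrs-in G V (∈-allFin x) ad ; (there m) ad → pendant-N (pend m) ad } }

    Result : List (Fin n) → Set
    Result B = Common N B × (Family₁ N B ⊎ (Family₂ N B ⊎ Family₃ N B))

    rest↭ : ∀ {Bs T} → S/ ↭ Bs ++ r ∷ T → V ↭ T ++ N ++ v ∷ Bs
    rest↭ {Bs} {T} perm = ↭trans S↭ (↭trans (++⁺ʳ (v ∷ N) rest′) (same-elements-↭ u₁ u₂ to from))
      where
      rest′ : rest ↭ Bs ++ T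
      rest′ = drop-∷ (↭trans perm (shift r Bs T))
      u₀ : Unique (rest ++ v ∷ N)
      u₀ = unique-↭ S↭ (unique-allFin n)
      u₁ : Unique ((Bs ++ T) ++ v ∷ N)
      u₁ = unique-↭ (++⁺ʳ (v ∷ N) rest′) u₀
      p₁ : (Bs ++ T) ++ v ∷ N ↭ T ++ N ++ v ∷ Bs
      p₁ = ↭trans (++⁺ʳ (v ∷ N) (↭-++-comm Bs T)) (↭trans (↭-reflexive (++-assoc T Bs (v ∷ N))) (++⁺ˡ T (↭trans (↭-++-comm Bs (v ∷ N)) (↭-sym (shift v N Bs)))))
      u₂ : Unique (T ++ N ++ v ∷ Bs)
      u₂ = unique-↭ p₁ u₁
      to : ∀ {x} → x ∈ (Bs ++ T) ++ v ∷ N → x ∈ T ++ N ++ v ∷ Bs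
      to = ∈-resp-↭ p₁
      from : ∀ {x} → x ∈ T ++ N ++ v ∷ Bs → x ∈ (Bs ++ T) ++ v ∷ N
      from = ∈-resp-↭ (↭-sym p₁)

    -- The attachment order, read backwards, first removes pendants of the contracted vertex r.
    phase₁ : ∀ Bs {T} → Ext K (2 + p) T → S/ ↭ Bs ++ T → (∀ {b} → b ∈ Bs → Pendant b) → ∃ Result
    phase₁ Bs {Q} (clique lenQ cl) perm pend = v ∷ Bs , common pend , inj₁ record
      { Q = Q′ ; whole = rest↭ (↭trans perm (++⁺ˡ Bs Q↭)) ; length-Q = suc-injective (trans (sym (↭-length Q↭)) lenQ)
      ; clique-Q = λ {x} {y} mx my ne → subst T (contract-o (≢r mx) (≢r my)) (cl (Q-in mx) (Q-in my) ne)
      ; touched = λ mq → contract-r⁻ (cl r∈Q (Q-in mq) (λ e → ≢r mq (sym e))) }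
      where
      r∈Q : r ∈ Q
      r∈Q with ∈-++⁻ Bs (∈-resp-↭ perm (here refl))
      ... | inj₁ b = contradiction refl (rest-≢r (proj₁ (pend b)))
      ... | inj₂ m = m
      uQ : Unique Q
      uQ = unique-++ʳ Bs (unique-↭ perm unique-S/)
      Q′ = proj₁ (split-∈ r∈Q)
      Q↭ = proj₂ (split-∈ r∈Q)
      Q-in : ∀ {x} → x ∈ Q′ → x ∈ Q
      Q-in m = ∈-resp-↭ (↭-sym Q↭) (there m)
      ≢r : ∀ {x} → x ∈ Q′ → x ≢ r
      ≢r m refl = unique-head (unique-↭ Q↭ uQ) m
    phase₁ Bs {u ∷ T} (leaf {s = s} e s∈ ad only u∉) perm pend = branch (u ≟F r) (s ≟F r)
      where
      branch : Dec (u ≡ r) → Dec (s ≡ r) → ∃ Result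
      branch (no u≢r) (yes refl) = phase₁ (u ∷ Bs) e (↭trans perm (shift u Bs T)) λ { (here refl) → u∈rest , pu ; (there m) → pend m }
        where
        u∈rest : u ∈ rest
        u∈rest with ∈-resp-↭ (↭-sym perm) (∈-++⁺ʳ Bs (here refl))
        ... | here e = contradiction e u≢r
        ... | there m = m
        pu : ∀ {x} → x ∈ S/ → Adj K u x → x ≡ r
        pu {x} m kad with ∈-++⁻ Bs (∈-resp-↭ perm m)
        ... | inj₁ b = contradiction (proj₂ (pend b) (there u∈rest) (Adj-sym K {u} {x} kad)) u≢r
        ... | inj₂ (here refl) = contradiction kad (Adj-irrefl K {u})
        ... | inj₂ (there t) = only t kad
      -- A leaf that does not hang from r is untouched by the contraction and has degree one in G.
      branch (no u≢r) (no s≢r) = lonely (s ∷ []) (s≤s z≤n) sub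
        where
        u∈rest : u ∈ rest
        u∈rest with ∈-resp-↭ (↭-sym perm) (∈-++⁺ʳ Bs (here refl))
        ... | here e = contradiction e u≢r
        ... | there m = m
        K-only : ∀ {x} → x ∈ S/ → Adj K u x → x ≡ s
        K-only {x} m kad with ∈-++⁻ Bs (∈-resp-↭ perm m)
        ... | inj₁ b = contradiction (proj₂ (pend b) (there u∈rest) (Adj-sym K {u} {x} kad)) u≢r
        ... | inj₂ (here refl) = contradiction kad (Adj-irrefl K {u})
        ... | inj₂ (there t) = only t kad
        sub : ∀ {x} → Adj G u x → x ∈ s ∷ []
        sub a with transfer u∈rest a
        ... | inj₁ (m , kad) = here (K-only (there m) kad)
        ... | inj₂ (_ , kr) = contradiction (sym (K-only (here refl) kr)) s≢r
      -- From here on r is itself a leaf, hanging from s. Among the vertices of T only s can have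
      -- neighbours in N.
      branch (yes refl) _ = phase₂ e s∈
        where
        inRest : ∀ {x} → x ∈ T → x ∈ rest
        inRest m with ∈-resp-↭ (↭-sym perm) (∈-++⁺ʳ Bs (there m))
        ... | here refl = contradiction m u∉
        ... | there i = i
        T-nbr : ∀ {w x} → w ∈ T → x ∈ S/ → Adj K w x → (x ≡ r × w ≡ s) ⊎ x ∈ T
        T-nbr {w} {x} w∈ m kad with ∈-++⁻ Bs (∈-resp-↭ perm m)
        ... | inj₁ b = contradiction (proj₂ (pend b) (there (inRest w∈)) (Adj-sym K {w} {x} kad)) (rest-≢r (inRest w∈))
        ... | inj₂ (here refl) = inj₁ (refl , only w∈ (Adj-sym K {w} {r} kad))
        ... | inj₂ (there t) = inj₂ t
        T-nbr′ : ∀ {w x} → w ∈ T → Adj G w x → (x ∈ N × w ≡ s) ⊎ (x ∈ T × Adj K w x)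
        T-nbr′ w∈ a with transfer (inRest w∈) a
        ... | inj₂ (m , kr) with T-nbr w∈ (here refl) kr
        ... | inj₁ (_ , e) = inj₁ (m , e)
        ... | inj₂ t = contradiction t u∉
        T-nbr′ w∈ a | inj₁ (m , kad) with T-nbr w∈ (there m) kad
        ... | inj₁ (refl , _) = contradiction refl (rest-≢r m)
        ... | inj₂ t = inj₂ (t , kad)
        touch = contract-r⁻ ad
        phase₂ : Ext K (2 + p) T → s ∈ T → ∃ Result
        phase₂ (clique lenQ cl) s∈ = v ∷ Bs , common pend , inj₂ (inj₁ record
          { Q = T ; s = s ; a = proj₁ touch ; whole = rest↭ perm ; length-Q = lenQ
          ; clique-Q = λ mx my ne → K→G (inRest mx) (inRest my) (cl mx my ne)
          ; s∈ = s∈ ; a∈ = proj₁ (proj₂ touch) ; joined = proj₂ (proj₂ touch) })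
        phase₂ (leaf {T = T₁} {w} {s₁} e₁ s₁∈ ad₁ only₁ w∉) s∈ with w ≟F s
        ... | no w≢s = lonely (s₁ ∷ []) (s≤s z≤n) sub
          where
          sub : ∀ {x} → Adj G w x → x ∈ s₁ ∷ []
          sub a with T-nbr′ (here refl) a
          ... | inj₁ (_ , e) = contradiction e w≢s
          ... | inj₂ (here refl , _) = contradiction a (Adj-irrefl G)
          ... | inj₂ (there t , kad) = here (only₁ t kad)
        ... | yes refl = phase₃ e₁ s₁∈
          where
          phase₃ : Ext K (2 + p) T₁ → s₁ ∈ T₁ → ∃ Result
          phase₃ (clique lenQ cl) s₁∈ = v ∷ Bs , common pend , inj₂ (inj₂ record
            { Q = T₁ ; s = s₁ ; y = w ; whole = ↭trans (rest↭ perm) (y-last T₁) ; length-Q = lenQ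
            ; clique-Q = λ mx my ne → K→G (inRest (there mx)) (inRest (there my)) (cl mx my ne)
            ; s∈ = s₁∈ ; joined = K→G (inRest (here refl)) (inRest (there s₁∈)) ad₁
            ; only-y = oy ; only-Q = oq })
            where
            y-last : ∀ T₁ → w ∷ T₁ ++ N ++ v ∷ Bs ↭ T₁ ++ N ++ w ∷ v ∷ Bs
            y-last T₁ = ↭trans (↭-sym (shift w T₁ (N ++ v ∷ Bs))) (++⁺ˡ T₁ (↭-sym (shift w N (v ∷ Bs))))
            oy : ∀ {x} → Adj G w x → x ≡ s₁ ⊎ x ∈ N
            oy a with T-nbr′ (here refl) a
            ... | inj₁ (m , _) = inj₂ m
            ... | inj₂ (here refl , _) = contradiction a (Adj-irrefl G)
            ... | inj₂ (there t , kad) = inj₁ (only₁ t kad)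
            oq : ∀ {q x} → q ∈ T₁ → Adj G q x → x ∈ T₁ ⊎ (q ≡ s₁ × x ≡ w)
            oq {q} mq a with T-nbr′ (there mq) a
            ... | inj₁ (_ , refl) = contradiction mq w∉
            ... | inj₂ (here refl , kad) = inj₂ (only₁ mq (Adj-sym K {q} {w} kad) , refl)
            ... | inj₂ (there t , _) = inj₁ t
          -- A further leaf w₂ can be adjacent only to its own attachment vertex s₂ and to w, which
          -- is one neighbour too few.
          phase₃ (leaf {T = T₂} {w₂} {s₂} e₂ s₂∈ ad₂ only₂ w₂∉) _ = lonely (s₂ ∷ w ∷ []) (s≤s (s≤s z≤n)) sub
            where
            sub : ∀ {x} → Adj G w₂ x → x ∈ s₂ ∷ w ∷ []
            sub a with T-nbr′ (there (here refl)) a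
            ... | inj₁ (_ , refl) = contradiction (here refl) w∉
            ... | inj₂ (here refl , _) = there (here refl)
            ... | inj₂ (there (here refl) , _) = contradiction a (Adj-irrefl G)
            ... | inj₂ (there (there t) , kad) = here (only₂ t kad)

all-or : ∀ {A : Set} {R : A → Set} {Q : Set} (xs : List A) → (∀ x → R x ⊎ Q) → (∀ {x} → x ∈ xs → R x) ⊎ Q
all-or [] _ = inj₁ λ ()
all-or (x ∷ xs) f with f x | all-or xs f
... | inj₂ q | _ = inj₂ q
... | inj₁ _ | inj₂ q = inj₂ q
... | inj₁ r | inj₁ h = inj₁ λ { (here refl) → r ; (there m) → h m }

Shape : ∀ {n} → Graph n → ℕ → ℕ → Set
Shape {n} G p δ = ∃₂ λ A B → length A ≡ δ × Common G p A B × (Family₁ G p A B ⊎ (Family₂ G p A B ⊎ Family₃ G p A B))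

module _ {n : ℕ} (G : Graph n) (p δ : ℕ) (2≤p : 2 ≤ p) (3≤δ : 3 ≤ δ) (cn : Conn G (allFin n)) (nc : ¬ ColOn G (allFin n) (suc p))
  (deg : ∀ v → δ ≤ length (nbrs G (allFin n) v)) where

  private
    V = allFin n
    k = 2 + p
    q = suc p
    Z = gapZ p

  LocalGap : Fin n → Set
  LocalGap v = length (filter (mono? {k = k} (nbrs G V v)) (Cols G V)) * (q ^ k * q ^ δ) * suc Z ≤ k ! * q ^ suc n * Z

  -- A local gap has three sources: an edge inside the neighbourhood, a gap of the contraction, or a
  -- degree above δ, which costs a factor q and hence more than (Z+1)/Z. Otherwise the degree is δ
  -- and the contraction is a clique with trees, so its shape can be read off.
  vertex-cases : ∀ v → LocalGap v ⊎ Shape G p δ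
  vertex-cases v with innerEdge? G V v
  ... | yes ie = inj₁ (≤-trans (≤-reflexive (cong (λ z → z * (q ^ k * q ^ δ) * suc Z) (innerEdge-mono G V v ie))) z≤n)
  ... | no ¬ie = cases (tomescu p 2≤p K S/ unique-S/ (contract-conn cn) (ncK 2≤p))
    where
    r = proj₁ (head-∈ (nbrs G V v) (≤-trans (≤-trans (s≤s z≤n) 3≤δ) (deg v)))
    r∈ = proj₂ (head-∈ (nbrs G V v) (≤-trans (≤-trans (s≤s z≤n) 3≤δ) (deg v)))
    open Quotient G V (unique-allFin n) {v} {r} (∈-allFin v) r∈
    ind : ∀ {a b} → a ∈ N → b ∈ N → ¬ Adj G a b
    ind ma mb ad = ¬ie (_ , _ , ma , mb , ad)
    ncK : 2 ≤ p → ¬ ColOn K S/ (suc p)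
    ncK (s≤s _) c = nc (contract-col ind c)
    m = length (filter (mono? {k = k} N) (Cols G V))
    x = # {k′ = q} K S/
    len : length S/ + length N ≡ n
    len = trans length-S/ (length-allFin n)
    regroup : ∀ a b c d e → a * b * (c * d) * e ≡ a * c * e * (b * d)
    regroup = solve-∀
    finish : ∀ y z → x * q ^ k * suc Z ≤ k ! * y * z → y * q ^ suc δ * z ≤ q ^ suc n * Z → LocalGap v
    finish y z h₁ h₂ = begin
      m * (q ^ k * q ^ δ) * suc Z ≤⟨ *-monoˡ-≤ (suc Z) (*-monoˡ-≤ (q ^ k * q ^ δ) (mono-count {k′ = q})) ⟩
      x * q * (q ^ k * q ^ δ) * suc Z ≡⟨ regroup x q (q ^ k) (q ^ δ) (suc Z) ⟩
      x * q ^ k * suc Z * (q * q ^ δ) ≤⟨ *-monoˡ-≤ (q * q ^ δ) h₁ ⟩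
      k ! * y * z * (q * q ^ δ) ≡⟨ l (k !) y z (q * q ^ δ) ⟩
      k ! * (y * q ^ suc δ * z) ≤⟨ *-monoʳ-≤ (k !) h₂ ⟩
      k ! * (q ^ suc n * Z) ≡⟨ sym (*-assoc (k !) (q ^ suc n) Z) ⟩
      k ! * q ^ suc n * Z ∎
      where
      open ≤-Reasoning
      l : ∀ a b c d → a * b * c * d ≡ a * (b * d * c)
      l = solve-∀
    cases : Tomescu p K S/ → LocalGap v ⊎ Shape G p δ
    cases (inj₂ g) = inj₁ (finish (q ^ length S/) Z g (*-monoˡ-≤ Z (≤-trans (≤-reflexive (sym (^-distribˡ-+-* q (length S/) (suc δ))))
      (^-monoʳ-≤ q (≤-trans (≤-reflexive (+-suc (length S/) δ)) (s≤s (≤-trans (+-monoʳ-≤ (length S/) (deg v)) (≤-reflexive len))))))))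
    cases (inj₁ (T , perm , e)) with m≤n⇒m<n∨m≡n (deg v)
    ... | inj₂ eq with Analysis.phase₁ G p δ 3≤δ deg {v} {r} r∈ (sym eq) ind [] e perm (λ ())
    ... | B , cm , fam = inj₂ (N , B , sym eq , cm , fam)
    cases (inj₁ (T , perm , e)) | inj₁ lt = inj₁ (finish (q ^ length S/) (suc Z) (*-monoˡ-≤ (suc Z) (tomescu⇒bounded p K S/ unique-S/ (inj₁ (T , perm , e))))
      (begin
        q ^ length S/ * q ^ suc δ * suc Z ≡⟨ cong (_* suc Z) (sym (^-distribˡ-+-* q (length S/) (suc δ))) ⟩
        q ^ (length S/ + suc δ) * suc Z ≤⟨ *-mono-≤ (^-monoʳ-≤ q (≤-trans (+-monoʳ-≤ (length S/) lt) (≤-reflexive len))) sZ ⟩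
        q ^ n * (q * Z) ≡⟨ l (q ^ n) q Z ⟩
        q ^ suc n * Z ∎))
      where
      open ≤-Reasoning
      l : ∀ a q Z → a * (q * Z) ≡ q * a * Z
      l = solve-∀
      sZ : suc Z ≤ q * Z
      sZ = ≤-trans (+-monoˡ-≤ Z (≤-trans (s≤s z≤n) (gapZ-≥4 p))) (≤-trans (≤-reflexive (cong (Z +_) (sym (+-identityʳ Z)))) (*-monoˡ-≤ Z (≤-trans 2≤p (n≤1+n p))))

  shape : k ! * q ^ suc n ≤ # {k′ = q} G V * (q ^ k * q ^ δ) → 4 * leafBound p δ Z < n → Shape G p δ
  shape low big with all-or V vertex-cases
  ... | inj₂ s = s
  ... | inj₁ gaps = contradiction big (not-all-gap p δ Z G (≤-trans (s≤s z≤n) 2≤p) cn (λ v → ≤-trans 3≤δ (deg v)) low (λ v → gaps (∈-allFin v)))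

-- The extremal graph

T∧⁻ : ∀ a {b} → T (a ∧ b) → T a × T b
T∧⁻ true t = tt , t

T∧⁺ : ∀ {a b} → T a → T b → T (a ∧ b)
T∧⁺ {true} _ t = t

T∨⁻ : ∀ a {b} → T (a ∨ b) → T a ⊎ T b
T∨⁻ true t = inj₁ tt
T∨⁻ false t = inj₂ t

T∨⁺ˡ : ∀ {a b} → T a → T (a ∨ b)
T∨⁺ˡ {true} _ = tt

T∨⁺ʳ : ∀ a {b} → T b → T (a ∨ b)
T∨⁺ʳ true _ = tt
T∨⁺ʳ false t = t

Tnot⁻ : ∀ a → T (not a) → ¬ T a
Tnot⁻ false _ ()

Tnot⁺ : ∀ {a} → ¬ T a → T (not a)
Tnot⁺ {true} h = h tt
Tnot⁺ {false} _ = tt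

data Half (k δ x y : ℕ) : Set where
  kk : x < k → y < k → x ≢ y → Half k δ x y
  ab : k ≤ x → x < k + δ → k + δ ≤ y → ¬ (x ≡ k × y ≡ k + δ) → Half k δ x y
  sb : x ≡ 0 → y ≡ k + δ → Half k δ x y

Star : (k δ x y : ℕ) → Set
Star k δ x y = Half k δ x y ⊎ Half k δ y x

module _ (k δ : ℕ) where
  open GStar k δ

  core⇒half : ∀ {x y} → x ≢ y → T (core x y) → Half k δ x y
  core⇒half {x} {y} ne t with T∨⁻ (isK x ∧ isK y) t
  ... | inj₁ h = let (a , b) = T∧⁻ (isK x) h in kk (<ᵇ⇒< x k a) (<ᵇ⇒< y k b) ne
  ... | inj₂ t′ with T∨⁻ (isA x ∧ isB y ∧ not (eqℕ x k ∧ eqℕ y (k + δ))) t′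
  ... | inj₁ h = let (a , b) = T∧⁻ (isA x) h ; (c , d) = T∧⁻ (isB y) b ; (e , f) = T∧⁻ (not (x <ᵇ k)) a in
    ab (≮⇒≥ (λ lt → Tnot⁻ (x <ᵇ k) e (<⇒<ᵇ lt))) (<ᵇ⇒< x (k + δ) f) (≮⇒≥ (λ lt → Tnot⁻ (y <ᵇ k + δ) c (<⇒<ᵇ lt)))
      (λ { (refl , refl) → Tnot⁻ (eqℕ x k ∧ eqℕ y (k + δ)) d (T∧⁺ {eqℕ x k} (≡⇒≡ᵇ x x refl) (≡⇒≡ᵇ y y refl)) })
  ... | inj₂ h = let (a , b) = T∧⁻ (eqℕ x 0) h in sb (≡ᵇ⇒≡ x 0 a) (≡ᵇ⇒≡ y (k + δ) b)

  half⇒core : ∀ {x y} → Half k δ x y → T (core x y)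
  half⇒core {x} {y} (kk a b _) = T∨⁺ˡ {isK x ∧ isK y} (T∧⁺ {isK x} (<⇒<ᵇ a) (<⇒<ᵇ b))
  half⇒core {x} {y} (ab a b c d) = T∨⁺ʳ (isK x ∧ isK y) (T∨⁺ˡ {isA x ∧ isB y ∧ not (eqℕ x k ∧ eqℕ y (k + δ))}
    (T∧⁺ {isA x} (T∧⁺ {not (x <ᵇ k)} (Tnot⁺ (λ t → ≤⇒≯ a (<ᵇ⇒< x k t))) (<⇒<ᵇ b)) (T∧⁺ {isB y} (Tnot⁺ (λ t → ≤⇒≯ c (<ᵇ⇒< y (k + δ) t)))
      (Tnot⁺ (λ t → d (let (e , f) = T∧⁻ (eqℕ x k) t in ≡ᵇ⇒≡ x k e , ≡ᵇ⇒≡ y (k + δ) f))))))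
  half⇒core {x} {y} (sb a b) = T∨⁺ʳ (isK x ∧ isK y) (T∨⁺ʳ (isA x ∧ isB y ∧ not (eqℕ x k ∧ eqℕ y (k + δ))) (T∧⁺ {eqℕ x 0} (≡⇒≡ᵇ x 0 a) (≡⇒≡ᵇ y (k + δ) b)))

  half-≢ : ∀ {x y} → 1 ≤ k → Half k δ x y → x ≢ y
  half-≢ _ (kk _ _ ne) = ne
  half-≢ _ (ab _ lt ge _) refl = ≤⇒≯ ge lt
  half-≢ 1≤k (sb refl e) e′ = <-irrefl (trans e′ e) (≤-trans 1≤k (m≤m+n k δ))

  adj⇒star : ∀ {x y} → T (a x y) → Star k δ x y
  adj⇒star {x} {y} t with T∧⁻ (core x y ∨ core y x) t
  ... | c , ne = go (T∨⁻ (core x y) c)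
    where
    x≢y : x ≢ y
    x≢y e = Tnot⁻ (eqℕ x y) ne (≡⇒≡ᵇ x y e)
    go : T (core x y) ⊎ T (core y x) → Star k δ x y
    go (inj₁ h) = inj₁ (core⇒half x≢y h)
    go (inj₂ h) = inj₂ (core⇒half (λ e → x≢y (sym e)) h)

  star⇒adj : ∀ {x y} → 1 ≤ k → Star k δ x y → T (a x y)
  star⇒adj {x} {y} 1≤k (inj₁ h) = T∧⁺ {core x y ∨ core y x} (T∨⁺ˡ {core x y} (half⇒core h)) (Tnot⁺ (λ t → half-≢ 1≤k h (≡ᵇ⇒≡ x y t)))
  star⇒adj {x} {y} 1≤k (inj₂ h) = T∧⁺ {core x y ∨ core y x} (T∨⁺ʳ (core x y) (half⇒core h)) (Tnot⁺ (λ t → half-≢ 1≤k h (sym (≡ᵇ⇒≡ x y t))))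

seg : ∀ {n} a m → a + m ≤ n → List (Fin n)
seg a zero _ = []
seg a (suc m) h = fromℕ< (≤-trans (s≤s (m≤m+n a m)) (≤-trans (≤-reflexive (sym (+-suc a m))) h)) ∷ seg (suc a) m (≤-trans (≤-reflexive (sym (+-suc a m))) h)

length-seg : ∀ {n} a m (h : a + m ≤ n) → length (seg a m h) ≡ m
length-seg a zero h = refl
length-seg a (suc m) h = cong suc (length-seg (suc a) m _)

seg-∈⁻ : ∀ {n} a m (h : a + m ≤ n) {x} → x ∈ seg a m h → a ≤ toℕ x × toℕ x < a + m
seg-∈⁻ a (suc m) h (here refl) = ≤-reflexive (sym (toℕ-fromℕ< _)) , ≤-trans (s≤s (≤-reflexive (toℕ-fromℕ< _))) (≤-trans (s≤s (m≤m+n a m)) (≤-reflexive (sym (+-suc a m))))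
seg-∈⁻ a (suc m) h (there i) with seg-∈⁻ (suc a) m _ i
... | l , u = ≤-trans (n≤1+n a) l , ≤-trans u (≤-reflexive (sym (+-suc a m)))

seg-∈⁺ : ∀ {n} a m (h : a + m ≤ n) {x} → a ≤ toℕ x → toℕ x < a + m → x ∈ seg a m h
seg-∈⁺ a zero h l u = contradiction (≤-trans u (≤-reflexive (+-identityʳ a))) (≤⇒≯ l)
seg-∈⁺ a (suc m) h {x} l u with m≤n⇒m<n∨m≡n l
... | inj₂ e = here (toℕ-injective (trans (sym e) (sym (toℕ-fromℕ< _))))
... | inj₁ l′ = there (seg-∈⁺ (suc a) m _ l′ (≤-trans u (≤-reflexive (+-suc a m))))

unique-seg : ∀ {n} a m (h : a + m ≤ n) → Unique (seg a m h)
unique-seg a zero h = []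
unique-seg a (suc m) h = unique-∷ (λ i → <-irrefl (sym (toℕ-fromℕ< _)) (proj₁ (seg-∈⁻ (suc a) m _ i))) (unique-seg (suc a) m _)

reach-trans : ∀ {n} {G : Graph n} {u v w} → Reach G u v → Reach G v w → Reach G u w
reach-trans here r = r
reach-trans (step a s) r = step a (reach-trans s r)

reach-sym : ∀ {n} {G : Graph n} {u v} → Reach G u v → Reach G v u
reach-sym here = here
reach-sym {G = G} (step a s) = reach-trans (reach-sym s) (step (Adj-sym G a) here)

connected⇒conn : ∀ {n} (G : Graph n) → Connected G → Conn G (allFin n)
connected⇒conn {n} G cn f {a} {b} _ _ fa fb = go (cn a b) fa
  where
  go : ∀ {u} → Reach G u b → f u ≡ true → ∃₂ λ x y → x ∈ allFin n × y ∈ allFin n × f x ≡ true × f y ≡ false × Adj G x y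
  go here fu = contradiction (trans (sym fu) fb) true≢false
  go {u} (step {w = w} ad r) fu with f w in e
  ... | true = go r e
  ... | false = u , w , ∈-allFin u , ∈-allFin w , fu , e , ad

-- `big` provides at least δ + 1 vertices in the large part, so that the endpoint k of the deleted
-- edge keeps δ neighbours. The named vertices 0, k + 1, k + δ and k + δ + 1 form a path-like
-- skeleton for connectedness.
module StarGraph (n q δ : ℕ) (2≤δ : 2 ≤ δ) (1≤q : 1 ≤ q) (big : suc q + δ + suc δ ≤ n) where

  private
    k = suc q
    Γ = Gstar n k δ

  lt : ∀ i → i ≤ k + δ + δ → i < n
  lt i h = ≤-trans (s≤s h) (≤-trans (≤-reflexive (sym (+-suc (k + δ) δ))) big)

  at : ∀ i → i ≤ k + δ + δ → Fin n
  at i h = fromℕ< (lt i h)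

  toℕ-at : ∀ i h → toℕ (at i h) ≡ i
  toℕ-at i h = toℕ-fromℕ< _

  star-adj : ∀ {u v} → Star k δ (toℕ u) (toℕ v) → Adj Γ u v
  star-adj = star⇒adj k δ (s≤s z≤n)

  adj-star : ∀ {u v} → Adj Γ u v → Star k δ (toℕ u) (toℕ v)
  adj-star = adj⇒star k δ

  half-at : ∀ {i j} hi hj → Half k δ i j → Adj Γ (at i hi) (at j hj)
  half-at hi hj h = star-adj (inj₁ (subst₂ (Half k δ) (sym (toℕ-at _ hi)) (sym (toℕ-at _ hj)) h))

  h₀ : 0 ≤ k + δ + δ
  h₀ = z≤n
  hb : k + δ ≤ k + δ + δ
  hb = m≤m+n (k + δ) δ
  hc : suc (k + δ) ≤ k + δ + δ
  hc = ≤-trans (≤-reflexive (+-comm 1 (k + δ))) (+-monoʳ-≤ (k + δ) (≤-trans (s≤s z≤n) 2≤δ))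
  ha : suc k ≤ k + δ + δ
  ha = ≤-trans (s≤s (≤-trans (m≤m+n k δ) ≤-refl)) hc

  k<k+δ : k < k + δ
  k<k+δ = ≤-trans (≤-reflexive (+-comm 1 k)) (+-monoʳ-≤ k (≤-trans (s≤s z≤n) 2≤δ))

  sk<k+δ : suc k < k + δ
  sk<k+δ = ≤-trans (≤-reflexive (+-comm 2 k)) (+-monoʳ-≤ k 2≤δ)

  v₀ a₁ b₀ b₁ : Fin n
  v₀ = at 0 h₀
  a₁ = at (suc k) ha
  b₀ = at (k + δ) hb
  b₁ = at (suc (k + δ)) hc

  1+k≢k : suc k ≢ k
  1+k≢k e = 1+n≢n e

  b₀-v₀ : Adj Γ b₀ v₀
  b₀-v₀ = Adj-sym Γ {v₀} {b₀} (half-at h₀ hb (sb refl refl))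

  a₁-b₀ : Adj Γ a₁ b₀
  a₁-b₀ = half-at ha hb (ab (n≤1+n k) sk<k+δ ≤-refl (λ { (e , _) → 1+k≢k e }))

  a₁-b₁ : Adj Γ a₁ b₁
  a₁-b₁ = half-at ha hc (ab (n≤1+n k) sk<k+δ (n≤1+n _) (λ { (e , _) → 1+k≢k e }))

  to-v₀ : ∀ u → Reach Γ u v₀
  to-v₀ u with <-cmp (toℕ u) k
  ... | tri< u<k _ _ with toℕ u ≟ℕ 0
  ... | yes e = subst (λ w → Reach Γ w v₀) (toℕ-injective (trans (toℕ-at 0 h₀) (sym e))) here
  ... | no ne = step (star-adj (inj₁ (kk u<k (subst (_< k) (sym (toℕ-at 0 h₀)) (s≤s z≤n)) (λ e → ne (trans e (toℕ-at 0 h₀)))))) here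
  -- The vertex k has lost its edge to b₀ and makes a detour through b₁ and a₁; the latter differs
  -- from k because δ ≥ 2.
  to-v₀ u | tri≈ _ u≡k _ = step {w = b₁} (star-adj (inj₁ (ab (≤-reflexive (sym u≡k)) (subst (_< k + δ) (sym u≡k) k<k+δ) (subst (k + δ ≤_) (sym (toℕ-at _ hc)) (n≤1+n _)) (λ { (_ , e) → 1+n≢n (trans (sym (toℕ-at _ hc)) e) }))))
    (step {w = a₁} (Adj-sym Γ {a₁} {b₁} a₁-b₁) (step {w = b₀} a₁-b₀ (step {w = v₀} b₀-v₀ here)))
  to-v₀ u | tri> _ u≢k k<u with <-cmp (toℕ u) (k + δ)
  ... | tri< u< _ _ = step {w = b₀} (star-adj (inj₁ (ab (<⇒≤ k<u) u< (≤-reflexive (sym (toℕ-at _ hb))) (λ { (e , _) → u≢k e })))) (step {w = v₀} b₀-v₀ here)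
  ... | tri≈ _ e _ = step {w = v₀} (star-adj (inj₂ (sb (toℕ-at 0 h₀) e))) here
  ... | tri> _ _ u> = step {w = a₁} (star-adj (inj₂ (ab (≤-trans (n≤1+n k) (≤-reflexive (sym (toℕ-at _ ha)))) (subst (_< k + δ) (sym (toℕ-at _ ha)) sk<k+δ) (<⇒≤ u>) (λ { (e , _) → 1+k≢k (trans (sym (toℕ-at _ ha)) e) }))))
    (step {w = b₀} a₁-b₀ (step {w = v₀} b₀-v₀ here))

  connected : Connected Γ
  connected u v = reach-trans (to-v₀ u) (reach-sym (to-v₀ v))

  colour : ℕ → Fin k
  colour x with x <? k | x <? k + δ
  ... | yes h | _ = fromℕ< h
  ... | no _ | yes _ = fz
  ... | no _ | no _ = fromℕ< {1} (s≤s 1≤q)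

  half-colour : ∀ {x y} → Half k δ x y → colour x ≢ colour y
  half-colour {x} {y} (kk a b ne) e with x <? k | y <? k
  ... | yes h | yes h′ = ne (trans (sym (toℕ-fromℕ< h)) (trans (cong toℕ e) (toℕ-fromℕ< h′)))
  ... | no h | _ = h a
  ... | yes _ | no h = h b
  half-colour {x} {y} (ab a b c _) e with x <? k | x <? k + δ | y <? k | y <? k + δ
  ... | yes h | _ | _ | _ = ≤⇒≯ a h
  ... | no _ | no h | _ | _ = h b
  ... | no _ | yes _ | yes h | _ = ≤⇒≯ c (≤-trans h (m≤m+n k δ))
  ... | no _ | yes _ | no _ | yes h = ≤⇒≯ c h
  ... | no _ | yes _ | no _ | no _ = 0≢1+n (trans (cong toℕ e) (toℕ-fromℕ< {1} {k} (s≤s 1≤q)))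
  half-colour (sb refl refl) e with k + δ <? k | k + δ <? k + δ
  ... | yes h | _ = ≤⇒≯ (m≤m+n k δ) h
  ... | no _ | yes h = <-irrefl refl h
  ... | no _ | no _ = 0≢1+n (trans (cong toℕ e) (toℕ-fromℕ< {1} {k} (s≤s 1≤q)))

  chromatic : ChromaticNumber Γ k
  chromatic = ((λ u → colour (toℕ u)) , pr) , none
    where
    pr : Proper Γ k (λ u → colour (toℕ u))
    pr u v ad e with adj-star {u} {v} ad
    ... | inj₁ h = half-colour h e
    ... | inj₂ h = half-colour h (sym e)
    hi : ∀ (i : Fin k) → toℕ i ≤ k + δ + δ
    hi i = ≤-trans (<⇒≤ (toℕ<n i)) (≤-trans (m≤m+n k δ) (m≤m+n (k + δ) δ))
    none : ∀ j → j < k → ¬ Colorable Γ j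
    none j j<k (c , proper) with pigeonhole j<k (λ i → c (at (toℕ i) (hi i)))
    ... | i , i′ , i<i′ , e = proper _ _ (half-at (hi i) (hi i′) (kk (toℕ<n i) (toℕ<n i′) (<⇒≢ i<i′))) e

  private
    V = allFin n

  nbr-in : ∀ {u v} → Star k δ (toℕ u) (toℕ v) → v ∈ nbrs Γ V u
  nbr-in {u} {v} s = nbrs-in Γ V {u} {v} (∈-allFin v) (star-adj {u} {v} s)

  sA : k + δ ≤ n
  sA = ≤-trans (m≤m+n (k + δ) (suc δ)) big
  sB : suc (k + δ) + δ ≤ n
  sB = ≤-trans (≤-reflexive (sym (+-suc (k + δ) δ))) big
  sK : 0 + k ≤ n
  sK = ≤-trans (m≤m+n k δ) sA
  sA′ : suc k + (δ ∸ 1) ≤ n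
  sA′ = ≤-trans (≤-reflexive (trans (sym (+-suc k (δ ∸ 1))) (cong (k +_) (m+[n∸m]≡n {1} (≤-trans (s≤s z≤n) 2≤δ))))) sA

  -- The clique vertices are the reason for δ ≤ q. The value δ is attained at b₁, a vertex of the
  -- large part away from the deleted edge.
  min-degree : δ ≤ q → MinDegree Γ δ
  min-degree δ≤q = low , b₁ , ≤-antisym high (low b₁)
    where
    sub-length : ∀ {u} (L : List (Fin n)) → Unique L → (∀ {x} → x ∈ L → Star k δ (toℕ u) (toℕ x)) → δ ≤ length L → δ ≤ degree Γ u
    sub-length {u} L uL sub le = ≤-trans le (unique-⊆-length uL (λ m → nbr-in {u} (sub m)))
    low : ∀ u → δ ≤ degree Γ u
    low u with <-cmp (toℕ u) k
    ... | tri< u<k _ _ = sub-length {u} (without u (seg 0 k sK)) (unique-filter (λ x → ¬? (x ≟F u)) (unique-seg 0 k sK))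
          (λ m → let (m₁ , ne) = ∈-filter⁻ (λ x → ¬? (x ≟F u)) {xs = seg 0 k sK} m in inj₁ (kk u<k (proj₂ (seg-∈⁻ 0 k sK m₁)) (λ e → ne (toℕ-injective (sym e)))))
          (≤-trans δ≤q (≤-pred (≤-trans (≤-reflexive (sym (length-seg 0 k sK))) len)))
      where
      len : length (seg 0 k sK) ≤ suc (length (without u (seg 0 k sK)))
      len = unique-⊆-length {ys = u ∷ without u (seg 0 k sK)} (unique-seg 0 k sK) go
        where
        go : ∀ {x} → x ∈ seg 0 k sK → x ∈ u ∷ without u (seg 0 k sK)
        go {x} m with x ≟F u
        ... | yes e = here e
        ... | no ne = there (without-∈ m ne)
    ... | tri≈ _ u≡k _ = sub-length {u} (seg (suc (k + δ)) δ sB) (unique-seg (suc (k + δ)) δ sB)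
          (λ m → let (l , _) = seg-∈⁻ (suc (k + δ)) δ sB m in inj₁ (ab (≤-reflexive (sym u≡k)) (subst (_< k + δ) (sym u≡k) k<k+δ) (<⇒≤ l) (λ { (_ , e) → <-irrefl (sym e) l })))
          (≤-reflexive (sym (length-seg (suc (k + δ)) δ sB)))
    ... | tri> _ _ k<u with <-cmp (toℕ u) (k + δ)
    ... | tri< u< _ _ = sub-length {u} (seg (suc (k + δ)) δ sB) (unique-seg (suc (k + δ)) δ sB)
          (λ m → let (l , _) = seg-∈⁻ (suc (k + δ)) δ sB m in inj₁ (ab (<⇒≤ k<u) u< (<⇒≤ l) (λ { (_ , e) → <-irrefl (sym e) l })))
          (≤-reflexive (sym (length-seg (suc (k + δ)) δ sB)))
    ... | tri≈ _ e _ = sub-length {u} (v₀ ∷ seg (suc k) (δ ∸ 1) sA′) (unique-∷ (λ m → ≤⇒≯ z≤n (≤-trans (s≤s z≤n) (≤-trans (proj₁ (seg-∈⁻ (suc k) (δ ∸ 1) sA′ m)) (≤-reflexive (toℕ-at 0 h₀))))) (unique-seg (suc k) (δ ∸ 1) sA′))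
          (λ { (here refl) → inj₂ (sb (toℕ-at 0 h₀) e)
             ; (there m) → let (l , h) = seg-∈⁻ (suc k) (δ ∸ 1) sA′ m in inj₂ (ab (<⇒≤ l) (≤-trans h (≤-reflexive eqδ)) (≤-reflexive (sym e)) (λ { (e′ , _) → <-irrefl (sym e′) l })) })
          (≤-reflexive (trans (sym (m+[n∸m]≡n {1} (≤-trans (s≤s z≤n) 2≤δ))) (cong suc (sym (length-seg (suc k) (δ ∸ 1) sA′)))))
      where
      eqδ : suc k + (δ ∸ 1) ≡ k + δ
      eqδ = trans (sym (+-suc k (δ ∸ 1))) (cong (k +_) (m+[n∸m]≡n {1} (≤-trans (s≤s z≤n) 2≤δ)))
    ... | tri> _ _ u> = sub-length {u} (seg k δ sA) (unique-seg k δ sA)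
          (λ m → let (l , h) = seg-∈⁻ k δ sA m in inj₂ (ab l h (<⇒≤ u>) (λ { (_ , e) → <-irrefl (sym e) u> })))
          (≤-reflexive (sym (length-seg k δ sA)))
    high : degree Γ b₁ ≤ δ
    high = ≤-trans (unique-⊆-length {ys = seg k δ sA} (unique-nbrs Γ b₁ (unique-allFin n)) sub) (≤-reflexive (length-seg k δ sA))
      where
      tb = toℕ-at _ hc
      big-b : k + δ < toℕ b₁
      big-b = ≤-reflexive (sym tb)
      sub : ∀ {x} → x ∈ nbrs Γ V b₁ → x ∈ seg k δ sA
      sub {x} m with adj-star {b₁} {x} (nbrs-adj Γ V {b₁} {x} m)
      ... | inj₁ (kk l _ _) = contradiction (≤-trans l (≤-trans (m≤m+n k δ) (<⇒≤ big-b))) (<-irrefl refl)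
      ... | inj₁ (ab _ l _ _) = contradiction l (≤⇒≯ (<⇒≤ big-b))
      ... | inj₁ (sb e _) = contradiction (trans (sym e) tb) 0≢1+n
      ... | inj₂ (kk _ l _) = contradiction (≤-trans l (≤-trans (m≤m+n k δ) (<⇒≤ big-b))) (<-irrefl refl)
      ... | inj₂ (ab l h _ _) = seg-∈⁺ k δ sA l h
      ... | inj₂ (sb _ e) = contradiction (sym e) (<⇒≢ big-b)

-- Lower bounds for the number of colourings

module _ {n k′ : ℕ} (G : Graph n) where

  private
    k = suc k′

  free-lower : ∀ S u (X : Colouring n k) D → (∀ {w} → w ∈ S → Adj G u w → w ∈ D) → k ≤ length (free G S u X) + length D
  free-lower S u X D sub = begin
    k ≡⟨ sym (length-allFin k) ⟩
    length (allFin k) ≤⟨ unique-⊆-length {ys = free G S u X ++ map (lookup X) D} (unique-allFin k) (λ {α} _ → go α) ⟩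
    length (free G S u X ++ map (lookup X) D) ≡⟨ trans (length-++ (free G S u X)) (cong (length (free G S u X) +_) (length-map (lookup X) D)) ⟩
    length (free G S u X) + length D ∎
    where
    open ≤-Reasoning
    go : ∀ α → α ∈ free G S u X ++ map (lookup X) D
    go α with seen? G S u X α
    ... | no ns = ∈-++⁺ˡ (∈-filter⁺ (λ α → ¬? (seen? G S u X α)) (∈-allFin α) ns)
    ... | yes s with seen-elim G u X s
    ... | w , w∈ , ad , refl = ∈-++⁺ʳ (free G S u X) (∈-map⁺ (lookup X) (sub w∈ ad))

  set : Fin n → Fin k → Colouring n k → Colouring n k
  set u α X = tabulate λ y → ifDec (y ≟F u) α (lookup X y)

  set-here : ∀ u α X → lookup (set u α X) u ≡ α
  set-here u α X = trans (lookup∘tabulate _ u) (ifDec-yes (u ≟F u) refl)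

  set-there : ∀ u α X {y} → y ≢ u → lookup (set u α X) y ≡ lookup X y
  set-there u α X {y} ne = trans (lookup∘tabulate _ y) (ifDec-no (y ≟F u) ne)

  #-∷-lower : ∀ S u → u ∉ S → sum (map (λ c → length (free G S u c)) (Cols G S)) ≤ # {k′ = k′} G (u ∷ S)
  #-∷-lower S u u∉ = begin
    sum (map (λ c → length (free G S u c)) (Cols G S)) ≡⟨ sum-cong (Cols G S) (λ {c} _ → sym (length-map (λ α → set u α c) (free G S u c))) ⟩
    sum (map (length ∘ ext) (Cols G S)) ≡⟨ sym (length-concatMap ext (Cols G S)) ⟩
    length (concatMap ext (Cols G S)) ≤⟨ unique-⊆-length (unique-concatMap ext (unique-Cols G S) (λ {c} _ → unique-map (λ α → set u α c) (unique-filter (λ α → ¬? (seen? G S u c α)) (unique-allFin k))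
         (λ {α} {β} _ _ e → trans (sym (set-here u α c)) (trans (cong (λ Z → lookup Z u) e) (set-here u β c)))) disjoint) member ⟩
    # G (u ∷ S) ∎
    where
    open ≤-Reasoning
    ext : Colouring n k → List (Colouring n k)
    ext c = map (λ α → set u α c) (free G S u c)
    ≢u : ∀ {y} → y ∈ S → y ≢ u
    ≢u m refl = u∉ m
    disjoint : ∀ {c d Z} → c ∈ Cols G S → d ∈ Cols G S → Z ∈ ext c → Z ∈ ext d → c ≡ d
    disjoint {c} {d} mc md zc zd with ∈-map⁻ (λ α → set u α c) zc | ∈-map⁻ (λ α → set u α d) zd
    ... | α , _ , refl | β , _ , e = Cols-ext {G = G} mc md (λ {y} m → trans (sym (set-there u α c (≢u m))) (trans (cong (λ Z → lookup Z y) e) (set-there u β d (≢u m))))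
    member : ∀ {Z} → Z ∈ concatMap ext (Cols G S) → Z ∈ Cols G (u ∷ S)
    member z with concatMap-∈ ext (Cols G S) z
    ... | c , mc , zc with ∈-map⁻ (λ α → set u α c) zc
    ... | α , mα , refl = Cols-intro {G = G} pr zo
      where
      fr : ¬ Seen G S u c α
      fr = proj₂ (∈-filter⁻ (λ α → ¬? (seen? G S u c α)) {xs = allFin k} mα)
      edge : ∀ {t} → t ∈ S → Adj G u t → lookup (set u α c) u ≢ lookup (set u α c) t
      edge {t} m ad e = fr (subst (Seen G S u c) (trans (sym (set-there u α c (≢u m))) (trans (sym e) (set-here u α c))) (seen-intro G u c m ad))
      pr : ProperOn G (u ∷ S) (set u α c)
      pr (here refl) (here refl) ad _ = Adj-irrefl G ad
      pr (here refl) (there m) ad e = edge m ad e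
      pr (there m) (here refl) ad e = edge m (Adj-sym G ad) (sym e)
      pr (there m) (there m′) ad e = Cols-proper {G = G} mc m m′ ad (trans (sym (set-there u α c (≢u m))) (trans e (set-there u α c (≢u m′))))
      zo : ZeroOff (u ∷ S) (set u α c)
      zo y no-y = trans (set-there u α c (λ e → no-y (here e))) (Cols-zero {G = G} mc y (λ m → no-y (there m)))

  leaf-lower : ∀ S u s → u ∉ S → (∀ {w} → w ∈ S → Adj G u w → w ≡ s) → # {k′ = k′} G S * k′ ≤ # {k′ = k′} G (u ∷ S)
  leaf-lower S u s u∉ only = ≤-trans (≤-reflexive (sym (sum-const k′ (Cols G S)))) (≤-trans (sum-mono (Cols G S) (λ {X} _ →
    ≤-pred (≤-trans (free-lower S u X (s ∷ []) (λ m ad → here (only m ad))) (≤-reflexive (+-comm _ 1))))) (#-∷-lower S u u∉))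

  leaves-lower : ∀ s L S → Unique (L ++ S) → (∀ {u w} → u ∈ L → w ∈ L ++ S → Adj G u w → w ≡ s) → # {k′ = k′} G S * k′ ^ length L ≤ # {k′ = k′} G (L ++ S)
  leaves-lower s [] S _ _ = ≤-reflexive (*-identityʳ _)
  leaves-lower s (u ∷ L) S uLS@(_ ∷ uLS′) only = begin
    # G S * (k′ * k′ ^ length L) ≡⟨ l (# G S) k′ (k′ ^ length L) ⟩
    # G S * k′ ^ length L * k′ ≤⟨ *-monoˡ-≤ k′ (leaves-lower s L S uLS′ (λ m m′ → only (there m) (there m′))) ⟩
    # G (L ++ S) * k′ ≤⟨ leaf-lower (L ++ S) u s (unique-head uLS) (λ m → only (here refl) (there m)) ⟩
    # G (u ∷ L ++ S) ∎
    where
    open ≤-Reasoning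
    l : ∀ a b c → a * (b * c) ≡ a * c * b
    l = solve-∀

  clique-lower : ∀ Q → Unique Q → ∀ r → length Q + r ≡ k → k ! ≤ # {k′ = k′} G Q * r !
  clique-lower [] _ r refl = ≤-trans (≤-reflexive (sym (*-identityˡ (r !)))) (*-monoˡ-≤ (r !) one)
    where
    one : 1 ≤ # {k′ = k′} G []
    one = unique-⊆-length {xs = tabulate (λ _ → fz) ∷ []} ([] ∷ []) λ { (here refl) → Cols-intro {G = G} (λ ()) (λ v _ → lookup∘tabulate _ v) }
  clique-lower (u ∷ Q) uQ@(_ ∷ uQ′) r e = begin
    k ! ≤⟨ clique-lower Q uQ′ (suc r) e′ ⟩
    # G Q * (suc r * r !) ≡⟨ sym (*-assoc (# G Q) (suc r) (r !)) ⟩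
    # G Q * suc r * r ! ≤⟨ *-monoˡ-≤ (r !) (≤-trans (≤-reflexive (sym (sum-const (suc r) (Cols G Q)))) (≤-trans (sum-mono (Cols G Q) (λ {X} _ →
        +-cancelʳ-≤ (length Q) _ _ (≤-trans (≤-reflexive (trans (+-comm (suc r) (length Q)) e′)) (free-lower Q u X Q (λ m _ → m))))) (#-∷-lower Q u (unique-head uQ)))) ⟩
    # G (u ∷ Q) * r ! ∎
    where
    open ≤-Reasoning
    e′ : length Q + suc r ≡ k
    e′ = trans (+-suc (length Q) r) e

-- Only colourings that are constant on the part of size δ are counted. Contracting this part gives
-- a clique with a tree: b₀ hangs from 0, r from b₀, and the other vertices of the large part from
-- r. This tree structure has exactly k! q^(n - δ + 1 - k) colourings, enough for the comparison.
module StarLower (n q δ : ℕ) (2≤δ : 2 ≤ δ) (1≤q : 1 ≤ q) (big : suc q + δ + suc δ ≤ n) where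

  open StarGraph n q δ 2≤δ 1≤q big
  private
    k = suc q
    Γ = Gstar n k δ
    V = allFin n

  N : List (Fin n)
  N = seg k δ sA

  hk : k ≤ k + δ + δ
  hk = ≤-trans (m≤m+n k δ) (m≤m+n (k + δ) δ)

  r : Fin n
  r = at k hk

  open Contract Γ N r

  private
    K = contract

  m′ : ℕ
  m′ = n ∸ suc (k + δ)

  hm : suc (k + δ) + m′ ≡ n
  hm = m+[n∸m]≡n (≤-trans (m≤m+n (suc (k + δ)) δ) sB)

  L S₁ S₂ S₃ : List (Fin n)
  L = seg (suc (k + δ)) m′ (≤-reflexive hm)
  S₁ = seg 0 k sK
  S₂ = b₀ ∷ S₁
  S₃ = r ∷ S₂

  tr : toℕ r ≡ k
  tr = toℕ-at k hk

  tb : toℕ b₀ ≡ k + δ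
  tb = toℕ-at _ hb

  S₁< : ∀ {x} → x ∈ S₁ → toℕ x < k
  S₁< m = proj₂ (seg-∈⁻ 0 k sK m)

  ≢r : ∀ {x} → toℕ x ≢ k → x ≢ r
  ≢r ne refl = ne tr

  K-adj : ∀ {x y} → toℕ x ≢ k → toℕ y ≢ k → Adj K x y → Star k δ (toℕ x) (toℕ y)
  K-adj {x} {y} nx ny ad = adj-star {x} {y} (subst T (contract-o (≢r nx) (≢r ny)) ad)

  not-star-far : ∀ {x y} → k + δ ≤ x → k + δ ≤ y → ¬ Star k δ x y
  not-star-far hx hy (inj₁ (kk l _ _)) = <-irrefl refl (≤-trans l (≤-trans (m≤m+n k δ) hx))
  not-star-far hx hy (inj₁ (ab _ l _ _)) = ≤⇒≯ hx l
  not-star-far hx hy (inj₁ (sb refl _)) = contradiction hx λ ()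
  not-star-far hx hy (inj₂ (kk l _ _)) = <-irrefl refl (≤-trans l (≤-trans (m≤m+n k δ) hy))
  not-star-far hx hy (inj₂ (ab _ l _ _)) = ≤⇒≯ hy l
  not-star-far hx hy (inj₂ (sb refl _)) = contradiction hy λ ()

  star-clique-far : ∀ {x y} → x < k → k + δ ≤ y → Star k δ x y → x ≡ 0 × y ≡ k + δ
  star-clique-far lx hy (inj₁ (kk _ l _)) = contradiction l (≤⇒≯ (≤-trans (m≤m+n k δ) hy))
  star-clique-far lx hy (inj₁ (ab l _ _ _)) = contradiction lx (≤⇒≯ l)
  star-clique-far lx hy (inj₁ (sb a b)) = a , b
  star-clique-far lx hy (inj₂ (kk l _ _)) = contradiction l (≤⇒≯ (≤-trans (m≤m+n k δ) hy))
  star-clique-far lx hy (inj₂ (ab _ l _ _)) = contradiction l (≤⇒≯ hy)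
  star-clique-far lx hy (inj₂ (sb refl _)) = contradiction hy λ ()

  star-clique-mid : ∀ {x y} → x < k → k ≤ y → y < k + δ → ¬ Star k δ x y
  star-clique-mid lx hy _ (inj₁ (kk _ l _)) = ≤⇒≯ hy l
  star-clique-mid lx hy _ (inj₁ (ab l _ _ _)) = ≤⇒≯ l lx
  star-clique-mid lx _ hy (inj₁ (sb _ refl)) = <-irrefl refl hy
  star-clique-mid lx hy _ (inj₂ (kk l _ _)) = ≤⇒≯ hy l
  star-clique-mid lx _ hy (inj₂ (ab _ _ l _)) = ≤⇒≯ l (≤-trans lx (m≤m+n k δ))
  star-clique-mid lx _ hy (inj₂ (sb _ refl)) = <-irrefl refl (≤-trans lx (m≤m+n k δ))

  k≢ : ∀ {x} → k + δ ≤ x → x ≢ k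
  k≢ h refl = ≤⇒≯ h k<k+δ

  only-b₀ : ∀ {w} → w ∈ S₁ → Adj K b₀ w → w ≡ v₀
  only-b₀ {w} m ad with K-adj {b₀} {w} (k≢ (≤-reflexive (sym tb))) (<⇒≢ (S₁< m)) ad
  ... | inj₁ s = toℕ-injective (trans (proj₁ (star-clique-far (S₁< m) (≤-reflexive (sym tb)) (inj₂ s))) (sym (toℕ-at 0 h₀)))
  ... | inj₂ s = toℕ-injective (trans (proj₁ (star-clique-far (S₁< m) (≤-reflexive (sym tb)) (inj₁ s))) (sym (toℕ-at 0 h₀)))

  only-r : ∀ {w} → w ∈ S₂ → Adj K r w → w ≡ b₀
  only-r (here refl) _ = refl
  only-r {w} (there m) ad with contract-r⁻ ad
  ... | a , a∈ , aw = contradiction (swap⊎ (adj-star {a} {w} aw)) (star-clique-mid (S₁< m) (proj₁ (seg-∈⁻ k δ sA a∈)) (proj₂ (seg-∈⁻ k δ sA a∈)))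
    where
    swap⊎ : ∀ {A B : Set} → A ⊎ B → B ⊎ A
    swap⊎ (inj₁ a) = inj₂ a
    swap⊎ (inj₂ b) = inj₁ b

  L> : ∀ {x} → x ∈ L → k + δ < toℕ x
  L> m = proj₁ (seg-∈⁻ (suc (k + δ)) m′ _ m)

  only-L : ∀ {u w} → u ∈ L → w ∈ L ++ S₃ → Adj K u w → w ≡ r
  only-L {u} {w} mu mw ad with ∈-++⁻ L mw
  ... | inj₁ mw′ = contradiction (K-adj {u} {w} (k≢ (<⇒≤ (L> mu))) (k≢ (<⇒≤ (L> mw′))) ad) (not-star-far (<⇒≤ (L> mu)) (<⇒≤ (L> mw′)))
  ... | inj₂ (here e) = e
  ... | inj₂ (there (here refl)) = contradiction (K-adj {u} {w} (k≢ (<⇒≤ (L> mu))) (k≢ (≤-reflexive (sym tb))) ad) (not-star-far (<⇒≤ (L> mu)) (≤-reflexive (sym tb)))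
  ... | inj₂ (there (there m)) with K-adj {u} {w} (k≢ (<⇒≤ (L> mu))) (<⇒≢ (S₁< m)) ad
  ... | inj₁ s = contradiction (proj₂ (star-clique-far (S₁< m) (<⇒≤ (L> mu)) (inj₂ s))) (λ e → <-irrefl (sym e) (L> mu))
  ... | inj₂ s = contradiction (proj₂ (star-clique-far (S₁< m) (<⇒≤ (L> mu)) (inj₁ s))) (λ e → <-irrefl (sym e) (L> mu))

  b₀∉ : b₀ ∉ S₁
  b₀∉ m = <-irrefl refl (≤-trans (S₁< m) (≤-trans (m≤m+n k δ) (≤-reflexive (sym tb))))

  r∉ : r ∉ S₂
  r∉ (here e) = k≢ ≤-refl (trans (sym tb) (trans (cong toℕ (sym e)) tr))
  r∉ (there m) = <-irrefl tr (S₁< m)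

  unique-S₃ : Unique S₃
  unique-S₃ = unique-∷ r∉ (unique-∷ b₀∉ (unique-seg 0 k sK))

  S₃≤ : ∀ {x} → x ∈ S₃ → toℕ x ≤ k + δ
  S₃≤ (here refl) = ≤-trans (≤-reflexive tr) (m≤m+n k δ)
  S₃≤ (there (here refl)) = ≤-reflexive tb
  S₃≤ (there (there m)) = ≤-trans (<⇒≤ (S₁< m)) (m≤m+n k δ)

  unique-T : Unique (L ++ S₃)
  unique-T = unique-++ (unique-seg (suc (k + δ)) m′ _) unique-S₃ (λ m m′ → ≤⇒≯ (S₃≤ m′) (L> m))

  tree-count : k ! * q * q * q ^ m′ ≤ # {k′ = q} K (L ++ S₃)
  tree-count = ≤-trans (*-monoˡ-≤ (q ^ m′) (*-monoˡ-≤ q (*-monoˡ-≤ q (≤-trans (clique-lower {k′ = q} K S₁ (unique-seg 0 k sK) 0 (trans (+-identityʳ _) (length-seg 0 k sK))) (≤-reflexive (*-identityʳ (# {k′ = q} K S₁)))))))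
    (≤-trans (*-monoˡ-≤ (q ^ m′) (*-monoˡ-≤ q (leaf-lower K S₁ b₀ v₀ b₀∉ only-b₀)))
    (≤-trans (*-monoˡ-≤ (q ^ m′) (leaf-lower K S₂ r b₀ r∉ only-r))
    (subst (λ z → # K S₃ * q ^ z ≤ # K (L ++ S₃)) (length-seg (suc (k + δ)) m′ (≤-reflexive hm)) (leaves-lower {k′ = q} K r L S₃ unique-T only-L))))

  spread : Colouring n k → Colouring n k
  spread c = tabulate λ y → ifDec (y ∈? N) (lookup c r) (lookup c y)

  spread-N : ∀ c {y} → y ∈ N → lookup (spread c) y ≡ lookup c r
  spread-N c {y} m = trans (lookup∘tabulate _ y) (ifDec-yes (y ∈? N) m)

  spread-o : ∀ c {y} → y ∉ N → lookup (spread c) y ≡ lookup c y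
  spread-o c {y} m = trans (lookup∘tabulate _ y) (ifDec-no (y ∈? N) m)

  r∈N : r ∈ N
  r∈N = seg-∈⁺ k δ sA (≤-reflexive (sym tr)) (subst (_< k + δ) (sym tr) k<k+δ)

  N-range : ∀ {x} → x ∈ N → k ≤ toℕ x × toℕ x < k + δ
  N-range = seg-∈⁻ k δ sA

  far∈T : ∀ {y} → k + δ ≤ toℕ y → y ∈ L ++ S₃
  far∈T {y} h with m≤n⇒m<n∨m≡n h
  ... | inj₁ h′ = ∈-++⁺ˡ (seg-∈⁺ (suc (k + δ)) m′ _ h′ (≤-trans (toℕ<n y) (≤-reflexive (sym hm))))
  ... | inj₂ e = ∈-++⁺ʳ L (there (here (toℕ-injective (trans (sym e) (sym tb)))))

  near∈T : ∀ {y} → toℕ y < k → y ∈ L ++ S₃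
  near∈T h = ∈-++⁺ʳ L (there (there (seg-∈⁺ 0 k sK z≤n h)))

  far∉N : ∀ {y} → k + δ ≤ toℕ y → y ∉ N
  far∉N h m = ≤⇒≯ h (proj₂ (N-range m))

  near∉N : ∀ {y} → toℕ y < k → y ∉ N
  near∉N h m = ≤⇒≯ (proj₁ (N-range m)) h

  spread-half : ∀ {c x y} → c ∈ Cols K (L ++ S₃) → Half k δ (toℕ x) (toℕ y) → lookup (spread c) x ≢ lookup (spread c) y
  spread-half {c} {x} {y} mc h@(kk a b ne) e = Cols-proper {G = K} mc (near∈T a) (near∈T b) (subst T (sym (contract-o (≢r (<⇒≢ a)) (≢r (<⇒≢ b)))) (star-adj {x} {y} (inj₁ h)))
    (trans (sym (spread-o c (near∉N a))) (trans e (spread-o c (near∉N b))))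
  spread-half {c} {x} {y} mc h@(ab a b d _) e = Cols-proper {G = K} mc (∈-++⁺ʳ L (here refl)) (far∈T d) (contract-r (≢r (k≢ d)) (seg-∈⁺ k δ sA a b) (star-adj {x} {y} (inj₁ h)))
    (trans (sym (spread-N c (seg-∈⁺ k δ sA a b))) (trans e (spread-o c (far∉N d))))
  spread-half {c} {x} {y} mc h@(sb a b) e = Cols-proper {G = K} mc (near∈T x<k) (far∈T (≤-reflexive (sym b))) (subst T (sym (contract-o (≢r (<⇒≢ x<k)) (≢r (k≢ (≤-reflexive (sym b)))))) (star-adj {x} {y} (inj₁ h)))
    (trans (sym (spread-o c (near∉N x<k))) (trans e (spread-o c (far∉N (≤-reflexive (sym b))))))
    where
    x<k : toℕ x < k
    x<k = subst (_< k) (sym a) (s≤s z≤n)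

  spread-count : # {k′ = q} K (L ++ S₃) ≤ # {k′ = q} Γ V
  spread-count = inj-length spread (unique-Cols K (L ++ S₃)) into inj
    where
    into : ∀ {c} → c ∈ Cols {k′ = q} K (L ++ S₃) → spread c ∈ Cols Γ V
    into {c} m = Cols-intro {G = Γ} pr (λ v nv → contradiction (∈-allFin v) nv)
      where
      pr : ProperOn Γ V (spread c)
      pr {s} {t} _ _ ad e with adj-star {s} {t} ad
      ... | inj₁ h = spread-half m h e
      ... | inj₂ h = spread-half m h (sym e)
    inj : ∀ {c d} → c ∈ Cols {k′ = q} K (L ++ S₃) → d ∈ Cols K (L ++ S₃) → spread c ≡ spread d → c ≡ d
    inj {c} {d} mc md e = Cols-ext {G = K} mc md λ {u} m → go u (u ∈? N) m
      where
      at-u : ∀ u → lookup (spread c) u ≡ lookup (spread d) u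
      at-u u = cong (λ Z → lookup Z u) e
      go : ∀ u → Dec (u ∈ N) → u ∈ L ++ S₃ → lookup c u ≡ lookup d u
      go u (no nu) _ = trans (sym (spread-o c nu)) (trans (at-u u) (spread-o d nu))
      go u (yes iu) m with ∈-++⁻ L m
      ... | inj₁ l = contradiction iu (far∉N (<⇒≤ (L> l)))
      ... | inj₂ (here refl) = trans (sym (spread-N c r∈N)) (trans (at-u r) (spread-N d r∈N))
      ... | inj₂ (there (here refl)) = contradiction iu (far∉N (≤-reflexive (sym tb)))
      ... | inj₂ (there (there s)) = contradiction iu (near∉N (S₁< s))

  lower : k ! * q ^ suc n ≤ # {k′ = q} Γ V * (q ^ k * q ^ δ)
  lower = begin
    k ! * q ^ suc n ≡⟨ cong (λ z → k ! * q ^ z) (trans (cong suc (sym hm)) (l₁ k δ m′)) ⟩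
    k ! * q ^ (2 + m′ + (k + δ)) ≡⟨ cong (k ! *_) (trans (^-distribˡ-+-* q (2 + m′) (k + δ)) (cong (q ^ (2 + m′) *_) (^-distribˡ-+-* q k δ))) ⟩
    k ! * (q * (q * q ^ m′) * (q ^ k * q ^ δ)) ≡⟨ l₂ (k !) q (q ^ m′) (q ^ k * q ^ δ) ⟩
    k ! * q * q * q ^ m′ * (q ^ k * q ^ δ) ≤⟨ *-monoˡ-≤ (q ^ k * q ^ δ) (≤-trans tree-count spread-count) ⟩
    # Γ V * (q ^ k * q ^ δ) ∎
    where
    open ≤-Reasoning
    l₁ : ∀ k δ m → suc (suc (k + δ) + m) ≡ 2 + m + (k + δ)
    l₁ = solve-∀
    l₂ : ∀ f q m c → f * (q * (q * m) * c) ≡ f * q * q * m * c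
    l₂ = solve-∀

-- Copies of the extremal graph on a given vertex set

pos : ∀ {n} → List (Fin n) → Fin n → ℕ
pos [] v = 0
pos (x ∷ xs) v = ifDec (v ≟F x) 0 (suc (pos xs v))

pos-head : ∀ {n} (x : Fin n) xs → pos (x ∷ xs) x ≡ 0
pos-head x xs = ifDec-yes (x ≟F x) refl

pos-< : ∀ {n} xs {v : Fin n} → v ∈ xs → pos xs v < length xs
pos-< (x ∷ xs) {v} m with v ≟F x | m
... | yes _ | _ = s≤s z≤n
... | no ne | here e = contradiction e ne
... | no _ | there m′ = s≤s (pos-< xs m′)

pos-inj : ∀ {n} xs {v w : Fin n} → v ∈ xs → w ∈ xs → pos xs v ≡ pos xs w → v ≡ w
pos-inj (x ∷ xs) {v} {w} mv mw e with v ≟F x | w ≟F x | mv | mw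
... | yes refl | yes refl | _ | _ = refl
... | yes _ | no _ | _ | _ = contradiction e 0≢1+n
... | no _ | yes _ | _ | _ = contradiction (sym e) 0≢1+n
... | no nv | no _ | here e′ | _ = contradiction e′ nv
... | no _ | no nw | there _ | here e′ = contradiction e′ nw
... | no _ | no _ | there a | there b = pos-inj xs a b (suc-injective e)

pos-++ˡ : ∀ {n} xs ys {v : Fin n} → v ∈ xs → pos (xs ++ ys) v ≡ pos xs v
pos-++ˡ (x ∷ xs) ys {v} m with v ≟F x | m
... | yes _ | _ = refl
... | no ne | here e = contradiction e ne
... | no _ | there m′ = cong suc (pos-++ˡ xs ys m′)

pos-++ʳ : ∀ {n} xs ys {v : Fin n} → v ∉ xs → pos (xs ++ ys) v ≡ length xs + pos ys v
pos-++ʳ [] ys _ = refl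
pos-++ʳ (x ∷ xs) ys {v} nm with v ≟F x
... | yes e = contradiction (here e) nm
... | no _ = cong suc (pos-++ʳ xs ys (λ m → nm (there m)))

T-ext : ∀ {a b} → (T a → T b) → (T b → T a) → a ≡ b
T-ext {true} {true} _ _ = refl
T-ext {true} {false} f _ = ⊥-elim (f tt)
T-ext {false} {true} _ g = ⊥-elim (g tt)
T-ext {false} {false} _ _ = refl

#-iso-≤ : ∀ {n k′} (G H : Graph n) → G ≅ H → # {k′ = k′} G (allFin n) ≤ # {k′ = k′} H (allFin n)
#-iso-≤ {n} {k′} G H (σ , e) = inj-length f (unique-Cols G (allFin n)) into inj
  where
  open Inverse σ using (to; from; strictlyInverseˡ; strictlyInverseʳ)
  f : Colouring n (suc k′) → Colouring n (suc k′)
  f X = tabulate λ i → lookup X (from i)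
  at : ∀ X i → lookup (f X) i ≡ lookup X (from i)
  at X i = lookup∘tabulate _ i
  back : ∀ i j → Adj H i j → Adj G (from i) (from j)
  back i j = subst T (sym (trans (e (from i) (from j)) (cong₂ (adj H) (strictlyInverseˡ i) (strictlyInverseˡ j))))
  into : ∀ {X} → X ∈ Cols G (allFin n) → f X ∈ Cols H (allFin n)
  into {X} m = Cols-intro {G = H} (λ {i} {j} _ _ ad eq → Cols-proper {G = G} m (∈-allFin _) (∈-allFin _) (back i j ad) (trans (sym (at X i)) (trans eq (at X j)))) (λ v nv → contradiction (∈-allFin v) nv)
  inj : ∀ {X Y} → X ∈ Cols G (allFin n) → Y ∈ Cols G (allFin n) → f X ≡ f Y → X ≡ Y
  inj {X} {Y} _ _ eq = vec-ext λ v → trans (cong (lookup X) (sym (strictlyInverseʳ v))) (trans (sym (at X (to v))) (trans (cong (λ Z → lookup Z (to v)) eq) (trans (at Y (to v)) (cong (lookup Y) (strictlyInverseʳ v)))))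

-- Numbers the vertices so that s, a and b₀ land on 0, k and k + δ. The pulled back graph H is a
-- copy of the extremal graph with deleted edge a b₀ and added edge s b₀, on the same vertices as
-- the graph it is compared with.
module Layout (n q δ : ℕ) (2≤q : 2 ≤ q) (s : Fin n) (Q′ : List (Fin n)) (a : Fin n) (A′ : List (Fin n)) (b₀ : Fin n) (B : List (Fin n))
  (lenQ : length (s ∷ Q′) ≡ suc q) (lenA : length (a ∷ A′) ≡ δ) (whole : allFin n ↭ (s ∷ Q′) ++ (a ∷ A′) ++ b₀ ∷ B) where

  private
    V = allFin n
    k = suc q
    Γ = Gstar n k δ

  Q A L : List (Fin n)
  Q = s ∷ Q′
  A = a ∷ A′
  L = Q ++ A ++ b₀ ∷ B

  uL : Unique L
  uL = unique-↭ whole (unique-allFin n)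

  ∈L : ∀ v → v ∈ L
  ∈L v = ∈-resp-↭ whole (∈-allFin v)

  cases : ∀ v → v ∈ Q ⊎ (v ∈ A ⊎ v ∈ b₀ ∷ B)
  cases v with ∈-++⁻ Q (∈L v)
  ... | inj₁ m = inj₁ m
  ... | inj₂ m = inj₂ (∈-++⁻ A m)

  Q∉ : ∀ {v} → v ∈ A ++ b₀ ∷ B → v ∉ Q
  Q∉ m m′ = unique-++-disjoint Q uL m′ m

  A∉ : ∀ {v} → v ∈ b₀ ∷ B → v ∉ A
  A∉ m m′ = unique-++-disjoint A (unique-++ʳ Q uL) m′ m

  place : Fin n → ℕ
  place v = pos L v

  p<n : ∀ v → place v < n
  p<n v = ≤-trans (pos-< L (∈L v)) (≤-reflexive (trans (sym (↭-length whole)) (length-allFin n)))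

  p-inj : ∀ {v w} → place v ≡ place w → v ≡ w
  p-inj {v} {w} e = pos-inj L (∈L v) (∈L w) e

  pQ : ∀ {v} → v ∈ Q → place v < k
  pQ m = subst₂ _<_ (sym (pos-++ˡ Q (A ++ b₀ ∷ B) m)) lenQ (pos-< Q m)

  pA-≡ : ∀ {v} → v ∈ A → place v ≡ k + pos A v
  pA-≡ m = trans (pos-++ʳ Q (A ++ b₀ ∷ B) (Q∉ (∈-++⁺ˡ m))) (cong₂ _+_ lenQ (pos-++ˡ A (b₀ ∷ B) m))

  pB-≡ : ∀ {v} → v ∈ b₀ ∷ B → place v ≡ k + δ + pos (b₀ ∷ B) v
  pB-≡ {v} m = trans (pos-++ʳ Q (A ++ b₀ ∷ B) (Q∉ (∈-++⁺ʳ A m))) (trans (cong₂ _+_ lenQ (trans (pos-++ʳ A (b₀ ∷ B) (A∉ m)) (cong (_+ pos (b₀ ∷ B) v) lenA))) (sym (+-assoc k δ (pos (b₀ ∷ B) v))))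

  pA : ∀ {v} → v ∈ A → k ≤ place v × place v < k + δ
  pA m = subst (k ≤_) (sym (pA-≡ m)) (m≤m+n k _) , subst (_< k + δ) (sym (pA-≡ m)) (+-monoʳ-< k (subst (pos A _ <_) lenA (pos-< A m)))

  pB : ∀ {v} → v ∈ b₀ ∷ B → k + δ ≤ place v
  pB m = subst (k + δ ≤_) (sym (pB-≡ m)) (m≤m+n (k + δ) _)

  ps : place s ≡ 0
  ps = trans (pos-++ˡ Q (A ++ b₀ ∷ B) (here refl)) (pos-head s Q′)

  pa : place a ≡ k
  pa = trans (pA-≡ (here refl)) (trans (cong (k +_) (pos-head a A′)) (+-identityʳ k))

  pb : place b₀ ≡ k + δ
  pb = trans (pB-≡ (here refl)) (trans (cong (k + δ +_) (pos-head b₀ B)) (+-identityʳ (k + δ)))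

  isQ : ∀ {v} → place v < k → v ∈ Q
  isQ {v} h with cases v
  ... | inj₁ m = m
  ... | inj₂ (inj₁ m) = contradiction h (≤⇒≯ (proj₁ (pA m)))
  ... | inj₂ (inj₂ m) = contradiction h (≤⇒≯ (≤-trans (m≤m+n k δ) (pB m)))

  isA : ∀ {v} → k ≤ place v → place v < k + δ → v ∈ A
  isA {v} h h′ with cases v
  ... | inj₁ m = contradiction (pQ m) (≤⇒≯ h)
  ... | inj₂ (inj₁ m) = m
  ... | inj₂ (inj₂ m) = contradiction h′ (≤⇒≯ (pB m))

  isB : ∀ {v} → k + δ ≤ place v → v ∈ b₀ ∷ B
  isB {v} h with cases v
  ... | inj₁ m = contradiction (pQ m) (≤⇒≯ (≤-trans (m≤m+n k δ) h))
  ... | inj₂ (inj₁ m) = contradiction (proj₂ (pA m)) (≤⇒≯ h)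
  ... | inj₂ (inj₂ m) = m

  data Edge (u v : Fin n) : Set where
    kk : u ∈ Q → v ∈ Q → u ≢ v → Edge u v
    ab : u ∈ A → v ∈ b₀ ∷ B → ¬ (u ≡ a × v ≡ b₀) → Edge u v
    sb : u ≡ s → v ≡ b₀ → Edge u v

  half⇒edge : ∀ {u v} → Half k δ (place u) (place v) → Edge u v
  half⇒edge (kk x y ne) = kk (isQ x) (isQ y) (λ { refl → ne refl })
  half⇒edge (ab x y z ne) = ab (isA x y) (isB z) (λ { (refl , refl) → ne (pa , pb) })
  half⇒edge (sb x y) = sb (p-inj (trans x (sym ps))) (p-inj (trans y (sym pb)))

  edge⇒half : ∀ {u v} → Edge u v → Half k δ (place u) (place v)
  edge⇒half (kk x y ne) = kk (pQ x) (pQ y) (λ e → ne (p-inj e))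
  edge⇒half (ab x y ne) = ab (proj₁ (pA x)) (proj₂ (pA x)) (pB y) (λ { (e , e′) → ne (p-inj (trans e (sym pa)) , p-inj (trans e′ (sym pb))) })
  edge⇒half (sb refl refl) = sb ps pb

  σ : Fin n → Fin n
  σ v = fromℕ< (p<n v)

  toℕ-σ : ∀ v → toℕ (σ v) ≡ place v
  toℕ-σ v = toℕ-fromℕ< (p<n v)

  σ-inj : ∀ {v w} → σ v ≡ σ w → v ≡ w
  σ-inj {v} {w} e = p-inj (trans (sym (toℕ-σ v)) (trans (cong toℕ e) (toℕ-σ w)))

  preimage : ∀ i → ∃ λ v → v ∈ V × i ≡ σ v
  preimage i = ∈-map⁻ σ (unique-full (unique-map σ (unique-allFin n) (λ _ _ → σ-inj)) (trans (length-map σ V) (length-allFin n)) i)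

  bij : Fin n ↔ Fin n
  bij = mk↔ₛ′ σ (λ i → proj₁ (preimage i)) (λ i → sym (proj₂ (proj₂ (preimage i)))) (λ v → σ-inj (sym (proj₂ (proj₂ (preimage (σ v))))))

  H : Graph n
  H = record { adj = λ u v → adj Γ (σ u) (σ v) ; sym = λ u v → adj-sym Γ (σ u) (σ v) ; irrefl = λ v → adj-irrefl Γ (σ v) }

  H≅ : H ≅ Γ
  H≅ = bij , λ u v → refl

  H-edge : ∀ {u v} → Adj H u v → Edge u v ⊎ Edge v u
  H-edge {u} {v} ad with subst₂ (Star k δ) (toℕ-σ u) (toℕ-σ v) (adj⇒star k δ {toℕ (σ u)} {toℕ (σ v)} ad)
  ... | inj₁ h = inj₁ (half⇒edge h)
  ... | inj₂ h = inj₂ (half⇒edge h)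

  edge-H : ∀ {u v} → Edge u v ⊎ Edge v u → Adj H u v
  edge-H {u} {v} h = star⇒adj k δ {toℕ (σ u)} {toℕ (σ v)} (s≤s z≤n) (subst₂ (Star k δ) (sym (toℕ-σ u)) (sym (toℕ-σ v)) (go h))
    where
    go : Edge u v ⊎ Edge v u → Star k δ (place u) (place v)
    go (inj₁ e) = inj₁ (edge⇒half e)
    go (inj₂ e) = inj₂ (edge⇒half e)

  iso : ∀ (G : Graph n) → (∀ {u v} → Adj G u v → Edge u v ⊎ Edge v u) → (∀ {u v} → Edge u v → Adj G u v) → G ≅ Γ
  iso G f g = bij , λ u v → T-ext {adj G u v} (λ ad → edge-H {u} {v} (f ad)) (λ h → back (H-edge {u} {v} h))
    where
    back : ∀ {u v} → Edge u v ⊎ Edge v u → Adj G u v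
    back (inj₁ e) = g e
    back {u} {v} (inj₂ e) = Adj-sym G {v} {u} (g e)

  H-proper : ∀ (X : Colouring n k) → (∀ {u v} → Edge u v → lookup X u ≢ lookup X v) → X ∈ Cols H V
  H-proper X h = Cols-intro {G = H} pr (λ v nv → contradiction (∈-allFin v) nv)
    where
    pr : ProperOn H V X
    pr {u} {v} _ _ ad e with H-edge {u} {v} ad
    ... | inj₁ ed = h ed e
    ... | inj₂ ed = h ed (sym e)

  private
    1<k : 1 < k
    1<k = s≤s (≤-trans (s≤s z≤n) 2≤q)

    2<k : 2 < k
    2<k = s≤s 2≤q

  one two : Fin k
  one = fromℕ< 1<k
  two = fromℕ< 2<k

  -- A colouring of the copy that equates the two ends of the deleted edge: a and b₀ get colour 1,
  -- the rest of A colour 0 and the rest of the large part colour 2. The clique is coloured by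
  -- position, so s has colour 0 and the edge s b₀ is respected.
  tint : Fin n → Fin k
  tint v with place v <? k
  ... | yes h = fromℕ< h
  ... | no _ = ifDec (v ≟F a) one (ifDec (v ≟F b₀) one (ifDec (place v <? k + δ) fz two))

  tint-Q : ∀ {v} → v ∈ Q → toℕ (tint v) ≡ place v
  tint-Q {v} m with place v <? k
  ... | yes h = toℕ-fromℕ< h
  ... | no nh = contradiction (pQ m) nh

  ≢-A : ∀ {v w} → v ∈ A → w ∈ b₀ ∷ B → v ≢ w
  ≢-A m m′ refl = A∉ m′ m

  tint-a : tint a ≡ one
  tint-a with place a <? k
  ... | yes h = contradiction h (≤⇒≯ (≤-reflexive (sym pa)))
  ... | no _ = ifDec-yes (a ≟F a) refl

  tint-b₀ : tint b₀ ≡ one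
  tint-b₀ with place b₀ <? k
  ... | yes h = contradiction h (≤⇒≯ (≤-trans (m≤m+n k δ) (≤-reflexive (sym pb))))
  ... | no _ = trans (ifDec-no (b₀ ≟F a) (λ e → ≢-A (here refl) (here refl) (sym e))) (ifDec-yes (b₀ ≟F b₀) refl)

  tint-A : ∀ {v} → v ∈ A → v ≢ a → tint v ≡ fz
  tint-A {v} m ne with place v <? k
  ... | yes h = contradiction h (≤⇒≯ (proj₁ (pA m)))
  ... | no _ = trans (ifDec-no (v ≟F a) ne) (trans (ifDec-no (v ≟F b₀) (≢-A m (here refl))) (ifDec-yes (place v <? k + δ) (proj₂ (pA m))))

  tint-B : ∀ {v} → v ∈ b₀ ∷ B → v ≢ b₀ → tint v ≡ two
  tint-B {v} m ne with place v <? k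
  ... | yes h = contradiction h (≤⇒≯ (≤-trans (m≤m+n k δ) (pB m)))
  ... | no _ = trans (ifDec-no (v ≟F a) (λ e → ≢-A (here refl) m (sym e))) (trans (ifDec-no (v ≟F b₀) ne) (ifDec-no (place v <? k + δ) (≤⇒≯ (pB m))))

  toℕ-one : toℕ one ≡ 1
  toℕ-one = toℕ-fromℕ< 1<k

  toℕ-two : toℕ two ≡ 2
  toℕ-two = toℕ-fromℕ< 2<k

  0≢one : fz ≢ one
  0≢one e = 0≢1+n (trans (cong toℕ e) toℕ-one)

  0≢two : fz ≢ two
  0≢two e = 0≢1+n (trans (cong toℕ e) toℕ-two)

  one≢two : one ≢ two
  one≢two e = 1+n≢n (sym (trans (sym toℕ-one) (trans (cong toℕ e) toℕ-two)))

  tint-proper : ∀ {u v} → Edge u v → tint u ≢ tint v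
  tint-proper (kk mu mv ne) e = ne (p-inj (trans (sym (tint-Q mu)) (trans (cong toℕ e) (tint-Q mv))))
  tint-proper {u} {v} (ab mu mv ne) e with u ≟F a | v ≟F b₀
  ... | yes refl | yes refl = ne (refl , refl)
  ... | yes refl | no nb = one≢two (trans (sym tint-a) (trans e (tint-B mv nb)))
  ... | no na | yes refl = 0≢one (trans (sym (tint-A mu na)) (trans e tint-b₀))
  ... | no na | no nb = 0≢two (trans (sym (tint-A mu na)) (trans e (tint-B mv nb)))
  tint-proper (sb refl refl) e = 0≢1+n (trans (sym ps) (trans (sym (tint-Q (here refl))) (trans (cong toℕ e) (trans (cong toℕ tint-b₀) toℕ-one))))

  special : Colouring n k
  special = tabulate tint

  special-∈ : special ∈ Cols H V
  special-∈ = H-proper special λ {u} {v} ed e → tint-proper ed (trans (sym (lookup∘tabulate tint u)) (trans e (lookup∘tabulate tint v)))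

  special-ends : lookup special a ≡ lookup special b₀
  special-ends = trans (lookup∘tabulate tint a) (trans tint-a (trans (sym tint-b₀) (sym (lookup∘tabulate tint b₀))))

  -- Strict, because the copy also has the colouring special, in which a and b₀ agree.
  fewer : ∀ (G : Graph n) (f : Colouring n k → Colouring n k) →
    (∀ {X} → X ∈ Cols G V → ∀ {u v} → Edge u v → lookup (f X) u ≢ lookup (f X) v) →
    (∀ {X} → X ∈ Cols G V → lookup (f X) a ≢ lookup (f X) b₀) →
    (∀ {X Y} → X ∈ Cols G V → Y ∈ Cols G V → f X ≡ f Y → X ≡ Y) → # {k′ = q} G (allFin n) < # {k′ = q} (Gstar n (suc q) δ) (allFin n)
  fewer G f pr sep inj = ≤-trans (subst (λ l → suc l ≤ # H V) (length-map f (Cols G V)) (unique-⊆-length {xs = special ∷ map f (Cols G V)}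
      (unique-∷ new (unique-map f (unique-Cols G V) inj)) sub)) (#-iso-≤ {k′ = q} H Γ H≅)
    where
    new : special ∉ map f (Cols G V)
    new m with ∈-map⁻ f m
    ... | X , mX , e = sep mX (trans (cong (λ Z → lookup Z a) (sym e)) (trans special-ends (cong (λ Z → lookup Z b₀) e)))
    sub : ∀ {Z} → Z ∈ special ∷ map f (Cols G V) → Z ∈ Cols H V
    sub (here refl) = special-∈
    sub (there m) with ∈-map⁻ f m
    ... | X , mX , refl = H-proper (f X) (pr mX)

-- Comparing the near-extremal graphs with the extremal one

swap-colours : ∀ {k} → Fin k → Fin k → Fin k → Fin k
swap-colours α β γ = ifDec (γ ≟F α) β (ifDec (γ ≟F β) α γ)

swap-left : ∀ {k} (α β : Fin k) → swap-colours α β α ≡ β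
swap-left α β = ifDec-yes (α ≟F α) refl

swap-right : ∀ {k} (α β : Fin k) → swap-colours α β β ≡ α
swap-right α β with β ≟F α
... | yes e = e
... | no _ = ifDec-yes (β ≟F β) refl

swap-other : ∀ {k} {α β γ : Fin k} → γ ≢ α → γ ≢ β → swap-colours α β γ ≡ γ
swap-other {α = α} {β} {γ} na nb = trans (ifDec-no (γ ≟F α) na) (ifDec-no (γ ≟F β) nb)

swap-invol : ∀ {k} (α β γ : Fin k) → swap-colours α β (swap-colours α β γ) ≡ γ
swap-invol α β γ = by (γ ≟F α) (γ ≟F β)
  where
  by : Dec (γ ≡ α) → Dec (γ ≡ β) → swap-colours α β (swap-colours α β γ) ≡ γ
  by (yes refl) _ = trans (cong (swap-colours γ β) (swap-left γ β)) (swap-right γ β)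
  by (no _) (yes refl) = trans (cong (swap-colours α γ) (swap-right α γ)) (swap-left α γ)
  by (no na) (no nb) = trans (cong (swap-colours α β) (swap-other na nb)) (swap-other na nb)

swap-inj : ∀ {k} (α β : Fin k) {γ γ′} → swap-colours α β γ ≡ swap-colours α β γ′ → γ ≡ γ′
swap-inj α β {γ} {γ′} e = trans (sym (swap-invol α β γ)) (trans (cong (swap-colours α β) e) (swap-invol α β γ′))

Outcome : ∀ {n} → Graph n → ℕ → ℕ → Set
Outcome {n} G q δ = # {k′ = q} G (allFin n) < # {k′ = q} (Gstar n (suc q) δ) (allFin n) ⊎ G ≅ Gstar n (suc q) δ

module _ {n p δ : ℕ} (2≤p : 2 ≤ p) (G : Graph n) (A B : List (Fin n)) (lenA : length A ≡ δ) (cm : Common G p A B) where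

  private
    V = allFin n
    q = suc p
    k = 2 + p
    2≤q : 2 ≤ q
    2≤q = ≤-trans 2≤p (n≤1+n p)

  open Common cm

  -- On the clique the colours of a and b₀ are exchanged, so that the condition on the edge a s
  -- becomes the one on s b₀. Since a and b₀ keep their colours, the exchange can be undone.
  family₂ : Family₂ G p A B → (∃ λ b → b ∈ B) → Outcome G q δ
  family₂ fam (b₀ , b₀∈) = inj₁ (fewer G f pr sep inj)
    where
    open Family₂ fam renaming (Q to Q₀; whole to whole₀; s to s₀; a to a₀)
    Q′ = proj₁ (split-∈ s∈)
    Q↭ = proj₂ (split-∈ s∈)
    A′ = proj₁ (split-∈ a∈)
    A↭ = proj₂ (split-∈ a∈)
    B′ = proj₁ (split-∈ b₀∈)
    B↭ = proj₂ (split-∈ b₀∈)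
    open Layout n q δ 2≤q s₀ Q′ a₀ A′ b₀ B′ (trans (sym (↭-length Q↭)) length-Q) (trans (sym (↭-length A↭)) lenA) (↭trans whole₀ (↭-++⁺ Q↭ (↭-++⁺ A↭ B↭)))
      hiding (A)
    inQ : ∀ {x} → x ∈ Q → x ∈ Q₀
    inQ = ∈-resp-↭ (↭-sym Q↭)
    inA : ∀ {x} → x ∈ a₀ ∷ A′ → x ∈ A
    inA = ∈-resp-↭ (↭-sym A↭)
    inB : ∀ {x} → x ∈ b₀ ∷ B′ → x ∈ B
    inB = ∈-resp-↭ (↭-sym B↭)
    f : Colouring n k → Colouring n k
    f X = tabulate λ v → ifDec (v ∈? Q) (swap-colours (lookup X a₀) (lookup X b₀) (lookup X v)) (lookup X v)
    f-in : ∀ X {v} → v ∈ Q → lookup (f X) v ≡ swap-colours (lookup X a₀) (lookup X b₀) (lookup X v)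
    f-in X {v} m = trans (lookup∘tabulate _ v) (ifDec-yes (v ∈? Q) m)
    f-out : ∀ X {v} → v ∉ Q → lookup (f X) v ≡ lookup X v
    f-out X {v} m = trans (lookup∘tabulate _ v) (ifDec-no (v ∈? Q) m)
    a∉ : a₀ ∉ Q
    a∉ = Q∉ (here refl)
    b∉ : b₀ ∉ Q
    b∉ = Q∉ (∈-++⁺ʳ (a₀ ∷ A′) (here refl))
    sep : ∀ {X} → X ∈ Cols G V → lookup (f X) a₀ ≢ lookup (f X) b₀
    sep {X} m e = Cols-proper {G = G} m (∈-allFin a₀) (∈-allFin b₀) (complete a∈ b₀∈) (trans (sym (f-out X a∉)) (trans e (f-out X b∉)))
    pr : ∀ {X} → X ∈ Cols G V → ∀ {u v} → Edge u v → lookup (f X) u ≢ lookup (f X) v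
    pr {X} m {u} {v} (kk mu mv ne) e = Cols-proper {G = G} m (∈-allFin u) (∈-allFin v) (clique-Q (inQ mu) (inQ mv) ne) (swap-inj (lookup X a₀) (lookup X b₀) (trans (sym (f-in X mu)) (trans e (f-in X mv))))
    pr {X} m {u} {v} (ab mu mv _) e = Cols-proper {G = G} m (∈-allFin u) (∈-allFin v) (complete (inA mu) (inB mv)) (trans (sym (f-out X (Q∉ (∈-++⁺ˡ mu)))) (trans e (f-out X (Q∉ (∈-++⁺ʳ (a₀ ∷ A′) mv)))))
    pr {X} m (sb refl refl) e = Cols-proper {G = G} m (∈-allFin a₀) (∈-allFin s₀) joined
      (swap-inj (lookup X a₀) (lookup X b₀) (trans (swap-left (lookup X a₀) (lookup X b₀)) (trans (sym (f-out X b∉)) (trans (sym e) (f-in X (here refl))))))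
    inj : ∀ {X Y} → X ∈ Cols G V → Y ∈ Cols G V → f X ≡ f Y → X ≡ Y
    inj {X} {Y} _ _ e = vec-ext λ v → go v (v ∈? Q)
      where
      at : ∀ v → lookup (f X) v ≡ lookup (f Y) v
      at v = cong (λ Z → lookup Z v) e
      off : ∀ {v} → v ∉ Q → lookup X v ≡ lookup Y v
      off {v} m = trans (sym (f-out X m)) (trans (at v) (f-out Y m))
      go : ∀ v → Dec (v ∈ Q) → lookup X v ≡ lookup Y v
      go v (no m) = off m
      go v (yes m) = swap-inj (lookup X a₀) (lookup X b₀) (trans (sym (f-in X m)) (trans (at v) (trans (f-in Y m) (cong₂ (λ α β → swap-colours α β (lookup Y v)) (sym (off a∉)) (sym (off b∉))))))

  -- If some vertex of A is not adjacent to y, the minimum degree joins y to the rest of A, and G is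
  -- the copy itself. Otherwise G contains the copy and one edge a y more, so the identity maps its
  -- colourings and misses the special one.
  family₃ : Family₃ G p A B → (∀ v → δ ≤ length (nbrs G V v)) → 1 ≤ δ → Outcome G q δ
  family₃ fam deg 1≤δ with anyF? (λ a → (a ∈? A) ×-dec ¬? (T? (adj G a (Family₃.y fam))))
  ... | yes (a₀ , a₀∈ , nadj) = inj₂ (iso G to from)
    where
    open Family₃ fam renaming (Q to Q₀; whole to whole₀; s to s₀)
    Q′ = proj₁ (split-∈ s∈)
    Q↭ = proj₂ (split-∈ s∈)
    A′ = proj₁ (split-∈ a₀∈)
    A↭ = proj₂ (split-∈ a₀∈)
    open Layout n q δ 2≤q s₀ Q′ a₀ A′ y B (trans (sym (↭-length Q↭)) length-Q) (trans (sym (↭-length A↭)) lenA) (↭trans whole₀ (↭-++⁺ Q↭ (++⁺ʳ (y ∷ B) A↭)))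
      hiding (A)
    inQ : ∀ {x} → x ∈ Q → x ∈ Q₀
    inQ = ∈-resp-↭ (↭-sym Q↭)
    toQ : ∀ {x} → x ∈ Q₀ → x ∈ Q
    toQ = ∈-resp-↭ Q↭
    inA : ∀ {x} → x ∈ a₀ ∷ A′ → x ∈ A
    inA = ∈-resp-↭ (↭-sym A↭)
    toA : ∀ {x} → x ∈ A → x ∈ a₀ ∷ A′
    toA = ∈-resp-↭ A↭
    y-full : ∀ {x} → x ∈ A → x ≢ a₀ → Adj G y x
    y-full m ne = nbrs-adj G V (⊆-full {ys = s₀ ∷ A′} _≟F_ (unique-nbrs G y (unique-allFin n)) sub (≤-trans (≤-reflexive (trans (sym (↭-length A↭)) lenA)) (deg y)) (there (A′-in (toA m) ne)))
      where
      sub : ∀ {x} → x ∈ nbrs G V y → x ∈ s₀ ∷ A′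
      sub mx with only-y (nbrs-adj G V mx)
      ... | inj₁ refl = here refl
      ... | inj₂ i with toA i
      ... | here refl = contradiction (Adj-sym G (nbrs-adj G V mx)) nadj
      ... | there i′ = there i′
      A′-in : ∀ {x} → x ∈ a₀ ∷ A′ → x ≢ a₀ → x ∈ A′
      A′-in (there i) _ = i
      A′-in (here e) ne = contradiction e ne
    from : ∀ {u v} → Edge u v → Adj G u v
    from (kk mu mv ne) = clique-Q (inQ mu) (inQ mv) ne
    from (ab mu (here refl) ne) = Adj-sym G (y-full (inA mu) (λ e → ne (e , refl)))
    from (ab mu (there mv) _) = complete (inA mu) mv
    from (sb refl refl) = Adj-sym G joined
    to : ∀ {u v} → Adj G u v → Edge u v ⊎ Edge v u
    to {u} {v} ad with cases u | cases v
    ... | inj₁ mu | _ with only-Q (inQ mu) ad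
    ... | inj₁ mv = inj₁ (kk mu (toQ mv) (λ { refl → Adj-irrefl G ad }))
    ... | inj₂ (e , e′) = inj₁ (sb e e′)
    to {u} {v} ad | inj₂ _ | inj₁ mv with only-Q (inQ mv) (Adj-sym G ad)
    ... | inj₁ mu = inj₂ (kk mv (toQ mu) (λ { refl → Adj-irrefl G ad }))
    ... | inj₂ (e , e′) = inj₂ (sb e e′)
    to {u} {v} ad | inj₂ (inj₁ mu) | inj₂ (inj₁ mv) = contradiction ad (independent (inA mu) (inA mv))
    to {u} {v} ad | inj₂ (inj₁ mu) | inj₂ (inj₂ mv) = inj₁ (ab mu mv (λ { (refl , refl) → nadj ad }))
    to {u} {v} ad | inj₂ (inj₂ mu) | inj₂ (inj₁ mv) = inj₂ (ab mv mu (λ { (refl , refl) → nadj (Adj-sym G ad) }))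
    to {u} {v} ad | inj₂ (inj₂ (here refl)) | inj₂ (inj₂ mv) with only-y ad
    ... | inj₁ refl = contradiction (here refl) (Q∉ (∈-++⁺ʳ (a₀ ∷ A′) mv))
    ... | inj₂ m = contradiction (toA m) (A∉ mv)
    to {u} {v} ad | inj₂ (inj₂ (there mu)) | inj₂ (inj₂ mv) = contradiction (toA (only-A mu ad)) (A∉ mv)
  ... | no full = inj₁ (fewer G id pr sep (λ _ _ e → e))
    where
    open Family₃ fam renaming (Q to Q₀; whole to whole₀; s to s₀)
    a₀ = proj₁ (head-∈ A (≤-trans 1≤δ (≤-reflexive (sym lenA))))
    a₀∈ = proj₂ (head-∈ A (≤-trans 1≤δ (≤-reflexive (sym lenA))))
    Q′ = proj₁ (split-∈ s∈)
    Q↭ = proj₂ (split-∈ s∈)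
    A′ = proj₁ (split-∈ a₀∈)
    A↭ = proj₂ (split-∈ a₀∈)
    open Layout n q δ 2≤q s₀ Q′ a₀ A′ y B (trans (sym (↭-length Q↭)) length-Q) (trans (sym (↭-length A↭)) lenA) (↭trans whole₀ (↭-++⁺ Q↭ (++⁺ʳ (y ∷ B) A↭)))
      hiding (A)
    adj-y : ∀ {x} → x ∈ A → Adj G x y
    adj-y {x} m with T? (adj G x y)
    ... | yes ad = ad
    ... | no na = contradiction (x , m , na) full
    sep : ∀ {X} → X ∈ Cols G V → lookup X a₀ ≢ lookup X y
    sep m = Cols-proper {G = G} m (∈-allFin a₀) (∈-allFin y) (adj-y a₀∈)
    adjacent : ∀ {u v} → Edge u v → Adj G u v
    adjacent (kk mu mv ne) = clique-Q (∈-resp-↭ (↭-sym Q↭) mu) (∈-resp-↭ (↭-sym Q↭) mv) ne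
    adjacent (ab mu (here refl) _) = adj-y (∈-resp-↭ (↭-sym A↭) mu)
    adjacent (ab mu (there mv) _) = complete (∈-resp-↭ (↭-sym A↭) mu) mv
    adjacent (sb refl refl) = Adj-sym G joined
    pr : ∀ {X} → X ∈ Cols G V → ∀ {u v} → Edge u v → lookup X u ≢ lookup X v
    pr m {u} {v} e = Cols-proper {G = G} m (∈-allFin u) (∈-allFin v) (adjacent e)

-- The first family: a clique through the contracted vertex

repeat : ∀ {n k} → Colouring n k → Fin n → List (Fin n) → Fin n
repeat X d [] = d
repeat X d (x ∷ xs) = ifDec (lookup X x ∈? map (lookup X) xs) x (repeat X d xs)

repeat-cong : ∀ {n k} (X Y : Colouring n k) d xs → (∀ {x} → x ∈ xs → lookup X x ≡ lookup Y x) → repeat X d xs ≡ repeat Y d xs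
repeat-cong X Y d [] _ = refl
repeat-cong X Y d (x ∷ xs) h = trans (cong (ifDec (lookup X x ∈? map (lookup X) xs) x) (repeat-cong X Y d xs (λ m → h (there m))))
  (cong₂ (λ c l → ifDec (c ∈? l) x (repeat Y d xs)) (h (here refl)) (colours xs (λ m → h (there m))))
  where
  colours : ∀ xs → (∀ {x} → x ∈ xs → lookup X x ≡ lookup Y x) → map (lookup X) xs ≡ map (lookup Y) xs
  colours [] _ = refl
  colours (x ∷ xs) h = cong₂ _∷_ (h (here refl)) (colours xs (λ m → h (there m)))

Repeats : ∀ {n k} → Colouring n k → List (Fin n) → Set
Repeats X A = ∃₂ λ a b → a ∈ A × b ∈ A × a ≢ b × lookup X a ≡ lookup X b

repeats? : ∀ {n k} (X : Colouring n k) A → Dec (Repeats X A)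
repeats? X A = anyF? (λ a → anyF? (λ b → (a ∈? A) ×-dec ((b ∈? A) ×-dec (¬? (a ≟F b) ×-dec (lookup X a ≟F lookup X b)))))

repeat-spec : ∀ {n k} (X : Colouring n k) d xs → Unique xs → Repeats X xs →
  repeat X d xs ∈ xs × (∃ λ b → b ∈ xs × b ≢ repeat X d xs × lookup X b ≡ lookup X (repeat X d xs))
repeat-spec X d (x ∷ xs) u@(_ ∷ u′) (a , b , ma , mb , ne , e) with lookup X x ∈? map (lookup X) xs
... | yes m with ∈-map⁻ (lookup X) m
... | y , y∈ , e′ = here refl , y , there y∈ , (λ { refl → unique-head u y∈ }) , sym e′
repeat-spec X d (x ∷ xs) u@(_ ∷ u′) (a , b , ma , mb , ne , e) | no nm with repeat-spec X d xs u′ (tail ma mb)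
  where
  tail : a ∈ x ∷ xs → b ∈ x ∷ xs → Repeats X xs
  tail (here refl) (here refl) = contradiction refl ne
  tail (here refl) (there mb) = contradiction (subst (_∈ map (lookup X) xs) (sym e) (∈-map⁺ (lookup X) mb)) nm
  tail (there ma) (here refl) = contradiction (subst (_∈ map (lookup X) xs) e (∈-map⁺ (lookup X) ma)) nm
  tail (there ma) (there mb) = a , b , ma , mb , ne , e
... | m , b′ , m′ , ne′ , e′ = there m , b′ , there m′ , ne′ , e′

-- Only q clique vertices are given, so a vertex bs of B is taken into the clique of the copy. In G
-- it is joined to A, in the copy to Q₀ and to b₀. Colourings therefore have to be changed on bs ∷
-- Q₀, and nowhere else.
module Overlap {n p δ : ℕ} (2≤p : 2 ≤ p) (G : Graph n) (bs a b₀ : Fin n) (Q₀ A′ B′ : List (Fin n))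
  (lenQ : length (bs ∷ Q₀) ≡ 2 + p) (lenA : length (a ∷ A′) ≡ δ) (whole : allFin n ↭ (bs ∷ Q₀) ++ (a ∷ A′) ++ b₀ ∷ B′)
  (complete : ∀ {x b} → x ∈ a ∷ A′ → b ∈ bs ∷ b₀ ∷ B′ → Adj G x b) (clique-Q : ∀ {x y} → x ∈ Q₀ → y ∈ Q₀ → x ≢ y → Adj G x y) where

  private
    V = allFin n
    q = suc p
    k = 2 + p

  open Layout n q δ (≤-trans 2≤p (n≤1+n p)) bs Q₀ a A′ b₀ B′ lenQ lenA whole

  bs∉Q₀ : bs ∉ Q₀
  bs∉Q₀ = unique-head (unique-++ˡ Q uL)
  A-off : ∀ {x} → x ∈ A → x ∉ Q
  A-off m = Q∉ (∈-++⁺ˡ m)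
  B-off : ∀ {x} → x ∈ b₀ ∷ B′ → x ∉ Q
  B-off m = Q∉ (∈-++⁺ʳ A m)

  -- Recolours the clique bs ∷ Q₀ of the copy, given a colour α of A that is missing on Q₀; the colour of bs is encoded
  -- by permuting the colours of the clique.
  η : Fin k → Colouring n k → Fin k
  η α X = swap-colours α (lookup X b₀) (lookup X bs)

  recolour : Fin k → Colouring n k → Colouring n k
  recolour α X = tabulate λ v → ifDec (v ≟F bs) (η α X) (ifDec (v ∈? Q₀) (swap-colours α (η α X) (lookup X v)) (lookup X v))

  rc-bs : ∀ α X → lookup (recolour α X) bs ≡ η α X
  rc-bs α X = trans (lookup∘tabulate _ bs) (ifDec-yes (bs ≟F bs) refl)

  rc-Q : ∀ α X {v} → v ∈ Q₀ → lookup (recolour α X) v ≡ swap-colours α (η α X) (lookup X v)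
  rc-Q α X {v} m = trans (lookup∘tabulate _ v) (trans (ifDec-no (v ≟F bs) (λ { refl → bs∉Q₀ m })) (ifDec-yes (v ∈? Q₀) m))

  rc-o : ∀ α X {v} → v ∉ Q → lookup (recolour α X) v ≡ lookup X v
  rc-o α X {v} m = trans (lookup∘tabulate _ v) (trans (ifDec-no (v ≟F bs) (λ e → m (here e))) (ifDec-no (v ∈? Q₀) (λ i → m (there i))))

  Missing : Fin k → Colouring n k → Set
  Missing α X = (∃ λ x → x ∈ A × lookup X x ≡ α) × (∀ {v} → v ∈ Q₀ → lookup X v ≢ α)

  outer : ∀ {f X : Colouring n k} → X ∈ Cols G V → (∀ {v} → v ∉ Q → lookup f v ≡ lookup X v) → ∀ {u v} → u ∈ A → v ∈ b₀ ∷ B′ → lookup f u ≢ lookup f v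
  outer m h {u} {v} mu mv e = Cols-proper {G = G} m (∈-allFin u) (∈-allFin v) (complete mu (there mv)) (trans (sym (h (A-off mu))) (trans e (h (B-off mv))))

  -- As α occurs on A, bs does not have it, and this keeps the new colour η of bs apart from the
  -- colour of b₀. Exchanging α, which Q₀ lacks, with η removes η from Q₀.
  recolour-proper : ∀ {α X} → X ∈ Cols G V → Missing α X → ∀ {u v} → Edge u v → lookup (recolour α X) u ≢ lookup (recolour α X) v
  recolour-proper {α} {X} m ((x , x∈ , xα) , miss) = go
    where
    β≢ : lookup X bs ≢ α
    β≢ e = Cols-proper {G = G} m (∈-allFin x) (∈-allFin bs) (complete x∈ (here refl)) (trans xα (sym e))
    bs-Q : ∀ {v} → v ∈ Q₀ → lookup (recolour α X) bs ≢ lookup (recolour α X) v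
    bs-Q mv e = miss mv (sym (swap-inj α (η α X) (trans (swap-left α (η α X)) (trans (sym (rc-bs α X)) (trans e (rc-Q α X mv))))))
    go : ∀ {u v} → Edge u v → lookup (recolour α X) u ≢ lookup (recolour α X) v
    go (kk (here refl) (here refl) ne) _ = ne refl
    go (kk (here refl) (there mv) _) e = bs-Q mv e
    go (kk (there mu) (here refl) _) e = bs-Q mu (sym e)
    go {u} {v} (kk (there mu) (there mv) ne) e = Cols-proper {G = G} m (∈-allFin u) (∈-allFin v) (clique-Q mu mv ne)
      (swap-inj α (η α X) (trans (sym (rc-Q α X mu)) (trans e (rc-Q α X mv))))
    go (ab mu mv _) e = outer {recolour α X} m (rc-o α X) mu mv e
    go (sb refl refl) e = β≢ (swap-inj α (lookup X b₀) (trans (trans (sym (rc-bs α X)) (trans e (rc-o α X (B-off (here refl))))) (sym (swap-left α (lookup X b₀)))))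

  -- For a given α, η is visible as the new colour of bs, and b₀ is unchanged; both exchanges can
  -- then be reversed.
  recolour-inj : ∀ {α X Y} → recolour α X ≡ recolour α Y → X ≡ Y
  recolour-inj {α} {X} {Y} e = vec-ext λ v → go v (cases v)
    where
    at : ∀ v → lookup (recolour α X) v ≡ lookup (recolour α Y) v
    at v = cong (λ Z → lookup Z v) e
    off : ∀ {v} → v ∉ Q → lookup X v ≡ lookup Y v
    off {v} m = trans (sym (rc-o α X m)) (trans (at v) (rc-o α Y m))
    η≡ : η α X ≡ η α Y
    η≡ = trans (sym (rc-bs α X)) (trans (at bs) (rc-bs α Y))
    go : ∀ v → v ∈ Q ⊎ (v ∈ A ⊎ v ∈ b₀ ∷ B′) → lookup X v ≡ lookup Y v
    go v (inj₂ (inj₁ m)) = off (A-off m)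
    go v (inj₂ (inj₂ m)) = off (B-off m)
    go v (inj₁ (here refl)) = swap-inj α (lookup X b₀) (trans η≡ (cong (λ γ → swap-colours α γ (lookup Y bs)) (sym (off (B-off (here refl))))))
    go v (inj₁ (there m)) = swap-inj α (η α X) (trans (sym (rc-Q α X m)) (trans (at v) (trans (rc-Q α Y m) (cong (λ z → swap-colours α z (lookup Y v)) (sym η≡)))))

  dominated : (∀ {v} → v ∈ Q₀ → Adj G a v) → # {k′ = suc p} G (allFin n) < # {k′ = suc p} (Gstar n (suc (suc p)) δ) (allFin n)
  dominated dom = fewer G f proper separated injective
    where
    f : Colouring n k → Colouring n k
    f X = recolour (lookup X a) X
    missing : ∀ {X} → X ∈ Cols G V → Missing (lookup X a) X
    missing m = (a , here refl , refl) , λ {v} mv e → Cols-proper {G = G} m (∈-allFin a) (∈-allFin v) (dom mv) (sym e)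
    proper : ∀ {X} → X ∈ Cols G V → ∀ {u v} → Edge u v → lookup (f X) u ≢ lookup (f X) v
    proper {X} m {u} {v} e = recolour-proper {lookup X a} {X} m (missing m) {u} {v} e
    separated : ∀ {X} → X ∈ Cols G V → lookup (f X) a ≢ lookup (f X) b₀
    separated {X} m = outer {f X} {X} m (rc-o (lookup X a) X) {a} {b₀} (here refl) (here refl)
    ends : ∀ {X Y} → f X ≡ f Y → lookup X a ≡ lookup Y a
    ends {X} {Y} e = trans (sym (rc-o (lookup X a) X (A-off (here refl)))) (trans (cong (λ Z → lookup Z a) e) (rc-o (lookup Y a) Y (A-off (here refl))))
    injective : ∀ {X Y} → X ∈ Cols G V → Y ∈ Cols G V → f X ≡ f Y → X ≡ Y
    injective {X} {Y} _ _ e = recolour-inj {lookup X a} {X} {Y} (trans e (cong (λ α → recolour α Y) (sym (ends {X} {Y} e))))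

  -- Between A and Q₀ only the matching π is missing. A colour repeated on A is therefore absent
  -- from Q₀, as each vertex of Q₀ avoids just one vertex of A, and `recolour` applies. If A is
  -- rainbow, its q colours leave one colour ω, which bs and b₀ must have, while v in Q₀ has ω or
  -- the colour of π v.
  module Matched (lenA≡ : length A ≡ q) (π : Fin n → Fin n) (π∈ : ∀ {v} → v ∈ Q₀ → π v ∈ A)
    (π-inj : ∀ {u v} → u ∈ Q₀ → v ∈ Q₀ → π u ≡ π v → u ≡ v) (π-adj : ∀ {x v} → x ∈ A → v ∈ Q₀ → x ≢ π v → Adj G x v)
    (q₁ q₂ : Fin n) (q₁∈ : q₁ ∈ Q₀) (q₂∈ : q₂ ∈ Q₀) (q₁≢q₂ : q₁ ≢ q₂) where

    uA : Unique A
    uA = unique-++ˡ A (unique-++ʳ Q uL)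

    -- The repeated colour is chosen by a rule that looks only at A. As A keeps its colours, α can
    -- be recovered from the image.
    alpha : Colouring n k → Fin k
    alpha X = lookup X (repeat X a A)

    missing : ∀ {X} → X ∈ Cols G V → Repeats X A → Missing (alpha X) X
    missing {X} m rep with repeat-spec X a A uA rep
    ... | x∈ , y , y∈ , ne , e = (repeat X a A , x∈ , refl) , λ {v} mv ev → case repeat X a A ≟F π v of λ
      { (yes eq) → Cols-proper {G = G} m (∈-allFin y) (∈-allFin v) (π-adj y∈ mv (λ e′ → ne (trans e′ (sym eq)))) (trans e (sym ev))
      ; (no neq) → Cols-proper {G = G} m (∈-allFin (repeat X a A)) (∈-allFin v) (π-adj x∈ mv neq) (sym ev) }

    module Rainbow {X : Colouring n k} (m : X ∈ Cols G V) (nr : ¬ Repeats X A) where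

      ω : Fin k
      ω = lookup X b₀

      A-inj : ∀ {x y} → x ∈ A → y ∈ A → lookup X x ≡ lookup X y → x ≡ y
      A-inj {x} {y} mx my e with x ≟F y
      ... | yes eq = eq
      ... | no ne = contradiction (x , y , mx , my , ne , e) nr

      A≢ω : ∀ {x} → x ∈ A → lookup X x ≢ ω
      A≢ω {x} mx = Cols-proper {G = G} m (∈-allFin x) (∈-allFin b₀) (complete mx (there (here refl)))

      palette : ∀ α → α ≡ ω ⊎ (∃ λ x → x ∈ A × α ≡ lookup X x)
      palette α with unique-full {xs = ω ∷ map (lookup X) A} (unique-∷ new (unique-map (lookup X) uA A-inj)) (cong suc (trans (length-map (lookup X) A) lenA≡)) α
        where
        new : ω ∉ map (lookup X) A
        new i with ∈-map⁻ (lookup X) i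
        ... | x , mx , e = A≢ω mx (sym e)
      ... | here e = inj₁ e
      ... | there i with ∈-map⁻ (lookup X) i
      ... | x , mx , e = inj₂ (x , mx , e)

      Q-colour : ∀ {v} → v ∈ Q₀ → lookup X v ≡ ω ⊎ lookup X v ≡ lookup X (π v)
      Q-colour {v} mv with palette (lookup X v)
      ... | inj₁ e = inj₁ e
      ... | inj₂ (x , mx , e) with x ≟F π v
      ... | yes refl = inj₂ e
      ... | no ne = contradiction (sym e) (Cols-proper {G = G} m (∈-allFin x) (∈-allFin v) (π-adj mx mv ne))

      bs-colour : lookup X bs ≡ ω
      bs-colour with palette (lookup X bs)
      ... | inj₁ e = e
      ... | inj₂ (x , mx , e) = contradiction (sym e) (Cols-proper {G = G} m (∈-allFin x) (∈-allFin bs) (complete mx (here refl)))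

    UsesOmega : Colouring n k → Set
    UsesOmega X = ∃ λ v → v ∈ Q₀ × lookup X v ≡ lookup X b₀

    usesOmega? : ∀ X → Dec (UsesOmega X)
    usesOmega? X = anyF? (λ v → (v ∈? Q₀) ×-dec (lookup X v ≟F lookup X b₀))

    along : Colouring n k → (Fin n → Fin n) → Colouring n k
    along X f = tabulate λ v → lookup X (f v)

    at-source : ∀ X f v {x} → f v ≡ x → lookup (along X f) v ≡ lookup X x
    at-source X f v e = trans (lookup∘tabulate (λ v → lookup X (f v)) v) (cong (lookup X) e)

    shift₁ : Fin n → Fin n → Fin n
    shift₁ w v = ifDec (v ≟F bs) (π w) v

    shift₂ : Fin n → Fin n
    shift₂ v = ifDec (v ≟F bs) (π q₁) (ifDec (v ≟F q₁) (π q₂) (ifDec (v ≟F q₂) b₀ v))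

    rotate : (X : Colouring n k) → Dec (UsesOmega X) → Colouring n k
    rotate X (yes (w , _)) = along X (shift₁ w)
    rotate X (no _) = along X shift₂

    Q₀≢bs : ∀ {v} → v ∈ Q₀ → v ≢ bs
    Q₀≢bs mv refl = bs∉Q₀ mv

    rot-o : ∀ X d {v} → v ∉ Q → lookup (rotate X d) v ≡ lookup X v
    rot-o X (yes (w , _)) {v} nv = at-source X (shift₁ w) v (ifDec-no (v ≟F bs) (λ e → nv (here e)))
    rot-o X (no _) {v} nv = at-source X shift₂ v (trans (ifDec-no (v ≟F bs) (λ e → nv (here e))) (trans (ifDec-no (v ≟F q₁) (λ { refl → nv (there q₁∈) })) (ifDec-no (v ≟F q₂) (λ { refl → nv (there q₂∈) }))))

    -- The vertex of A or b₀ whose colour v carries after the second rule. Distinctness of colours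
    -- on the clique becomes injectivity of this map.
    code : Fin n → Fin n
    code v = ifDec (v ≟F q₁) (π q₂) (ifDec (v ≟F q₂) b₀ (π v))

    rot-bs-no : ∀ X nu → lookup (rotate X (no nu)) bs ≡ lookup X (π q₁)
    rot-bs-no X nu = at-source X shift₂ bs (ifDec-yes (bs ≟F bs) refl)

    rot-bs-yes : ∀ X w → lookup (rotate X (yes w)) bs ≡ lookup X (π (proj₁ w))
    rot-bs-yes X (w , _) = at-source X (shift₁ w) bs (ifDec-yes (bs ≟F bs) refl)

    rot-Q-yes : ∀ X w {v} → v ∈ Q₀ → lookup (rotate X (yes w)) v ≡ lookup X v
    rot-Q-yes X (w , _) {v} mv = at-source X (shift₁ w) v (ifDec-no (v ≟F bs) (Q₀≢bs mv))

    rot-q₁-no : ∀ X nu → lookup (rotate X (no nu)) q₁ ≡ lookup X (π q₂)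
    rot-q₁-no X nu = at-source X shift₂ q₁ (trans (ifDec-no (q₁ ≟F bs) (Q₀≢bs q₁∈)) (ifDec-yes (q₁ ≟F q₁) refl))

    rot-Q-no : ∀ X nu {v} → X ∈ Cols G V → ¬ Repeats X A → v ∈ Q₀ → lookup (rotate X (no nu)) v ≡ lookup X (code v)
    rot-Q-no X nu {v} m nr mv = trans (at-source X shift₂ v (ifDec-no (v ≟F bs) (Q₀≢bs mv))) (pick (v ≟F q₁) (v ≟F q₂))
      where
      own : lookup X v ≡ lookup X b₀ ⊎ lookup X v ≡ lookup X (π v) → lookup X v ≡ lookup X (π v)
      own (inj₁ e) = contradiction (v , mv , e) nu
      own (inj₂ e) = e
      pick : (d₁ : Dec (v ≡ q₁)) (d₂ : Dec (v ≡ q₂)) → lookup X (ifDec d₁ (π q₂) (ifDec d₂ b₀ v)) ≡ lookup X (ifDec d₁ (π q₂) (ifDec d₂ b₀ (π v)))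
      pick (yes _) _ = refl
      pick (no _) (yes _) = refl
      pick (no _) (no _) = own (Rainbow.Q-colour m nr mv)

    b₀∉A : b₀ ∉ A
    b₀∉A i = A∉ (here refl) i

    code-inj : ∀ {u v} → u ∈ Q₀ → v ∈ Q₀ → code u ≡ code v → u ≡ v
    code-inj {u} {v} mu mv = go (u ≟F q₁) (u ≟F q₂) (v ≟F q₁) (v ≟F q₂)
      where
      go : (d₁ : Dec (u ≡ q₁)) (d₂ : Dec (u ≡ q₂)) (e₁ : Dec (v ≡ q₁)) (e₂ : Dec (v ≡ q₂)) →
        ifDec d₁ (π q₂) (ifDec d₂ b₀ (π u)) ≡ ifDec e₁ (π q₂) (ifDec e₂ b₀ (π v)) → u ≡ v
      go (yes u₁) _ (yes v₁) _ _ = trans u₁ (sym v₁)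
      go (yes _) _ (no _) (yes _) e = contradiction (subst (_∈ A) e (π∈ q₂∈)) b₀∉A
      go (yes _) _ (no _) (no n₂) e = contradiction (sym (π-inj q₂∈ mv e)) n₂
      go (no _) (yes _) (yes _) _ e = contradiction (subst (_∈ A) (sym e) (π∈ q₂∈)) b₀∉A
      go (no _) (yes u₂) (no _) (yes v₂) _ = trans u₂ (sym v₂)
      go (no _) (yes _) (no _) (no _) e = contradiction (subst (_∈ A) (sym e) (π∈ mv)) b₀∉A
      go (no _) (no n₂) (yes _) _ e = contradiction (π-inj mu q₂∈ e) n₂
      go (no _) (no _) (no _) (yes _) e = contradiction (subst (_∈ A) e (π∈ mu)) b₀∉A
      go (no _) (no _) (no _) (no _) e = π-inj mu mv e

    code-≢ : ∀ {v} → v ∈ Q₀ → code v ≢ π q₁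
    code-≢ {v} mv = go (v ≟F q₁) (v ≟F q₂)
      where
      go : (d₁ : Dec (v ≡ q₁)) (d₂ : Dec (v ≡ q₂)) → ifDec d₁ (π q₂) (ifDec d₂ b₀ (π v)) ≢ π q₁
      go (yes _) _ e = q₁≢q₂ (sym (π-inj q₂∈ q₁∈ e))
      go (no _) (yes _) e = b₀∉A (subst (_∈ A) (sym e) (π∈ q₁∈))
      go (no n₁) (no _) e = n₁ (π-inj mv q₁∈ e)

    code-range : ∀ {v} → v ∈ Q₀ → code v ∈ A ⊎ code v ≡ b₀
    code-range {v} mv = go (v ≟F q₁) (v ≟F q₂)
      where
      go : (d₁ : Dec (v ≡ q₁)) (d₂ : Dec (v ≡ q₂)) → ifDec d₁ (π q₂) (ifDec d₂ b₀ (π v)) ∈ A ⊎ ifDec d₁ (π q₂) (ifDec d₂ b₀ (π v)) ≡ b₀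
      go (yes _) _ = inj₁ (π∈ q₂∈)
      go (no _) (yes _) = inj₂ refl
      go (no _) (no _) = inj₁ (π∈ mv)

    rotate-proper : ∀ {X} → X ∈ Cols G V → ¬ Repeats X A → ∀ d {u v} → Edge u v → lookup (rotate X d) u ≢ lookup (rotate X d) v
    rotate-proper {X} m nr d (ab mu mv _) e = outer {rotate X d} m (rot-o X d) mu mv e
    rotate-proper {X} m nr d@(yes w′@(w , w∈ , wω)) (sb refl refl) e = Rainbow.A≢ω m nr (π∈ w∈) (trans (sym (rot-bs-yes X w′)) (trans e (rot-o X d (B-off (here refl)))))
    rotate-proper {X} m nr d@(no nu) (sb refl refl) e = Rainbow.A≢ω m nr (π∈ q₁∈) (trans (sym (rot-bs-no X nu)) (trans e (rot-o X d (B-off (here refl)))))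
    rotate-proper {X} m nr d@(yes w′@(w , w∈ , wω)) {u} {v} (kk mu mv ne) = go mu mv
      where
      head : ∀ {v} → v ∈ Q₀ → lookup (rotate X d) bs ≢ lookup (rotate X d) v
      head {v} mv e with trans (sym (rot-bs-yes X w′)) (trans e (rot-Q-yes X w′ mv)) | Rainbow.Q-colour m nr mv
      ... | e′ | inj₁ vω = Rainbow.A≢ω m nr (π∈ w∈) (trans e′ vω)
      ... | e′ | inj₂ vπ with π-inj w∈ mv (Rainbow.A-inj m nr (π∈ w∈) (π∈ mv) (trans e′ vπ))
      ... | refl = Rainbow.A≢ω m nr (π∈ w∈) (trans e′ wω)
      go : u ∈ Q → v ∈ Q → lookup (rotate X d) u ≢ lookup (rotate X d) v
      go (here refl) (here refl) _ = ne refl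
      go (here refl) (there mv) e = head mv e
      go (there mu) (here refl) e = head mu (sym e)
      go (there mu) (there mv) e = Cols-proper {G = G} m (∈-allFin u) (∈-allFin v) (clique-Q mu mv ne) (trans (sym (rot-Q-yes X w′ mu)) (trans e (rot-Q-yes X w′ mv)))
    rotate-proper {X} m nr d@(no nu) {u} {v} (kk mu mv ne) = go mu mv
      where
      codes : ∀ {x y} → x ∈ A ⊎ x ≡ b₀ → y ∈ A ⊎ y ≡ b₀ → lookup X x ≡ lookup X y → x ≡ y
      codes (inj₁ a) (inj₁ b) e = Rainbow.A-inj m nr a b e
      codes (inj₁ a) (inj₂ refl) e = contradiction e (Rainbow.A≢ω m nr a)
      codes (inj₂ refl) (inj₁ b) e = contradiction (sym e) (Rainbow.A≢ω m nr b)
      codes (inj₂ refl) (inj₂ refl) _ = refl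
      head : ∀ {v} → v ∈ Q₀ → lookup (rotate X d) bs ≢ lookup (rotate X d) v
      head {v} mv e = code-≢ mv (sym (codes (inj₁ (π∈ q₁∈)) (code-range mv) (trans (sym (rot-bs-no X nu)) (trans e (rot-Q-no X nu m nr mv)))))
      go : u ∈ Q → v ∈ Q → lookup (rotate X d) u ≢ lookup (rotate X d) v
      go (here refl) (here refl) _ = ne refl
      go (here refl) (there mv) e = head mv e
      go (there mu) (here refl) e = head mu (sym e)
      go (there mu) (there mv) e = ne (code-inj mu mv (codes (code-range mu) (code-range mv) (trans (sym (rot-Q-no X nu m nr mu)) (trans e (rot-Q-no X nu m nr mv)))))

    rotate-inj : ∀ {X Y} → X ∈ Cols G V → Y ∈ Cols G V → ¬ Repeats X A → ¬ Repeats Y A → ∀ d e → rotate X d ≡ rotate Y e → X ≡ Y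
    rotate-inj {X} {Y} mX mY nX nY d e eq = vec-ext λ v → go v (cases v)
      where
      at : ∀ v → lookup (rotate X d) v ≡ lookup (rotate Y e) v
      at v = cong (λ Z → lookup Z v) eq
      off : ∀ {v} → v ∉ Q → lookup X v ≡ lookup Y v
      off {v} nv = trans (sym (rot-o X d nv)) (trans (at v) (rot-o Y e nv))
      offA : ∀ {x} → x ∈ A → lookup X x ≡ lookup Y x
      offA mx = off (A-off mx)
      ω≡ : lookup X b₀ ≡ lookup Y b₀
      ω≡ = off (B-off (here refl))
      -- The two rules have different images, as q₁ shows: after the first it has ω or the colour of
      -- π q₁, after the second that of π q₂.
      clash : ∀ {X Y : Colouring n k} → X ∈ Cols G V → ¬ Repeats X A → (∀ {x} → x ∈ A → lookup X x ≡ lookup Y x) → ∀ w nu → lookup (rotate X (yes w)) q₁ ≡ lookup (rotate Y (no nu)) q₁ → ⊥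
      clash {X} {Y} mX nX oA w nu e₁ with trans (sym (rot-Q-yes X w q₁∈)) (trans e₁ (trans (rot-q₁-no Y nu) (sym (oA (π∈ q₂∈))))) | Rainbow.Q-colour mX nX q₁∈
      ... | e₂ | inj₁ o = Rainbow.A≢ω mX nX (π∈ q₂∈) (trans (sym e₂) o)
      ... | e₂ | inj₂ o = q₁≢q₂ (π-inj q₁∈ q₂∈ (Rainbow.A-inj mX nX (π∈ q₁∈) (π∈ q₂∈) (trans (sym o) e₂)))
      own : ∀ {X} → X ∈ Cols G V → ¬ Repeats X A → ¬ UsesOmega X → ∀ {v} → v ∈ Q₀ → lookup X v ≡ lookup X (π v)
      own mX nX nu {v} mv with Rainbow.Q-colour mX nX mv
      ... | inj₁ o = contradiction (v , mv , o) nu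
      ... | inj₂ o = o
      inner : ∀ d e → (∀ v → lookup (rotate X d) v ≡ lookup (rotate Y e) v) → ∀ {v} → v ∈ Q₀ → lookup X v ≡ lookup Y v
      inner (yes w) (yes w′) at {v} mv = trans (sym (rot-Q-yes X w mv)) (trans (at v) (rot-Q-yes Y w′ mv))
      inner (no nu) (no nu′) at {v} mv = trans (own mX nX nu mv) (trans (offA (π∈ mv)) (sym (own mY nY nu′ mv)))
      inner (yes w) (no nu) at mv = ⊥-elim (clash {X} {Y} mX nX offA w nu (at q₁))
      inner (no nu) (yes w) at mv = ⊥-elim (clash {Y} {X} mY nY (λ mx → sym (offA mx)) w nu (sym (at q₁)))
      go : ∀ v → v ∈ Q ⊎ (v ∈ A ⊎ v ∈ b₀ ∷ B′) → lookup X v ≡ lookup Y v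
      go v (inj₂ (inj₁ i)) = offA i
      go v (inj₂ (inj₂ i)) = off (B-off i)
      go v (inj₁ (here refl)) = trans (Rainbow.bs-colour mX nX) (trans ω≡ (sym (Rainbow.bs-colour mY nY)))
      go v (inj₁ (there i)) = inner d e at i

    transform : (X : Colouring n k) → Dec (Repeats X A) → Colouring n k
    transform X (yes _) = recolour (alpha X) X
    transform X (no _) = rotate X (usesOmega? X)

    transform-o : ∀ X d {v} → v ∉ Q → lookup (transform X d) v ≡ lookup X v
    transform-o X (yes _) nv = rc-o (alpha X) X nv
    transform-o X (no _) nv = rot-o X (usesOmega? X) nv

    transform-proper : ∀ {X} → X ∈ Cols G V → ∀ d {u v} → Edge u v → lookup (transform X d) u ≢ lookup (transform X d) v
    transform-proper m (yes r) = recolour-proper m (missing m r)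
    transform-proper {X} m (no nr) = rotate-proper m nr (usesOmega? X)

    -- Whether A is rainbow is unaffected, so the image reveals which transformation was applied.
    transform-inj : ∀ {X Y} → X ∈ Cols G V → Y ∈ Cols G V → ∀ d e → transform X d ≡ transform Y e → X ≡ Y
    transform-inj {X} {Y} mX mY d e eq = go d e eq
      where
      offA : ∀ {x} → x ∈ A → lookup X x ≡ lookup Y x
      offA {x} mx = trans (sym (transform-o X d (A-off mx))) (trans (cong (λ Z → lookup Z x) eq) (transform-o Y e (A-off mx)))
      move : ∀ {X Y} → (∀ {x} → x ∈ A → lookup X x ≡ lookup Y x) → Repeats {k = k} X A → Repeats Y A
      move o (a , b , ma , mb , ne , e) = a , b , ma , mb , ne , trans (sym (o ma)) (trans e (o mb))
      alpha≡ : Repeats X A → alpha X ≡ alpha Y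
      alpha≡ r = trans (cong (lookup X) (repeat-cong X Y a A offA)) (offA (subst (_∈ A) (repeat-cong X Y a A offA) (proj₁ (repeat-spec X a A uA r))))
      go : ∀ d e → transform X d ≡ transform Y e → X ≡ Y
      go (yes r) (yes _) eq = recolour-inj {alpha X} {X} {Y} (trans eq (cong (λ α → recolour α Y) (sym (alpha≡ r))))
      go (yes r) (no nr) _ = contradiction (move {X} {Y} offA r) nr
      go (no nr) (yes r) _ = contradiction (move {Y} {X} (λ mx → sym (offA mx)) r) nr
      go (no n₁) (no n₂) eq = rotate-inj mX mY n₁ n₂ (usesOmega? X) (usesOmega? Y) eq

    matched : # {k′ = suc p} G (allFin n) < # {k′ = suc p} (Gstar n (suc (suc p)) δ) (allFin n)
    matched = fewer G (λ X → transform X (repeats? X A)) (λ {X} m → transform-proper m (repeats? X A))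
      (λ {X} m → outer {transform X (repeats? X A)} m (transform-o X (repeats? X A)) (here refl) (here refl))
      (λ {X} {Y} mX mY e → transform-inj mX mY (repeats? X A) (repeats? Y A) e)

two-distinct : ∀ {A : Set} (xs : List A) → Unique xs → 2 ≤ length xs → ∃₂ λ x y → x ∈ xs × y ∈ xs × x ≢ y
two-distinct (x ∷ y ∷ xs) ((ne ∷ _) ∷ _) _ = x , y , here refl , there (here refl) , ne
two-distinct (x ∷ []) _ (s≤s ())

module _ {n p δ : ℕ} (2≤p : 2 ≤ p) (G : Graph n) (A B : List (Fin n)) (lenA : length A ≡ δ) (cm : Common G p A B)
  (fam : Family₁ G p A B) (nc : ¬ ColOn G (allFin n) (suc p)) where

  private
    V = allFin n
    q = suc p

  open Common cm
  open Family₁ fam renaming (Q to Q₀; whole to whole₀)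

  private
    uW : Unique (Q₀ ++ A ++ B)
    uW = unique-↭ whole₀ (unique-allFin n)
    part : ∀ x → x ∈ Q₀ ⊎ (x ∈ A ⊎ x ∈ B)
    part x with ∈-++⁻ Q₀ (∈-resp-↭ whole₀ (∈-allFin x))
    ... | inj₁ m = inj₁ m
    ... | inj₂ m = inj₂ (∈-++⁻ A m)
    QA : ∀ {x} → x ∈ Q₀ → x ∉ A
    QA m m′ = unique-++-disjoint Q₀ uW m (∈-++⁺ˡ m′)
    QB : ∀ {x} → x ∈ Q₀ → x ∉ B
    QB m m′ = unique-++-disjoint Q₀ uW m (∈-++⁺ʳ A m′)
    AB : ∀ {x} → x ∈ A → x ∉ B
    AB m m′ = unique-++-disjoint A (unique-++ʳ Q₀ uW) m m′

  Choice : (Fin n → Fin n) → Set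
  Choice j = ∀ {x} → x ∈ A → j x ∈ Q₀ × ¬ Adj G x (j x)

  index : Fin n → Fin q
  index y with pos Q₀ y <? q
  ... | yes h = fromℕ< h
  ... | no _ = fz

  index-inj : ∀ {x y} → x ∈ Q₀ → y ∈ Q₀ → index x ≡ index y → x ≡ y
  index-inj {x} {y} mx my e with pos Q₀ x <? q | pos Q₀ y <? q
  ... | yes h | yes h′ = pos-inj Q₀ mx my (trans (sym (toℕ-fromℕ< h)) (trans (cong toℕ e) (toℕ-fromℕ< h′)))
  ... | no h | _ = contradiction (subst (pos Q₀ x <_) length-Q (pos-< Q₀ mx)) h
  ... | yes _ | no h = contradiction (subst (pos Q₀ y <_) length-Q (pos-< Q₀ my)) h

  -- A vertex of Q₀ that is never chosen would give a (k-1)-colouring of G.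
  hit : ∀ {j} → Choice j → ∀ {v} → v ∈ Q₀ → ∃ λ x → x ∈ A × j x ≡ v
  hit {j} ch {v} v∈ with anyF? (λ x → (x ∈? A) ×-dec (j x ≟F v))
  ... | yes (x , mx , e) = x , mx , e
  ... | no none = contradiction ((λ x → index (rep x)) , λ s t _ _ → pr s t) nc
    where
    -- Q₀ serves as the palette of k - 1 colours: a vertex of A is coloured by its chosen
    -- non-neighbour, and B by the vertex v that nobody chose.
    rep : Fin n → Fin n
    rep x = ifDec (x ∈? A) (j x) (ifDec (x ∈? Q₀) x v)
    rep-A : ∀ {x} → x ∈ A → rep x ≡ j x
    rep-A {x} m = ifDec-yes (x ∈? A) m
    rep-Q : ∀ {x} → x ∈ Q₀ → rep x ≡ x
    rep-Q {x} m = trans (ifDec-no (x ∈? A) (QA m)) (ifDec-yes (x ∈? Q₀) m)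
    rep-B : ∀ {x} → x ∈ B → rep x ≡ v
    rep-B {x} m = trans (ifDec-no (x ∈? A) (λ i → AB i m)) (ifDec-no (x ∈? Q₀) (λ i → QB i m))
    rep-∈ : ∀ x → rep x ∈ Q₀
    rep-∈ x with part x
    ... | inj₁ m = subst (_∈ Q₀) (sym (rep-Q m)) m
    ... | inj₂ (inj₁ m) = subst (_∈ Q₀) (sym (rep-A m)) (proj₁ (ch m))
    ... | inj₂ (inj₂ m) = subst (_∈ Q₀) (sym (rep-B m)) v∈
    pr : ∀ s t → Adj G s t → index (rep s) ≢ index (rep t)
    pr s t ad e = go (part s) (part t)
      where
      e′ : rep s ≡ rep t
      e′ = index-inj (rep-∈ s) (rep-∈ t) e
      go : s ∈ Q₀ ⊎ (s ∈ A ⊎ s ∈ B) → t ∈ Q₀ ⊎ (t ∈ A ⊎ t ∈ B) → ⊥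
      go (inj₁ a) (inj₁ b) = Adj-irrefl G (subst (Adj G s) (sym (trans (sym (rep-Q a)) (trans e′ (rep-Q b)))) ad)
      go (inj₁ a) (inj₂ (inj₁ b)) = proj₂ (ch b) (subst (Adj G t) (trans (sym (rep-Q a)) (trans e′ (rep-A b))) (Adj-sym G ad))
      go (inj₁ a) (inj₂ (inj₂ b)) = QA a (only-A b (Adj-sym G ad))
      go (inj₂ (inj₁ a)) (inj₁ b) = proj₂ (ch a) (subst (Adj G s) (trans (sym (rep-Q b)) (trans (sym e′) (rep-A a))) ad)
      go (inj₂ (inj₁ a)) (inj₂ (inj₁ b)) = independent a b ad
      go (inj₂ (inj₁ a)) (inj₂ (inj₂ b)) = none (s , a , trans (sym (rep-A a)) (trans e′ (rep-B b)))
      go (inj₂ (inj₂ a)) (inj₁ b) = QA b (only-A a ad)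
      go (inj₂ (inj₂ a)) (inj₂ (inj₁ b)) = none (t , b , trans (sym (rep-A b)) (trans (sym e′) (rep-B a)))
      go (inj₂ (inj₂ a)) (inj₂ (inj₂ b)) = AB (only-A a ad) b

  pick : Fin n → Fin n
  pick x with anyF? (λ v → (v ∈? Q₀) ×-dec ¬? (T? (adj G x v)))
  ... | yes (v , _) = v
  ... | no _ = x

  pick-choice : (∀ {x} → x ∈ A → ∃ λ v → v ∈ Q₀ × ¬ Adj G x v) → Choice pick
  pick-choice h {x} mx with anyF? (λ v → (v ∈? Q₀) ×-dec ¬? (T? (adj G x v)))
  ... | yes (v , r) = r
  ... | no none = contradiction (h mx) none

  module _ (h : ∀ {x} → x ∈ A → ∃ λ v → v ∈ Q₀ × ¬ Adj G x v) (δ≤q : δ ≤ q) where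

    private
      ch = pick-choice h

    partner : Fin n → Fin n
    partner v with v ∈? Q₀
    ... | yes m = proj₁ (hit ch m)
    ... | no _ = v

    partner-spec : ∀ {v} → v ∈ Q₀ → partner v ∈ A × pick (partner v) ≡ v
    partner-spec {v} m with v ∈? Q₀
    ... | yes m′ = proj₂ (hit ch m′)
    ... | no nm = contradiction m nm

    partner-inj : ∀ {u v} → u ∈ Q₀ → v ∈ Q₀ → partner u ≡ partner v → u ≡ v
    partner-inj mu mv e = trans (sym (proj₂ (partner-spec mu))) (trans (cong pick e) (proj₂ (partner-spec mv)))

    unique-Q₀ : Unique Q₀
    unique-Q₀ = unique-++ˡ Q₀ uW

    -- Distinct clique vertices have distinct partners, so |A| is at least q, and δ ≤ q gives the
    -- converse.
    length-A : length A ≡ q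
    length-A = ≤-antisym (≤-trans (≤-reflexive lenA) δ≤q) (≤-trans (≤-reflexive (sym length-Q)) (inj-length partner unique-Q₀ (λ m → proj₁ (partner-spec m)) partner-inj))

    partner-onto : ∀ {x} → x ∈ A → ∃ λ v → v ∈ Q₀ × x ≡ partner v
    partner-onto mx = ∈-map⁻ partner (⊆-full _≟F_ (unique-map partner unique-Q₀ partner-inj) sub (≤-reflexive (trans length-A (sym (trans (length-map partner Q₀) length-Q)))) mx)
      where
      sub : ∀ {y} → y ∈ map partner Q₀ → y ∈ A
      sub i with ∈-map⁻ partner i
      ... | v , mv , refl = proj₁ (partner-spec mv)

    -- If x, the partner of v′, were also not adjacent to v, it could choose v instead. Then nothing
    -- would choose v′, against `hit`.
    partner-adj : ∀ {x v} → x ∈ A → v ∈ Q₀ → x ≢ partner v → Adj G x v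
    partner-adj {x} {v} mx mv ne with T? (adj G x v)
    ... | yes ad = ad
    ... | no nad with partner-onto mx
    ... | v′ , mv′ , refl = ⊥-elim (clash (hit choice′ mv′))
      where
      v≢v′ : v′ ≢ v
      v≢v′ refl = ne refl
      j : Fin n → Fin n
      j y = ifDec (y ≟F x) v (pick y)
      choice′ : Choice j
      choice′ {y} my with y ≟F x
      ... | yes refl = mv , nad
      ... | no n = ch my
      clash : (∃ λ y → y ∈ A × j y ≡ v′) → ⊥
      clash (y , my , e) with y ≟F x
      ... | yes refl = v≢v′ (sym (trans (sym refl) e))
      ... | no n with partner-onto my
      ... | v″ , mv″ , refl = n (cong partner (trans (sym (proj₂ (partner-spec mv″))) e))

  arrange : ∀ {bs b₀ B′ a A′} → B ≡ bs ∷ b₀ ∷ B′ → A ↭ a ∷ A′ → V ↭ (bs ∷ Q₀) ++ (a ∷ A′) ++ b₀ ∷ B′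
  arrange {bs} {b₀} {B′} {a} {A′} refl A↭ = ↭trans whole₀ (↭trans (++⁺ˡ Q₀ (++⁺ʳ B A↭)) (↭trans (++⁺ˡ Q₀ (shift bs (a ∷ A′) (b₀ ∷ B′))) (shift bs Q₀ ((a ∷ A′) ++ b₀ ∷ B′))))

  -- Either some vertex of A is adjacent to all of Q₀ and its colour is absent there, or every
  -- vertex of A has a non-neighbour in Q₀, which forces the matched structure. The two vertices q₁
  -- and q₂ exist because the clique has q ≥ 2 vertices.
  overlap-fewer : δ ≤ q → 1 ≤ δ → ∀ bs b₀ B′ → B ≡ bs ∷ b₀ ∷ B′ → # {k′ = q} G V < # {k′ = q} (Gstar n (suc q) δ) V
  overlap-fewer δ≤q 1≤δ bs b₀ B′ refl with anyF? (λ a → (a ∈? A) ×-dec allF? (λ v → (v ∈? Q₀) →-dec T? (adj G a v)))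
  ... | yes (a , ma , dom) = Overlap.dominated 2≤p G bs a b₀ Q₀ (proj₁ (split-∈ ma)) B′ (cong suc length-Q) (trans (sym (↭-length A↭)) lenA) (arrange refl A↭)
        (λ mx mb → complete (∈-resp-↭ (↭-sym A↭) mx) mb) clique-Q (λ {v} mv → dom v mv)
    where
    A↭ = proj₂ (split-∈ ma)
  ... | no none = Overlap.Matched.matched 2≤p G bs a b₀ Q₀ A′ B′ (cong suc length-Q) (trans (sym (↭-length A↭)) lenA) (arrange refl A↭)
        (λ mx mb → complete (from mx) mb) clique-Q (trans (sym (↭-length A↭)) (length-A h δ≤q)) (partner h δ≤q) (λ m → ∈-resp-↭ A↭ (proj₁ (partner-spec h δ≤q m)))
        (partner-inj h δ≤q) (λ mx → partner-adj h δ≤q (from mx)) (proj₁ two) (proj₁ (proj₂ two)) (proj₁ (proj₂ (proj₂ two))) (proj₁ (proj₂ (proj₂ (proj₂ two)))) (proj₂ (proj₂ (proj₂ (proj₂ two))))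
    where
    a = proj₁ (head-∈ A (≤-trans 1≤δ (≤-reflexive (sym lenA))))
    a∈ = proj₂ (head-∈ A (≤-trans 1≤δ (≤-reflexive (sym lenA))))
    A′ = proj₁ (split-∈ a∈)
    A↭ = proj₂ (split-∈ a∈)
    from : ∀ {x} → x ∈ a ∷ A′ → x ∈ A
    from = ∈-resp-↭ (↭-sym A↭)
    two = two-distinct Q₀ (unique-++ˡ Q₀ uW) (≤-trans 2≤p (≤-trans (n≤1+n p) (≤-reflexive (sym length-Q))))
    h : ∀ {x} → x ∈ A → ∃ λ v → v ∈ Q₀ × ¬ Adj G x v
    h {x} mx with anyF? (λ v → (v ∈? Q₀) ×-dec ¬? (T? (adj G x v)))
    ... | yes r = r
    ... | no all = contradiction (x , mx , dom) none
      where
      dom : ∀ v → v ∈ Q₀ → Adj G x v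
      dom v mv with T? (adj G x v)
      ... | yes ad = ad
      ... | no nad = contradiction (v , mv , nad) all

-- From colouring functions to vectors, and the conclusion

length-filter-concatMap : ∀ {A B : Set} {R : B → Set} (R? : Decidable R) (g : A → List B) xs →
  length (filter R? (concatMap g xs)) ≡ sum (map (λ x → length (filter R? (g x))) xs)
length-filter-concatMap R? g [] = refl
length-filter-concatMap R? g (x ∷ xs) = trans (cong length (filter-++ R? (g x) (concatMap g xs))) (trans (length-++ (filter R? (g x))) (cong (length (filter R? (g x)) +_) (length-filter-concatMap R? g xs)))

length-filter-map : ∀ {A B : Set} {R : B → Set} (R? : Decidable R) (h : A → B) xs → length (filter R? (map h xs)) ≡ length (filter (R? ∘ h) xs)
length-filter-map R? h [] = refl
length-filter-map R? h (x ∷ xs) with R? (h x)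
... | yes _ = cong suc (length-filter-map R? h xs)
... | no _ = length-filter-map R? h xs

-- Both enumerations run through the colours in the same order, so they are compared entry by entry;
-- the predicates are related whenever function and vector have the same values.
allFuns-count : ∀ n k {Q : (Fin n → Fin k) → Set} (Q? : Decidable Q) {R : Colouring n k → Set} (R? : Decidable R) →
  (∀ f X → (∀ i → f i ≡ lookup X i) → (Q f → R X) × (R X → Q f)) → length (filter Q? (allFuns n k)) ≡ length (filter R? (allColourings n k))
allFuns-count zero k {Q} Q? {R} R? h = base _ (h _ [] (λ ()))
  where
  base : ∀ f → (Q f → R []) × (R [] → Q f) → length (filter Q? (f ∷ [])) ≡ length (filter R? ([] ∷ []))
  base f (to , from) with Q? f | R? []
  ... | yes _ | yes _ = refl
  ... | yes q | no nr = contradiction (to q) nr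
  ... | no nq | yes r = contradiction (from r) nq
  ... | no _ | no _ = refl
allFuns-count (suc n) k Q? R? h = trans (length-filter-concatMap Q? (λ a → map (a ∷ᶠ_) (allFuns n k)) (allFin k))
  (trans (sum-cong (allFin k) (λ {a} _ → trans (length-filter-map Q? (a ∷ᶠ_) (allFuns n k))
      (trans (allFuns-count n k (Q? ∘ (a ∷ᶠ_)) (R? ∘ (a ∷_)) (λ f X e → h (a ∷ᶠ f) (a ∷ X) (λ { fz → refl ; (fs i) → e i })))
        (sym (length-filter-map R? (a ∷_) (allColourings n k))))))
    (sym (length-filter-concatMap R? (λ a → map (a ∷_) (allColourings n k)) (allFin k))))

P≡# : ∀ {n} (G : Graph n) k′ → P G (suc k′) ≡ # {k′ = k′} G (allFin n)
P≡# {n} G k′ = trans (allFuns-count n (suc k′) (proper? G (suc k′)) (isCol? G (allFin n)) same) (cong length (sym (Cols-≡ G (allFin n))))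
  where
  same : ∀ f X → (∀ i → f i ≡ lookup X i) → (Proper G (suc k′) f → IsCol {k′ = k′} G (allFin n) X) × (IsCol {k′ = k′} G (allFin n) X → Proper G (suc k′) f)
  same f X e = (λ pr → (λ s t _ _ ad eq → pr s t ad (trans (e s) (trans eq (sym (e t))))) , (λ v nv → contradiction (∈-allFin v) nv)) ,
    (λ ic u v ad eq → proj₁ ic u v (∈-allFin u) (∈-allFin v) ad (trans (sym (e u)) (trans eq (e v))))

family-outcome : ∀ {n p δ} → 2 ≤ p → 3 ≤ δ → δ ≤ suc p → (G : Graph n) → ¬ ColOn G (allFin n) (suc p) → (∀ v → δ ≤ length (nbrs G (allFin n) v)) →
  2 + p + δ + 2 ≤ n → Shape G p δ → Outcome G (suc p) δ
family-outcome {n} {p} {δ} 2≤p 3≤δ δ≤q G nc deg big (A , B , lenA , cm , fam) = go B cm fam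
  where
  size : ∀ {Q B} → allFin n ↭ Q ++ A ++ B → n ≡ length Q + (δ + length B)
  size {Q} {B} w = trans (sym (length-allFin n)) (trans (↭-length w) (trans (length-++ Q) (cong (length Q +_) (trans (length-++ A) (cong (_+ length B) lenA)))))
  large : ∀ {Q B} → allFin n ↭ Q ++ A ++ B → length Q ≤ 2 + p → 2 ≤ length B
  large {Q} {B} w le = +-cancelˡ-≤ (2 + p + δ) 2 _ (≤-trans big (≤-trans (≤-reflexive (size {Q} {B} w)) (≤-trans (+-monoˡ-≤ (δ + length B) le) (≤-reflexive (sym (+-assoc (2 + p) δ (length B)))))))
  go : ∀ B → Common G p A B → Family₁ G p A B ⊎ (Family₂ G p A B ⊎ Family₃ G p A B) → Outcome G (suc p) δ
  go B cm (inj₂ (inj₂ f₃)) = family₃ 2≤p G A B lenA cm f₃ deg (≤-trans (s≤s z≤n) 3≤δ)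
  go B cm (inj₂ (inj₁ f₂)) = family₂ 2≤p G A B lenA cm f₂ (head-∈ B (≤-trans (s≤s z≤n) (large {Family₂.Q f₂} {B} (Family₂.whole f₂) (≤-reflexive (Family₂.length-Q f₂)))))
  go B cm (inj₁ f₁) = two B cm f₁ (large {Family₁.Q f₁} {B} (Family₁.whole f₁) (≤-trans (≤-reflexive (Family₁.length-Q f₁)) (n≤1+n (suc p))))
    where
    two : ∀ B → Common G p A B → Family₁ G p A B → 2 ≤ length B → Outcome G (suc p) δ
    two (bs ∷ b₀ ∷ B′) cm f₁ _ = inj₁ (overlap-fewer 2≤p G A (bs ∷ b₀ ∷ B′) lenA cm f₁ nc δ≤q (≤-trans (s≤s z≤n) 3≤δ) bs b₀ B′ refl)
    two (bs ∷ []) _ _ (s≤s ())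
    two [] _ _ ()

-- The first summand makes the large part big enough for the degrees of the extremal graph and for
-- the choice of bs and b₀. The second exceeds the largest n compatible with local gaps at all
-- vertices.
threshold : ℕ → ℕ → ℕ
threshold p δ = (2 + p + δ + (2 + δ)) + suc (4 * leafBound p δ (gapZ p))

-- A graph that misses the lower bound proved for the extremal graph has fewer colourings than it.
-- Any other graph satisfies the assumption of `shape`.
extremal : ∀ p δ → 2 ≤ p → 3 ≤ δ → δ ≤ suc p → ∀ n → threshold p δ ≤ n → ∀ (G : Graph n) →
  Connected G → ChromaticNumber G (2 + p) → MinDegree G δ → Outcome G (suc p) δ
extremal p δ 2≤p 3≤δ δ≤q n N≤n G cn (_ , below) (deg , _)
  with (2 + p) ! * suc p ^ suc n ≤? # {k′ = suc p} G (allFin n) * (suc p ^ (2 + p) * suc p ^ δ)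
... | yes low = family-outcome 2≤p 3≤δ δ≤q G nc deg big (shape G p δ 2≤p 3≤δ (connected⇒conn G cn) nc deg low (≤-trans (m≤n+m _ (2 + p + δ + (2 + δ))) N≤n))
  where
  nc : ¬ ColOn G (allFin n) (suc p)
  nc (c , pr) = below (suc p) ≤-refl (c , λ u v → pr u v (∈-allFin u) (∈-allFin v))
  big : 2 + p + δ + 2 ≤ n
  big = ≤-trans (≤-trans (+-monoʳ-≤ (2 + p + δ) (m≤m+n 2 δ)) (m≤m+n _ (suc (4 * leafBound p δ (gapZ p))))) N≤n
... | no ¬low = inj₁ (*-cancelʳ-< c _ _ (<-≤-trans (≰⇒> ¬low) (StarLower.lower n (suc p) δ (≤-trans (n≤1+n 2) 3≤δ) (s≤s z≤n) big)))
  where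
  c = suc p ^ (2 + p) * suc p ^ δ
  big : 2 + p + δ + suc δ ≤ n
  big = ≤-trans (≤-trans (+-monoʳ-≤ (2 + p + δ) (n≤1+n (suc δ))) (m≤m+n _ (suc (4 * leafBound p δ (gapZ p))))) N≤n

theorem4 : ∀ (k δ : ℕ) → 3 ≤ δ → δ ≤ k ∸ 1 →
    Σ ℕ λ N → ∀ (n : ℕ) → N ≤ n →
    (Connected (Gstar n k δ) × ChromaticNumber (Gstar n k δ) k × MinDegree (Gstar n k δ) δ)
    × (∀ (G : Graph n) → Connected G → ChromaticNumber G k → MinDegree G δ →
    (P G k ≤ P (Gstar n k δ) k) × (P G k ≡ P (Gstar n k δ) k → G ≅ Gstar n k δ))
theorem4 zero δ 3≤δ δ≤ = contradiction (≤-trans 3≤δ δ≤) λ ()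
theorem4 (suc zero) δ 3≤δ δ≤ = contradiction (≤-trans 3≤δ δ≤) λ ()
theorem4 (suc (suc p)) δ 3≤δ δ≤q = threshold p δ , λ n N≤n → star n N≤n , λ G cn chr md → compare (extremal p δ 2≤p 3≤δ δ≤q n N≤n G cn chr md)
  where
  q = suc p
  2≤p : 2 ≤ p
  2≤p = ≤-pred (≤-trans 3≤δ δ≤q)
  star : ∀ n → threshold p δ ≤ n → Connected (Gstar n (suc q) δ) × ChromaticNumber (Gstar n (suc q) δ) (suc q) × MinDegree (Gstar n (suc q) δ) δ
  star n N≤n = connected , chromatic , min-degree δ≤q
    where
    big : suc q + δ + suc δ ≤ n
    big = ≤-trans (≤-trans (+-monoʳ-≤ (2 + p + δ) (n≤1+n (suc δ))) (m≤m+n _ (suc (4 * leafBound p δ (gapZ p))))) N≤n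
    open StarGraph n q δ (≤-trans (n≤1+n 2) 3≤δ) (s≤s z≤n) big
  compare : ∀ {n} {G : Graph n} → Outcome G q δ → (P G (suc q) ≤ P (Gstar n (suc q) δ) (suc q)) × (P G (suc q) ≡ P (Gstar n (suc q) δ) (suc q) → G ≅ Gstar n (suc q) δ)
  compare {n} {G} (inj₁ lt) = subst₂ _≤_ (sym (P≡# G q)) (sym (P≡# (Gstar n (suc q) δ) q)) (<⇒≤ lt) ,
    λ e → contradiction lt (<-irrefl (trans (sym (P≡# G q)) (trans e (P≡# (Gstar n (suc q) δ) q))))
  compare {n} {G} (inj₂ iso) = subst₂ _≤_ (sym (P≡# G q)) (sym (P≡# (Gstar n (suc q) δ) q)) (#-iso-≤ {k′ = q} G (Gstar n (suc q) δ) iso) , λ _ → iso
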